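{- Let $n\in\mathbb{N}$. Then \begin{align*} N(1,1,1,10;n)=& \tfrac{1}{7}\big(- \sigma_{\chi_0,\chi_3}(n) -5\sigma_{\chi_1,\chi_2}(n) +4 \sigma_{\chi_2,\chi_1}(n) +20\sigma_{\chi_3,\chi_0}(n)\big) +\tfrac{4}{7}\big(-3d_1(n) +15d_2(n) -15 d_3(n)+ 9d_4(n)\big),\\ N(1,1,2,5;n)= & \tfrac{1}{7}\big(- \sigma_{\chi_0,\chi_3}(n) +5\sigma_{\chi_1,\chi_2}(n) - 4 \sigma_{\chi_2,\chi_1}(n) + 20\sigma_{\chi_3,\chi_0}(n)\big) +\tfrac{8}{7}\big(-d_1(n) + 2 d_4(n)\big),\\ N(1,2,2,10;n)= & \tfrac{1}{7}\big(- \sigma_{\chi_0,\chi_3}(n) -5\sigma_{\chi_1,\chi_2}(n) +2 \sigma_{\chi_2,\chi_1}(n) +10 \sigma_{\chi_3,\chi_0}(n) \big) +\tfrac{4}{7}\big(d_1(n) + 5d_2(n) + 5 d_3(n)+ d_4(n)\big),\\ N(1,5,5,10;n)= &\tfrac{1}{7}\big(- \sigma_{\chi_0,\chi_3}(n) -\sigma_{\chi_1,\chi_2}(n) +4 \sigma_{\chi_2,\chi_1}(n) +4\sigma_{\chi_3,\chi_0}(n)\big) +\tfrac{8}{7}\big(d_2(n) -d_3(n)+d_4(n)\big),\\ N(1,10,10,10;n) = &\tfrac{1}{7}\big(- \sigma_{\chi_0,\chi_3}(n) -\sigma_{\chi_1,\chi_2}(n) +2 \sigma_{\chi_2,\chi_1}(n)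 +2\sigma_{\chi_3,\chi_0}(n)\big) +\tfrac{12}{7}\big(d_2(n) +d_3(n)+d_4(n)\big),\\ N(2,2,2,5 ;n) = & \tfrac{1}{7}\big(- \sigma_{\chi_0,\chi_3}(n) +5\sigma_{\chi_1,\chi_2}(n) -2 \sigma_{\chi_2,\chi_1}(n) +10\sigma_{\chi_3,\chi_0}(n) \big) -\tfrac{12}{7}d_1(n),\\ N(2,5,5,5;n) =& \tfrac{1}{7}\big(- \sigma_{\chi_0,\chi_3}(n) +\sigma_{\chi_1,\chi_2}(n) -4 \sigma_{\chi_2,\chi_1}(n) +4\sigma_{\chi_3,\chi_0}(n)\big) +\tfrac{12}{7}\big(-d_1(n) -d_2(n) -3d_3(n)+d_4(n)\big),\\ N(2,5,10,10;n)= &\tfrac{1}{7}\big(- \sigma_{\chi_0,\chi_3}(n) +\sigma_{\chi_1,\chi_2}(n) -2 \sigma_{\chi_2,\chi_1}(n) +2\sigma_{\chi_3,\chi_0}(n)\big) +\tfrac{4}{7}\big(-d_1(n) +d_2(n) -3d_3(n)+d_4(n)\big). \end{align*}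
   Context: For $a_1,a_2,a_3,a_4\in\mathbb{N}$ and $n\in\mathbb{N}_0$, $N(a_1,a_2,a_3,a_4;n)$ denotes the number of $(x_1,x_2,x_3,x_4)\in\mathbb{Z}^4$ with $n=a_1x_1^2+a_2x_2^2+a_3x_3^2+a_4x_4^2$. Let $\chi_0$ be the trivial character, and $\chi_1(m)=\left(\frac{5}{m}\right)$, $\chi_2(m)=\left(\frac{8}{m}\right)$, $\chi_3(m)=\left(\frac{40}{m}\right)$ (Kronecker symbols). For Dirichlet characters $\chi,\psi$ and $x\in\mathbb{N}$, $\sigma_{\chi,\psi}(x)=\sum_{m\mid x}\psi(m)\chi(x/m)\,m$ (sum over positive divisors $m$). Let $q=e^{2\pi i z}$ with $\mathrm{Im}(z)>0$ and $\eta(z)=q^{1/24}\prod_{m\ge1}(1-q^m)$. The integers $d_k(n)$ are defined by $\sum_{n\ge1}d_1(n)q^n=\dfrac{\eta^2(z)\eta^6(4z)\eta(20z)}{\eta^3(2z)\eta^2(8z)}$, $\sum_{n\ge1}d_2(n)q^n=\dfrac{\eta^2(5z)\eta(8z)\eta(10z)\eta(40z)}{\eta(20z)}$, $\sum_{n\ge1}d_3(n)q^n=\dfrac{\eta(z)\eta(5z)\eta(20z)\eta^2(40z)}{\eta(10z)}$, $\sum_{n\ge1}d_4(n)q^n=\dfrac{\eta(z)\eta(4z)\eta(5z)\eta^2(8z)}{\eta(2z)}$. -}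

module Defs where

open import Data.Nat as ℕ using (ℕ; zero; suc; _∸_; _≤ᵇ_; _%_)
open import Data.Nat.Divisibility using (_∣?_)
open import Data.Nat.DivMod using (_/_)
open import Data.Integer as ℤ using (ℤ; +_; -[1+_]; _+_; _-_; _*_; -_)
open import Data.List using (List; []; _∷_; map; foldr; length; filter; upTo; concatMap)
open import Data.Product using (_×_; _,_)
open import Data.Bool using (if_then_else_)
open import Relation.Nullary.Decidable using (⌊_⌋)

sumℤ : List ℤ → ℤ
sumℤ = foldr _+_ (+ 0)

range : ℕ → List ℤ
range n = map (λ i → (+ i) - (+ n)) (upTo (suc (n ℕ.+ n)))

box4 : ℕ → List (ℤ × ℤ × ℤ × ℤ)
box4 n = concatMap (λ x₁ → concatMap (λ x₂ → concatMap (λ x₃ → map (λ x₄ → (x₁ , x₂ , x₃ , x₄))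
           (range n)) (range n)) (range n)) (range n)

-- N(a1,a2,a3,a4;n): number of (x1,x2,x3,x4) ∈ ℤ⁴ with n = Σ a_i x_i².
-- Since every a_i ≥ 1, any solution has |x_i| ≤ n, so counting in the box is exact.
N : ℕ → ℕ → ℕ → ℕ → ℕ → ℕ
N a₁ a₂ a₃ a₄ n = length (filter (λ { (x₁ , x₂ , x₃ , x₄) →
    (+ n) ℤ.≟ ((+ a₁) * x₁ * x₁ + (+ a₂) * x₂ * x₂ + (+ a₃) * x₃ * x₃ + (+ a₄) * x₄ * x₄) })
  (box4 n))

χ₀ : ℕ → ℤ
χ₀ m = + 1

-- Kronecker symbol (5/m): m ≡ ±1 (mod 5) ↦ 1, m ≡ ±2 (mod 5) ↦ -1, 5 ∣ m ↦ 0
χ₁ : ℕ → ℤ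
χ₁ m with m % 5
... | 0 = + 0
... | 1 = + 1
... | 4 = + 1
... | _ = - (+ 1)

-- Kronecker symbol (8/m): m even ↦ 0, m ≡ ±1 (mod 8) ↦ 1, m ≡ ±3 (mod 8) ↦ -1
χ₂ : ℕ → ℤ
χ₂ m with m % 8
... | 1 = + 1
... | 7 = + 1
... | 3 = - (+ 1)
... | 5 = - (+ 1)
... | _ = + 0

-- Kronecker symbol (40/m) = (8/m)(5/m)
χ₃ : ℕ → ℤ
χ₃ m = χ₂ m * χ₁ m

-- divisors m = k+1 of x, listed by k ∈ {0,…,x-1}
divisorsPred : ℕ → List ℕ
divisorsPred x = filter (λ k → suc k ∣? x) (upTo x)

σ : (ℕ → ℤ) → (ℕ → ℤ) → ℕ → ℤ
σ χ ψ x = sumℤ (map (λ k → ψ (suc k) * χ (x / suc k) * (+ suc k)) (divisorsPred x))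

-- formal power series, given by their coefficient function
Series : Set
Series = ℕ → ℤ

one : Series
one zero = + 1
one (suc _) = + 0

mulOneMinus : ℕ → Series → Series
mulOneMinus j f i = f i - (if j ≤ᵇ i then f (i ∸ j) else + 0)

-- multiply by (1 - q^j)^{-1} = Σ_t q^{tj}   (for j ≥ 1 only t ≤ i contribute)
divOneMinus : ℕ → Series → Series
divOneMinus j f i = sumℤ (map (λ t → if t ℕ.* j ≤ᵇ i then f (i ∸ t ℕ.* j) else + 0) (upTo (suc i)))

iter : ℕ → (Series → Series) → Series → Series
iter zero g f = f
iter (suc k) g f = g (iter k g f)

powOneMinus : ℤ → ℕ → Series → Series
powOneMinus (+ e) j = iter e (mulOneMinus j)
powOneMinus -[1+ e ] j = iter (suc e) (divOneMinus j)

etaFactorUpTo : ℕ → ℕ × ℤ → Series → Series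
etaFactorUpTo M (k , e) f = foldr (λ m g → powOneMinus e (k ℕ.* m) g) f (map suc (upTo M))

-- Coefficient of q^N in ∏_{(k,e)} ∏_{m ≥ 1} (1 - q^{k m})^e   (all k ≥ 1).
-- Factors with k m > N do not affect this coefficient, so truncating at m ≤ N is exact.
prodCoeff : List (ℕ × ℤ) → ℕ → ℤ
prodCoeff fs N = foldr (etaFactorUpTo N) one fs N

-- Coefficient of q^n in the eta quotient q^s ∏_{(k,e)} ∏_{m≥1}(1-q^{km})^e,
-- where s = (Σ k e)/24 is the leading exponent.
etaQuotCoeff : ℕ → List (ℕ × ℤ) → ℕ → ℤ
etaQuotCoeff s fs n = if s ≤ᵇ n then prodCoeff fs (n ∸ s) else + 0

-- η²(z)η⁶(4z)η(20z) / (η³(2z)η²(8z)) ;  (2·1+6·4+20-3·2-2·8)/24 = 1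
d₁ : ℕ → ℤ
d₁ = etaQuotCoeff 1 ((1 , + 2) ∷ (4 , + 6) ∷ (20 , + 1) ∷ (2 , - (+ 3)) ∷ (8 , - (+ 2)) ∷ [])

-- η²(5z)η(8z)η(10z)η(40z) / η(20z) ;  (10+8+10+40-20)/24 = 2
d₂ : ℕ → ℤ
d₂ = etaQuotCoeff 2 ((5 , + 2) ∷ (8 , + 1) ∷ (10 , + 1) ∷ (40 , + 1) ∷ (20 , - (+ 1)) ∷ [])

-- η(z)η(5z)η(20z)η²(40z) / η(10z) ;  (1+5+20+80-10)/24 = 4
d₃ : ℕ → ℤ
d₃ = etaQuotCoeff 4 ((1 , + 1) ∷ (5 , + 1) ∷ (20 , + 1) ∷ (40 , + 2) ∷ (10 , - (+ 1)) ∷ [])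

-- η(z)η(4z)η(5z)η²(8z) / η(2z) ;  (1+4+5+16-2)/24 = 1
d₄ : ℕ → ℤ
d₄ = etaQuotCoeff 1 ((1 , + 1) ∷ (4 , + 1) ∷ (5 , + 1) ∷ (8 , + 2) ∷ (2 , - (+ 1)) ∷ [])

module Submission where

-- By Gauss' product formulas the eta quotients are products of dilations of the theta functions φ, ψ and of
-- W = ψ(q²)φ(q⁵) - qφ(q)ψ(q¹⁰) = ∏(1-qᵐ)(1-q⁵ᵐ), and N(a₁,a₂,a₃,a₄;n) is the n-th coefficient of ∏ φ(q^aᵢ).  So every
-- formula is an identity between four Eisenstein series of weight two and quartic polynomials in theta functions.
--
-- Products of Lambert series of weight one are handled by Liouville's elementary method: for functions F, G periodic in
-- all arguments with F(a,b,x+y,y) + F(b,a,y,x+y) = G(a,b,x+y,y) - G(a,a+b,x,y), the sum of F over ax + by = n collapses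
-- to a sum over the divisors of n.  A finite table for G thus certifies each quadratic relation between weight-one
-- series.  These relations give the Lambert series for the discriminants -4, -8, -20, -40 as products of thetas, express
-- the four weight-two Eisenstein series, and imply the quintic modular equation between φ(±q) and φ(±q⁵).  The eight
-- formulas are then consequences of that equation by polynomial algebra.

-- Formal power series offer no bound after which comparing finitely many coefficients is enough, so
-- infinitely many coefficients have to be reached in other ways. In the certificates this is done
-- by periodicity. Elsewhere it is done by functional equations between `A(q)` and `A(q²)`: if two
-- solutions agree modulo `qⁿ`, their dilations agree modulo `q²ⁿ`, and the equation carries this
-- back to the solutions, so that the known precision (nearly) doubles at each round. The two-square
-- theorem, the products for `ψ` and `W` and the theta series of discriminant -20 are obtained this
-- way. The discriminants -20 and -40 have two classes of forms each, in different genera. `X₂₀` and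
-- `X₄₀` are half the sum of the two theta series, `Y₂₀` and `Y₄₀` half their difference. The genus
-- character splits over the two summation variables, so the `Y` series carry one character in each.
-- The denominator 7 comes from the Eisenstein series belonging to `σ χ₀ χ₃`: its constant term is
-- `L(-1, χ₃)/2 = -7`, while the other three have constant term 0.

open import Defs
open import Algebra.Bundles using (CommutativeRing)
open import Data.Bool using (Bool; true; false; T; if_then_else_; _∧_)
open import Data.Nat as ℕ using (ℕ; zero; suc; _∸_; z≤n; s≤s; _≤_; _<_; _%_; NonZero)
import Data.Nat.Properties as ℕP
open import Data.Nat.DivMod using (_/_)
import Data.Nat.DivMod as DM
open import Data.Nat.Divisibility using (_∣_; _∣?_; divides)
import Data.Nat.Divisibility as ∣P
open import Data.Integer as ℤ using (ℤ; +_; -[1+_]; _+_; _-_; _*_; -_)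
import Data.Integer.Properties as ℤP
open import Data.Integer.Tactic.RingSolver using (solve-∀)
open import Data.List as List using (List; []; _∷_)
open import Data.Vec as Vec using (Vec; []; _∷_)
open import Data.Vec.N-ary using (N-ary; _$ⁿ_)
open import Data.Fin using (#_)
open import Data.Fin.Patterns using (0F; 1F; 2F; 3F; 4F)
open import Data.Maybe using (Maybe; just; nothing; is-just)
open import Data.Product using (_,_; _×_; Σ; proj₁; proj₂)
open import Data.Sum using (inj₁; inj₂)
open import Data.Empty using (⊥; ⊥-elim)
open import Data.Unit using (⊤)
import Data.List.Properties as ListP
open import Relation.Binary.PropositionalEquality using (_≡_; _≢_; refl; sym; trans; cong; cong₂; subst; module ≡-Reasoning)
open import Relation.Binary.Structures using (IsEquivalence)
open import Relation.Nullary using (¬_; yes; no; Dec)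
open import Relation.Nullary.Decidable using (⌊_⌋)
open import Level using (0ℓ)
open import Function using (_∘_; case_of_)
import Algebra.Solver.Ring as RingSolver
open import Algebra.Solver.Ring.AlmostCommutativeRing using (fromCommutativeRing; _-Raw-AlmostCommutative⟶_)

-- Formal power series

infix  4 _≈_
infixl 6 _⊕_
infixl 7 _⊛_
infix  8 ⊝_

-- A record, and not a synonym for pointwise equality, so that `f` and `g` can be inferred from the
-- type of a proof.
record _≈_ (f g : Series) : Set where
  constructor pw
  field coeff : ∀ n → f n ≡ g n
open _≈_ public

tail : Series → Series
tail f n = f (suc n)

-- Opaque so that unification treats sums as terms instead of comparing their coefficients.
opaque
  _⊕_ : Series → Series → Series
  (f ⊕ g) n = f n + g n

  ⊝_ : Series → Series
  (⊝ f) n = - f n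

  ⊕-at : ∀ f g n → (f ⊕ g) n ≡ f n + g n
  ⊕-at f g n = refl

  ⊝-at : ∀ f n → (⊝ f) n ≡ - f n
  ⊝-at f n = refl

_∙_ : ℤ → Series → Series
(c ∙ f) n = c * f n

-- The Cauchy product through `f = f 0 + q · tail f`; its laws are then inductions on the index with
-- `tail f` in place of `f`.
_⊛_ : Series → Series → Series
(f ⊛ g) zero    = f 0 * g 0
(f ⊛ g) (suc n) = f 0 * g (suc n) + (tail f ⊛ g) n

con : ℤ → Series
con c zero    = c
con c (suc _) = + 0

con-0 : ∀ i → con (+ 0) i ≡ + 0
con-0 zero    = refl
con-0 (suc i) = refl

⊛-congₙ : ∀ {f f′ g g′} n → (∀ i → i ℕ.≤ n → f i ≡ f′ i) → (∀ i → i ℕ.≤ n → g i ≡ g′ i) →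
          (f ⊛ g) n ≡ (f′ ⊛ g′) n
⊛-congₙ zero    p q = cong₂ _*_ (p 0 z≤n) (q 0 z≤n)
⊛-congₙ (suc n) p q = cong₂ _+_ (cong₂ _*_ (p 0 z≤n) (q (suc n) ℕP.≤-refl))
  (⊛-congₙ n (λ i i≤n → p (suc i) (s≤s i≤n)) (λ i i≤n → q i (ℕP.m≤n⇒m≤1+n i≤n)))

⊛-cong : ∀ {f f′ g g′} → f ≈ f′ → g ≈ g′ → f ⊛ g ≈ f′ ⊛ g′
⊛-cong p q = pw λ n → ⊛-congₙ n (λ i _ → coeff p i) (λ i _ → coeff q i)

opaque
  unfolding _⊕_
  ⊛-distribʳ : ∀ h f g n → ((f ⊕ g) ⊛ h) n ≡ ((f ⊛ h) ⊕ (g ⊛ h)) n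
  ⊛-distribʳ h f g zero    = ℤP.*-distribʳ-+ (h 0) (f 0) (g 0)
  ⊛-distribʳ h f g (suc n) rewrite ⊛-distribʳ h (tail f) (tail g) n =
    lemma (f 0) (g 0) (h (suc n)) ((tail f ⊛ h) n) ((tail g ⊛ h) n)
    where
    lemma : ∀ a b c d e → (a + b) * c + (d + e) ≡ (a * c + d) + (b * c + e)
    lemma = solve-∀

∙-⊛ : ∀ c f g n → ((c ∙ f) ⊛ g) n ≡ (c ∙ (f ⊛ g)) n
∙-⊛ c f g zero    = ℤP.*-assoc c (f 0) (g 0)
∙-⊛ c f g (suc n) rewrite ∙-⊛ c (tail f) g n = lemma c (f 0) (g (suc n)) ((tail f ⊛ g) n)
  where
  lemma : ∀ c a b d → c * a * b + c * d ≡ c * (a * b + d)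
  lemma = solve-∀

⊛-sucʳ : ∀ f g n → (f ⊛ g) (suc n) ≡ (f ⊛ tail g) n + f (suc n) * g 0
⊛-sucʳ f g zero    = refl
⊛-sucʳ f g (suc n) rewrite ⊛-sucʳ (tail f) g n = sym (ℤP.+-assoc (f 0 * g (suc (suc n))) _ _)

⊛-comm : ∀ f g n → (f ⊛ g) n ≡ (g ⊛ f) n
⊛-comm f g zero    = ℤP.*-comm (f 0) (g 0)
⊛-comm f g (suc n) rewrite ⊛-sucʳ g f n | ⊛-comm (tail f) g n = lemma (f 0) (g (suc n)) ((g ⊛ tail f) n)
  where
  lemma : ∀ a b c → a * b + c ≡ c + b * a
  lemma = solve-∀

opaque
  unfolding _⊕_
  ⊛-assoc : ∀ f g h n → ((f ⊛ g) ⊛ h) n ≡ (f ⊛ (g ⊛ h)) n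
  ⊛-assoc f g h zero    = ℤP.*-assoc (f 0) (g 0) (h 0)
  ⊛-assoc f g h (suc n)
    rewrite ⊛-distribʳ h (f 0 ∙ tail g) (tail f ⊛ g) n
          | ∙-⊛ (f 0) (tail g) h n
          | ⊛-assoc (tail f) g h n
    = lemma (f 0) (g 0) (h (suc n)) ((tail g ⊛ h) n) ((tail f ⊛ (g ⊛ h)) n)
    where
    lemma : ∀ a b c d e → a * b * c + (a * d + e) ≡ a * (b * c + d) + e
    lemma = solve-∀

con-⊛ : ∀ c f n → (con c ⊛ f) n ≡ (c ∙ f) n
con-⊛ c f zero    = refl
con-⊛ c f (suc n) = trans (cong (_+_ (c * f (suc n))) (zero-⊛ n)) (ℤP.+-identityʳ _)
  where
  zero-⊛ : ∀ n → (tail (con c) ⊛ f) n ≡ + 0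
  zero-⊛ zero    = refl
  zero-⊛ (suc n) = trans (ℤP.+-identityˡ _) (zero-⊛ n)

opaque
  unfolding _⊕_ ⊝_

  ⊕-cong : ∀ {f f′ g g′} → f ≈ f′ → g ≈ g′ → f ⊕ g ≈ f′ ⊕ g′
  ⊕-cong p q = pw λ n → cong₂ _+_ (coeff p n) (coeff q n)

  ⊝-cong : ∀ {f f′} → f ≈ f′ → ⊝ f ≈ ⊝ f′
  ⊝-cong p = pw λ n → cong -_ (coeff p n)

  ⊕-assoc : ∀ f g h → (f ⊕ g) ⊕ h ≈ f ⊕ (g ⊕ h)
  ⊕-assoc f g h = pw λ n → ℤP.+-assoc (f n) (g n) (h n)

  ⊕-comm : ∀ f g → f ⊕ g ≈ g ⊕ f
  ⊕-comm f g = pw λ n → ℤP.+-comm (f n) (g n)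

  ⊕-idˡ : ∀ f → con (+ 0) ⊕ f ≈ f
  ⊕-idˡ f = pw λ { zero → ℤP.+-identityˡ (f 0) ; (suc n) → ℤP.+-identityˡ (f (suc n)) }

  ⊕-invˡ : ∀ f → (⊝ f) ⊕ f ≈ con (+ 0)
  ⊕-invˡ f = pw λ { zero → ℤP.+-inverseˡ (f 0) ; (suc n) → ℤP.+-inverseˡ (f (suc n)) }

  ⊛-distribˡ : ∀ h f g → h ⊛ (f ⊕ g) ≈ (h ⊛ f) ⊕ (h ⊛ g)
  ⊛-distribˡ h f g = pw λ n → trans (⊛-comm h (f ⊕ g) n)
    (trans (⊛-distribʳ h f g n) (cong₂ _+_ (⊛-comm f h n) (⊛-comm g h n)))

  con-+ : ∀ a b → con (a + b) ≈ con a ⊕ con b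
  con-+ a b = pw λ { zero → refl ; (suc n) → refl }

  con-neg : ∀ a → con (- a) ≈ ⊝ con a
  con-neg a = pw λ { zero → refl ; (suc n) → refl }

⊛-idˡ : ∀ f → con (+ 1) ⊛ f ≈ f
⊛-idˡ f = pw λ n → trans (con-⊛ (+ 1) f n) (ℤP.*-identityˡ (f n))

≈-equiv : IsEquivalence _≈_
≈-equiv = record { refl = pw λ n → refl ; sym = λ p → pw λ n → sym (coeff p n)
                 ; trans = λ p q → pw λ n → trans (coeff p n) (coeff q n) }

seriesRing : CommutativeRing 0ℓ 0ℓ
seriesRing = record
  { Carrier = Series ; _≈_ = _≈_ ; _+_ = _⊕_ ; _*_ = _⊛_ ; -_ = ⊝_ ; 0# = con (+ 0) ; 1# = con (+ 1)
  ; isCommutativeRing = record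
    { isRing = record
      { +-isAbelianGroup = record
        { isGroup = record
          { isMonoid = record
            { isSemigroup = record
              { isMagma = record { isEquivalence = ≈-equiv ; ∙-cong = ⊕-cong }
              ; assoc = ⊕-assoc }
            ; identity = ⊕-idˡ , λ f → ≈-trans (⊕-comm f _) (⊕-idˡ f) }
          ; inverse = ⊕-invˡ , λ f → ≈-trans (⊕-comm f _) (⊕-invˡ f)
          ; ⁻¹-cong = ⊝-cong }
        ; comm = ⊕-comm }
      ; *-cong = ⊛-cong ; *-assoc = λ f g h → pw (⊛-assoc f g h)
      ; *-identity = ⊛-idˡ , λ f → ≈-trans (pw (⊛-comm f _)) (⊛-idˡ f)
      ; distrib = ⊛-distribˡ , λ h f g → pw (⊛-distribʳ h f g) }
    ; *-comm = λ f g → pw (⊛-comm f g) } }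
  where
  ≈-trans = IsEquivalence.trans ≈-equiv

module S where
  open CommutativeRing seriesRing public using (refl; sym; trans; setoid)

con-hom : ℤ.+-*-rawRing -Raw-AlmostCommutative⟶ fromCommutativeRing seriesRing
con-hom = record
  { ⟦_⟧ = con
  ; +-homo = con-+
  ; *-homo = λ a b → pw λ n → sym (trans (con-⊛ a (con b) n) (go a b n))
  ; -‿homo = con-neg
  ; 0-homo = S.refl
  ; 1-homo = S.refl }
  where
  go : ∀ a b n → a * con b n ≡ con (a * b) n
  go a b zero    = refl
  go a b (suc n) = ℤP.*-zeroʳ a

coeff≟ : ∀ a b → Maybe (con a ≈ con b)
coeff≟ a b with a ℤP.≟ b
... | yes refl = just S.refl
... | no  _    = nothing

module Ring = RingSolver ℤ.+-*-rawRing (fromCommutativeRing seriesRing) con-hom coeff≟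
open Ring public using (Polynomial; ⟦_⟧; _:+_; _:*_; :-_; _:-_; _:=_) renaming (con to κ)

private
  close : ∀ m → N-ary m (Polynomial m) (Polynomial m × Polynomial m) → Polynomial m × Polynomial m
  close m f = f $ⁿ Vec.map Ring.var (Vec.allFin m)

-- Both sides are normalised as integer polynomials during type checking. The hidden argument of
-- type `T` can be filled exactly when the normal forms agree, which also excludes the case
-- `nothing`.
identity : ∀ m (f : N-ary m (Polynomial m) (Polynomial m × Polynomial m)) →
           let (e₁ , e₂) = close m f in
           {T (is-just (Ring.normalise e₁ Ring.≟N Ring.normalise e₂))} →
           (ρ : Vec Series m) → ⟦ e₁ ⟧ ρ ≈ ⟦ e₂ ⟧ ρ
identity m f ρ with Ring.normalise (proj₁ (close m f)) Ring.≟N Ring.normalise (proj₂ (close m f))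
... | just p = S.trans (S.sym (Ring.correct (proj₁ (close m f)) ρ)) (S.trans (Ring.⟦ p ⟧N-cong ρ) (Ring.correct (proj₂ (close m f)) ρ))

-- Finite sums and the Kronecker delta

∑ : ℕ → (ℕ → ℤ) → ℤ
∑ zero    f = + 0
∑ (suc n) f = ∑ n f + f n

∑-cong : ∀ n {f g : ℕ → ℤ} → (∀ i → i < n → f i ≡ g i) → ∑ n f ≡ ∑ n g
∑-cong zero    p = refl
∑-cong (suc n) p = cong₂ _+_ (∑-cong n λ i i<n → p i (ℕP.m≤n⇒m≤1+n i<n)) (p n ℕP.≤-refl)

∑-0 : ∀ n {f : ℕ → ℤ} → (∀ i → i < n → f i ≡ + 0) → ∑ n f ≡ + 0
∑-0 n p = trans (∑-cong n p) (go n)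
  where
  go : ∀ n → ∑ n (λ _ → + 0) ≡ + 0
  go zero    = refl
  go (suc n) = trans (ℤP.+-identityʳ _) (go n)

∑-+ : ∀ n (f g : ℕ → ℤ) → ∑ n (λ i → f i + g i) ≡ ∑ n f + ∑ n g
∑-+ zero    f g = refl
∑-+ (suc n) f g rewrite ∑-+ n f g = lemma (∑ n f) (∑ n g) (f n) (g n)
  where
  lemma : ∀ a b c d → a + b + (c + d) ≡ a + c + (b + d)
  lemma = solve-∀

∑-*ˡ : ∀ n c (f : ℕ → ℤ) → ∑ n (λ i → c * f i) ≡ c * ∑ n f
∑-*ˡ zero    c f = sym (ℤP.*-zeroʳ c)
∑-*ˡ (suc n) c f rewrite ∑-*ˡ n c f = sym (ℤP.*-distribˡ-+ c (∑ n f) (f n))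

∑-swap : ∀ m n (f : ℕ → ℕ → ℤ) → ∑ m (λ i → ∑ n (f i)) ≡ ∑ n (λ j → ∑ m (λ i → f i j))
∑-swap zero    n f = sym (∑-0 n λ _ _ → refl)
∑-swap (suc m) n f rewrite ∑-swap m n f = sym (∑-+ n _ (f m))

∑-suc : ∀ n (f : ℕ → ℤ) → ∑ (suc n) f ≡ f 0 + ∑ n (λ i → f (suc i))
∑-suc zero    f = trans (ℤP.+-identityˡ (f 0)) (sym (ℤP.+-identityʳ (f 0)))
∑-suc (suc n) f rewrite ∑-suc n f = ℤP.+-assoc (f 0) _ _

∑-++ : ∀ m n (f : ℕ → ℤ) → ∑ (m ℕ.+ n) f ≡ ∑ m f + ∑ n (λ i → f (m ℕ.+ i))
∑-++ m zero    f rewrite ℕP.+-identityʳ m = sym (ℤP.+-identityʳ _)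
∑-++ m (suc n) f rewrite ℕP.+-suc m n | ∑-++ m n f = ℤP.+-assoc (∑ m f) _ _

∑-extend : ∀ {m n} (f : ℕ → ℤ) → m ≤ n → (∀ i → m ≤ i → f i ≡ + 0) → ∑ n f ≡ ∑ m f
∑-extend {m} {n} f m≤n p = begin
  ∑ n f                                      ≡⟨ cong (λ k → ∑ k f) (sym (ℕP.m+[n∸m]≡n m≤n)) ⟩
  ∑ (m ℕ.+ (n ∸ m)) f                        ≡⟨ ∑-++ m (n ∸ m) f ⟩
  ∑ m f + ∑ (n ∸ m) (λ i → f (m ℕ.+ i))      ≡⟨ cong (_+_ (∑ m f)) (∑-0 (n ∸ m) λ i _ → p _ (ℕP.m≤m+n m i)) ⟩
  ∑ m f + + 0                                ≡⟨ ℤP.+-identityʳ _ ⟩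
  ∑ m f                                      ∎
  where open ≡-Reasoning

δ : ℕ → ℕ → ℤ
δ m n = if m ℕ.≡ᵇ n then + 1 else + 0

δ-refl : ∀ n → δ n n ≡ + 1
δ-refl zero    = refl
δ-refl (suc n) = δ-refl n

δ-≢ : ∀ {m n} → m ≢ n → δ m n ≡ + 0
δ-≢ {zero}  {zero}  p = ⊥-elim (p refl)
δ-≢ {zero}  {suc n} p = refl
δ-≢ {suc m} {zero}  p = refl
δ-≢ {suc m} {suc n} p = δ-≢ {m} {n} (λ e → p (cong suc e))

∑-δ : ∀ {n k} (f : ℕ → ℤ) → k < n → ∑ n (λ i → δ i k * f i) ≡ f k
∑-δ {suc n} {k} f k<n with k ℕP.≟ n
... | yes refl rewrite δ-refl k = begin
  ∑ k (λ i → δ i k * f i) + + 1 * f k ≡⟨ cong₂ _+_ (∑-0 k λ i i<k → cong (_* f i) (δ-≢ (ℕP.<⇒≢ i<k))) (ℤP.*-identityˡ _) ⟩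
  + 0 + f k                           ≡⟨ ℤP.+-identityˡ _ ⟩
  f k                                 ∎
  where open ≡-Reasoning
... | no k≢n rewrite δ-≢ {n} {k} (λ e → k≢n (sym e)) =
  trans (ℤP.+-identityʳ _) (∑-δ f (ℕP.≤∧≢⇒< (ℕP.≤-pred k<n) k≢n))

-- Congruence modulo powers of q, and cancellation

infix 4 _≈[_]_
record _≈[_]_ (f : Series) (n : ℕ) (g : Series) : Set where
  constructor tr
  field coeff< : ∀ i → i < n → f i ≡ g i
open _≈[_]_ public

≈⇒≈[] : ∀ {f g n} → f ≈ g → f ≈[ n ] g
≈⇒≈[] p = tr λ i _ → coeff p i

≈[]⇒≈ : ∀ {f g} → (∀ n → f ≈[ n ] g) → f ≈ g
≈[]⇒≈ p = pw λ n → coeff< (p (suc n)) n ℕP.≤-refl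

≈[]-weaken : ∀ {f g m n} → m ≤ n → f ≈[ n ] g → f ≈[ m ] g
≈[]-weaken m≤n p = tr λ i i<m → coeff< p i (ℕP.<-≤-trans i<m m≤n)

[]-refl : ∀ {f n} → f ≈[ n ] f
[]-refl = tr λ _ _ → refl

[]-sym : ∀ {f g n} → f ≈[ n ] g → g ≈[ n ] f
[]-sym p = tr λ i i<n → sym (coeff< p i i<n)

[]-trans : ∀ {f g h n} → f ≈[ n ] g → g ≈[ n ] h → f ≈[ n ] h
[]-trans p q = tr λ i i<n → trans (coeff< p i i<n) (coeff< q i i<n)

[]-⊛ : ∀ {f f′ g g′ n} → f ≈[ n ] f′ → g ≈[ n ] g′ → f ⊛ g ≈[ n ] f′ ⊛ g′
[]-⊛ p q = tr λ i i<n → ⊛-congₙ i (λ j j≤i → coeff< p j (ℕP.≤-<-trans j≤i i<n)) (λ j j≤i → coeff< q j (ℕP.≤-<-trans j≤i i<n))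

opaque
  unfolding _⊕_ ⊝_

  []-⊕ : ∀ {f f′ g g′ n} → f ≈[ n ] f′ → g ≈[ n ] g′ → f ⊕ g ≈[ n ] f′ ⊕ g′
  []-⊕ p q = tr λ i i<n → cong₂ _+_ (coeff< p i i<n) (coeff< q i i<n)

  []-⊝ : ∀ {f f′ n} → f ≈[ n ] f′ → ⊝ f ≈[ n ] ⊝ f′
  []-⊝ p = tr λ i i<n → cong -_ (coeff< p i i<n)

⊛-lead : ∀ d u i → (∀ j → j < i → d j ≡ + 0) → (d ⊛ u) i ≡ d i * u 0
⊛-lead d u zero    p = refl
⊛-lead d u (suc i) p rewrite p 0 (s≤s z≤n) =
  trans (ℤP.+-identityˡ _) (⊛-lead (tail d) u i (λ j j<i → p (suc j) (s≤s j<i)))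

*-cancel-0 : ∀ {a b} → b ≢ + 0 → a * b ≡ + 0 → a ≡ + 0
*-cancel-0 {a} b≢0 p with ℤP.i*j≡0⇒i≡0∨j≡0 a p
... | inj₁ a≡0 = a≡0
... | inj₂ b≡0 = ⊥-elim (b≢0 b≡0)

-- The lowest non-zero coefficient of `d` would meet only `u 0` in the product (`⊛-lead`), and the
-- integers have no zero divisors. The bound `m` in `go` carries the strong induction.
unit-0 : ∀ u d n → u 0 ≢ + 0 → u ⊛ d ≈[ n ] con (+ 0) → d ≈[ n ] con (+ 0)
unit-0 u d n u≢0 p = tr λ i i<n → trans (go (suc i) i ℕP.≤-refl i<n) (sym (con-0 i))
  where
  go : ∀ m i → i < m → i < n → d i ≡ + 0
  go (suc m) i (s≤s i≤m) i<n = *-cancel-0 u≢0 (begin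
    d i * u 0      ≡⟨ sym (⊛-lead d u i λ j j<i → go m j (ℕP.<-≤-trans j<i i≤m) (ℕP.<-trans j<i i<n)) ⟩
    (d ⊛ u) i      ≡⟨ ⊛-comm d u i ⟩
    (u ⊛ d) i      ≡⟨ coeff< p i i<n ⟩
    con (+ 0) i    ≡⟨ con-0 i ⟩
    + 0            ∎)
    where open ≡-Reasoning

opaque
  unfolding _⊕_ ⊝_

  ⊖-0 : ∀ {f g n} → f ⊕ ⊝ g ≈[ n ] con (+ 0) → f ≈[ n ] g
  ⊖-0 {f} {g} p = tr λ i i<n → trans (lemma (f i) (g i)) (trans (cong (_+ g i) (trans (coeff< p i i<n) (con-0 i))) (ℤP.+-identityˡ _))
    where
    lemma : ∀ a b → a ≡ a + - b + b
    lemma = solve-∀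

unit-cancel : ∀ u {f g n} → u 0 ≢ + 0 → u ⊛ f ≈[ n ] u ⊛ g → f ≈[ n ] g
unit-cancel u {f} {g} {n} u≢0 p = ⊖-0 (unit-0 u (f ⊕ ⊝ g) n u≢0 ([]-trans
  (≈⇒≈[] (identity 3 (λ u f g → u :* (f :+ :- g) := u :* f :+ :- (u :* g)) (u ∷ f ∷ g ∷ [])))
  ([]-trans ([]-⊕ p []-refl) (≈⇒≈[] (identity 1 (λ x → x :+ :- x := κ (+ 0)) (u ⊛ g ∷ []))))))

-- The ring of series is an integral domain. The index `k` witnesses that `u` is not zero; leading
-- zeros of `u` are stripped by `tail` until `unit-0` applies.
nz-0 : ∀ k u d → u k ≢ + 0 → u ⊛ d ≈ con (+ 0) → d ≈ con (+ 0)
nz-0 k u d uk p with u 0 ℤP.≟ + 0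
... | no u0 = ≈[]⇒≈ λ n → unit-0 u d n u0 (≈⇒≈[] p)
nz-0 zero    u d uk p | yes u0 = ⊥-elim (uk u0)
nz-0 (suc k) u d uk p | yes u0 = nz-0 k (tail u) d uk (pw λ n →
  trans (trans (sym (ℤP.+-identityˡ _)) (cong (λ z → z * d (suc n) + (tail u ⊛ d) n) (sym u0))) (trans (coeff p (suc n)) (z n)))
  where
  z : ∀ n → con (+ 0) (suc n) ≡ con (+ 0) n
  z zero    = refl
  z (suc n) = refl

cancel : ∀ k u {f g} → u k ≢ + 0 → u ⊛ f ≈ u ⊛ g → f ≈ g
cancel k u {f} {g} uk p = ≈[]⇒≈ λ n → ⊖-0 (≈⇒≈[] (nz-0 k u (f ⊕ ⊝ g) uk (S.trans
  (identity 3 (λ u f g → u :* (f :+ :- g) := u :* f :+ :- (u :* g)) (u ∷ f ∷ g ∷ []))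
  (S.trans (⊕-cong p S.refl) (identity 1 (λ x → x :+ :- x := κ (+ 0)) (u ⊛ g ∷ []))))))

-- The difference of squares factors, and `k` witnesses that `f ⊕ g` is not zero. This is how the
-- sign of a square root is fixed later on.
square-injective : ∀ k f g → f k + g k ≢ + 0 → f ⊛ f ≈ g ⊛ g → f ≈ g
square-injective k f g fg p = ≈[]⇒≈ λ n → ⊖-0 (≈⇒≈[] (nz-0 k (f ⊕ g) (f ⊕ ⊝ g) (λ e → fg (trans (sym (⊕-at f g k)) e)) (S.trans
  (identity 2 (λ f g → (f :+ g) :* (f :+ :- g) := f :* f :+ :- (g :* g)) (f ∷ g ∷ []))
  (S.trans (⊕-cong p S.refl) (identity 1 (λ x → x :+ :- x := κ (+ 0)) (g ⊛ g ∷ []))))))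

-- Monomials and dilations

M : ℕ → Series
M zero            = con (+ 1)
M (suc k) zero    = + 0
M (suc k) (suc n) = M k n

M-⊛-< : ∀ k f n → n < k → (M k ⊛ f) n ≡ + 0
M-⊛-< (suc k) f zero    _         = refl
M-⊛-< (suc k) f (suc n) (s≤s n<k) = trans (ℤP.+-identityˡ _) (M-⊛-< k f n n<k)

M-⊛-+ : ∀ k f n → (M k ⊛ f) (k ℕ.+ n) ≡ f n
M-⊛-+ zero    f n = trans (con-⊛ (+ 1) f n) (ℤP.*-identityˡ _)
M-⊛-+ (suc k) f n = trans (ℤP.+-identityˡ _) (M-⊛-+ k f n)

M-⊛ : ∀ k f n → k ≤ n → (M k ⊛ f) n ≡ f (n ∸ k)
M-⊛ k f n k≤n = trans (cong (M k ⊛ f) (sym (ℕP.m+[n∸m]≡n k≤n))) (M-⊛-+ k f (n ∸ k))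

M-+ : ∀ j k → M j ⊛ M k ≈ M (j ℕ.+ k)
M-+ zero    k = pw λ n → M-⊛-+ 0 (M k) n
M-+ (suc j) k = pw λ { zero → refl ; (suc n) → trans (ℤP.+-identityˡ _) (coeff (M-+ j k) n) }

-- The counter `c` is the number of zeros still due before the next coefficient of `f`. Each
-- coefficient is followed by `j` zeros, so the spacing is `suc j`.
dilFrom : ℕ → ℕ → Series → Series
dilFrom j zero    f zero    = f 0
dilFrom j zero    f (suc n) = dilFrom j j (tail f) n
dilFrom j (suc c) f zero    = + 0
dilFrom j (suc c) f (suc n) = dilFrom j c f n

-- dil k f is f(q^k); the value at k = 0 is junk.
dil : ℕ → Series → Series
dil zero    f = f
dil (suc j) f = dilFrom j 0 f

dilFrom-+ : ∀ j c f n → dilFrom j c f (c ℕ.+ n) ≡ dilFrom j 0 f n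
dilFrom-+ j zero    f n = refl
dilFrom-+ j (suc c) f n = dilFrom-+ j c f n

dilFrom-< : ∀ j c f n → n < c → dilFrom j c f n ≡ + 0
dilFrom-< j (suc c) f zero    _         = refl
dilFrom-< j (suc c) f (suc n) (s≤s n<c) = dilFrom-< j c f n n<c

-- The three equations determine `D`, so operators can be identified without comparing their
-- recursions. Composition of dilations and the invariance of even series under `neg` are obtained
-- like this.
record IsDilation (k : ℕ) (D : Series → Series) : Set where
  constructor isDilation
  field
    at-0 : ∀ f → D f 0 ≡ f 0
    at-< : ∀ f r → 0 < r → r < k → D f r ≡ + 0
    at-+ : ∀ f n → D f (k ℕ.+ n) ≡ D (tail f) n
open IsDilation

dil-isDilation : ∀ j → IsDilation (suc j) (dil (suc j))
dil-isDilation j = isDilation (λ f → refl) (λ { f (suc r) _ (s≤s r<j) → dilFrom-< j j (tail f) r r<j })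
  (λ f n → dilFrom-+ j j (tail f) n)

dilation-unique : ∀ {j D D′} → IsDilation (suc j) D → IsDilation (suc j) D′ → ∀ f → D f ≈ D′ f
dilation-unique {j} {D} {D′} d d′ f = pw λ n → go (suc n) f n ℕP.≤-refl
  where
  go : ∀ m f n → n < m → D f n ≡ D′ f n
  go m       f zero    _ = trans (at-0 d f) (sym (at-0 d′ f))
  go (suc m) f (suc n) (s≤s n<m) with suc n ℕP.<? suc j
  ... | yes n<j = trans (at-< d f (suc n) (s≤s z≤n) n<j) (sym (at-< d′ f (suc n) (s≤s z≤n) n<j))
  ... | no  n≮j = subst (λ i → D f i ≡ D′ f i) (ℕP.m+[n∸m]≡n (ℕP.≮⇒≥ n≮j))
        (trans (at-+ d f _) (trans (go m (tail f) (n ∸ j) (ℕP.≤-<-trans (ℕP.m∸n≤m n j) n<m)) (sym (at-+ d′ f _))))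

dil-* : ∀ j f n → dil (suc j) f (n ℕ.* suc j) ≡ f n
dil-* j f zero    = refl
dil-* j f (suc n) = trans (at-+ (dil-isDilation j) f (n ℕ.* suc j)) (dil-* j (tail f) n)

dil-drop : ∀ j f l n → dil (suc j) f (l ℕ.* suc j ℕ.+ n) ≡ dil (suc j) (λ i → f (l ℕ.+ i)) n
dil-drop j f zero    n = refl
dil-drop j f (suc l) n = trans (cong (dil (suc j) f) (ℕP.+-assoc (suc j) (l ℕ.* suc j) n))
  (trans (at-+ (dil-isDilation j) f _) (dil-drop j (tail f) l n))

dil-∤ : ∀ j f n → ¬ (suc j ∣ n) → dil (suc j) f n ≡ + 0
dil-∤ j f n k∤n = begin
  dil (suc j) f n                                            ≡⟨ cong (dil (suc j) f) e ⟩
  dil (suc j) f (n / suc j ℕ.* suc j ℕ.+ n % suc j)          ≡⟨ dil-drop j f (n / suc j) (n % suc j) ⟩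
  dil (suc j) (λ i → f (n / suc j ℕ.+ i)) (n % suc j)        ≡⟨ at-< (dil-isDilation j) _ _ (ℕP.n≢0⇒n>0 λ r → k∤n (∣P.m%n≡0⇒n∣m n (suc j) r)) (DM.m%n<n n (suc j)) ⟩
  + 0                                                        ∎
  where
  open ≡-Reasoning
  e : n ≡ n / suc j ℕ.* suc j ℕ.+ n % suc j
  e = trans (DM.m≡m%n+[m/n]*n n (suc j)) (ℕP.+-comm (n % suc j) _)

dil-congₙ : ∀ j {f g} n → (∀ i → i ℕ.* suc j ≤ n → f i ≡ g i) → dil (suc j) f n ≡ dil (suc j) g n
dil-congₙ j {f} {g} n p with suc j ∣? n
... | yes (divides m refl) = trans (dil-* j f m) (trans (p m ℕP.≤-refl) (sym (dil-* j g m)))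
... | no k∤n = trans (dil-∤ j f n k∤n) (sym (dil-∤ j g n k∤n))

dil-cong : ∀ k {f g} → f ≈ g → dil k f ≈ dil k g
dil-cong zero    p = p
dil-cong (suc j) p = pw λ n → dil-congₙ j n λ i _ → coeff p i

dil-injective : ∀ j {f g} → dil (suc j) f ≈ dil (suc j) g → f ≈ g
dil-injective j {f} {g} p = pw λ n → trans (sym (dil-* j f n)) (trans (coeff p (n ℕ.* suc j)) (dil-* j g n))

-- The doubling step of every uniqueness argument below: an index `2m` smaller than `2n` reads the
-- coefficient `m`, which is smaller than `n`.
[]-dil2 : ∀ {f g n} → f ≈[ n ] g → dil 2 f ≈[ n ℕ.+ n ] dil 2 g
[]-dil2 {n = n} p = tr λ i i<2n → dil-congₙ 1 i λ m m*2≤i → coeff< p m (ℕP.*-cancelʳ-< 2 m n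
  (ℕP.≤-<-trans m*2≤i (subst (i <_) (trans (cong (n ℕ.+_) (sym (ℕP.+-identityʳ n))) (ℕP.*-comm 2 n)) i<2n)))

dil-∘ : ∀ j l f → dil (suc j) (dil (suc l) f) ≈ dil (suc j ℕ.* suc l) f
dil-∘ j l f = dilation-unique (isDilation (λ f → refl) lt plus) (dil-isDilation _) f
  where
  D : Series → Series
  D f = dil (suc j) (dil (suc l) f)
  lt : ∀ f r → 0 < r → r < suc j ℕ.* suc l → D f r ≡ + 0
  lt f r 0<r r<jl with suc j ∣? r
  ... | no  k∤r = dil-∤ j _ r k∤r
  ... | yes (divides m refl) = trans (dil-* j _ m) (at-< (dil-isDilation l) f m
          (ℕP.n≢0⇒n>0 λ { refl → ℕP.<-irrefl refl 0<r })
          (ℕP.*-cancelʳ-< (suc j) m (suc l) (subst (m ℕ.* suc j <_) (ℕP.*-comm (suc j) (suc l)) r<jl)))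
  plus : ∀ f n → D f (suc j ℕ.* suc l ℕ.+ n) ≡ D (tail f) n
  plus f n = trans (cong (λ i → D f (i ℕ.+ n)) (ℕP.*-comm (suc j) (suc l)))
    (trans (dil-drop j (dil (suc l) f) (suc l) n) (dil-congₙ j n λ i _ → at-+ (dil-isDilation l) f i))

opaque
  unfolding _⊕_ ⊝_

  dil-⊕ : ∀ k f g → dil k (f ⊕ g) ≈ dil k f ⊕ dil k g
  dil-⊕ zero    f g = S.refl
  dil-⊕ (suc j) f g = pw go
    where
    go : ∀ n → dil (suc j) (f ⊕ g) n ≡ dil (suc j) f n + dil (suc j) g n
    go n with suc j ∣? n
    ... | yes (divides m refl) rewrite dil-* j (f ⊕ g) m | dil-* j f m | dil-* j g m = refl
    ... | no k∤n rewrite dil-∤ j (f ⊕ g) n k∤n | dil-∤ j f n k∤n | dil-∤ j g n k∤n = refl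

  dil-⊝ : ∀ k f → dil k (⊝ f) ≈ ⊝ dil k f
  dil-⊝ zero    f = S.refl
  dil-⊝ (suc j) f = pw go
    where
    go : ∀ n → dil (suc j) (⊝ f) n ≡ - dil (suc j) f n
    go n with suc j ∣? n
    ... | yes (divides m refl) rewrite dil-* j (⊝ f) m | dil-* j f m = refl
    ... | no k∤n rewrite dil-∤ j (⊝ f) n k∤n | dil-∤ j f n k∤n = refl

  dil-∙ : ∀ j c f n → dil (suc j) (c ∙ f) n ≡ c * dil (suc j) f n
  dil-∙ j c f n with suc j ∣? n
  ... | yes (divides m refl) rewrite dil-* j (c ∙ f) m | dil-* j f m = refl
  ... | no k∤n rewrite dil-∤ j (c ∙ f) n k∤n | dil-∤ j f n k∤n = sym (ℤP.*-zeroʳ c)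

  dil-unfold : ∀ j f → dil (suc j) f ≈ con (f 0) ⊕ M (suc j) ⊛ dil (suc j) (tail f)
  dil-unfold j f = pw go
    where
    go : ∀ n → dil (suc j) f n ≡ con (f 0) n + (M (suc j) ⊛ dil (suc j) (tail f)) n
    go zero    = sym (ℤP.+-identityʳ _)
    go (suc n) with suc n ℕP.<? suc j
    ... | yes n<j rewrite M-⊛-< (suc j) (dil (suc j) (tail f)) (suc n) n<j = at-< (dil-isDilation j) f _ (s≤s z≤n) n<j
    ... | no  n≮j = trans (subst (λ i → dil (suc j) f i ≡ dil (suc j) (tail f) (i ∸ suc j)) (ℕP.m+[n∸m]≡n (ℕP.≮⇒≥ n≮j))
          (trans (at-+ (dil-isDilation j) f _) (cong (dil (suc j) (tail f)) (sym (ℕP.m+n∸m≡n (suc j) _)))))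
          (sym (trans (ℤP.+-identityˡ _) (M-⊛ (suc j) _ (suc n) (ℕP.≮⇒≥ n≮j))))

dil-con : ∀ k c → dil k (con c) ≈ con c
dil-con zero    c = S.refl
dil-con (suc j) c = pw λ { zero → refl ; (suc n) → go (suc n) (s≤s z≤n) }
  where
  go : ∀ n → 0 < n → dil (suc j) (con c) n ≡ con c n
  go (suc n) _ with suc j ∣? suc n
  ... | yes (divides (suc m) e) = trans (cong (dil (suc j) (con c)) e) (dil-* j (con c) (suc m))
  ... | no k∤n = dil-∤ j (con c) (suc n) k∤n

-- Splitting off the constant term, `f(qᵏ) = f 0 + qᵏ · (tail f)(qᵏ)`, reduces the index `n` for `f`
-- to the index `n - k` for `tail f`; below `k` only the constant terms contribute.
dil-⊛ : ∀ k f g → dil k (f ⊛ g) ≈ dil k f ⊛ dil k g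
dil-⊛ zero    f g = S.refl
dil-⊛ (suc j) f g = pw λ n → go (suc n) f n ℕP.≤-refl
  where
  D : Series → Series
  D = dil (suc j)
  expand : ∀ f → D f ⊛ D g ≈ con (f 0) ⊛ D g ⊕ M (suc j) ⊛ (D (tail f) ⊛ D g)
  expand f = S.trans (⊛-cong (dil-unfold j f) S.refl)
    (identity 4 (λ c m t g → (c :+ m :* t) :* g := c :* g :+ m :* (t :* g)) (con (f 0) ∷ M (suc j) ∷ D (tail f) ∷ D g ∷ []))
  go : ∀ m f n → n < m → D (f ⊛ g) n ≡ (D f ⊛ D g) n
  go m f zero _ = refl
  go (suc m) f (suc n) (s≤s n<m) with suc n ℕP.<? suc j
  ... | yes n<j = trans (at-< (dil-isDilation j) (f ⊛ g) _ (s≤s z≤n) n<j) (sym (trans (coeff (expand f) (suc n))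
        (trans (trans (⊕-at _ _ (suc n)) (cong₂ _+_ (trans (con-⊛ (f 0) (D g) (suc n)) (trans (cong (f 0 *_) (at-< (dil-isDilation j) g _ (s≤s z≤n) n<j)) (ℤP.*-zeroʳ (f 0))))
                          (M-⊛-< (suc j) _ (suc n) n<j))) refl)))
  ... | no n≮j = begin
    D (f ⊛ g) (suc n)                                        ≡⟨ cong (D (f ⊛ g)) (sym e) ⟩
    D (f ⊛ g) (suc j ℕ.+ r)                                  ≡⟨ trans (at-+ (dil-isDilation j) (f ⊛ g) r) (dil-congₙ j r λ i _ → sym (⊕-at (f 0 ∙ tail g) (tail f ⊛ g) i)) ⟩
    D ((f 0 ∙ tail g) ⊕ (tail f ⊛ g)) r                      ≡⟨ trans (coeff (dil-⊕ (suc j) (f 0 ∙ tail g) (tail f ⊛ g)) r) (⊕-at _ _ r) ⟩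
    D (f 0 ∙ tail g) r + D (tail f ⊛ g) r                    ≡⟨ cong₂ _+_ (dil-∙ j (f 0) (tail g) r) (go m (tail f) r (ℕP.≤-<-trans (ℕP.m∸n≤m n j) n<m)) ⟩
    f 0 * D (tail g) r + (D (tail f) ⊛ D g) r                ≡⟨ cong₂ _+_ (cong (f 0 *_) (sym (at-+ (dil-isDilation j) g r))) (sym (M-⊛-+ (suc j) _ r)) ⟩
    f 0 * D g (suc j ℕ.+ r) + (M (suc j) ⊛ (D (tail f) ⊛ D g)) (suc j ℕ.+ r) ≡⟨ trans (cong (_+ (M (suc j) ⊛ (D (tail f) ⊛ D g)) (suc j ℕ.+ r)) (sym (con-⊛ (f 0) (D g) (suc j ℕ.+ r)))) (sym (⊕-at _ _ (suc j ℕ.+ r))) ⟩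
    (con (f 0) ⊛ D g ⊕ M (suc j) ⊛ (D (tail f) ⊛ D g)) (suc j ℕ.+ r) ≡⟨ sym (coeff (expand f) (suc j ℕ.+ r)) ⟩
    (D f ⊛ D g) (suc j ℕ.+ r)                                ≡⟨ cong (D f ⊛ D g) e ⟩
    (D f ⊛ D g) (suc n)                                      ∎
    where
    open ≡-Reasoning
    r : ℕ
    r = n ∸ j
    e : suc j ℕ.+ r ≡ suc n
    e = ℕP.m+[n∸m]≡n (ℕP.≮⇒≥ n≮j)

-- The substitution of -q for q

sgn : ℕ → ℤ
sgn zero    = + 1
sgn (suc n) = - sgn n

neg : Series → Series
neg f n = sgn n * f n

neg-cong : ∀ {f g} → f ≈ g → neg f ≈ neg g
neg-cong p = pw λ n → cong (sgn n *_) (coeff p n)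

opaque
  unfolding _⊕_ ⊝_

  neg-⊕ : ∀ f g → neg (f ⊕ g) ≈ neg f ⊕ neg g
  neg-⊕ f g = pw λ n → ℤP.*-distribˡ-+ (sgn n) (f n) (g n)

  neg-⊝ : ∀ f → neg (⊝ f) ≈ ⊝ neg f
  neg-⊝ f = pw λ n → sym (ℤP.neg-distribʳ-* (sgn n) (f n))

neg-tail : ∀ f n → neg f (suc n) ≡ - neg (tail f) n
neg-tail f n = sym (ℤP.neg-distribˡ-* (sgn n) (f (suc n)))

sgn² : ∀ n → sgn n * sgn n ≡ + 1
sgn² zero    = refl
sgn² (suc n) = trans (lemma (sgn n)) (sgn² n)
  where
  lemma : ∀ a → - a * - a ≡ a * a
  lemma = solve-∀

neg-⊛ : ∀ f g → neg (f ⊛ g) ≈ neg f ⊛ neg g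
neg-⊛ f g = pw (go f)
  where
  go : ∀ f n → neg (f ⊛ g) n ≡ (neg f ⊛ neg g) n
  go f zero    = lemma (f 0) (g 0)
    where
    lemma : ∀ a b → + 1 * (a * b) ≡ + 1 * a * (+ 1 * b)
    lemma = solve-∀
  go f (suc n) = begin
    neg (f ⊛ g) (suc n)                                           ≡⟨ lemma (sgn n) (f 0) (g (suc n)) ((tail f ⊛ g) n) ⟩
    + 1 * f 0 * neg g (suc n) + - neg (tail f ⊛ g) n              ≡⟨ cong (λ z → + 1 * f 0 * neg g (suc n) + - z) (go (tail f) n) ⟩
    + 1 * f 0 * neg g (suc n) + - (neg (tail f) ⊛ neg g) n        ≡⟨ cong (_+_ (+ 1 * f 0 * neg g (suc n))) (sym (trans (⊛-congₙ n (λ i _ → neg-tail′ i) (λ _ _ → refl)) (trans (∙-⊛ (- + 1) (neg (tail f)) (neg g) n) (ℤP.-1*i≡-i _)))) ⟩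
    + 1 * f 0 * neg g (suc n) + (tail (neg f) ⊛ neg g) n          ∎
    where
    open ≡-Reasoning
    lemma : ∀ s a b c → - s * (a * b + c) ≡ + 1 * a * (- s * b) + - (s * c)
    lemma = solve-∀
    neg-tail′ : ∀ i → tail (neg f) i ≡ - + 1 * neg (tail f) i
    neg-tail′ i = trans (neg-tail f i) (sym (ℤP.-1*i≡-i _))

neg-neg : ∀ f → neg (neg f) ≈ f
neg-neg f = pw λ n → trans (sym (ℤP.*-assoc (sgn n) (sgn n) (f n))) (trans (cong (_* f n) (sgn² n)) (ℤP.*-identityˡ _))

neg-con : ∀ c → neg (con c) ≈ con c
neg-con c = pw λ { zero → ℤP.*-identityˡ c ; (suc n) → ℤP.*-zeroʳ (- sgn n) }

neg-dil2 : ∀ f → neg (dil 2 f) ≈ dil 2 f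
neg-dil2 f = dilation-unique
  (isDilation (λ f → ℤP.*-identityˡ _) (λ f r 0<r r<2 → trans (cong (sgn r *_) (at-< (dil-isDilation 1) f r 0<r r<2)) (ℤP.*-zeroʳ (sgn r)))
    (λ f n → cong₂ _*_ (ℤP.neg-involutive (sgn n)) (at-+ (dil-isDilation 1) f n))) (dil-isDilation 1) f

module ≈R where
  open import Relation.Binary.Reasoning.Setoid S.setoid public

-- Theta functions and the Euler product

𝟏 𝟐 𝟒 q : Series
𝟏 = con (+ 1)
𝟐 = con (+ 2)
𝟒 = con (+ 4)
q = M 1

M-δ : ∀ k n → M k n ≡ δ k n
M-δ zero    zero    = refl
M-δ zero    (suc n) = refl
M-δ (suc k) zero    = refl
M-δ (suc k) (suc n) = M-δ k n

δ-injective : ∀ (e : ℕ → ℕ) → (∀ {m n} → e m ≡ e n → m ≡ n) → ∀ m n → δ (e m) (e n) ≡ δ m n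
δ-injective e inj m n with m ℕP.≟ n
... | yes refl = trans (δ-refl (e m)) (sym (δ-refl m))
... | no  m≢n  = trans (δ-≢ (λ p → m≢n (inj p))) (sym (δ-≢ m≢n))

∑-even-odd : ∀ m (f : ℕ → ℤ) → ∑ (m ℕ.+ m) f ≡ ∑ m (λ y → f (y ℕ.+ y) + f (suc (y ℕ.+ y)))
∑-even-odd zero    f = refl
∑-even-odd (suc m) f rewrite ℕP.+-suc m m | ∑-even-odd m f = ℤP.+-assoc (∑ m _) (f (m ℕ.+ m)) _

-- The series Σ_x c x · q^(e x); meaningful when x ≤ e x.
sparse : (ℕ → ℤ) → (ℕ → ℕ) → Series
sparse c e n = ∑ (suc n) (λ x → c x * δ (e x) n)

sparse-∑ : ∀ c e m n → (∀ x → x ≤ e x) → n < m → sparse c e n ≡ ∑ m (λ x → c x * δ (e x) n)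
sparse-∑ c e m n le n<m = sym (∑-extend _ n<m λ x n<x →
  trans (cong (c x *_) (δ-≢ (ℕP.>⇒≢ (ℕP.<-≤-trans n<x (le x))))) (ℤP.*-zeroʳ (c x)))

dil-sparse : ∀ j c e m n → (∀ x → x ≤ e x) → n < m → dil (suc j) (sparse c e) n ≡ ∑ m (λ x → c x * δ (e x ℕ.* suc j) n)
dil-sparse j c e m n le n<m with suc j ∣? n
... | yes (divides l refl) = trans (dil-* j _ l) (trans
  (sparse-∑ c e m l le (ℕP.≤-<-trans (ℕP.m≤m*n l (suc j)) n<m))
  (∑-cong m λ x _ → cong (c x *_) (sym (δ-injective (ℕ._* suc j) (ℕP.*-cancelʳ-≡ _ _ (suc j)) (e x) l))))
... | no k∤n = trans (dil-∤ j _ n k∤n) (sym (∑-0 m λ x _ →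
  trans (cong (c x *_) (δ-≢ λ p → k∤n (divides (e x) (sym p)))) (ℤP.*-zeroʳ (c x))))

tri : ℕ → ℕ
tri zero    = 0
tri (suc y) = suc y ℕ.+ tri y

two : ℕ → ℤ
two zero    = + 1
two (suc _) = + 2

φ ψ : Series
φ = sparse two (λ x → x ℕ.* x)
ψ = sparse (λ _ → + 1) tri

x≤x² : ∀ x → x ≤ x ℕ.* x
x≤x² zero    = z≤n
x≤x² (suc x) = ℕP.m≤m*n (suc x) (suc x)

x≤tri : ∀ x → x ≤ tri x
x≤tri zero    = z≤n
x≤tri (suc x) = ℕP.m≤m+n (suc x) (tri x)

module _ where
  open import Data.Nat.Tactic.RingSolver using () renaming (solve-∀ to ℕ-solve)
  2y² : ∀ y → (y ℕ.+ y) ℕ.* (y ℕ.+ y) ≡ (y ℕ.* y) ℕ.* 4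
  2y² = ℕ-solve
  2tri : ∀ y → tri y ℕ.* 2 ≡ y ℕ.* suc y
  2tri zero    = refl
  2tri (suc y) = trans (ℕP.*-distribʳ-+ 2 (suc y) (tri y)) (trans (cong (suc y ℕ.* 2 ℕ.+_) (2tri y)) (lemma y))
    where
    lemma : ∀ y → suc y ℕ.* 2 ℕ.+ y ℕ.* suc y ≡ suc y ℕ.* suc (suc y)
    lemma = ℕ-solve
  odd² : ∀ y → suc (y ℕ.+ y) ℕ.* suc (y ℕ.+ y) ≡ suc (tri y ℕ.* 8)
  odd² y = trans (lemma y) (cong (λ z → suc (z ℕ.* 4)) (sym (2tri y)) ⟨≡⟩ cong suc (ℕP.*-assoc (tri y) 2 4))
    where
    lemma : ∀ y → suc (y ℕ.+ y) ℕ.* suc (y ℕ.+ y) ≡ suc ((y ℕ.* suc y) ℕ.* 4)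
    lemma = ℕ-solve
    _⟨≡⟩_ : ∀ {a b c : ℕ} → a ≡ b → b ≡ c → a ≡ c
    _⟨≡⟩_ = trans

-- An even `x = 2y` contributes the exponent `4y²`, an odd `x = 2y + 1` the exponent
-- `8 · tri y + 1`.
φ-split : φ ≈ dil 4 φ ⊕ 𝟐 ⊛ (q ⊛ dil 8 ψ)
φ-split = pw λ n → trans (coeffs n) (sym (⊕-at _ _ n))
  where
  open ≡-Reasoning
  two-even : ∀ y → two (y ℕ.+ y) ≡ two y
  two-even zero    = refl
  two-even (suc y) = refl
  odd : ∀ n → ∑ (suc n) (λ y → δ (suc (y ℕ.+ y) ℕ.* suc (y ℕ.+ y)) n) ≡ (q ⊛ dil 8 ψ) n
  odd zero    = refl
  odd (suc n) = trans (trans (∑-cong (suc (suc n)) λ y _ → trans (cong (λ z → δ z (suc n)) (odd² y)) (sym (ℤP.*-identityˡ _)))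
      (sym (dil-sparse 7 (λ _ → + 1) tri (suc (suc n)) n x≤tri (ℕP.m≤n⇒m≤1+n ℕP.≤-refl)))) (sym (M-⊛-+ 1 (dil 8 ψ) n))
  coeffs : ∀ n → φ n ≡ dil 4 φ n + (𝟐 ⊛ (q ⊛ dil 8 ψ)) n
  coeffs n = begin
   φ n                                                                     ≡⟨ sparse-∑ two _ (suc n ℕ.+ suc n) n x≤x² (ℕP.m≤m+n (suc n) (suc n)) ⟩
   ∑ (suc n ℕ.+ suc n) (λ x → two x * δ (x ℕ.* x) n)                       ≡⟨ ∑-even-odd (suc n) _ ⟩
   ∑ (suc n) (λ y → two (y ℕ.+ y) * δ ((y ℕ.+ y) ℕ.* (y ℕ.+ y)) n + + 2 * δ (suc (y ℕ.+ y) ℕ.* suc (y ℕ.+ y)) n)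
      ≡⟨ ∑-+ (suc n) _ _ ⟩
   ∑ (suc n) (λ y → two (y ℕ.+ y) * δ ((y ℕ.+ y) ℕ.* (y ℕ.+ y)) n) + ∑ (suc n) (λ y → + 2 * δ (suc (y ℕ.+ y) ℕ.* suc (y ℕ.+ y)) n)
      ≡⟨ cong₂ _+_ (trans (∑-cong (suc n) λ y _ → cong₂ _*_ (two-even y) (cong (λ z → δ z n) (2y² y))) (sym (dil-sparse 3 two _ (suc n) n x≤x² ℕP.≤-refl)))
                   (trans (trans (∑-*ˡ (suc n) (+ 2) _) (cong (_*_ (+ 2)) (odd n))) (sym (con-⊛ (+ 2) (q ⊛ dil 8 ψ) n))) ⟩
   dil 4 φ n + (𝟐 ⊛ (q ⊛ dil 8 ψ)) n ∎

φ′ : Series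
φ′ = neg φ

neg-M : ∀ j → neg (M j) ≈ con (sgn j) ⊛ M j
neg-M j = pw λ n → trans (go j n) (sym (con-⊛ (sgn j) (M j) n))
  where
  go : ∀ j n → neg (M j) n ≡ sgn j * M j n
  go j n with j ℕP.≟ n
  ... | yes refl = refl
  ... | no  j≢n rewrite M-δ j n | δ-≢ j≢n = trans (ℤP.*-zeroʳ (sgn n)) (sym (ℤP.*-zeroʳ (sgn j)))

neg-dil-even : ∀ j f → neg (dil (suc j ℕ.* 2) f) ≈ dil (suc j ℕ.* 2) f
neg-dil-even j f = S.trans (neg-cong e) (S.trans (neg-dil2 _) (S.sym e))
  where
  e : dil (suc j ℕ.* 2) f ≈ dil 2 (dil (suc j) f)
  e = subst (λ k → dil k f ≈ dil 2 (dil (suc j) f)) (ℕP.*-comm 2 (suc j)) (S.sym (dil-∘ 1 j f))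

φ′-split : φ′ ≈ dil 4 φ ⊕ ⊝ (𝟐 ⊛ (q ⊛ dil 8 ψ))
φ′-split = begin
  neg φ                                                    ≈⟨ neg-cong φ-split ⟩
  neg (dil 4 φ ⊕ 𝟐 ⊛ (q ⊛ dil 8 ψ))                        ≈⟨ neg-⊕ _ _ ⟩
  neg (dil 4 φ) ⊕ neg (𝟐 ⊛ (q ⊛ dil 8 ψ))                  ≈⟨ ⊕-cong (neg-dil-even 1 φ) (S.trans (neg-⊛ 𝟐 _) (⊛-cong (neg-con _) (S.trans (neg-⊛ q _) (⊛-cong (neg-M 1) (neg-dil-even 3 ψ))))) ⟩
  dil 4 φ ⊕ 𝟐 ⊛ ((con (- + 1) ⊛ q) ⊛ dil 8 ψ)              ≈⟨ identity 3 (λ f q p → f :+ κ (+ 2) :* ((κ (- + 1) :* q) :* p) := f :+ :- (κ (+ 2) :* (q :* p))) (dil 4 φ ∷ q ∷ dil 8 ψ ∷ []) ⟩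
  dil 4 φ ⊕ ⊝ (𝟐 ⊛ (q ⊛ dil 8 ψ))                          ∎
  where open ≈R

Poch : ℕ → ℕ → Series
Poch k zero    = 𝟏
Poch k (suc m) = Poch k m ⊛ (𝟏 ⊕ ⊝ M (k ℕ.* suc m))

B⁺ : ℕ → Series
B⁺ zero    = 𝟏
B⁺ (suc m) = B⁺ m ⊛ (𝟏 ⊕ M (suc m))

-- `B⁺ s` times the factors `1 - qⁱ` for `s + 2 ≤ i ≤ s + t + 1`. The index `s + 1` is left out; `U`
-- restores it with the sign minus (`U-V₁`) or plus (`U-V₂`), which is what makes the telescoping
-- work.
V : ℕ → ℕ → Series
V s zero    = B⁺ s
V s (suc t) = V s t ⊛ (𝟏 ⊕ ⊝ M (2 ℕ.+ (s ℕ.+ t)))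

U : ℕ → ℕ → Series
U s zero    = B⁺ s
U s (suc t) = U s t ⊛ (𝟏 ⊕ ⊝ M (suc (s ℕ.+ t)))

U-V₁ : ∀ s t → U s (suc t) ≈ V s t ⊛ (𝟏 ⊕ ⊝ M (suc s))
U-V₁ s zero    = ⊛-cong S.refl (⊕-cong S.refl (⊝-cong (pw λ n → cong (λ z → M (suc z) n) (ℕP.+-identityʳ s))))
U-V₁ s (suc t) = S.trans (⊛-cong (U-V₁ s t) (⊕-cong S.refl (⊝-cong (pw λ n → cong (λ z → M (suc z) n) (ℕP.+-suc s t)))))
  (identity 3 (λ v a b → (v :* a) :* b := (v :* b) :* a) (V s t ∷ (𝟏 ⊕ ⊝ M (suc s)) ∷ (𝟏 ⊕ ⊝ M (2 ℕ.+ (s ℕ.+ t))) ∷ []))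

U-V₂ : ∀ s t → U (suc s) t ≈ V s t ⊛ (𝟏 ⊕ M (suc s))
U-V₂ s zero    = S.refl
U-V₂ s (suc t) = S.trans (⊛-cong (U-V₂ s t) S.refl)
  (identity 3 (λ v a b → (v :* a) :* b := (v :* b) :* a) (V s t ∷ (𝟏 ⊕ M (suc s)) ∷ (𝟏 ⊕ ⊝ M (2 ℕ.+ (s ℕ.+ t))) ∷ []))

U-0 : ∀ n → U 0 n ≈ Poch 1 n
U-0 zero    = S.refl
U-0 (suc n) = ⊛-cong (U-0 n) (⊕-cong S.refl (⊝-cong (pw λ i → cong (λ z → M z i) (sym (ℕP.*-identityˡ (suc n))))))

⨁ : ℕ → (ℕ → Series) → Series
⨁ n f i = ∑ n (λ s → f s i)

⨁-cong : ∀ n {f g : ℕ → Series} → (∀ i → i < n → f i ≈ g i) → ⨁ n f ≈ ⨁ n g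
⨁-cong n p = pw λ k → ∑-cong n λ i i<n → coeff (p i i<n) k

⨁-suc : ∀ n f → ⨁ (suc n) f ≈ ⨁ n f ⊕ f n
⨁-suc n f = pw λ k → sym (⊕-at (⨁ n f) (f n) k)

⨁-⊕ : ∀ n f g → ⨁ n (λ i → f i ⊕ g i) ≈ ⨁ n f ⊕ ⨁ n g
⨁-⊕ n f g = pw λ k → trans (∑-cong n λ i _ → ⊕-at (f i) (g i) k) (trans (∑-+ n _ _) (sym (⊕-at (⨁ n f) (⨁ n g) k)))

⨁-⊛ : ∀ n c f → ⨁ n (λ i → c ⊛ f i) ≈ c ⊛ ⨁ n f
⨁-⊛ zero    c f = S.sym (S.trans (⊛-cong S.refl (pw λ { zero → refl ; (suc _) → refl })) (S.trans (identity 1 (λ c → c :* κ (+ 0) := κ (+ 0)) (c ∷ [])) (pw λ { zero → refl ; (suc _) → refl })))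
⨁-⊛ (suc n) c f = S.trans (⨁-suc n _) (S.trans (⊕-cong (⨁-⊛ n c f) S.refl)
  (S.trans (identity 3 (λ c a b → c :* a :+ c :* b := c :* (a :+ b)) (c ∷ ⨁ n f ∷ f n ∷ [])) (⊛-cong S.refl (S.sym (⨁-suc n f)))))

term : ℕ → ℕ → Series
term n i = con (sgn (suc i)) ⊛ (M (suc i ℕ.* suc n) ⊛ V i (n ∸ suc i))

partialTheta : ℕ → Series
partialTheta n i = ∑ (suc n) (λ x → two x * sgn x * δ (x ℕ.* x) i)

partialTheta-suc : ∀ n → partialTheta (suc n) ≈ partialTheta n ⊕ con (+ 2 * sgn (suc n)) ⊛ M (suc n ℕ.* suc n)
partialTheta-suc n = pw λ i → trans (cong (_+_ (partialTheta n i)) (sym (trans (con-⊛ (+ 2 * sgn (suc n)) (M (suc n ℕ.* suc n)) i)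
  (cong (_*_ (+ 2 * sgn (suc n))) (M-δ (suc n ℕ.* suc n) i))))) (sym (⊕-at _ _ i))

-- Shanks' telescoping: with a = q^(s+1), b = q^(n+1) the change of the s-th summand from n to n+1 is t s - t (s+1).
module Shanks (n : ℕ) where
  b : Series
  b = M (suc n)
  t : ℕ → Series
  t s = con (sgn s) ⊛ (M (suc s ℕ.* suc n) ⊛ U s (n ∸ s))
  step : ℕ → Series
  step i = con (sgn (suc i)) ⊛ ((M (suc i ℕ.* suc n) ⊛ M (suc i)) ⊛ (V i (n ∸ suc i) ⊛ (𝟏 ⊕ ⊝ b)))
         ⊕ ⊝ ((𝟏 ⊕ b) ⊛ term n i)

  step-t : ∀ s → s < n → step s ≈ t s ⊕ ⊝ t (suc s)
  step-t s s<n = begin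
    step s
      ≈⟨ ⊕-cong (⊛-cong csgn S.refl) (⊝-cong (⊛-cong S.refl (⊛-cong csgn S.refl))) ⟩
    (⊝ c) ⊛ ((m ⊛ a) ⊛ (v ⊛ (𝟏 ⊕ ⊝ b))) ⊕ ⊝ ((𝟏 ⊕ b) ⊛ ((⊝ c) ⊛ (m ⊛ v)))
      ≈⟨ identity 5 (λ c m a v b → (:- c) :* ((m :* a) :* (v :* (κ (+ 1) :+ :- b))) :+ :- ((κ (+ 1) :+ b) :* ((:- c) :* (m :* v)))
            := c :* (m :* (v :* (κ (+ 1) :+ :- a))) :+ :- ((:- c) :* ((m :* b) :* (v :* (κ (+ 1) :+ a))))) (c ∷ m ∷ a ∷ v ∷ b ∷ []) ⟩
    c ⊛ (m ⊛ (v ⊛ (𝟏 ⊕ ⊝ a))) ⊕ ⊝ ((⊝ c) ⊛ ((m ⊛ b) ⊛ (v ⊛ (𝟏 ⊕ a))))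
      ≈⟨ ⊕-cong (⊛-cong S.refl (⊛-cong S.refl (S.sym u₁))) (⊝-cong (⊛-cong (S.sym csgn) (⊛-cong mb (S.sym (U-V₂ s (n ∸ suc s)))))) ⟩
    t s ⊕ ⊝ t (suc s) ∎
    where
    open ≈R
    c m a v : Series
    c = con (sgn s)
    m = M (suc s ℕ.* suc n)
    a = M (suc s)
    v = V s (n ∸ suc s)
    csgn : con (sgn (suc s)) ≈ ⊝ c
    csgn = con-neg (sgn s)
    u₁ : U s (n ∸ s) ≈ v ⊛ (𝟏 ⊕ ⊝ a)
    u₁ = subst (λ z → U s z ≈ v ⊛ (𝟏 ⊕ ⊝ a)) (sym (ℕP.+-∸-assoc 1 s<n)) (U-V₁ s (n ∸ suc s))
    mb : m ⊛ b ≈ M (suc (suc s) ℕ.* suc n)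
    mb = S.trans (M-+ (suc s ℕ.* suc n) (suc n)) (pw λ i → cong (λ z → M z i) (ℕP.+-comm (suc s ℕ.* suc n) (suc n)))

  telescope : ∀ s → s ≤ n → ⨁ s step ≈ t 0 ⊕ ⊝ t s
  telescope zero    _ = S.trans (pw λ { zero → refl ; (suc _) → refl }) (S.sym (identity 1 (λ x → x :+ :- x := κ (+ 0)) (t 0 ∷ [])))
  telescope (suc s) s<n = S.trans (⨁-suc s step) (S.trans (⊕-cong (telescope s (ℕP.<⇒≤ s<n)) (step-t s s<n))
    (identity 3 (λ x y z → (x :+ :- y) :+ (y :+ :- z) := x :+ :- z) (t 0 ∷ t s ∷ t (suc s) ∷ [])))

-- A finite form of Gauss' product for `φ(-q)`, multiplied by `B⁺ n` to clear denominators.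
-- `partialTheta n` is the sum of `(-1)ˣ q^(x²)` over all integers `x` of absolute value at most
-- `n`. Every `term n i` is divisible by `q^(n+1)`, so the sum on the right disappears modulo that
-- power.
shanks : ∀ n → B⁺ n ⊛ partialTheta n ≈ Poch 1 n ⊕ 𝟐 ⊛ ⨁ n (term n)
shanks zero = S.trans (identity 1 (λ x → κ (+ 1) :* x := x) (partialTheta 0 ∷ []))
  (S.trans (pw λ { zero → refl ; (suc n) → refl }) (S.sym (S.trans (⊕-cong S.refl (⊛-cong S.refl (pw λ { zero → refl ; (suc _) → refl })))
    (identity 0 (κ (+ 1) :+ κ (+ 2) :* κ (+ 0) := κ (+ 1)) []))))
shanks (suc n) = begin
  B⁺ (suc n) ⊛ partialTheta (suc n)
    ≈⟨ ⊛-cong S.refl (S.trans (partialTheta-suc n) (⊕-cong S.refl (⊛-cong c2 S.refl))) ⟩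
  (Bn ⊛ (𝟏 ⊕ b)) ⊛ (partialTheta n ⊕ (𝟐 ⊛ ⊝ c) ⊛ m)
    ≈⟨ identity 5 (λ B b p c m → (B :* (κ (+ 1) :+ b)) :* (p :+ (κ (+ 2) :* :- c) :* m) := (κ (+ 1) :+ b) :* (B :* p) :+ (κ (+ 2) :* :- c) :* (m :* (B :* (κ (+ 1) :+ b))))
         (Bn ∷ b ∷ partialTheta n ∷ c ∷ m ∷ []) ⟩
  (𝟏 ⊕ b) ⊛ (Bn ⊛ partialTheta n) ⊕ (𝟐 ⊛ ⊝ c) ⊛ (m ⊛ (Bn ⊛ (𝟏 ⊕ b)))
    ≈⟨ ⊕-cong (⊛-cong S.refl (shanks n)) S.refl ⟩
  (𝟏 ⊕ b) ⊛ (Pn ⊕ 𝟐 ⊛ Z) ⊕ (𝟐 ⊛ ⊝ c) ⊛ (m ⊛ (Bn ⊛ (𝟏 ⊕ b)))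
    ≈⟨ identity 6 (λ P b Z c m B → (κ (+ 1) :+ b) :* (P :+ κ (+ 2) :* Z) :+ (κ (+ 2) :* :- c) :* (m :* (B :* (κ (+ 1) :+ b)))
          := P :* (κ (+ 1) :+ :- b) :+ κ (+ 2) :* (((κ (+ 1) :+ b) :* Z :+ (b :* P :+ :- (c :* (m :* B)))) :+ (:- c) :* ((m :* b) :* B)))
         (Pn ∷ b ∷ Z ∷ c ∷ m ∷ Bn ∷ []) ⟩
  Pn ⊛ (𝟏 ⊕ ⊝ b) ⊕ 𝟐 ⊛ (((𝟏 ⊕ b) ⊛ Z ⊕ (b ⊛ Pn ⊕ ⊝ (c ⊛ (m ⊛ Bn)))) ⊕ (⊝ c) ⊛ ((m ⊛ b) ⊛ Bn))
    -- The bracket `b ⊛ Pn ⊕ ⊝ (c ⊛ (m ⊛ Bn))` is the telescoped sum of the steps. It turns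
    -- `(𝟏 ⊕ b) ⊛ Z` into the first `n` terms for `suc n`, and the remaining product is the new term
    -- with index `n`.
    ≈⟨ ⊕-cong (⊛-cong S.refl (⊕-cong S.refl (⊝-cong (pw λ i → cong (λ z → M z i) (sym (ℕP.*-identityˡ (suc n))))))) (⊛-cong S.refl
        (S.trans (⊕-cong (S.trans (⊕-cong S.refl (S.sym tele)) combine) last) (S.sym (⨁-suc n (term (suc n)))))) ⟩
  Poch 1 (suc n) ⊕ 𝟐 ⊛ ⨁ (suc n) (term (suc n)) ∎
  where
  open ≈R
  open Shanks n
  Bn Pn Z c m : Series
  Bn = B⁺ n
  Pn = Poch 1 n
  Z = ⨁ n (term n)
  c = con (sgn n)
  m = M (suc n ℕ.* suc n)
  c2 : con (+ 2 * sgn (suc n)) ≈ 𝟐 ⊛ ⊝ c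
  c2 = S.trans (identity-con (+ 2) (sgn (suc n))) (⊛-cong S.refl (con-neg (sgn n)))
    where
    identity-con : ∀ a b → con (a * b) ≈ con a ⊛ con b
    identity-con a b = pw λ { zero → refl ; (suc i) → sym (trans (con-⊛ a (con b) (suc i)) (ℤP.*-zeroʳ a)) }
  tele : ⨁ n step ≈ b ⊛ Pn ⊕ ⊝ (c ⊛ (m ⊛ Bn))
  tele = S.trans (telescope n ℕP.≤-refl) (⊕-cong
    (S.trans (⊛-cong S.refl (⊛-cong (pw λ i → cong (λ z → M z i) (ℕP.+-identityʳ (suc n))) (U-0 n))) (identity 1 (λ x → κ (+ 1) :* x := x) (b ⊛ Pn ∷ [])))
    (⊝-cong (⊛-cong S.refl (⊛-cong S.refl (pw λ i → cong (λ z → U n z i) (ℕP.n∸n≡0 n))))))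
  Mmul : ∀ i → M (suc i ℕ.* suc (suc n)) ≈ M (suc i ℕ.* suc n) ⊛ M (suc i)
  Mmul i = S.trans (pw λ k → cong (λ z → M z k) (trans (ℕP.*-suc (suc i) (suc n)) (ℕP.+-comm (suc i) _))) (S.sym (M-+ (suc i ℕ.* suc n) (suc i)))
  combine : (𝟏 ⊕ b) ⊛ Z ⊕ ⨁ n step ≈ ⨁ n (term (suc n))
  combine = S.trans (⊕-cong (S.sym (⨁-⊛ n (𝟏 ⊕ b) (term n))) S.refl) (S.trans (S.sym (⨁-⊕ n _ step)) (⨁-cong n λ i i<n →
    S.trans (identity 2 (λ x y → x :+ (y :+ :- x) := y) ((𝟏 ⊕ b) ⊛ term n i ∷ con (sgn (suc i)) ⊛ ((M (suc i ℕ.* suc n) ⊛ M (suc i)) ⊛ (V i (n ∸ suc i) ⊛ (𝟏 ⊕ ⊝ b))) ∷ []))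
      (⊛-cong S.refl (⊛-cong (S.sym (Mmul i)) (S.sym (vstep i i<n))))))
    where
    vstep : ∀ i → i < n → V i (suc n ∸ suc i) ≈ V i (n ∸ suc i) ⊛ (𝟏 ⊕ ⊝ b)
    vstep i i<n = subst (λ z → V i z ≈ V i (n ∸ suc i) ⊛ (𝟏 ⊕ ⊝ b)) (sym (ℕP.+-∸-assoc 1 i<n))
      (⊛-cong S.refl (⊕-cong S.refl (⊝-cong (pw λ k → cong (λ z → M (suc z) k) (ℕP.m+[n∸m]≡n i<n)))))
  last : (⊝ c) ⊛ ((m ⊛ b) ⊛ Bn) ≈ term (suc n) n
  last = ⊛-cong (S.sym (con-neg (sgn n))) (⊛-cong (S.sym (Mmul n)) (pw λ i → cong (λ z → V n z i) (sym (ℕP.n∸n≡0 n))))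

M-cong : ∀ {k l} → k ≡ l → M k ≈ M l
M-cong refl = S.refl

dil-M : ∀ j k → dil (suc j) (M k) ≈ M (suc j ℕ.* k)
dil-M j k = pw λ n → trans (go n) (sym (M-δ (suc j ℕ.* k) n))
  where
  go : ∀ n → dil (suc j) (M k) n ≡ δ (suc j ℕ.* k) n
  go n with suc j ∣? n
  ... | yes (divides m refl) = trans (dil-* j (M k) m) (trans (M-δ k m) (trans
          (sym (δ-injective (ℕ._* suc j) (ℕP.*-cancelʳ-≡ _ _ (suc j)) k m)) (cong (λ z → δ z (m ℕ.* suc j)) (ℕP.*-comm k (suc j)))))
  ... | no k∤n = trans (dil-∤ j (M k) n k∤n) (sym (δ-≢ λ e → k∤n (divides k (trans (sym e) (ℕP.*-comm (suc j) k)))))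

M-small : ∀ k n → n ≤ k → M k ≈[ n ] con (+ 0)
M-small k n n≤k = tr λ i i<n → trans (M-δ k i) (trans (δ-≢ (ℕP.>⇒≢ (ℕP.<-≤-trans i<n n≤k))) (sym (con-0 i)))

factor-small : ∀ k n f → n ≤ k → f ⊛ (𝟏 ⊕ ⊝ M k) ≈[ n ] f
factor-small k n f n≤k = []-trans ([]-⊛ []-refl ([]-⊕ []-refl ([]-⊝ (M-small k n n≤k))))
  (≈⇒≈[] (identity 1 (λ f → f :* (κ (+ 1) :+ :- κ (+ 0)) := f) (f ∷ [])))

Poch-stable : ∀ k {n m} → n ≤ m → Poch (suc k) m ≈[ suc n ] Poch (suc k) n
Poch-stable k {n} n≤m = go (ℕP.≤⇒≤′ n≤m)
  where
  go : ∀ {m} → n ℕ.≤′ m → Poch (suc k) m ≈[ suc n ] Poch (suc k) n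
  go ℕ.≤′-refl = []-refl
  go (ℕ.≤′-step {m} p) = []-trans (factor-small (suc k ℕ.* suc m) _ _ (ℕP.≤-trans (s≤s (ℕP.≤′⇒≤ p)) (ℕP.m≤n*m (suc m) (suc k)))) (go p)

-- Euler's product of all `1 - qᵐ`, read off on the diagonal: by `Poch-stable` the coefficient `n`
-- no longer changes after `n` factors.
E : Series
E n = Poch 1 n n

dil-Poch : ∀ j m → dil (suc j) (Poch 1 m) ≈ Poch (suc j) m
dil-Poch j zero    = dil-con (suc j) (+ 1)
dil-Poch j (suc m) = S.trans (dil-⊛ (suc j) _ _) (⊛-cong (dil-Poch j m) (S.trans (dil-⊕ (suc j) _ _) (⊕-cong (dil-con (suc j) (+ 1))
  (S.trans (dil-⊝ (suc j) _) (⊝-cong (S.trans (dil-M j (1 ℕ.* suc m)) (M-cong (cong (suc j ℕ.*_) (ℕP.*-identityˡ (suc m))))))))))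

E-Poch : ∀ m → E ≈[ suc m ] Poch 1 m
E-Poch m = tr λ i i≤m → sym (coeff< (Poch-stable 0 (ℕP.≤-pred i≤m)) i ℕP.≤-refl)

dilE-Poch : ∀ j m → dil (suc j) E ≈[ suc m ] Poch (suc j) m
dilE-Poch j m = tr λ i i≤m → trans (dil-congₙ j i λ l lj≤i → coeff< (E-Poch m) l
    (s≤s (ℕP.≤-trans (ℕP.m≤m*n l (suc j)) (ℕP.≤-trans lj≤i (ℕP.≤-pred i≤m)))))
  (coeff (dil-Poch j m) i)

B⁺-Poch : ∀ n → B⁺ n ⊛ Poch 1 n ≈ Poch 2 n
B⁺-Poch zero    = identity 0 (κ (+ 1) :* κ (+ 1) := κ (+ 1)) []
B⁺-Poch (suc n) = begin
  (B⁺ n ⊛ (𝟏 ⊕ M (suc n))) ⊛ (Poch 1 n ⊛ (𝟏 ⊕ ⊝ M (1 ℕ.* suc n)))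
    ≈⟨ ⊛-cong S.refl (⊛-cong S.refl (⊕-cong S.refl (⊝-cong (M-cong (ℕP.*-identityˡ (suc n)))))) ⟩
  (B⁺ n ⊛ (𝟏 ⊕ a)) ⊛ (Poch 1 n ⊛ (𝟏 ⊕ ⊝ a))
    ≈⟨ identity 3 (λ b p a → (b :* (κ (+ 1) :+ a)) :* (p :* (κ (+ 1) :+ :- a)) := (b :* p) :* (κ (+ 1) :+ :- (a :* a))) (B⁺ n ∷ Poch 1 n ∷ a ∷ []) ⟩
  (B⁺ n ⊛ Poch 1 n) ⊛ (𝟏 ⊕ ⊝ (a ⊛ a))
    ≈⟨ ⊛-cong (B⁺-Poch n) (⊕-cong S.refl (⊝-cong (S.trans (M-+ (suc n) (suc n)) (M-cong (cong (suc n ℕ.+_) (sym (ℕP.+-identityʳ (suc n)))))))) ⟩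
  Poch 2 n ⊛ (𝟏 ⊕ ⊝ M (2 ℕ.* suc n)) ∎
  where
  open ≈R
  a : Series
  a = M (suc n)

φ′-partial : ∀ n → φ′ ≈[ suc n ] partialTheta n
φ′-partial n = tr λ i i<n → begin
  sgn i * φ i                                             ≡⟨ cong (sgn i *_) (sparse-∑ two _ (suc n) i x≤x² i<n) ⟩
  sgn i * ∑ (suc n) (λ x → two x * δ (x ℕ.* x) i)         ≡⟨ sym (∑-*ˡ (suc n) (sgn i) _) ⟩
  ∑ (suc n) (λ x → sgn i * (two x * δ (x ℕ.* x) i))       ≡⟨ ∑-cong (suc n) (λ x _ → move x i) ⟩
  partialTheta n i                                        ∎
  where
  open ≡-Reasoning
  sgn-+ : ∀ a b → sgn (a ℕ.+ b) ≡ sgn a * sgn b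
  sgn-+ zero    b = sym (ℤP.*-identityˡ _)
  sgn-+ (suc a) b = trans (cong -_ (sgn-+ a b)) (ℤP.neg-distribˡ-* (sgn a) (sgn b))
  sgn-sq : ∀ x → sgn (x ℕ.* x) ≡ sgn x
  sgn-sq zero    = refl
  sgn-sq (suc x) = trans (cong sgn (cong suc (trans (cong (x ℕ.+_) (ℕP.*-suc x x)) (sym (ℕP.+-assoc x x (x ℕ.* x))))))
    (cong -_ (trans (sgn-+ (x ℕ.+ x) (x ℕ.* x)) (trans (cong (_* sgn (x ℕ.* x)) (trans (sgn-+ x x) (sgn² x))) (trans (ℤP.*-identityˡ _) (sgn-sq x)))))
  move : ∀ x i → sgn i * (two x * δ (x ℕ.* x) i) ≡ two x * sgn x * δ (x ℕ.* x) i
  move x i with x ℕ.* x ℕP.≟ i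
  ... | yes refl rewrite δ-refl (x ℕ.* x) | sgn-sq x = lemma (sgn x) (two x)
    where
    lemma : ∀ s t → s * (t * + 1) ≡ t * s * + 1
    lemma = solve-∀
  ... | no ne rewrite δ-≢ ne = trans (cong (sgn i *_) (ℤP.*-zeroʳ (two x))) (trans (ℤP.*-zeroʳ (sgn i)) (sym (ℤP.*-zeroʳ (two x * sgn x))))

terms-small : ∀ n → ⨁ n (term n) ≈[ suc n ] con (+ 0)
terms-small n = tr λ k k≤n → trans (∑-0 n λ i _ → trans (con-⊛ (sgn (suc i)) _ k)
    (trans (cong (sgn (suc i) *_) (M-⊛-< (suc i ℕ.* suc n) _ k (ℕP.<-≤-trans k≤n (ℕP.m≤n*m (suc n) (suc i))))) (ℤP.*-zeroʳ (sgn (suc i)))))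
  (sym (con-0 k))

gauss : φ′ ⊛ dil 2 E ≈ E ⊛ E
gauss = ≈[]⇒≈ λ n → ≈[]-weaken (ℕP.n≤1+n n) (
  []-trans ([]-⊛ (φ′-partial n) (dilE-Poch 1 n))
  ([]-trans (≈⇒≈[] (S.trans (⊛-cong S.refl (S.sym (B⁺-Poch n)))
     (S.trans (identity 3 (λ t b p → t :* (b :* p) := (b :* t) :* p) (partialTheta n ∷ B⁺ n ∷ Poch 1 n ∷ [])) (⊛-cong (shanks n) S.refl))))
  ([]-trans ([]-⊛ ([]-⊕ []-refl ([]-⊛ []-refl (terms-small n))) []-refl)
  ([]-trans (≈⇒≈[] (identity 1 (λ p → (p :+ κ (+ 2) :* κ (+ 0)) :* p := p :* p) (Poch 1 n ∷ [])))
  ([]-⊛ ([]-sym (E-Poch n)) ([]-sym (E-Poch n)))))))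

-- The induction adds two factors at a time. The odd power `a` gives `(1 - a)(1 + a) = 1 - a²`; the
-- even power `c` gives `(1 - c)²`, and `Poch 4` supplies `1 - c²`. The squares go to the long
-- product of `Poch 2`, the two factors `1 - c` to the short ones.
Poch-neg : ∀ m → Poch 1 (m ℕ.+ m) ⊛ neg (Poch 1 (m ℕ.+ m)) ⊛ Poch 4 m ≈ Poch 2 (m ℕ.+ m) ⊛ (Poch 2 m ⊛ Poch 2 m)
Poch-neg zero = S.trans (⊛-cong (⊛-cong S.refl (neg-con (+ 1))) S.refl) (identity 0 (κ (+ 1) :* κ (+ 1) :* κ (+ 1) := κ (+ 1) :* (κ (+ 1) :* κ (+ 1))) [])
Poch-neg (suc m) rewrite ℕP.+-suc m m = begin
  (p₁ ⊛ (𝟏 ⊕ ⊝ M (1 ℕ.* suc k)) ⊛ (𝟏 ⊕ ⊝ M (1 ℕ.* suc (suc k)))) ⊛ neg (p₁ ⊛ (𝟏 ⊕ ⊝ M (1 ℕ.* suc k)) ⊛ (𝟏 ⊕ ⊝ M (1 ℕ.* suc (suc k)))) ⊛ (Poch 4 m ⊛ (𝟏 ⊕ ⊝ M (4 ℕ.* suc m)))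
    ≈⟨ ⊛-cong (⊛-cong pos (S.trans (neg-cong pos) negs)) (⊛-cong S.refl (⊕-cong S.refl (⊝-cong c4))) ⟩
  (p₁ ⊛ (𝟏 ⊕ ⊝ a) ⊛ (𝟏 ⊕ ⊝ c)) ⊛ (neg p₁ ⊛ (𝟏 ⊕ ⊝ (con (- + 1) ⊛ a)) ⊛ (𝟏 ⊕ ⊝ (con (+ 1) ⊛ c))) ⊛ (Poch 4 m ⊛ (𝟏 ⊕ ⊝ (c ⊛ c)))
    ≈⟨ identity 5 (λ p n r a c → (p :* (κ (+ 1) :+ :- a) :* (κ (+ 1) :+ :- c)) :* (n :* (κ (+ 1) :+ :- (κ (- + 1) :* a)) :* (κ (+ 1) :+ :- (κ (+ 1) :* c))) :* (r :* (κ (+ 1) :+ :- (c :* c)))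
         := (p :* n :* r) :* ((κ (+ 1) :+ :- (a :* a)) :* (κ (+ 1) :+ :- (c :* c)) :* ((κ (+ 1) :+ :- c) :* (κ (+ 1) :+ :- c)))) (p₁ ∷ neg p₁ ∷ Poch 4 m ∷ a ∷ c ∷ []) ⟩
  (p₁ ⊛ neg p₁ ⊛ Poch 4 m) ⊛ ((𝟏 ⊕ ⊝ (a ⊛ a)) ⊛ (𝟏 ⊕ ⊝ (c ⊛ c)) ⊛ ((𝟏 ⊕ ⊝ c) ⊛ (𝟏 ⊕ ⊝ c)))
    ≈⟨ ⊛-cong (Poch-neg m) S.refl ⟩
  (Poch 2 k ⊛ (Poch 2 m ⊛ Poch 2 m)) ⊛ ((𝟏 ⊕ ⊝ (a ⊛ a)) ⊛ (𝟏 ⊕ ⊝ (c ⊛ c)) ⊛ ((𝟏 ⊕ ⊝ c) ⊛ (𝟏 ⊕ ⊝ c)))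
    ≈⟨ identity 5 (λ p r A C c → (p :* (r :* r)) :* (A :* C :* (c :* c)) := p :* A :* C :* ((r :* c) :* (r :* c)))
         (Poch 2 k ∷ Poch 2 m ∷ (𝟏 ⊕ ⊝ (a ⊛ a)) ∷ (𝟏 ⊕ ⊝ (c ⊛ c)) ∷ (𝟏 ⊕ ⊝ c) ∷ []) ⟩
  Poch 2 k ⊛ (𝟏 ⊕ ⊝ (a ⊛ a)) ⊛ (𝟏 ⊕ ⊝ (c ⊛ c)) ⊛ ((Poch 2 m ⊛ (𝟏 ⊕ ⊝ c)) ⊛ (Poch 2 m ⊛ (𝟏 ⊕ ⊝ c)))
    ≈⟨ ⊛-cong (⊛-cong (⊛-cong S.refl (⊕-cong S.refl (⊝-cong (sqM (suc k))))) (⊕-cong S.refl (⊝-cong (sqM (suc (suc k)))))) (⊛-cong c2 c2) ⟩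
  Poch 2 k ⊛ (𝟏 ⊕ ⊝ M (2 ℕ.* suc k)) ⊛ (𝟏 ⊕ ⊝ M (2 ℕ.* suc (suc k))) ⊛ (Poch 2 (suc m) ⊛ Poch 2 (suc m)) ∎
  where
  open ≈R
  open import Data.Nat.Tactic.RingSolver using () renaming (solve-∀ to ℕ-solve)
  k : ℕ
  k = m ℕ.+ m
  p₁ a c : Series
  p₁ = Poch 1 k
  a = M (suc k)
  c = M (suc (suc k))
  sqM : ∀ l → M l ⊛ M l ≈ M (2 ℕ.* l)
  sqM l = S.trans (M-+ l l) (M-cong (cong (l ℕ.+_) (sym (ℕP.+-identityʳ l))))
  c4 : M (4 ℕ.* suc m) ≈ c ⊛ c
  c4 = S.sym (S.trans (M-+ (suc (suc k)) (suc (suc k))) (M-cong (lemma m)))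
    where
    lemma : ∀ m → suc (suc (m ℕ.+ m)) ℕ.+ suc (suc (m ℕ.+ m)) ≡ 4 ℕ.* suc m
    lemma = ℕ-solve
  c2 : Poch 2 m ⊛ (𝟏 ⊕ ⊝ c) ≈ Poch 2 (suc m)
  c2 = ⊛-cong S.refl (⊕-cong S.refl (⊝-cong (M-cong (lemma m))))
    where
    lemma : ∀ m → suc (suc (m ℕ.+ m)) ≡ 2 ℕ.* suc m
    lemma = ℕ-solve
  pos : p₁ ⊛ (𝟏 ⊕ ⊝ M (1 ℕ.* suc k)) ⊛ (𝟏 ⊕ ⊝ M (1 ℕ.* suc (suc k))) ≈ p₁ ⊛ (𝟏 ⊕ ⊝ a) ⊛ (𝟏 ⊕ ⊝ c)
  pos = ⊛-cong (⊛-cong S.refl (⊕-cong S.refl (⊝-cong (M-cong (ℕP.*-identityˡ (suc k)))))) (⊕-cong S.refl (⊝-cong (M-cong (ℕP.*-identityˡ (suc (suc k))))))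
  sgn-even : ∀ m → sgn (m ℕ.+ m) ≡ + 1
  sgn-even zero    = refl
  sgn-even (suc m) = trans (cong (λ z → - sgn z) (ℕP.+-suc m m)) (trans (ℤP.neg-involutive _) (sgn-even m))
  neg-factor : ∀ l s → sgn l ≡ s → neg (𝟏 ⊕ ⊝ M l) ≈ 𝟏 ⊕ ⊝ (con s ⊛ M l)
  neg-factor l s refl = S.trans (neg-⊕ _ _) (⊕-cong (neg-con _) (S.trans (neg-⊝ _) (⊝-cong (neg-M l))))
  negs : neg (p₁ ⊛ (𝟏 ⊕ ⊝ a) ⊛ (𝟏 ⊕ ⊝ c)) ≈ neg p₁ ⊛ (𝟏 ⊕ ⊝ (con (- + 1) ⊛ a)) ⊛ (𝟏 ⊕ ⊝ (con (+ 1) ⊛ c))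
  negs = S.trans (neg-⊛ _ _) (⊛-cong (S.trans (neg-⊛ _ _) (⊛-cong S.refl (neg-factor (suc k) _ (cong -_ (sgn-even m)))))
    (neg-factor (suc (suc k)) _ (trans (ℤP.neg-involutive _) (sgn-even m))))

[]-neg : ∀ {f g n} → f ≈[ n ] g → neg f ≈[ n ] neg g
[]-neg p = tr λ i i<n → cong (sgn i *_) (coeff< p i i<n)

E-neg : E ⊛ neg E ⊛ dil 4 E ≈ dil 2 E ⊛ (dil 2 E ⊛ dil 2 E)
E-neg = ≈[]⇒≈ λ n → ≈[]-weaken (ℕP.n≤1+n n) (
  let E₁ = ≈[]-weaken (s≤s (ℕP.m≤m+n n n)) (E-Poch (n ℕ.+ n)) in
  []-trans ([]-⊛ ([]-⊛ E₁ ([]-neg E₁)) (dilE-Poch 3 n))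
  ([]-trans (≈⇒≈[] (Poch-neg n))
  ([]-⊛ (≈[]-weaken (s≤s (ℕP.m≤m+n n n)) ([]-sym (dilE-Poch 1 (n ℕ.+ n)))) ([]-⊛ ([]-sym (dilE-Poch 1 n)) ([]-sym (dilE-Poch 1 n))))))

φ+φ′ : φ ⊕ φ′ ≈ 𝟐 ⊛ dil 4 φ
φ+φ′ = S.trans (⊕-cong φ-split φ′-split) (identity 2 (λ a b → (a :+ b) :+ (a :+ :- b) := κ (+ 2) :* a) (dil 4 φ ∷ 𝟐 ⊛ (q ⊛ dil 8 ψ) ∷ []))

φ-φ′ : φ ⊕ ⊝ φ′ ≈ 𝟒 ⊛ (q ⊛ dil 8 ψ)
φ-φ′ = S.trans (⊕-cong φ-split (⊝-cong φ′-split)) (identity 2 (λ a b → (a :+ κ (+ 2) :* b) :+ :- (a :+ :- (κ (+ 2) :* b)) := κ (+ 4) :* b) (dil 4 φ ∷ q ⊛ dil 8 ψ ∷ []))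

φE₂ : φ ⊛ dil 2 E ≈ neg E ⊛ neg E
φE₂ = S.trans (⊛-cong (S.sym (neg-neg φ)) (S.sym (neg-dil2 E))) (S.trans (S.sym (neg-⊛ φ′ (dil 2 E))) (S.trans (neg-cong gauss) (neg-⊛ E E)))

-- Since `φ(-q) = E(q)²/E(q²)`, the claim is the square of `E-neg` up to a common factor;
-- multiplication by `E(q²)² E(q⁴)²` avoids the quotients.
φφ′ : φ ⊛ φ′ ≈ dil 2 φ′ ⊛ dil 2 φ′
φφ′ = cancel 0 (e₂ ⊛ e₂ ⊛ (e₄ ⊛ e₄)) (λ ()) (begin
  (e₂ ⊛ e₂ ⊛ (e₄ ⊛ e₄)) ⊛ (φ ⊛ φ′)
    ≈⟨ identity 4 (λ e f p r → (e :* e :* (f :* f)) :* (p :* r) := (p :* e) :* (r :* e) :* (f :* f)) (e₂ ∷ e₄ ∷ φ ∷ φ′ ∷ []) ⟩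
  (φ ⊛ e₂) ⊛ (φ′ ⊛ e₂) ⊛ (e₄ ⊛ e₄)
    ≈⟨ ⊛-cong (⊛-cong φE₂ gauss) S.refl ⟩
  (neg E ⊛ neg E) ⊛ (E ⊛ E) ⊛ (e₄ ⊛ e₄)
    ≈⟨ identity 3 (λ n e f → (n :* n) :* (e :* e) :* (f :* f) := (e :* n :* f) :* (e :* n :* f)) (neg E ∷ E ∷ e₄ ∷ []) ⟩
  (E ⊛ neg E ⊛ e₄) ⊛ (E ⊛ neg E ⊛ e₄)
    ≈⟨ ⊛-cong E-neg E-neg ⟩
  (e₂ ⊛ (e₂ ⊛ e₂)) ⊛ (e₂ ⊛ (e₂ ⊛ e₂))
    ≈⟨ identity 1 (λ e → (e :* (e :* e)) :* (e :* (e :* e)) := (e :* e) :* ((e :* e) :* (e :* e))) (e₂ ∷ []) ⟩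
  (e₂ ⊛ e₂) ⊛ ((e₂ ⊛ e₂) ⊛ (e₂ ⊛ e₂))
    ≈⟨ ⊛-cong S.refl (⊛-cong (S.sym gauss₂) (S.sym gauss₂)) ⟩
  (e₂ ⊛ e₂) ⊛ ((dil 2 φ′ ⊛ e₄) ⊛ (dil 2 φ′ ⊛ e₄))
    ≈⟨ identity 3 (λ e f p → (e :* e) :* ((p :* f) :* (p :* f)) := (e :* e :* (f :* f)) :* (p :* p)) (e₂ ∷ e₄ ∷ dil 2 φ′ ∷ []) ⟩
  (e₂ ⊛ e₂ ⊛ (e₄ ⊛ e₄)) ⊛ (dil 2 φ′ ⊛ dil 2 φ′) ∎)
  where
  open ≈R
  e₂ e₄ : Series
  e₂ = dil 2 E
  e₄ = dil 4 E
  gauss₂ : dil 2 φ′ ⊛ e₄ ≈ e₂ ⊛ e₂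
  gauss₂ = S.trans (⊛-cong S.refl (S.sym (dil-∘ 1 1 E))) (S.trans (S.sym (dil-⊛ 2 φ′ (dil 2 E))) (S.trans (dil-cong 2 gauss) (dil-⊛ 2 E E)))

-- The left minus the right side is -2 times its own dilation by 2, hence zero.
φ²+φ′² : φ ⊛ φ ⊕ φ′ ⊛ φ′ ≈ 𝟐 ⊛ (dil 2 φ ⊛ dil 2 φ)
φ²+φ′² = ≈[]⇒≈ λ n → ⊖-0 (≈⇒≈[] (pw λ i → trans (go (suc i) i ℕP.≤-refl) (sym (con-0 i))))
  where
  open ≈R
  I : Series
  I = φ ⊛ φ ⊕ φ′ ⊛ φ′ ⊕ ⊝ (𝟐 ⊛ (dil 2 φ ⊛ dil 2 φ))
  dilI : dil 2 I ≈ dil 2 φ ⊛ dil 2 φ ⊕ dil 2 φ′ ⊛ dil 2 φ′ ⊕ ⊝ (𝟐 ⊛ (dil 4 φ ⊛ dil 4 φ))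
  dilI = S.trans (dil-⊕ 2 _ _) (⊕-cong (S.trans (dil-⊕ 2 _ _) (⊕-cong (dil-⊛ 2 φ φ) (dil-⊛ 2 φ′ φ′)))
    (S.trans (dil-⊝ 2 _) (⊝-cong (S.trans (dil-⊛ 2 𝟐 _) (⊛-cong (dil-con 2 _) (S.trans (dil-⊛ 2 _ _) (⊛-cong (dil-∘ 1 1 φ) (dil-∘ 1 1 φ))))))))
  self : I ≈ con (- + 2) ⊛ dil 2 I
  self = begin
    I ≈⟨ identity 3 (λ p r s → p :* p :+ r :* r :+ :- (κ (+ 2) :* (s :* s)) := (p :+ r) :* (p :+ r) :+ :- (κ (+ 2) :* (p :* r)) :+ :- (κ (+ 2) :* (s :* s))) (φ ∷ φ′ ∷ dil 2 φ ∷ []) ⟩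
    (φ ⊕ φ′) ⊛ (φ ⊕ φ′) ⊕ ⊝ (𝟐 ⊛ (φ ⊛ φ′)) ⊕ ⊝ (𝟐 ⊛ (dil 2 φ ⊛ dil 2 φ))
      ≈⟨ ⊕-cong (⊕-cong (⊛-cong φ+φ′ φ+φ′) (⊝-cong (⊛-cong S.refl φφ′))) S.refl ⟩
    (𝟐 ⊛ dil 4 φ) ⊛ (𝟐 ⊛ dil 4 φ) ⊕ ⊝ (𝟐 ⊛ (dil 2 φ′ ⊛ dil 2 φ′)) ⊕ ⊝ (𝟐 ⊛ (dil 2 φ ⊛ dil 2 φ))
      ≈⟨ identity 3 (λ f r s → (κ (+ 2) :* f) :* (κ (+ 2) :* f) :+ :- (κ (+ 2) :* (r :* r)) :+ :- (κ (+ 2) :* (s :* s)) := κ (- + 2) :* (s :* s :+ r :* r :+ :- (κ (+ 2) :* (f :* f)))) (dil 4 φ ∷ dil 2 φ′ ∷ dil 2 φ ∷ []) ⟩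
    con (- + 2) ⊛ (dil 2 φ ⊛ dil 2 φ ⊕ dil 2 φ′ ⊛ dil 2 φ′ ⊕ ⊝ (𝟐 ⊛ (dil 4 φ ⊛ dil 4 φ)))
      ≈⟨ ⊛-cong S.refl (S.sym dilI) ⟩
    con (- + 2) ⊛ dil 2 I ∎
  at : ∀ n → I n ≡ - + 2 * dil 2 I n
  at n = trans (coeff self n) (con-⊛ (- + 2) (dil 2 I) n)
  go : ∀ m n → n < m → I n ≡ + 0
  go m zero _ = *-cancel-0 {I 0} {+ 3} (λ ()) (trans (lemma (I 0)) (trans (cong (_+ + 2 * I 0) (at 0)) (lemma′ (I 0))))
    where
    lemma : ∀ a → a * + 3 ≡ a + + 2 * a
    lemma = solve-∀
    lemma′ : ∀ a → - + 2 * a + + 2 * a ≡ + 0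
    lemma′ = solve-∀
  go (suc m) (suc n) (s≤s n<m) with 2 ∣? suc n
  ... | no  2∤n = trans (at (suc n)) (trans (cong (- + 2 *_) (dil-∤ 1 I (suc n) 2∤n)) refl)
  ... | yes (divides l e) = trans (at (suc n)) (trans (cong (- + 2 *_) (trans (cong (dil 2 I) e) (trans (dil-* 1 I l)
          (go m l (ℕP.<-≤-trans (ℕP.<-≤-trans (half l n e) ℕP.≤-refl) n<m))))) refl)
    where
    half : ∀ l n → suc n ≡ l ℕ.* 2 → l < suc n
    half zero    n ()
    half (suc l) n e = subst (suc l <_) (sym e) (ℕP.m<m*n (suc l) 2 (s≤s (s≤s z≤n)))

-- The square of `φ(q) - φ(-q) = 4qψ(q⁸)` reduces to a difference of squares of `φ(q²)` and
-- `φ(-q²)`, whose two factors are again given by the splitting of `φ`. The dilation by 8 is there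
-- because `ψ` enters the splitting only as `ψ(q⁸)`.
ψ²₈ : dil 8 ψ ⊛ dil 8 ψ ≈ dil 8 φ ⊛ dil 8 (dil 2 ψ)
ψ²₈ = cancel 2 (con (+ 16) ⊛ (q ⊛ q)) (λ ()) (begin
  (con (+ 16) ⊛ (q ⊛ q)) ⊛ (dil 8 ψ ⊛ dil 8 ψ)
    ≈⟨ identity 2 (λ q p → (κ (+ 16) :* (q :* q)) :* (p :* p) := (κ (+ 4) :* (q :* p)) :* (κ (+ 4) :* (q :* p))) (q ∷ dil 8 ψ ∷ []) ⟩
  (𝟒 ⊛ (q ⊛ dil 8 ψ)) ⊛ (𝟒 ⊛ (q ⊛ dil 8 ψ))
    ≈⟨ ⊛-cong (S.sym φ-φ′) (S.sym φ-φ′) ⟩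
  (φ ⊕ ⊝ φ′) ⊛ (φ ⊕ ⊝ φ′)
    ≈⟨ identity 2 (λ p r → (p :+ :- r) :* (p :+ :- r) := (p :* p :+ r :* r) :+ :- (κ (+ 2) :* (p :* r))) (φ ∷ φ′ ∷ []) ⟩
  (φ ⊛ φ ⊕ φ′ ⊛ φ′) ⊕ ⊝ (𝟐 ⊛ (φ ⊛ φ′))
    ≈⟨ ⊕-cong φ²+φ′² (⊝-cong (⊛-cong S.refl φφ′)) ⟩
  𝟐 ⊛ (dil 2 φ ⊛ dil 2 φ) ⊕ ⊝ (𝟐 ⊛ (dil 2 φ′ ⊛ dil 2 φ′))
    ≈⟨ identity 2 (λ p r → κ (+ 2) :* (p :* p) :+ :- (κ (+ 2) :* (r :* r)) := κ (+ 2) :* ((p :+ r) :* (p :+ :- r))) (dil 2 φ ∷ dil 2 φ′ ∷ []) ⟩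
  𝟐 ⊛ ((dil 2 φ ⊕ dil 2 φ′) ⊛ (dil 2 φ ⊕ ⊝ dil 2 φ′))
    ≈⟨ ⊛-cong S.refl (⊛-cong plus minus) ⟩
  𝟐 ⊛ ((𝟐 ⊛ dil 8 φ) ⊛ (𝟒 ⊛ ((q ⊛ q) ⊛ dil 8 (dil 2 ψ))))
    ≈⟨ identity 3 (λ f q p → κ (+ 2) :* ((κ (+ 2) :* f) :* (κ (+ 4) :* ((q :* q) :* p))) := (κ (+ 16) :* (q :* q)) :* (f :* p)) (dil 8 φ ∷ q ∷ dil 8 (dil 2 ψ) ∷ []) ⟩
  (con (+ 16) ⊛ (q ⊛ q)) ⊛ (dil 8 φ ⊛ dil 8 (dil 2 ψ)) ∎)
  where
  open ≈R
  plus : dil 2 φ ⊕ dil 2 φ′ ≈ 𝟐 ⊛ dil 8 φ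
  plus = S.trans (S.sym (dil-⊕ 2 φ φ′)) (S.trans (dil-cong 2 φ+φ′) (S.trans (dil-⊛ 2 𝟐 _) (⊛-cong (dil-con 2 _) (dil-∘ 1 3 φ))))
  minus : dil 2 φ ⊕ ⊝ dil 2 φ′ ≈ 𝟒 ⊛ ((q ⊛ q) ⊛ dil 8 (dil 2 ψ))
  minus = S.trans (S.trans (⊕-cong S.refl (S.sym (dil-⊝ 2 φ′))) (S.sym (dil-⊕ 2 φ (⊝ φ′)))) (S.trans (dil-cong 2 φ-φ′)
    (S.trans (dil-⊛ 2 𝟒 _) (⊛-cong (dil-con 2 _) (S.trans (dil-⊛ 2 q _) (⊛-cong (S.trans (dil-M 1 1) (S.sym (M-+ 1 1))) (S.trans (dil-∘ 1 7 ψ) (S.sym (dil-∘ 7 1 ψ))))))))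

ψ² : ψ ⊛ ψ ≈ φ ⊛ dil 2 ψ
ψ² = dil-injective 7 (S.trans (dil-⊛ 8 ψ ψ) (S.trans ψ²₈ (S.sym (dil-⊛ 8 φ (dil 2 ψ)))))

module _ (A B : Series) (A₀ : A 0 ≡ + 1) (B₀ : B 0 ≡ + 1) where
  private
    refine : ∀ n → A ⊛ A ⊛ dil 2 B ≈ dil 2 A ⊛ (B ⊛ B) → A ≈[ n ] B → A ≈[ n ℕ.+ n ] B
    refine n h p = ⊖-0 (unit-0 (A ⊕ B) (A ⊕ ⊝ B) (n ℕ.+ n)
        (λ e → case trans (sym (cong₂ _+_ A₀ B₀)) (trans (sym (⊕-at A B 0)) e) of λ ())
        ([]-trans (≈⇒≈[] (identity 2 (λ a b → (a :+ b) :* (a :+ :- b) := a :* a :+ :- (b :* b)) (A ∷ B ∷ [])))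
        ([]-trans ([]-⊕ sq []-refl) (≈⇒≈[] (identity 1 (λ x → x :+ :- x := κ (+ 0)) (B ⊛ B ∷ []))))))
      where
      sq : A ⊛ A ≈[ n ℕ.+ n ] B ⊛ B
      sq = unit-cancel (dil 2 B) (λ e → case trans (sym B₀) e of λ ())
        ([]-trans (≈⇒≈[] (S.trans (identity 2 (λ a b → b :* (a :* a) := a :* a :* b) (A ∷ dil 2 B ∷ [])) h)) ([]-⊛ ([]-dil2 p) []-refl))

  -- The quotient `A²/A(q²)` determines a series with constant term 1. Agreement modulo `qⁿ` gives
  -- agreement of the dilations, hence of the squares, modulo `q²ⁿ`; then `A ⊕ B`, with constant
  -- term 2, is cancelled.
  square-dil-unique : A ⊛ A ⊛ dil 2 B ≈ dil 2 A ⊛ (B ⊛ B) → A ≈ B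
  square-dil-unique h = ≈[]⇒≈ go
    where
    go : ∀ n → A ≈[ n ] B
    go zero          = tr λ _ ()
    go (suc zero)    = tr λ { zero _ → trans A₀ (sym B₀) ; (suc _) (s≤s ()) }
    go (suc (suc n)) = ≈[]-weaken (s≤s (subst (suc n ≤_) (sym (ℕP.+-suc n n)) (s≤s (ℕP.m≤m+n n n)))) (refine (suc n) h (go (suc n)))

-- By `ψ²`, `φE₂` and `E-neg` both sides have the same quotient `A²/A(q²)`.
ψE : ψ ⊛ E ≈ dil 2 E ⊛ dil 2 E
ψE = square-dil-unique (ψ ⊛ E) (e₂ ⊛ e₂) refl refl (cancel 0 e₂ (λ ()) (begin
  e₂ ⊛ ((ψ ⊛ E) ⊛ (ψ ⊛ E) ⊛ dil 2 (e₂ ⊛ e₂))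
    ≈⟨ ⊛-cong S.refl (⊛-cong S.refl (S.trans (dil-⊛ 2 e₂ e₂) (⊛-cong (dil-∘ 1 1 E) (dil-∘ 1 1 E)))) ⟩
  e₂ ⊛ ((ψ ⊛ E) ⊛ (ψ ⊛ E) ⊛ (e₄ ⊛ e₄))
    ≈⟨ identity 4 (λ e p E f → e :* ((p :* E) :* (p :* E) :* (f :* f)) := (p :* p) :* e :* (E :* E :* (f :* f))) (e₂ ∷ ψ ∷ E ∷ e₄ ∷ []) ⟩
  (ψ ⊛ ψ) ⊛ e₂ ⊛ (E ⊛ E ⊛ (e₄ ⊛ e₄))
    ≈⟨ ⊛-cong (⊛-cong ψ² S.refl) S.refl ⟩
  (φ ⊛ dil 2 ψ) ⊛ e₂ ⊛ (E ⊛ E ⊛ (e₄ ⊛ e₄))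
    ≈⟨ identity 5 (λ p s e E f → (p :* s) :* e :* (E :* E :* (f :* f)) := (p :* e) :* s :* (E :* E :* (f :* f))) (φ ∷ dil 2 ψ ∷ e₂ ∷ E ∷ e₄ ∷ []) ⟩
  (φ ⊛ e₂) ⊛ dil 2 ψ ⊛ (E ⊛ E ⊛ (e₄ ⊛ e₄))
    ≈⟨ ⊛-cong (⊛-cong φE₂ S.refl) S.refl ⟩
  (neg E ⊛ neg E) ⊛ dil 2 ψ ⊛ (E ⊛ E ⊛ (e₄ ⊛ e₄))
    ≈⟨ identity 4 (λ n s E f → (n :* n) :* s :* (E :* E :* (f :* f)) := s :* ((E :* n :* f) :* (E :* n :* f))) (neg E ∷ dil 2 ψ ∷ E ∷ e₄ ∷ []) ⟩
  dil 2 ψ ⊛ ((E ⊛ neg E ⊛ e₄) ⊛ (E ⊛ neg E ⊛ e₄))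
    ≈⟨ ⊛-cong S.refl (⊛-cong E-neg E-neg) ⟩
  dil 2 ψ ⊛ ((e₂ ⊛ (e₂ ⊛ e₂)) ⊛ (e₂ ⊛ (e₂ ⊛ e₂)))
    ≈⟨ identity 2 (λ s e → s :* ((e :* (e :* e)) :* (e :* (e :* e))) := e :* ((s :* e) :* ((e :* e) :* (e :* e)))) (dil 2 ψ ∷ e₂ ∷ []) ⟩
  e₂ ⊛ ((dil 2 ψ ⊛ e₂) ⊛ ((e₂ ⊛ e₂) ⊛ (e₂ ⊛ e₂)))
    ≈⟨ ⊛-cong S.refl (⊛-cong (S.sym (dil-⊛ 2 ψ E)) S.refl) ⟩
  e₂ ⊛ (dil 2 (ψ ⊛ E) ⊛ ((e₂ ⊛ e₂) ⊛ (e₂ ⊛ e₂))) ∎))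
  where
  open ≈R
  e₂ e₄ : Series
  e₂ = dil 2 E
  e₄ = dil 4 E

-- Liouville's method

opaque
  ∑₁ : ℕ → (ℕ → ℤ) → ℤ
  ∑₁ n f = ∑ n (λ i → f (suc i))

  ∑₁-def : ∀ n f → ∑₁ n f ≡ ∑ n (λ i → f (suc i))
  ∑₁-def n f = refl

  ∑₁-cong : ∀ n {f g : ℕ → ℤ} → (∀ i → 0 < i → f i ≡ g i) → ∑₁ n f ≡ ∑₁ n g
  ∑₁-cong n p = ∑-cong n λ i _ → p (suc i) (s≤s z≤n)

  ∑₁-cong≤ : ∀ n {f g : ℕ → ℤ} → (∀ i → i < n → f (suc i) ≡ g (suc i)) → ∑₁ n f ≡ ∑₁ n g
  ∑₁-cong≤ n p = ∑-cong n p

  ∑₁-0 : ∀ n {f : ℕ → ℤ} → (∀ i → 0 < i → f i ≡ + 0) → ∑₁ n f ≡ + 0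
  ∑₁-0 n p = ∑-0 n λ i _ → p (suc i) (s≤s z≤n)

  ∑₁-+ : ∀ n (f g : ℕ → ℤ) → ∑₁ n (λ i → f i + g i) ≡ ∑₁ n f + ∑₁ n g
  ∑₁-+ n f g = ∑-+ n (λ i → f (suc i)) (λ i → g (suc i))

  ∑₁-*ˡ : ∀ n c (f : ℕ → ℤ) → ∑₁ n (λ i → c * f i) ≡ c * ∑₁ n f
  ∑₁-*ˡ n c f = ∑-*ˡ n c (λ i → f (suc i))

  ∑₁-swap : ∀ m n (f : ℕ → ℕ → ℤ) → ∑₁ m (λ i → ∑₁ n (λ j → f i j)) ≡ ∑₁ n (λ j → ∑₁ m (λ i → f i j))
  ∑₁-swap m n f = ∑-swap m n (λ i j → f (suc i) (suc j))

  ∑₁-extend : ∀ {m n} (f : ℕ → ℤ) → m ≤ n → (∀ i → m < i → f i ≡ + 0) → ∑₁ n f ≡ ∑₁ m f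
  ∑₁-extend f m≤n p = ∑-extend (λ i → f (suc i)) m≤n λ i m≤i → p (suc i) (s≤s m≤i)

  ∑₁-δ : ∀ {n k} (f : ℕ → ℤ) → 0 < k → k ≤ n → ∑₁ n (λ i → δ i k * f i) ≡ f k
  ∑₁-δ {k = suc k} f _ k<n = ∑-δ (λ i → f (suc i)) k<n

-- A generalised Lambert series, the sum of `f a x · q^(ax)` over positive `a` and `x`. The
-- condition `ax = n` is a factor `δ` over a square rather than a sum over divisors, so that sums
-- can be interchanged freely.
Λ : (ℕ → ℕ → ℤ) → Series
Λ f n = ∑₁ n (λ a → ∑₁ n (λ x → δ (a ℕ.* x) n * f a x))

lam : ℤ → (ℕ → ℕ → ℤ) → Series
lam u f = con u ⊕ Λ f

sum₄ : ℕ → (ℕ → ℕ → ℕ → ℕ → ℤ) → ℤ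
sum₄ n H = ∑₁ n (λ a → ∑₁ n (λ b → ∑₁ n (λ x → ∑₁ n (λ y → H a b x y))))

sum₄-cong : ∀ n {H H′ : ℕ → ℕ → ℕ → ℕ → ℤ} → (∀ a b x y → 0 < a → 0 < b → 0 < x → 0 < y → H a b x y ≡ H′ a b x y) → sum₄ n H ≡ sum₄ n H′
sum₄-cong n p = ∑₁-cong n λ a a>0 → ∑₁-cong n λ b b>0 → ∑₁-cong n λ x x>0 → ∑₁-cong n λ y y>0 → p a b x y a>0 b>0 x>0 y>0

sum₄-+ : ∀ n H H′ → sum₄ n (λ a b x y → H a b x y + H′ a b x y) ≡ sum₄ n H + sum₄ n H′
sum₄-+ n H H′ = trans (∑₁-cong n λ a _ → trans (∑₁-cong n λ b _ → trans (∑₁-cong n λ x _ → ∑₁-+ n _ _) (∑₁-+ n _ _)) (∑₁-+ n _ _)) (∑₁-+ n _ _)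

sum₄-swap₁₂ : ∀ n H → sum₄ n H ≡ sum₄ n (λ a b x y → H b a x y)
sum₄-swap₁₂ n H = ∑₁-swap n n _

sum₄-swap₂₃ : ∀ n H → sum₄ n H ≡ sum₄ n (λ a b x y → H a x b y)
sum₄-swap₂₃ n H = ∑₁-cong n λ a _ → ∑₁-swap n n _

sum₄-swap₃₄ : ∀ n H → sum₄ n H ≡ sum₄ n (λ a b x y → H a b y x)
sum₄-swap₃₄ n H = ∑₁-cong n λ a _ → ∑₁-cong n λ b _ → ∑₁-swap n n _

S[_] : (ℕ → ℕ → ℕ → ℕ → ℤ) → Series
S[ F ] n = sum₄ n (λ a b x y → δ (a ℕ.* x ℕ.+ b ℕ.* y) n * F a b x y)

⨁₁ : ℕ → (ℕ → Series) → Series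
⨁₁ n f i = ∑₁ n (λ a → f a i)

⨁₁-cong : ∀ n {f g : ℕ → Series} → (∀ i → 0 < i → f i ≈ g i) → ⨁₁ n f ≈ ⨁₁ n g
⨁₁-cong n p = pw λ k → ∑₁-cong n λ i i>0 → coeff (p i i>0) k

⨁₁-⊛ : ∀ n c f → ⨁₁ n (λ i → c ⊛ f i) ≈ c ⊛ ⨁₁ n f
⨁₁-⊛ n c f = S.trans (pw λ k → ∑₁-def n _) (S.trans (⨁-⊛ n c (λ i → f (suc i))) (⊛-cong S.refl (pw λ k → sym (∑₁-def n _))))

Λ-truncated : ∀ f {m n} → n ≤ m → Λ f n ≡ ⨁₁ m (λ a → ⨁₁ m (λ x → con (f a x) ⊛ M (a ℕ.* x))) n
Λ-truncated f {m} {n} n≤m = sym (begin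
  ∑₁ m (λ a → ∑₁ m (λ x → (con (f a x) ⊛ M (a ℕ.* x)) n))
    ≡⟨ ∑₁-cong m (λ a _ → ∑₁-cong m λ x _ → trans (con-⊛ (f a x) (M (a ℕ.* x)) n) (trans (cong (f a x *_) (M-δ (a ℕ.* x) n)) (ℤP.*-comm (f a x) _))) ⟩
  ∑₁ m (λ a → ∑₁ m (λ x → δ (a ℕ.* x) n * f a x))
    ≡⟨ ∑₁-cong m (λ { (suc a) _ → ∑₁-extend _ n≤m λ x n<x → cong (_* f (suc a) x) (δ-≢ (ℕP.>⇒≢ (ℕP.<-≤-trans n<x (ℕP.m≤n*m x (suc a))))) }) ⟩
  ∑₁ m (λ a → ∑₁ n (λ x → δ (a ℕ.* x) n * f a x))
    ≡⟨ ∑₁-extend _ n≤m (λ a n<a → ∑₁-0 n λ { (suc x) _ → cong (_* f a (suc x)) (δ-≢ (ℕP.>⇒≢ (ℕP.<-≤-trans n<a (ℕP.m≤m*n a (suc x))))) }) ⟩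
  Λ f n ∎)
  where open ≡-Reasoning

⨁₁-⊛ʳ : ∀ n f g → ⨁₁ n f ⊛ g ≈ ⨁₁ n (λ i → f i ⊛ g)
⨁₁-⊛ʳ n f g = S.trans (pw (⊛-comm (⨁₁ n f) g)) (S.trans (S.sym (⨁₁-⊛ n g f)) (⨁₁-cong n λ i _ → pw (⊛-comm g (f i))))

Λ-⊛ : ∀ f g → Λ f ⊛ Λ g ≈ S[ (λ a b x y → f a x * g b y) ]
Λ-⊛ f g = pw λ n → begin
  (Λ f ⊛ Λ g) n
    ≡⟨ ⊛-congₙ n (λ i i≤n → Λ-truncated f i≤n) (λ i i≤n → Λ-truncated g i≤n) ⟩
  (⨁₁ n (λ a → ⨁₁ n (λ x → t f a x)) ⊛ ⨁₁ n (λ b → ⨁₁ n (λ y → t g b y))) n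
    ≡⟨ coeff (expand n) n ⟩
  ∑₁ n (λ a → ∑₁ n (λ x → ∑₁ n (λ b → ∑₁ n (λ y → (t f a x ⊛ t g b y) n))))
    ≡⟨ ∑₁-cong n (λ a _ → ∑₁-cong n λ x _ → ∑₁-cong n λ b _ → ∑₁-cong n λ y _ → point a x b y n) ⟩
  ∑₁ n (λ a → ∑₁ n (λ x → ∑₁ n (λ b → ∑₁ n (λ y → δ (a ℕ.* x ℕ.+ b ℕ.* y) n * (f a x * g b y)))))
    ≡⟨ sum₄-swap₂₃ n (λ a x b y → δ (a ℕ.* x ℕ.+ b ℕ.* y) n * (f a x * g b y)) ⟩
  S[ (λ a b x y → f a x * g b y) ] n ∎
  where
  open ≡-Reasoning
  t : (ℕ → ℕ → ℤ) → ℕ → ℕ → Series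
  t f a x = con (f a x) ⊛ M (a ℕ.* x)
  expand : ∀ n → ⨁₁ n (λ a → ⨁₁ n (λ x → t f a x)) ⊛ ⨁₁ n (λ b → ⨁₁ n (λ y → t g b y))
               ≈ ⨁₁ n (λ a → ⨁₁ n (λ x → ⨁₁ n (λ b → ⨁₁ n (λ y → t f a x ⊛ t g b y))))
  expand n = S.trans (⨁₁-⊛ʳ n _ _) (⨁₁-cong n λ a _ → S.trans (⨁₁-⊛ʳ n _ _) (⨁₁-cong n λ x _ →
    S.trans (S.sym (⨁₁-⊛ n _ _)) (⨁₁-cong n λ b _ → S.sym (⨁₁-⊛ n _ _))))
  point : ∀ a x b y n → (t f a x ⊛ t g b y) n ≡ δ (a ℕ.* x ℕ.+ b ℕ.* y) n * (f a x * g b y)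
  point a x b y n = trans (coeff (S.trans
      (identity 4 (λ c m d k → (c :* m) :* (d :* k) := c :* (d :* (m :* k))) (con (f a x) ∷ M (a ℕ.* x) ∷ con (g b y) ∷ M (b ℕ.* y) ∷ []))
      (⊛-cong S.refl (⊛-cong S.refl (M-+ (a ℕ.* x) (b ℕ.* y))))) n)
    (trans (con-⊛ (f a x) (con (g b y) ⊛ M (a ℕ.* x ℕ.+ b ℕ.* y)) n) (trans (cong (f a x *_) (trans (con-⊛ (g b y) (M (a ℕ.* x ℕ.+ b ℕ.* y)) n) (cong (g b y *_) (M-δ (a ℕ.* x ℕ.+ b ℕ.* y) n)))) (lemma (f a x) (g b y) (δ (a ℕ.* x ℕ.+ b ℕ.* y) n))))
    where
    lemma : ∀ a b d → a * (b * d) ≡ d * (a * b)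
    lemma = solve-∀

lt : ℕ → ℕ → ℤ
lt x y = if x ℕ.<ᵇ y then + 1 else + 0

lt-true : ∀ {x y} → x < y → lt x y ≡ + 1
lt-true {zero}  {suc y} _         = refl
lt-true {suc x} {suc y} (s≤s x<y) = lt-true {x} {y} x<y

lt-false : ∀ {x y} → y ≤ x → lt x y ≡ + 0
lt-false {x}     {zero}  _         = refl
lt-false {suc x} {suc y} (s≤s y≤x) = lt-false {x} {y} y≤x

trichotomy : ∀ x y → lt x y + δ x y + lt y x ≡ + 1
trichotomy zero    zero    = refl
trichotomy zero    (suc y) = refl
trichotomy (suc x) zero    = refl
trichotomy (suc x) (suc y) = trichotomy x y

∑₁-shift : ∀ n y (g : ℕ → ℤ) → (∀ x → n < x → g x ≡ + 0) → ∑₁ n (λ x → lt y x * g x) ≡ ∑₁ n (λ x → g (x ℕ.+ y))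
∑₁-shift n y g g0 = trans (∑₁-def n _) (trans go (sym (∑₁-def n _)))
  where
  open ≡-Reasoning
  h : ℕ → ℤ
  h i = lt y (suc i) * g (suc i)
  go : ∑ n h ≡ ∑ n (λ x → g (suc x ℕ.+ y))
  go with y ℕP.≤? n
  ... | no y≰n = trans (∑-0 n λ i i<n → cong (_* g (suc i)) (lt-false (ℕP.<⇒≤ (ℕP.≤-<-trans i<n (ℕP.≰⇒> y≰n)))))
                       (sym (∑-0 n λ i _ → g0 _ (ℕP.<-≤-trans (ℕP.≰⇒> y≰n) (ℕP.m≤n+m y (suc i)))))
  ... | yes y≤n = begin
   ∑ n h                                        ≡⟨ cong (λ k → ∑ k h) (sym (ℕP.m+[n∸m]≡n y≤n)) ⟩
   ∑ (y ℕ.+ (n ∸ y)) h                          ≡⟨ ∑-++ y (n ∸ y) h ⟩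
   ∑ y h + ∑ (n ∸ y) (λ j → h (y ℕ.+ j))        ≡⟨ cong₂ _+_ (∑-0 y λ i i<y → cong (_* g (suc i)) (lt-false i<y))
                                                    (∑-cong (n ∸ y) λ j _ → trans (cong (_* g (suc (y ℕ.+ j))) (lt-true (s≤s (ℕP.m≤m+n y j)))) (trans (ℤP.*-identityˡ _) (cong (λ z → g (suc z)) (ℕP.+-comm y j)))) ⟩
   + 0 + ∑ (n ∸ y) (λ j → g (suc j ℕ.+ y))      ≡⟨ ℤP.+-identityˡ _ ⟩
   ∑ (n ∸ y) (λ j → g (suc j ℕ.+ y))            ≡⟨ sym (∑-extend _ (ℕP.m∸n≤m n y) λ j le → g0 _ (s≤s (subst (n ≤_) (ℕP.+-comm y j) (ℕP.≤-trans (ℕP.m≤n+m∸n n y) (ℕP.+-monoʳ-≤ y le))))) ⟩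
   ∑ n (λ j → g (suc j ℕ.+ y))                  ∎

∑₁-+₃ : ∀ n (f g h : ℕ → ℤ) → ∑₁ n (λ i → f i + g i + h i) ≡ ∑₁ n f + ∑₁ n g + ∑₁ n h
∑₁-+₃ n f g h = trans (∑₁-+ n (λ i → f i + g i) h) (cong (_+ ∑₁ n h) (∑₁-+ n f g))

∑∑-+₃ : ∀ n (f g h : ℕ → ℕ → ℤ) → ∑₁ n (λ i → ∑₁ n (λ j → f i j + g i j + h i j)) ≡
  ∑₁ n (λ i → ∑₁ n (λ j → f i j)) + ∑₁ n (λ i → ∑₁ n (λ j → g i j)) + ∑₁ n (λ i → ∑₁ n (λ j → h i j))
∑∑-+₃ n f g h = trans (∑₁-cong n λ i _ → ∑₁-+₃ n (f i) (g i) (h i)) (∑₁-+₃ n (λ i → ∑₁ n (f i)) (λ i → ∑₁ n (g i)) (λ i → ∑₁ n (h i)))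

-- The pairs with `x < y`, `x = y` and `x > y` are separated and the unequal ones are described by
-- the smaller entry and the difference. As `k` vanishes outside the square, the new variables may
-- again run up to `n`.
∑₁-split : ∀ n (k : ℕ → ℕ → ℤ) → (∀ x y → n < x → k x y ≡ + 0) → (∀ x y → n < y → k x y ≡ + 0) →
  ∑₁ n (λ x → ∑₁ n (λ y → k x y)) ≡ ∑₁ n (λ x → ∑₁ n (λ y → k x (x ℕ.+ y))) + ∑₁ n (λ x → k x x) + ∑₁ n (λ x → ∑₁ n (λ y → k (x ℕ.+ y) y))
∑₁-split n k k₁ k₂ = begin
  ∑₁ n (λ x → ∑₁ n (λ y → k x y))
    ≡⟨ ∑₁-cong n (λ x _ → ∑₁-cong n λ y _ → trans (sym (ℤP.*-identityˡ _)) (trans (cong (_* k x y) (sym (trichotomy x y))) (trans (lemma (lt x y) (δ x y) (lt y x) (k x y)) (cong (λ z → lt x y * k x y + z * k x y + lt y x * k x y) (δ-sym x y))))) ⟩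
  ∑₁ n (λ x → ∑₁ n (λ y → lt x y * k x y + δ y x * k x y + lt y x * k x y))
    ≡⟨ ∑∑-+₃ n (λ x y → lt x y * k x y) (λ x y → δ y x * k x y) (λ x y → lt y x * k x y) ⟩
  ∑₁ n (λ x → ∑₁ n (λ y → lt x y * k x y)) + ∑₁ n (λ x → ∑₁ n (λ y → δ y x * k x y)) + ∑₁ n (λ x → ∑₁ n (λ y → lt y x * k x y))
    ≡⟨ cong₂ _+_ (cong₂ _+_ (∑₁-cong n λ x _ → trans (∑₁-shift n x (k x) (k₂ x)) (∑₁-cong n λ y _ → cong (k x) (ℕP.+-comm y x)))
                            (∑₁-cong≤ n λ x x<n → ∑₁-δ (λ y → k (suc x) y) (s≤s z≤n) x<n))
                 (trans (∑₁-swap n n _) (trans (∑₁-cong n λ y _ → ∑₁-shift n y (λ x → k x y) (λ x → k₁ x y)) (∑₁-swap n n _))) ⟩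
  ∑₁ n (λ x → ∑₁ n (λ y → k x (x ℕ.+ y))) + ∑₁ n (λ x → k x x) + ∑₁ n (λ x → ∑₁ n (λ y → k (x ℕ.+ y) y)) ∎
  where
  open ≡-Reasoning
  δ-sym : ∀ x y → δ x y ≡ δ y x
  δ-sym zero    zero    = refl
  δ-sym zero    (suc y) = refl
  δ-sym (suc x) zero    = refl
  δ-sym (suc x) (suc y) = δ-sym x y
  lemma : ∀ a b c d → (a + b + c) * d ≡ a * d + b * d + c * d
  lemma = solve-∀

conv : (ℕ → ℕ → ℤ) → ℕ → ℤ
conv k d = ∑ (d ∸ 1) (λ i → k (suc i) (d ∸ suc i))

∑₁-conv : ∀ n (k : ℕ → ℕ → ℤ) → (∀ a b → n < a ℕ.+ b → k a b ≡ + 0) → ∑₁ n (λ a → ∑₁ n (λ b → k a b)) ≡ ∑₁ n (conv k)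
∑₁-conv n k k0 = begin
  ∑₁ n (λ a → ∑₁ n (λ b → k a b))
    ≡⟨ ∑₁-cong n (λ a _ → trans (∑₁-cong n λ b b>0 → here a b b>0) (sym (∑₁-shift n a (λ d → lt a d * k a (d ∸ a)) (vanish a)))) ⟩
  ∑₁ n (λ a → ∑₁ n (λ d → lt a d * (lt a d * k a (d ∸ a))))
    ≡⟨ ∑₁-swap n n _ ⟩
  ∑₁ n (λ d → ∑₁ n (λ a → lt a d * (lt a d * k a (d ∸ a))))
    ≡⟨ ∑₁-cong≤ n (λ e e<n → inner e e<n) ⟩
  ∑₁ n (conv k) ∎
  where
  open ≡-Reasoning
  here : ∀ a b → 0 < b → k a b ≡ lt a (b ℕ.+ a) * k a (b ℕ.+ a ∸ a)
  here a b b>0 = sym (trans (cong₂ _*_ (lt-true (ℕP.m<n+m a b>0)) (cong (k a) (ℕP.m+n∸n≡m b a))) (ℤP.*-identityˡ _))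
  vanish : ∀ a d → n < d → lt a d * k a (d ∸ a) ≡ + 0
  vanish a d n<d with a ℕP.≤? d
  ... | yes a≤d = trans (cong (lt a d *_) (k0 a (d ∸ a) (subst (n <_) (sym (ℕP.m+[n∸m]≡n a≤d)) n<d))) (ℤP.*-zeroʳ (lt a d))
  ... | no  a≰d = cong (_* k a (d ∸ a)) (lt-false (ℕP.<⇒≤ (ℕP.≰⇒> a≰d)))
  inner : ∀ e → e < n → ∑₁ n (λ a → lt a (suc e) * (lt a (suc e) * k a (suc e ∸ a))) ≡ conv k (suc e)
  inner e e<n = trans (∑₁-def n _) (trans (∑-extend _ (ℕP.<⇒≤ e<n) λ i e≤i → cong (_* (lt (suc i) (suc e) * k (suc i) (suc e ∸ suc i))) (lt-false (s≤s e≤i)))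
    (∑-cong e λ i i<e → trans (cong₂ (λ u v → u * (v * k (suc i) (e ∸ i))) (lt-true (s≤s i<e)) (lt-true (s≤s i<e)))
      (trans (ℤP.*-identityˡ _) (ℤP.*-identityˡ _))))

δ-large : ∀ {m n} k → n < m → δ m n * k ≡ + 0
δ-large {m} {n} k n<m = cong (_* k) (δ-≢ {m} {n} (ℕP.>⇒≢ n<m))

-- (a, b, x + y, y) ↦ (a, a + b, x, y) preserves a x + b y and matches the terms of S[ G ] having x > y with those having
-- a < b; by symmetry of G only the diagonals x = y and a = b survive in S[ F ].
module Liouville (F G : ℕ → ℕ → ℕ → ℕ → ℤ)
  (G-sym : ∀ a b x y → G b a y x ≡ G a b x y)
  (F-G : ∀ a b x y → F a b (x ℕ.+ y) y + F b a y (x ℕ.+ y) ≡ G a b (x ℕ.+ y) y - G a (a ℕ.+ b) x y) where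

  private
    -- `T₁ H` collects the terms of `S[ H ]` with `x > y`, `T₂ H` those with `a < b`, each with the
    -- larger entry written as a sum. The diagonals are `Dx` and `Da`.
    T₁ T₂ : (ℕ → ℕ → ℕ → ℕ → ℤ) → ℕ → ℤ
    T₁ H n = sum₄ n (λ a b x y → δ (a ℕ.* (x ℕ.+ y) ℕ.+ b ℕ.* y) n * H a b (x ℕ.+ y) y)
    T₂ H n = sum₄ n (λ a b x y → δ (a ℕ.* x ℕ.+ (a ℕ.+ b) ℕ.* y) n * H a (a ℕ.+ b) x y)

    swapped : (ℕ → ℕ → ℕ → ℕ → ℤ) → ℕ → ℕ → ℕ → ℕ → ℤ
    swapped H a b x y = H b a y x

    Dx Da : (ℕ → ℕ → ℕ → ℕ → ℤ) → ℕ → ℤ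
    Dx H n = ∑₁ n (λ d → ∑₁ n (λ e → δ (d ℕ.* e) n * conv (λ a b → H a b e e) d))
    Da H n = ∑₁ n (λ d → ∑₁ n (λ e → δ (d ℕ.* e) n * conv (λ x y → H d d x y) e))

    conv-*ˡ : ∀ c k d → conv (λ a b → c * k a b) d ≡ c * conv k d
    conv-*ˡ c k d = ∑-*ˡ (d ∸ 1) c _

    a≤aᵡ : ∀ {n} a x → 0 < a → n < x → n < a ℕ.* x
    a≤aᵡ (suc a) x _ n<x = ℕP.<-≤-trans n<x (ℕP.m≤n*m x (suc a))

    a≤xᵃ : ∀ {n} a x → 0 < x → n < a → n < a ℕ.* x
    a≤xᵃ a (suc x) _ n<a = ℕP.<-≤-trans n<a (ℕP.m≤m*n a (suc x))

    split-xy : ∀ H n → S[ H ] n ≡ T₁ H n + T₁ (swapped H) n + Dx H n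
    split-xy H n = begin
      S[ H ] n
        ≡⟨ ∑₁-cong n (λ a a>0 → ∑₁-cong n λ b b>0 → ∑₁-split n (λ x y → δ (a ℕ.* x ℕ.+ b ℕ.* y) n * H a b x y)
             (λ x y n<x → δ-large (H a b x y) (ℕP.<-≤-trans (a≤aᵡ a x a>0 n<x) (ℕP.m≤m+n (a ℕ.* x) (b ℕ.* y))))
             (λ x y n<y → δ-large (H a b x y) (ℕP.<-≤-trans (a≤aᵡ b y b>0 n<y) (ℕP.m≤n+m (b ℕ.* y) (a ℕ.* x))))) ⟩
      ∑₁ n (λ a → ∑₁ n (λ b → U₁ a b + D a b + U₂ a b))
        ≡⟨ ∑∑-+₃ n U₁ D U₂ ⟩
      ∑₁ n (λ a → ∑₁ n (λ b → U₁ a b)) + ∑₁ n (λ a → ∑₁ n (λ b → D a b)) + T₁ H n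
        ≡⟨ cong₂ (λ u v → u + v + T₁ H n) lower diag ⟩
      T₁ (swapped H) n + Dx H n + T₁ H n
        ≡⟨ lemma (T₁ (swapped H) n) (Dx H n) (T₁ H n) ⟩
      T₁ H n + T₁ (swapped H) n + Dx H n ∎
      where
      open ≡-Reasoning
      U₁ D U₂ : ℕ → ℕ → ℤ
      U₁ a b = ∑₁ n (λ x → ∑₁ n (λ y → δ (a ℕ.* x ℕ.+ b ℕ.* (x ℕ.+ y)) n * H a b x (x ℕ.+ y)))
      D a b = ∑₁ n (λ x → δ (a ℕ.* x ℕ.+ b ℕ.* x) n * H a b x x)
      U₂ a b = ∑₁ n (λ x → ∑₁ n (λ y → δ (a ℕ.* (x ℕ.+ y) ℕ.+ b ℕ.* y) n * H a b (x ℕ.+ y) y))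
      lemma : ∀ a b c → a + b + c ≡ c + a + b
      lemma = solve-∀
      lower : ∑₁ n (λ a → ∑₁ n (λ b → U₁ a b)) ≡ T₁ (swapped H) n
      lower = trans (sum₄-swap₁₂ n (λ a b x y → δ (a ℕ.* x ℕ.+ b ℕ.* (x ℕ.+ y)) n * H a b x (x ℕ.+ y)))
        (trans (sum₄-swap₃₄ n (λ a b x y → δ (b ℕ.* x ℕ.+ a ℕ.* (x ℕ.+ y)) n * H b a x (x ℕ.+ y)))
        (sum₄-cong n λ a b x y _ _ _ _ → cong₂ (λ u v → δ u n * H b a y v)
          (trans (ℕP.+-comm (b ℕ.* y) _) (cong (λ z → a ℕ.* z ℕ.+ b ℕ.* y) (ℕP.+-comm y x))) (ℕP.+-comm y x)))
      diag : ∑₁ n (λ a → ∑₁ n (λ b → D a b)) ≡ Dx H n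
      diag = begin
        ∑₁ n (λ a → ∑₁ n (λ b → ∑₁ n (λ x → δ (a ℕ.* x ℕ.+ b ℕ.* x) n * H a b x x)))
          ≡⟨ trans (∑₁-cong n λ a _ → ∑₁-swap n n _) (∑₁-swap n n _) ⟩
        ∑₁ n (λ x → ∑₁ n (λ a → ∑₁ n (λ b → δ (a ℕ.* x ℕ.+ b ℕ.* x) n * H a b x x)))
          ≡⟨ ∑₁-cong n (λ x x>0 → trans (∑₁-conv n (λ a b → δ (a ℕ.* x ℕ.+ b ℕ.* x) n * H a b x x)
               (λ a b n<ab → δ-large (H a b x x) (subst (n <_) (ℕP.*-distribʳ-+ x a b) (a≤xᵃ (a ℕ.+ b) x x>0 n<ab))))
               (∑₁-cong n λ d _ → trans (∑-cong (d ∸ 1) λ i i<d → cong (λ z → δ z n * H (suc i) (d ∸ suc i) x x)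
                   (trans (sym (ℕP.*-distribʳ-+ x (suc i) (d ∸ suc i))) (cong (ℕ._* x) (ℕP.m+[n∸m]≡n (below d i i<d)))))
                 (conv-*ˡ (δ (d ℕ.* x) n) (λ a b → H a b x x) d))) ⟩
        ∑₁ n (λ x → ∑₁ n (λ d → δ (d ℕ.* x) n * conv (λ a b → H a b x x) d))
          ≡⟨ ∑₁-swap n n _ ⟩
        Dx H n ∎
        where
        below : ∀ d i → i < d ∸ 1 → suc i ≤ d
        below (suc d) i i<d = ℕP.m≤n⇒m≤1+n i<d

    split-ab : ∀ H n → S[ H ] n ≡ T₂ H n + T₂ (swapped H) n + Da H n
    split-ab H n = begin
      S[ H ] n
        ≡⟨ reorder (λ a b x y → δ (a ℕ.* x ℕ.+ b ℕ.* y) n * H a b x y) ⟩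
      sum₄ n (λ x y a b → δ (a ℕ.* x ℕ.+ b ℕ.* y) n * H a b x y)
        ≡⟨ ∑₁-cong n (λ x x>0 → ∑₁-cong n λ y y>0 → ∑₁-split n (λ a b → δ (a ℕ.* x ℕ.+ b ℕ.* y) n * H a b x y)
             (λ a b n<a → δ-large (H a b x y) (ℕP.<-≤-trans (a≤xᵃ a x x>0 n<a) (ℕP.m≤m+n (a ℕ.* x) (b ℕ.* y))))
             (λ a b n<b → δ-large (H a b x y) (ℕP.<-≤-trans (a≤xᵃ b y y>0 n<b) (ℕP.m≤n+m (b ℕ.* y) (a ℕ.* x))))) ⟩
      ∑₁ n (λ x → ∑₁ n (λ y → U₁ x y + D x y + U₂ x y))
        ≡⟨ ∑∑-+₃ n U₁ D U₂ ⟩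
      ∑₁ n (λ x → ∑₁ n (λ y → U₁ x y)) + ∑₁ n (λ x → ∑₁ n (λ y → D x y)) + ∑₁ n (λ x → ∑₁ n (λ y → U₂ x y))
        ≡⟨ cong₂ _+_ (cong₂ _+_ (sym (reorder (λ a b x y → δ (a ℕ.* x ℕ.+ (a ℕ.+ b) ℕ.* y) n * H a (a ℕ.+ b) x y))) diag) upper ⟩
      T₂ H n + Da H n + T₂ (swapped H) n
        ≡⟨ lemma (T₂ H n) (Da H n) (T₂ (swapped H) n) ⟩
      T₂ H n + T₂ (swapped H) n + Da H n ∎
      where
      open ≡-Reasoning
      U₁ D U₂ : ℕ → ℕ → ℤ
      U₁ x y = ∑₁ n (λ a → ∑₁ n (λ b → δ (a ℕ.* x ℕ.+ (a ℕ.+ b) ℕ.* y) n * H a (a ℕ.+ b) x y))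
      D x y = ∑₁ n (λ a → δ (a ℕ.* x ℕ.+ a ℕ.* y) n * H a a x y)
      U₂ x y = ∑₁ n (λ a → ∑₁ n (λ b → δ ((a ℕ.+ b) ℕ.* x ℕ.+ b ℕ.* y) n * H (a ℕ.+ b) b x y))
      lemma : ∀ a b c → a + b + c ≡ a + c + b
      lemma = solve-∀
      reorder : ∀ K → sum₄ n K ≡ sum₄ n (λ x y a b → K a b x y)
      reorder K = trans (sum₄-swap₂₃ n K) (trans (sum₄-swap₁₂ n _) (trans (sum₄-swap₃₄ n _) (sum₄-swap₂₃ n _)))
      upper : ∑₁ n (λ x → ∑₁ n (λ y → U₂ x y)) ≡ T₂ (swapped H) n
      upper = trans (sym (reorder (λ a b x y → δ ((a ℕ.+ b) ℕ.* x ℕ.+ b ℕ.* y) n * H (a ℕ.+ b) b x y)))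
        (trans (sum₄-swap₁₂ n _) (trans (sum₄-swap₃₄ n _) (sum₄-cong n λ a b x y _ _ _ _ → cong₂ (λ u v → δ u n * H v a y x)
          (trans (ℕP.+-comm ((b ℕ.+ a) ℕ.* y) _) (cong (λ z → a ℕ.* x ℕ.+ z ℕ.* y) (ℕP.+-comm b a))) (ℕP.+-comm b a))))
      diag : ∑₁ n (λ x → ∑₁ n (λ y → D x y)) ≡ Da H n
      diag = begin
        ∑₁ n (λ x → ∑₁ n (λ y → ∑₁ n (λ a → δ (a ℕ.* x ℕ.+ a ℕ.* y) n * H a a x y)))
          ≡⟨ trans (∑₁-cong n λ a _ → ∑₁-swap n n _) (∑₁-swap n n _) ⟩
        ∑₁ n (λ a → ∑₁ n (λ x → ∑₁ n (λ y → δ (a ℕ.* x ℕ.+ a ℕ.* y) n * H a a x y)))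
          ≡⟨ ∑₁-cong n (λ a a>0 → trans (∑₁-conv n (λ x y → δ (a ℕ.* x ℕ.+ a ℕ.* y) n * H a a x y)
               (λ x y n<xy → δ-large (H a a x y) (subst (n <_) (ℕP.*-distribˡ-+ a x y) (a≤aᵡ a (x ℕ.+ y) a>0 n<xy))))
               (∑₁-cong n λ e _ → trans (∑-cong (e ∸ 1) λ i i<e → cong (λ z → δ z n * H a a (suc i) (e ∸ suc i))
                   (trans (sym (ℕP.*-distribˡ-+ a (suc i) (e ∸ suc i))) (cong (a ℕ.*_) (ℕP.m+[n∸m]≡n (below e i i<e)))))
                 (conv-*ˡ (δ (a ℕ.* e) n) (H a a) e))) ⟩
        Da H n ∎
        where
        below : ∀ d i → i < d ∸ 1 → suc i ≤ d
        below (suc d) i i<d = ℕP.m≤n⇒m≤1+n i<d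

    T₁-F : ∀ n → T₁ F n + T₁ (swapped F) n + T₂ G n ≡ T₁ G n
    T₁-F n = trans (cong (_+ T₂ G n) (sym (sum₄-+ n _ _))) (trans (sym (sum₄-+ n _ _)) (sum₄-cong n λ a b x y _ _ _ _ →
      trans (cong (λ z → δ (a ℕ.* (x ℕ.+ y) ℕ.+ b ℕ.* y) n * F a b (x ℕ.+ y) y + δ (a ℕ.* (x ℕ.+ y) ℕ.+ b ℕ.* y) n * F b a y (x ℕ.+ y) + δ z n * G a (a ℕ.+ b) x y) (exps a b x y))
      (trans (lemma (δ (a ℕ.* (x ℕ.+ y) ℕ.+ b ℕ.* y) n) (F a b (x ℕ.+ y) y) (F b a y (x ℕ.+ y)) (G a (a ℕ.+ b) x y))
      (cong (δ (a ℕ.* (x ℕ.+ y) ℕ.+ b ℕ.* y) n *_) (trans (cong (_+ G a (a ℕ.+ b) x y) (F-G a b x y)) (lemma′ (G a b (x ℕ.+ y) y) _))))))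
      where
      exps : ∀ a b x y → a ℕ.* x ℕ.+ (a ℕ.+ b) ℕ.* y ≡ a ℕ.* (x ℕ.+ y) ℕ.+ b ℕ.* y
      exps = ℕ-solve
        where open import Data.Nat.Tactic.RingSolver using () renaming (solve-∀ to ℕ-solve)
      lemma : ∀ d f g h → d * f + d * g + d * h ≡ d * (f + g + h)
      lemma = solve-∀
      lemma′ : ∀ a b → a - b + b ≡ a
      lemma′ = solve-∀

    swapped-G : ∀ n → T₁ (swapped G) n ≡ T₁ G n × T₂ (swapped G) n ≡ T₂ G n
    swapped-G n = sum₄-cong n (λ a b x y _ _ _ _ → cong (δ (a ℕ.* (x ℕ.+ y) ℕ.+ b ℕ.* y) n *_) (G-sym a b (x ℕ.+ y) y))
                , sum₄-cong n (λ a b x y _ _ _ _ → cong (δ (a ℕ.* x ℕ.+ (a ℕ.+ b) ℕ.* y) n *_) (G-sym a (a ℕ.+ b) x y))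

  -- Splitting by `x` and `y` and using the hypothesis on `F` gives `S[ F ] = T₁ G - T₂ G + Dx F`.
  -- Splitting `S[ G ]` in both ways gives `2 T₁ G + Dx G = 2 T₂ G + Da G`, because `G` is
  -- symmetric; hence the factor 2.
  liouville : ∀ n → + 2 * S[ F ] n ≡ ∑₁ n (λ d → ∑₁ n (λ e → δ (d ℕ.* e) n *
    (conv (λ x y → G d d x y) e - conv (λ a b → G a b e e) d + + 2 * conv (λ a b → F a b e e) d)))
  liouville n = begin
    + 2 * S[ F ] n                                             ≡⟨ cong (+ 2 *_) (split-xy F n) ⟩
    + 2 * (T₁ F n + T₁ (swapped F) n + Dx F n)                 ≡⟨ lemma₁ (T₁ F n) (T₁ (swapped F) n) (Dx F n) (T₂ G n) ⟩
    + 2 * (T₁ F n + T₁ (swapped F) n + T₂ G n) - + 2 * T₂ G n + + 2 * Dx F n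
      ≡⟨ cong (λ z → + 2 * z - + 2 * T₂ G n + + 2 * Dx F n) (T₁-F n) ⟩
    + 2 * T₁ G n - + 2 * T₂ G n + + 2 * Dx F n                 ≡⟨ lemma₂ (T₁ G n) (T₂ G n) (Dx F n) (Dx G n) (Da G n) both ⟩
    Da G n - Dx G n + + 2 * Dx F n                             ≡⟨ combine ⟩
    ∑₁ n (λ d → ∑₁ n (λ e → δ (d ℕ.* e) n * (conv (λ x y → G d d x y) e - conv (λ a b → G a b e e) d + + 2 * conv (λ a b → F a b e e) d))) ∎
    where
    open ≡-Reasoning
    lemma₁ : ∀ a b c d → + 2 * (a + b + c) ≡ + 2 * (a + b + d) - + 2 * d + + 2 * c
    lemma₁ = solve-∀
    both : T₁ G n + T₁ G n + Dx G n ≡ T₂ G n + T₂ G n + Da G n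
    both = trans (cong (λ z → T₁ G n + z + Dx G n) (sym (proj₁ (swapped-G n)))) (trans (sym (split-xy G n))
           (trans (split-ab G n) (cong (λ z → T₂ G n + z + Da G n) (proj₂ (swapped-G n)))))
    lemma₂ : ∀ t u f x a → t + t + x ≡ u + u + a → + 2 * t - + 2 * u + + 2 * f ≡ a - x + + 2 * f
    lemma₂ t u f x a h = trans (l₁ t u f x) (trans (cong (λ z → z - x - + 2 * u + + 2 * f) h) (l₂ u f x a))
      where
      l₁ : ∀ t u f x → + 2 * t - + 2 * u + + 2 * f ≡ (t + t + x) - x - + 2 * u + + 2 * f
      l₁ = solve-∀
      l₂ : ∀ u f x a → (u + u + a) - x - + 2 * u + + 2 * f ≡ a - x + + 2 * f
      l₂ = solve-∀
    p r s : ℕ → ℕ → ℤ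
    p d e = δ (d ℕ.* e) n * conv (λ x y → G d d x y) e
    r d e = δ (d ℕ.* e) n * conv (λ a b → G a b e e) d
    s d e = δ (d ℕ.* e) n * conv (λ a b → F a b e e) d
    combine : Da G n - Dx G n + + 2 * Dx F n ≡ ∑₁ n (λ d → ∑₁ n (λ e → δ (d ℕ.* e) n *
      (conv (λ x y → G d d x y) e - conv (λ a b → G a b e e) d + + 2 * conv (λ a b → F a b e e) d)))
    combine = trans (cong₂ _+_ (cong (_+_ (Da G n)) (sym (neg∑∑ r))) (sym (c∑∑ (+ 2) s)))
      (trans (cong (λ z → z + ∑₁ n (λ d → ∑₁ n (λ e → + 2 * s d e))) (sym (∑∑-+ p (λ d e → - (+ 1) * r d e))))
      (trans (sym (∑∑-+ (λ d e → p d e + - (+ 1) * r d e) (λ d e → + 2 * s d e))) (∑₁-cong n λ d _ → ∑₁-cong n λ e _ →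
        lemma₃ (δ (d ℕ.* e) n) (conv (λ x y → G d d x y) e) (conv (λ a b → G a b e e) d) (conv (λ a b → F a b e e) d))))
      where
      lemma₃ : ∀ δ a b c → δ * a + - (+ 1) * (δ * b) + + 2 * (δ * c) ≡ δ * (a - b + + 2 * c)
      lemma₃ = solve-∀
      ∑∑-+ : ∀ (f g : ℕ → ℕ → ℤ) → ∑₁ n (λ d → ∑₁ n (λ e → f d e + g d e)) ≡ ∑₁ n (λ d → ∑₁ n (f d)) + ∑₁ n (λ d → ∑₁ n (g d))
      ∑∑-+ f g = trans (∑₁-cong n λ d _ → ∑₁-+ n (f d) (g d)) (∑₁-+ n (λ d → ∑₁ n (f d)) (λ d → ∑₁ n (g d)))
      c∑∑ : ∀ c (f : ℕ → ℕ → ℤ) → ∑₁ n (λ d → ∑₁ n (λ e → c * f d e)) ≡ c * ∑₁ n (λ d → ∑₁ n (f d))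
      c∑∑ c f = trans (∑₁-cong n λ d _ → ∑₁-*ˡ n c (f d)) (∑₁-*ˡ n c (λ d → ∑₁ n (f d)))
      neg∑∑ : ∀ (f : ℕ → ℕ → ℤ) → ∑₁ n (λ d → ∑₁ n (λ e → - (+ 1) * f d e)) ≡ - ∑₁ n (λ d → ∑₁ n (f d))
      neg∑∑ f = trans (c∑∑ (- (+ 1)) f) (ℤP.-1*i≡-i _)

-- Certified identities

-- A factor `(u , f)` stands for `u + Λ f`, a term for a multiple of a product of two factors.
-- Relations are kept as lists so that their parts of degree 0, 1 and 2 in `Λ` can be computed:
-- `constant`, `linear` and `quartic`, the last being a function of four variables.
Factor Term : Set
Factor = ℤ × (ℕ → ℕ → ℤ)
Term = ℤ × Factor × Factor

⟪_⟫ : Factor → Series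
⟪ u , f ⟫ = lam u f

total : List Term → Series
total []                = con (+ 0)
total ((c , f , g) ∷ t) = con c ⊛ (⟪ f ⟫ ⊛ ⟪ g ⟫) ⊕ total t

quartic : List Term → ℕ → ℕ → ℕ → ℕ → ℤ
quartic []                            a b x y = + 0
quartic ((c , (u , f) , (v , g)) ∷ t) a b x y = c * (f a x * g b y) + quartic t a b x y

linear : List Term → ℕ → ℕ → ℤ
linear []                            d e = + 0
linear ((c , (u , f) , (v , g)) ∷ t) d e = c * (u * g d e + v * f d e) + linear t d e

constant : List Term → ℤ
constant []                            = + 0
constant ((c , (u , f) , (v , g)) ∷ t) = c * (u * v) + constant t

Λ-cong : ∀ {f g : ℕ → ℕ → ℤ} → (∀ a x → 0 < a → 0 < x → f a x ≡ g a x) → Λ f ≈ Λ g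
Λ-cong p = pw λ n → ∑₁-cong n λ a a>0 → ∑₁-cong n λ x x>0 → cong (δ (a ℕ.* x) n *_) (p a x a>0 x>0)

Λ-linear : ∀ c f g → Λ (λ a x → c * f a x + g a x) ≈ con c ⊛ Λ f ⊕ Λ g
Λ-linear c f g = pw λ n → trans (∑₁-cong n λ a _ → trans (∑₁-cong n λ x _ → lemma (δ (a ℕ.* x) n) c (f a x) (g a x))
    (trans (∑₁-+ n (λ x → c * (δ (a ℕ.* x) n * f a x)) (λ x → δ (a ℕ.* x) n * g a x)) (cong (_+ ∑₁ n (λ x → δ (a ℕ.* x) n * g a x)) (∑₁-*ˡ n c (λ x → δ (a ℕ.* x) n * f a x)))))
  (trans (∑₁-+ n (λ a → c * ∑₁ n (λ x → δ (a ℕ.* x) n * f a x)) (λ a → ∑₁ n (λ x → δ (a ℕ.* x) n * g a x)))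
  (trans (cong (_+ Λ g n) (trans (∑₁-*ˡ n c (λ a → ∑₁ n (λ x → δ (a ℕ.* x) n * f a x))) (sym (con-⊛ c (Λ f) n)))) (sym (⊕-at _ _ n))))
  where
  lemma : ∀ d c f g → d * (c * f + g) ≡ c * (d * f) + d * g
  lemma = solve-∀

Λ-0 : Λ (λ _ _ → + 0) ≈ con (+ 0)
Λ-0 = pw λ n → trans (∑₁-0 n λ a _ → ∑₁-0 n λ x _ → ℤP.*-zeroʳ (δ (a ℕ.* x) n)) (sym (con-0 n))

S-linear : ∀ c F H → S[ (λ a b x y → c * F a b x y + H a b x y) ] ≈ con c ⊛ S[ F ] ⊕ S[ H ]
S-linear c F H = pw λ n → trans (sum₄-cong n λ a b x y _ _ _ _ → lemma (δ (a ℕ.* x ℕ.+ b ℕ.* y) n) c (F a b x y) (H a b x y))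
  (trans (sum₄-+ n (λ a b x y → c * (δ (a ℕ.* x ℕ.+ b ℕ.* y) n * F a b x y)) (λ a b x y → δ (a ℕ.* x ℕ.+ b ℕ.* y) n * H a b x y))
  (trans (cong (_+ S[ H ] n) (trans (scale n) (sym (con-⊛ c S[ F ] n)))) (sym (⊕-at _ _ n))))
  where
  lemma : ∀ d c f g → d * (c * f + g) ≡ c * (d * f) + d * g
  lemma = solve-∀
  scale : ∀ n → sum₄ n (λ a b x y → c * (δ (a ℕ.* x ℕ.+ b ℕ.* y) n * F a b x y)) ≡ c * S[ F ] n
  scale n = trans (∑₁-cong n λ a _ → trans (∑₁-cong n λ b _ → trans (∑₁-cong n λ x _ → ∑₁-*ˡ n c _) (∑₁-*ˡ n c _)) (∑₁-*ˡ n c _)) (∑₁-*ˡ n c _)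

S-0 : S[ (λ _ _ _ _ → + 0) ] ≈ con (+ 0)
S-0 = pw λ n → trans (∑₁-0 n λ a _ → ∑₁-0 n λ b _ → ∑₁-0 n λ x _ → ∑₁-0 n λ y _ → ℤP.*-zeroʳ (δ (a ℕ.* x ℕ.+ b ℕ.* y) n)) (sym (con-0 n))

con-* : ∀ a b → con (a * b) ≈ con a ⊛ con b
con-* a b = pw λ { zero → refl ; (suc i) → sym (trans (con-⊛ a (con b) (suc i)) (ℤP.*-zeroʳ a)) }

total-expand : ∀ t → total t ≈ con (constant t) ⊕ (Λ (linear t) ⊕ S[ quartic t ])
total-expand [] = S.trans (identity 0 (κ (+ 0) := κ (+ 0) :+ (κ (+ 0) :+ κ (+ 0))) []) (⊕-cong S.refl (⊕-cong (S.sym Λ-0) (S.sym S-0)))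
total-expand ((c , (u , f) , (v , g)) ∷ t) = begin
  con c ⊛ ((con u ⊕ Λ f) ⊛ (con v ⊕ Λ g)) ⊕ total t
    ≈⟨ ⊕-cong (identity 5 (λ c u v f g → c :* ((u :+ f) :* (v :+ g)) := c :* (u :* v) :+ (c :* (u :* g :+ v :* f) :+ c :* (f :* g))) (con c ∷ con u ∷ con v ∷ Λ f ∷ Λ g ∷ [])) (total-expand t) ⟩
  (con c ⊛ (con u ⊛ con v) ⊕ (con c ⊛ (con u ⊛ Λ g ⊕ con v ⊛ Λ f) ⊕ con c ⊛ (Λ f ⊛ Λ g))) ⊕ (con k ⊕ (Λ l ⊕ S[ Q ]))
    ≈⟨ ⊕-cong (⊕-cong (S.trans (⊛-cong S.refl (S.sym (con-* u v))) (S.sym (con-* c (u * v)))) (⊕-cong (⊛-cong S.refl weight1) (⊛-cong S.refl (Λ-⊛ f g)))) S.refl ⟩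
  (con (c * (u * v)) ⊕ (con c ⊛ Λ (λ d e → u * g d e + v * f d e) ⊕ con c ⊛ S[ (λ a b x y → f a x * g b y) ])) ⊕ (con k ⊕ (Λ l ⊕ S[ Q ]))
    ≈⟨ identity 6 (λ a b d e f g → (a :+ (b :+ d)) :+ (e :+ (f :+ g)) := (a :+ e) :+ ((b :+ f) :+ (d :+ g)))
         (con (c * (u * v)) ∷ con c ⊛ Λ (λ d e → u * g d e + v * f d e) ∷ con c ⊛ S[ (λ a b x y → f a x * g b y) ] ∷ con k ∷ Λ l ∷ S[ Q ] ∷ []) ⟩
  (con (c * (u * v)) ⊕ con k) ⊕ ((con c ⊛ Λ (λ d e → u * g d e + v * f d e) ⊕ Λ l) ⊕ (con c ⊛ S[ (λ a b x y → f a x * g b y) ] ⊕ S[ Q ]))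
    ≈⟨ ⊕-cong (S.sym (con-+ _ _)) (⊕-cong (S.sym (Λ-linear c _ l)) (S.sym (S-linear c _ Q))) ⟩
  con (c * (u * v) + k) ⊕ (Λ (linear ((c , (u , f) , (v , g)) ∷ t)) ⊕ S[ quartic ((c , (u , f) , (v , g)) ∷ t) ]) ∎
  where
  open ≈R
  k = constant t
  l = linear t
  Q = quartic t
  weight1 : con u ⊛ Λ g ⊕ con v ⊛ Λ f ≈ Λ (λ d e → u * g d e + v * f d e)
  weight1 = S.trans (⊕-cong S.refl (S.trans (identity 1 (λ x → x := x :+ κ (+ 0)) (con v ⊛ Λ f ∷ [])) (S.trans (⊕-cong S.refl (S.sym Λ-0))
      (S.trans (S.sym (Λ-linear v f _)) (Λ-cong λ a x _ _ → ℤP.+-identityʳ _))))) (S.sym (Λ-linear u g (λ d e → v * f d e)))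

allBelow : ℕ → (ℕ → Bool) → Bool
allBelow zero    p = true
allBelow (suc n) p = p n ∧ allBelow n p

∧-true : ∀ {a b} → a ∧ b ≡ true → a ≡ true × b ≡ true
∧-true {true} {true} _ = refl , refl

allBelow-sound : ∀ n p → allBelow n p ≡ true → ∀ i → i < n → p i ≡ true
allBelow-sound (suc n) p h i i≤n with i ℕP.≟ n
... | yes refl = proj₁ (∧-true h)
... | no  i≢n  = allBelow-sound n p (proj₂ (∧-true {p n} h)) i (ℕP.≤∧≢⇒< (ℕP.≤-pred i≤n) i≢n)

≟-sound : ∀ (a b : ℤ) → ⌊ a ℤ.≟ b ⌋ ≡ true → a ≡ b
≟-sound a b h with a ℤ.≟ b
... | yes p = p
≟-sound a b () | no _

-- `N₁` is the period in `a` and `b`, `N₂` that in `x` and `y`. The claim is that the relation `t`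
-- sums to a constant plus the Lambert series with coefficients `(α d + β e) · χ d e`; the table `G`
-- is the witness for Liouville's method.
module Certificate (N₁ N₂ : ℕ) .{{_ : NonZero N₁}} .{{_ : NonZero N₂}}
  (t : List Term) (G : ℕ → ℕ → ℕ → ℕ → ℤ) (α β : ℤ) (χ : ℕ → ℕ → ℤ) where

  F : ℕ → ℕ → ℕ → ℕ → ℤ
  F = quartic t

  ε : ℕ → ℕ → ℤ
  ε d e = (α * + d + β * + e) * χ d e

  -- `τ i j` is twice the defect of the claim at the divisor pair `(i + 1, j + 1)`. It is not
  -- periodic, but a shift by one period changes it by `δ₁` or `δ₂`, and these are. So `τ` vanishes
  -- everywhere once `τ`, `δ₁` and `δ₂` vanish on one box of residues.
  τ δ₁ δ₂ : ℕ → ℕ → ℤ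
  τ i j = + 2 * linear t (suc i) (suc j) + (conv (λ x y → G (suc i) (suc i) x y) (suc j) - conv (λ a b → G a b (suc j) (suc j)) (suc i)
        + + 2 * conv (λ a b → F a b (suc j) (suc j)) (suc i)) - + 2 * ε (suc i) (suc j)

  -- The `N` summands that a periodic `conv k` gains when its argument grows from `e + 1` to
  -- `e + 1 + N`; see `conv-step`.
  period : ℕ → (ℕ → ℕ → ℤ) → ℕ → ℤ
  period N k e = ∑ N (λ j → k (suc (e ℕ.+ j)) (N ∸ j))

  δ₁ i j = + 2 * period N₁ (λ a b → F a b (suc j) (suc j)) i - period N₁ (λ a b → G a b (suc j) (suc j)) i - + 2 * (α * + N₁ * χ (suc i) (suc j))
  δ₂ i j = period N₂ (λ x y → G (suc i) (suc i) x y) j - + 2 * (β * + N₂ * χ (suc i) (suc j))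

  check₄ check₂ : Bool
  check₄ = allBelow N₁ λ a → allBelow N₁ λ b → allBelow N₂ λ x → allBelow N₂ λ y →
    ⌊ F a b (x ℕ.+ y) y + F b a y (x ℕ.+ y) ℤ.≟ G a b (x ℕ.+ y) y - G a (a ℕ.+ b) x y ⌋ ∧ ⌊ G b a y x ℤ.≟ G a b x y ⌋
  check₂ = allBelow N₁ λ i → allBelow N₂ λ j → ⌊ τ i j ℤ.≟ + 0 ⌋ ∧ (⌊ δ₁ i j ℤ.≟ + 0 ⌋ ∧ ⌊ δ₂ i j ℤ.≟ + 0 ⌋)

  Periodic₄ : (ℕ → ℕ → ℕ → ℕ → ℤ) → Set
  Periodic₄ H = ∀ a b x y → H (a % N₁) (b % N₁) (x % N₂) (y % N₂) ≡ H a b x y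

  Periodic₂ : (ℕ → ℕ → ℤ) → Set
  Periodic₂ h = ∀ a x → h (a % N₁) (x % N₂) ≡ h a x

  PeriodicTerms : List Term → Set
  PeriodicTerms []                            = ℕ.zero ≡ 0
  PeriodicTerms ((c , (u , f) , (v , g)) ∷ t) = Periodic₂ f × Periodic₂ g × PeriodicTerms t

  module Sound (tₚ : PeriodicTerms t) (Gₚ : Periodic₄ G) (χₚ : Periodic₂ χ) (c₄ : check₄ ≡ true) (c₂ : check₂ ≡ true) where
    private
      Fₚ : Periodic₄ F
      Fₚ = go t tₚ
        where
        go : ∀ t → PeriodicTerms t → Periodic₄ (quartic t)
        go [] _ a b x y = refl
        go ((c , (u , f) , (v , g)) ∷ t) (p , q , r) a b x y = cong₂ _+_ (cong (c *_) (cong₂ _*_ (p a x) (q b y))) (go t r a b x y)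

      lₚ : Periodic₂ (linear t)
      lₚ = go t tₚ
        where
        go : ∀ t → PeriodicTerms t → Periodic₂ (linear t)
        go [] _ a x = refl
        go ((c , (u , f) , (v , g)) ∷ t) (p , q , r) a x = cong₂ _+_ (cong (c *_) (cong₂ _+_ (cong (u *_) (q a x)) (cong (v *_) (p a x)))) (go t r a x)

      cong₄ : ∀ {H} → Periodic₄ H → ∀ {a a′ b b′ x x′ y y′} → a % N₁ ≡ a′ % N₁ → b % N₁ ≡ b′ % N₁ → x % N₂ ≡ x′ % N₂ → y % N₂ ≡ y′ % N₂ → H a b x y ≡ H a′ b′ x′ y′
      cong₄ {H} p {a} {a′} {b} {b′} {x} {x′} {y} {y′} e₁ e₂ e₃ e₄ = trans (sym (p a b x y)) (trans (lemma e₁ e₂ e₃ e₄) (p a′ b′ x′ y′))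
        where
        lemma : ∀ {a a′ b b′ x x′ y y′} → a ≡ a′ → b ≡ b′ → x ≡ x′ → y ≡ y′ → H a b x y ≡ H a′ b′ x′ y′
        lemma refl refl refl refl = refl

      cong2 : ∀ {h} → Periodic₂ h → ∀ {a a′ x x′} → a % N₁ ≡ a′ % N₁ → x % N₂ ≡ x′ % N₂ → h a x ≡ h a′ x′
      cong2 {h} p {a} {a′} {x} {x′} e₁ e₂ = trans (sym (p a x)) (trans (cong₂ h e₁ e₂) (p a′ x′))

      %+ : ∀ N .{{_ : NonZero N}} a b → (a % N ℕ.+ b % N) % N ≡ (a ℕ.+ b) % N
      %+ N a b = sym (DM.%-distribˡ-+ a b N)

      %% : ∀ N .{{_ : NonZero N}} a → a % N % N ≡ a % N
      %% N a = DM.m%n%n≡m%n a N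

      +N : ∀ N .{{_ : NonZero N}} a → (a ℕ.+ N) % N ≡ a % N
      +N N a = DM.[m+n]%n≡m%n a N

      suc% : ∀ N .{{_ : NonZero N}} {a b} → a % N ≡ b % N → suc a % N ≡ suc b % N
      suc% N {a} {b} e = trans (DM.%-distribˡ-+ 1 a N) (trans (cong (λ z → (1 % N ℕ.+ z) % N) e) (sym (DM.%-distribˡ-+ 1 b N)))

      plus% : ∀ N .{{_ : NonZero N}} {a b} c → a % N ≡ b % N → (a ℕ.+ c) % N ≡ (b ℕ.+ c) % N
      plus% N {a} {b} c e = trans (DM.%-distribˡ-+ a c N) (trans (cong (λ z → (z ℕ.+ c % N) % N) e) (sym (DM.%-distribˡ-+ b c N)))

      finite₄ : ∀ a b x y → (F a b (x ℕ.+ y) y + F b a y (x ℕ.+ y) ≡ G a b (x ℕ.+ y) y - G a (a ℕ.+ b) x y) × (G b a y x ≡ G a b x y)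
      finite₄ a b x y = let
          h = allBelow-sound N₂ _ (allBelow-sound N₂ _ (allBelow-sound N₁ _ (allBelow-sound N₁ _ c₄ (a % N₁) (DM.m%n<n a N₁)) (b % N₁) (DM.m%n<n b N₁)) (x % N₂) (DM.m%n<n x N₂)) (y % N₂) (DM.m%n<n y N₂)
          h₁ = ≟-sound (F (a % N₁) (b % N₁) (x % N₂ ℕ.+ y % N₂) (y % N₂) + F (b % N₁) (a % N₁) (y % N₂) (x % N₂ ℕ.+ y % N₂))
                 (G (a % N₁) (b % N₁) (x % N₂ ℕ.+ y % N₂) (y % N₂) - G (a % N₁) (a % N₁ ℕ.+ b % N₁) (x % N₂) (y % N₂)) (proj₁ (∧-true h))
          h₂ = ≟-sound (G (b % N₁) (a % N₁) (y % N₂) (x % N₂)) (G (a % N₁) (b % N₁) (x % N₂) (y % N₂)) (proj₂ (∧-true h))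
        in trans (cong₂ _+_ (cong₄ {F} Fₚ (sym (%% N₁ a)) (sym (%% N₁ b)) (sym (%+ N₂ x y)) (sym (%% N₂ y))) (cong₄ {F} Fₚ (sym (%% N₁ b)) (sym (%% N₁ a)) (sym (%% N₂ y)) (sym (%+ N₂ x y))))
            (trans h₁ (cong₂ _-_ (cong₄ {G} Gₚ (%% N₁ a) (%% N₁ b) (%+ N₂ x y) (%% N₂ y)) (cong₄ {G} Gₚ (%% N₁ a) (%+ N₁ a b) (%% N₂ x) (%% N₂ y))))
         , trans (sym (Gₚ b a y x)) (trans h₂ (Gₚ a b x y))

      conv-cong : ∀ (k k′ : ℕ → ℕ → ℤ) d → (∀ a b → k a b ≡ k′ a b) → conv k d ≡ conv k′ d
      conv-cong k k′ d p = ∑-cong (d ∸ 1) λ i _ → p _ _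

      period-cong : ∀ N (k k′ : ℕ → ℕ → ℤ) e → (∀ a b → k a b ≡ k′ a b) → period N k e ≡ period N k′ e
      period-cong N k k′ e p = ∑-cong N λ i _ → p _ _

      conv-step : ∀ N .{{_ : NonZero N}} k → (∀ {a a′ b b′} → a % N ≡ a′ % N → b % N ≡ b′ % N → k a b ≡ k a′ b′) → ∀ e →
        conv k (suc (e ℕ.+ N)) ≡ conv k (suc e) + period N k e
      conv-step N k kₚ e = trans (∑-++ e N (λ i → k (suc i) (e ℕ.+ N ∸ i))) (cong₂ _+_
        (∑-cong e λ i i<e → kₚ refl (trans (cong (_% N) (trans (cong (_∸ i) (ℕP.+-comm e N)) (trans (ℕP.+-∸-assoc N (ℕP.<⇒≤ i<e)) (ℕP.+-comm N (e ∸ i))))) (+N N (e ∸ i))))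
        (∑-cong N λ j _ → cong (k (suc (e ℕ.+ j))) (ℕP.[m+n]∸[m+o]≡n∸o e N j)))

      period-% : ∀ N .{{_ : NonZero N}} k → (∀ {a a′ b b′} → a % N ≡ a′ % N → b % N ≡ b′ % N → k a b ≡ k a′ b′) → ∀ e e′ → e % N ≡ e′ % N →
        period N k e ≡ period N k e′
      period-% N k kₚ e e′ h = ∑-cong N λ j _ → kₚ (suc% N (plus% N j h)) refl

      Fe Ge : ℕ → ℕ → ℕ → ℤ
      Fe j a b = F a b (suc j) (suc j)
      Ge j a b = G a b (suc j) (suc j)
      Feₚ : ∀ j {a a′ b b′} → a % N₁ ≡ a′ % N₁ → b % N₁ ≡ b′ % N₁ → Fe j a b ≡ Fe j a′ b′
      Feₚ j e₁ e₂ = cong₄ {F} Fₚ e₁ e₂ refl refl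
      Geₚ : ∀ j {a a′ b b′} → a % N₁ ≡ a′ % N₁ → b % N₁ ≡ b′ % N₁ → Ge j a b ≡ Ge j a′ b′
      Geₚ j e₁ e₂ = cong₄ {G} Gₚ e₁ e₂ refl refl
      Gdₚ : ∀ d {x x′ y y′} → x % N₂ ≡ x′ % N₂ → y % N₂ ≡ y′ % N₂ → G d d x y ≡ G d d x′ y′
      Gdₚ d e₁ e₂ = cong₄ {G} Gₚ refl refl e₁ e₂

      Fe-% : ∀ {j j′} → suc j % N₂ ≡ suc j′ % N₂ → ∀ a b → Fe j a b ≡ Fe j′ a b
      Fe-% h a b = cong₄ {F} Fₚ {a} {a} {b} {b} refl refl h h
      Ge-% : ∀ {j j′} → suc j % N₂ ≡ suc j′ % N₂ → ∀ a b → Ge j a b ≡ Ge j′ a b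
      Ge-% h a b = cong₄ {G} Gₚ {a} {a} {b} {b} refl refl h h
      Gd-% : ∀ {d d′} → d % N₁ ≡ d′ % N₁ → ∀ x y → G d d x y ≡ G d′ d′ x y
      Gd-% h x y = cong₄ {G} Gₚ {_} {_} {_} {_} {x} {x} {y} {y} h h refl refl

      finite₂ : ∀ i j → i < N₁ → j < N₂ → τ i j ≡ + 0 × δ₁ i j ≡ + 0 × δ₂ i j ≡ + 0
      finite₂ i j i< j< = let h = ∧-true {⌊ τ i j ℤ.≟ + 0 ⌋} (allBelow-sound N₂ _ (allBelow-sound N₁ _ c₂ i i<) j j<) ; h′ = ∧-true {⌊ δ₁ i j ℤ.≟ + 0 ⌋} (proj₂ h) in
        ≟-sound (τ i j) _ (proj₁ h) , ≟-sound (δ₁ i j) _ (proj₁ h′) , ≟-sound (δ₂ i j) _ (proj₂ h′)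

      δ₁-0 : ∀ i j → δ₁ i j ≡ + 0
      δ₁-0 i j = trans (cong₂ _-_ (cong₂ _-_ (cong (+ 2 *_) (trans (period-% N₁ (Fe j) (Feₚ j) i (i % N₁) (sym (%% N₁ i)))
            (period-cong N₁ (Fe j) (Fe (j % N₂)) (i % N₁) (Fe-% j≡))))
          (trans (period-% N₁ (Ge j) (Geₚ j) i (i % N₁) (sym (%% N₁ i))) (period-cong N₁ (Ge j) (Ge (j % N₂)) (i % N₁) (Ge-% j≡))))
          (cong (λ z → + 2 * (α * + N₁ * z)) (cong2 {χ} χₚ {suc i} {suc (i % N₁)} {suc j} {suc (j % N₂)} (suc% N₁ (sym (%% N₁ i))) j≡)))
        (proj₁ (proj₂ (finite₂ (i % N₁) (j % N₂) (DM.m%n<n i N₁) (DM.m%n<n j N₂))))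
        where
        j≡ : suc j % N₂ ≡ suc (j % N₂) % N₂
        j≡ = suc% N₂ (sym (%% N₂ j))

      δ₂-0 : ∀ i j → δ₂ i j ≡ + 0
      δ₂-0 i j = trans (cong₂ _-_ (trans (period-% N₂ (G (suc i) (suc i)) (Gdₚ (suc i)) j (j % N₂) (sym (%% N₂ j))) (period-cong N₂ (G (suc i) (suc i)) (G (suc (i % N₁)) (suc (i % N₁))) (j % N₂) (Gd-% i≡)))
          (cong (λ z → + 2 * (β * + N₂ * z)) (cong2 {χ} χₚ {suc i} {suc (i % N₁)} {suc j} {suc (j % N₂)} i≡ (suc% N₂ (sym (%% N₂ j))))))
        (proj₂ (proj₂ (finite₂ (i % N₁) (j % N₂) (DM.m%n<n i N₁) (DM.m%n<n j N₂))))
        where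
        i≡ : suc i % N₁ ≡ suc (i % N₁) % N₁
        i≡ = suc% N₁ (sym (%% N₁ i))

      τ-step₁ : ∀ i j → τ (i ℕ.+ N₁) j ≡ τ i j + δ₁ i j
      τ-step₁ i j = trans (cong₂ (λ u v → + 2 * linear t (suc (i ℕ.+ N₁)) (suc j) + u - + 2 * v) (cong₂ (λ u v → u + + 2 * v) (cong₂ _-_ (conv-cong (G (suc (i ℕ.+ N₁)) (suc (i ℕ.+ N₁))) (G (suc i) (suc i)) (suc j) (Gd-% i≡)) (conv-step N₁ (Ge j) (Geₚ j) i)) (conv-step N₁ (Fe j) (Feₚ j) i))
            (cong (λ z → (α * + suc (i ℕ.+ N₁) + β * + suc j) * z) (cong2 {χ} χₚ {suc (i ℕ.+ N₁)} {suc i} {suc j} {suc j} i≡ refl)))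
        (trans (cong (λ z → + 2 * z + (conv (G (suc i) (suc i)) (suc j) - (conv (Ge j) (suc i) + period N₁ (Ge j) i) + + 2 * (conv (Fe j) (suc i) + period N₁ (Fe j) i)) - + 2 * ((α * + suc (i ℕ.+ N₁) + β * + suc j) * χ (suc i) (suc j))) (cong2 {linear t} lₚ {suc (i ℕ.+ N₁)} {suc i} {suc j} {suc j} i≡ refl))
        (lemma (linear t (suc i) (suc j)) (conv (G (suc i) (suc i)) (suc j)) (conv (Ge j) (suc i)) (period N₁ (Ge j) i) (conv (Fe j) (suc i)) (period N₁ (Fe j) i) α (+ suc i) (+ N₁) (β * + suc j) (χ (suc i) (suc j))))
        where
        i≡ : suc (i ℕ.+ N₁) % N₁ ≡ suc i % N₁
        i≡ = suc% N₁ (+N N₁ i)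
        lemma : ∀ l g c p f r α d N b χ → + 2 * l + (g - (c + p) + + 2 * (f + r)) - + 2 * ((α * (d + N) + b) * χ)
              ≡ + 2 * l + (g - c + + 2 * f) - + 2 * ((α * d + b) * χ) + (+ 2 * r - p - + 2 * (α * N * χ))
        lemma = solve-∀

      τ-step₂ : ∀ i j → τ i (j ℕ.+ N₂) ≡ τ i j + δ₂ i j
      τ-step₂ i j = trans (cong₂ (λ u v → + 2 * linear t (suc i) (suc (j ℕ.+ N₂)) + u - + 2 * v) (cong₂ (λ u v → u + + 2 * v) (cong₂ _-_ (conv-step N₂ (G (suc i) (suc i)) (Gdₚ (suc i)) j) (conv-cong (Ge (j ℕ.+ N₂)) (Ge j) (suc i) (Ge-% j≡))) (conv-cong (Fe (j ℕ.+ N₂)) (Fe j) (suc i) (Fe-% j≡)))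
            (cong (λ z → (α * + suc i + β * + suc (j ℕ.+ N₂)) * z) (cong2 {χ} χₚ {suc i} {suc i} {suc (j ℕ.+ N₂)} {suc j} refl j≡)))
        (trans (cong (λ z → + 2 * z + ((conv (G (suc i) (suc i)) (suc j) + period N₂ (G (suc i) (suc i)) j) - conv (Ge j) (suc i) + + 2 * conv (Fe j) (suc i)) - + 2 * ((α * + suc i + β * + suc (j ℕ.+ N₂)) * χ (suc i) (suc j))) (cong2 {linear t} lₚ {suc i} {suc i} {suc (j ℕ.+ N₂)} {suc j} refl j≡))
        (lemma (linear t (suc i) (suc j)) (conv (G (suc i) (suc i)) (suc j)) (period N₂ (G (suc i) (suc i)) j) (conv (Ge j) (suc i)) (conv (Fe j) (suc i)) (α * + suc i) β (+ suc j) (+ N₂) (χ (suc i) (suc j))))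
        where
        j≡ : suc (j ℕ.+ N₂) % N₂ ≡ suc j % N₂
        j≡ = suc% N₂ (+N N₂ j)
        lemma : ∀ l g p c f a β e N χ → + 2 * l + ((g + p) - c + + 2 * f) - + 2 * ((a + β * (e + N)) * χ)
              ≡ + 2 * l + (g - c + + 2 * f) - + 2 * ((a + β * e) * χ) + (p - + 2 * (β * N * χ))
        lemma = solve-∀

      shrink : ∀ N .{{_ : NonZero N}} i → ¬ (i < N) → i ≡ (i ∸ N) ℕ.+ N × i ∸ N < i
      shrink N@(suc n) i i≮N = sym (ℕP.m∸n+n≡m (ℕP.≮⇒≥ i≮N)) , ℕP.∸-monoʳ-< {i} {N} {0} (s≤s z≤n) (ℕP.≮⇒≥ i≮N)

      -- Descent by one period at a time into the box covered by `finite₂`; `m` bounds `i + j`.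
      τ-0 : ∀ m i j → i ℕ.+ j < m → τ i j ≡ + 0
      τ-0 (suc m) i j (s≤s h) with i ℕP.<? N₁ | j ℕP.<? N₂
      ... | yes i< | yes j< = proj₁ (finite₂ i j i< j<)
      ... | no i≮ | _ = let (e , lt) = shrink N₁ i i≮ in trans (cong (λ z → τ z j) e) (trans (τ-step₁ (i ∸ N₁) j)
              (cong₂ _+_ (τ-0 m (i ∸ N₁) j (ℕP.<-≤-trans (ℕP.+-monoˡ-< j lt) h)) (δ₁-0 (i ∸ N₁) j)))
      ... | yes _ | no j≮ = let (e , lt) = shrink N₂ j j≮ in trans (cong (τ i) e) (trans (τ-step₂ i (j ∸ N₂))
              (cong₂ _+_ (τ-0 m i (j ∸ N₂) (ℕP.<-≤-trans (ℕP.+-monoʳ-< i lt) h)) (δ₂-0 i (j ∸ N₂))))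

    open Liouville F G (λ a b x y → proj₂ (finite₄ a b x y)) (λ a b x y → proj₁ (finite₄ a b x y))

    -- The comparison is made after doubling, since `liouville` evaluates `2 · S[ F ]`; the
    -- vanishing of `τ` is then the equality of the coefficients.
    certified : total t ≈ con (constant t) ⊕ Λ ε
    certified = S.trans (total-expand t) (⊕-cong S.refl (pw λ n → trans (⊕-at _ _ n) (ℤP.*-cancelˡ-≡ (+ 2) _ _ (begin
      + 2 * (Λ (linear t) n + S[ F ] n)
        ≡⟨ ℤP.*-distribˡ-+ (+ 2) (Λ (linear t) n) (S[ F ] n) ⟩
      + 2 * Λ (linear t) n + + 2 * S[ F ] n
        ≡⟨ cong₂ _+_ (scale n (linear t)) (liouville n) ⟩
      ∑₁ n (λ d → ∑₁ n (λ e → δ (d ℕ.* e) n * (+ 2 * linear t d e))) + ∑₁ n (λ d → ∑₁ n (λ e → δ (d ℕ.* e) n * R d e))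
        ≡⟨ trans (sym (∑₁-+ n (λ d → ∑₁ n (λ e → δ (d ℕ.* e) n * (+ 2 * linear t d e))) (λ d → ∑₁ n (λ e → δ (d ℕ.* e) n * R d e))))
             (∑₁-cong n λ d _ → sym (∑₁-+ n (λ e → δ (d ℕ.* e) n * (+ 2 * linear t d e)) (λ e → δ (d ℕ.* e) n * R d e))) ⟩
      ∑₁ n (λ d → ∑₁ n (λ e → δ (d ℕ.* e) n * (+ 2 * linear t d e) + δ (d ℕ.* e) n * R d e))
        ≡⟨ ∑₁-cong n (λ { (suc i) _ → ∑₁-cong n λ { (suc j) _ → trans (sym (ℤP.*-distribˡ-+ (δ (suc i ℕ.* suc j) n) _ _))
             (cong (δ (suc i ℕ.* suc j) n *_) (lemma (+ 2 * linear t (suc i) (suc j) + R (suc i) (suc j)) (+ 2 * ε (suc i) (suc j)) (τ-0 (suc (i ℕ.+ j)) i j ℕP.≤-refl))) } }) ⟩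
      ∑₁ n (λ d → ∑₁ n (λ e → δ (d ℕ.* e) n * (+ 2 * ε d e)))
        ≡⟨ sym (scale n ε) ⟩
      + 2 * Λ ε n ∎))))
      where
      open ≡-Reasoning
      R : ℕ → ℕ → ℤ
      R d e = conv (λ x y → G d d x y) e - conv (λ a b → G a b e e) d + + 2 * conv (λ a b → F a b e e) d
      lemma : ∀ a b → a - b ≡ + 0 → a ≡ b
      lemma a b h = trans (l a b) (trans (cong (_+ b) h) (ℤP.+-identityˡ b))
        where
        l : ∀ a b → a ≡ a - b + b
        l = solve-∀
      scale : ∀ n (f : ℕ → ℕ → ℤ) → + 2 * Λ f n ≡ ∑₁ n (λ d → ∑₁ n (λ e → δ (d ℕ.* e) n * (+ 2 * f d e)))
      scale n f = trans (sym (∑₁-*ˡ n (+ 2) _)) (∑₁-cong n λ d _ → trans (sym (∑₁-*ˡ n (+ 2) _)) (∑₁-cong n λ e _ → move (δ (d ℕ.* e) n) (f d e)))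
        where
        move : ∀ d f → + 2 * (d * f) ≡ d * (+ 2 * f)
        move = solve-∀

-- Characters and the certificates for the quadratic relations

χ₋₄ χ₋₈ χ₋₂₀ χ₋₄₀ 𝟙 odd : ℕ → ℤ
χ₋₄ m = t (m % 4)
  where
  t : ℕ → ℤ
  t 1 = + 1
  t 3 = - (+ 1)
  t _ = + 0
χ₋₈ m = t (m % 8)
  where
  t : ℕ → ℤ
  t 1 = + 1
  t 3 = + 1
  t 5 = - (+ 1)
  t 7 = - (+ 1)
  t _ = + 0
χ₋₂₀ m = χ₋₄ m * χ₁ m
χ₋₄₀ m = χ₋₈ m * χ₁ m
𝟙 _ = + 1
odd m = + (m % 2)

-- Moves `α` to the multiples of `k`. In a Lambert series this amounts to replacing `q` by `qᵏ`,
-- whichever of the two variables carries it (`factor-Dˡ`, `factor-Dʳ`); the certificates choose the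
-- variable so as to keep the periods small.
D : ℕ → (ℕ → ℤ) → ℕ → ℤ
D zero    α a = + 0
D (suc k) α a = if a % suc k ℕ.≡ᵇ 0 then α (a / suc k) else + 0

factor : ℤ → ℤ → (ℕ → ℤ) → (ℕ → ℤ) → Factor
factor u c α β = u , λ a x → c * (α a * β x)

Periodic : (N : ℕ) .{{_ : NonZero N}} → (ℕ → ℤ) → Set
Periodic N α = ∀ a → α (a % N) ≡ α a

χ₋₄-periodic : ∀ N .{{_ : NonZero N}} → 4 ∣ N → Periodic N χ₋₄
χ₋₄-periodic N 4∣N a rewrite DM.m∣n⇒o%n%m≡o%m 4 N a 4∣N = refl

χ₋₈-periodic : ∀ N .{{_ : NonZero N}} → 8 ∣ N → Periodic N χ₋₈
χ₋₈-periodic N 8∣N a rewrite DM.m∣n⇒o%n%m≡o%m 8 N a 8∣N = refl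

χ₁-cong : ∀ m n → m % 5 ≡ n % 5 → χ₁ m ≡ χ₁ n
χ₁-cong m n e with m % 5 | n % 5 | e
... | 0 | _ | refl = refl
... | 1 | _ | refl = refl
... | 2 | _ | refl = refl
... | 3 | _ | refl = refl
... | 4 | _ | refl = refl
... | suc (suc (suc (suc (suc _)))) | _ | refl = refl

χ₂-cong : ∀ m n → m % 8 ≡ n % 8 → χ₂ m ≡ χ₂ n
χ₂-cong m n e with m % 8 | n % 8 | e
... | 0 | _ | refl = refl
... | 1 | _ | refl = refl
... | 2 | _ | refl = refl
... | 3 | _ | refl = refl
... | 4 | _ | refl = refl
... | 5 | _ | refl = refl
... | 6 | _ | refl = refl
... | 7 | _ | refl = refl
... | suc (suc (suc (suc (suc (suc (suc (suc _))))))) | _ | refl = refl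

χ₁-periodic : ∀ N .{{_ : NonZero N}} → 5 ∣ N → Periodic N χ₁
χ₁-periodic N 5∣N a = χ₁-cong (a % N) a (DM.m∣n⇒o%n%m≡o%m 5 N a 5∣N)

χ₂-periodic : ∀ N .{{_ : NonZero N}} → 8 ∣ N → Periodic N χ₂
χ₂-periodic N 8∣N a = χ₂-cong (a % N) a (DM.m∣n⇒o%n%m≡o%m 8 N a 8∣N)

χ₋₂₀-periodic : ∀ N .{{_ : NonZero N}} → 20 ∣ N → Periodic N χ₋₂₀
χ₋₂₀-periodic N 20∣N a = cong₂ _*_ (χ₋₄-periodic N (∣P.∣-trans (divides 5 refl) 20∣N) a) (χ₁-periodic N (∣P.∣-trans (divides 4 refl) 20∣N) a)

χ₋₄₀-periodic : Periodic 40 χ₋₄₀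
χ₋₄₀-periodic a = cong₂ _*_ (χ₋₈-periodic 40 (divides 5 refl) a) (χ₁-periodic 40 (divides 8 refl) a)

𝟙-periodic : ∀ N .{{_ : NonZero N}} → Periodic N 𝟙
𝟙-periodic N a = refl

odd-periodic : Periodic 2 odd
odd-periodic a = cong +_ (DM.m%n%n≡m%n a 2)

D-periodic : ∀ k N .{{_ : NonZero N}} .{{_ : NonZero (N ℕ.* suc k)}} {α} → Periodic N α → Periodic (N ℕ.* suc k) (D (suc k) α)
D-periodic k N {α} p a rewrite DM.m∣n⇒o%n%m≡o%m (suc k) (N ℕ.* suc k) a (divides N refl) with a % suc k ℕ.≡ᵇ 0
... | true  = trans (cong α (DM.m%[n*o]/o≡m/o%n a N (suc k) {{_}} {{_}} {{ℕP.m*n≢0 N (suc k)}})) (p (a / suc k))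
... | false = refl

factor-periodic : ∀ N₁ N₂ .{{_ : NonZero N₁}} .{{_ : NonZero N₂}} u c {α β} → Periodic N₁ α → Periodic N₂ β →
  ∀ a x → proj₂ (factor u c α β) (a % N₁) (x % N₂) ≡ proj₂ (factor u c α β) a x
factor-periodic N₁ N₂ u c p q a x = cong (c *_) (cong₂ _*_ (p a) (q x))

nth : List ℕ → ℕ → ℕ
nth []       _       = 0
nth (r ∷ rs) zero    = r
nth (r ∷ rs) (suc i) = nth rs i

-- The function G of a certificate is stored as a symmetric matrix whose rows and columns are indexed by the
-- residues (a , x) and (b , y): the decimal digit d stands for the value u (d - 3).
digit : ℕ → ℕ → ℕ
digit zero    r = r % 10
digit (suc i) r = digit i (r / 10)

residue : (N₁ N₂ : ℕ) .{{_ : NonZero N₁}} .{{_ : NonZero N₂}} → ℕ → ℕ → ℕ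
residue N₁ N₂ a x = a % N₁ ℕ.* N₂ ℕ.+ x % N₂

fromTable : (N₁ N₂ : ℕ) .{{_ : NonZero N₁}} .{{_ : NonZero N₂}} → ℤ → List ℕ → ℕ → ℕ → ℕ → ℕ → ℤ
fromTable N₁ N₂ u rows a b x y = u * (+ digit (N₁ ℕ.* N₂ ∸ suc (residue N₁ N₂ b y)) (nth rows (residue N₁ N₂ a x)) - + 3)

fromTable-periodic : ∀ N₁ N₂ .{{_ : NonZero N₁}} .{{_ : NonZero N₂}} u rows a b x y →
  fromTable N₁ N₂ u rows (a % N₁) (b % N₁) (x % N₂) (y % N₂) ≡ fromTable N₁ N₂ u rows a b x y
fromTable-periodic N₁ N₂ u rows a b x y = cong₂ (λ r c → u * (+ digit (N₁ ℕ.* N₂ ∸ suc c) (nth rows r) - + 3)) (stable a x) (stable b y)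
  where
  stable : ∀ a x → residue N₁ N₂ (a % N₁) (x % N₂) ≡ residue N₁ N₂ a x
  stable a x = cong₂ (λ u v → u ℕ.* N₂ ℕ.+ v) (DM.m%n%n≡m%n a N₁) (DM.m%n%n≡m%n x N₂)

∑₁-multiples : ∀ j (g : ℕ → ℤ) m → ∑₁ (m ℕ.* suc j) (λ a → if a % suc j ℕ.≡ᵇ 0 then g (a / suc j) else + 0) ≡ ∑₁ m g
∑₁-multiples j g m = trans (∑₁-def _ _) (trans (go m) (sym (∑₁-def m g)))
  where
  k : ℕ
  k = suc j
  h : ℕ → ℤ
  h a = if a % suc j ℕ.≡ᵇ 0 then g (a / suc j) else + 0
  below : ∀ m i → i < j → h (suc (m ℕ.* k ℕ.+ i)) ≡ + 0
  below m i i<j = cong (λ r → if r ℕ.≡ᵇ 0 then g (suc (m ℕ.* k ℕ.+ i) / suc j) else + 0)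
    (trans (cong (_% suc j) (trans (sym (ℕP.+-suc (m ℕ.* k) i)) (ℕP.+-comm (m ℕ.* k) (suc i)))) (trans (DM.[m+kn]%n≡m%n (suc i) m (suc j)) (DM.m<n⇒m%n≡m (s≤s i<j))))
  last : ∀ m → h (suc (m ℕ.* k ℕ.+ j)) ≡ g (suc m)
  last m = trans (cong h (trans (sym (ℕP.+-suc (m ℕ.* k) j)) (ℕP.+-comm (m ℕ.* k) k)))
    (trans (cong (λ r → if r ℕ.≡ᵇ 0 then g (suc m ℕ.* suc j / suc j) else + 0) (DM.m*n%n≡0 (suc m) (suc j))) (cong g (DM.m*n/n≡m (suc m) (suc j))))
  go : ∀ m → ∑ (m ℕ.* k) (λ i → h (suc i)) ≡ ∑ m (λ i → g (suc i))
  go zero    = refl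
  go (suc m) = trans (cong (λ z → ∑ z (λ i → h (suc i))) (ℕP.+-comm k (m ℕ.* k))) (trans (∑-++ (m ℕ.* k) k (λ i → h (suc i)))
    (cong₂ _+_ (go m) (trans (cong₂ _+_ (∑-0 j λ i i<j → below m i i<j) (last m)) (ℤP.+-identityˡ _))))

Λ-flip : ∀ f → Λ (λ a x → f x a) ≈ Λ f
Λ-flip f = pw λ n → trans (∑₁-swap n n (λ a x → δ (a ℕ.* x) n * f x a)) (∑₁-cong n λ a _ → ∑₁-cong n λ x _ → cong (λ z → δ z n * f a x) (ℕP.*-comm x a))

Λ-multiples : ∀ j f → Λ (λ a x → if a % suc j ℕ.≡ᵇ 0 then f (a / suc j) x else + 0) ≈ dil (suc j) (Λ f)
Λ-multiples j f = pw go
  where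
  k : ℕ
  k = suc j
  f′ : ℕ → ℕ → ℤ
  f′ a x = if a % suc j ℕ.≡ᵇ 0 then f (a / suc j) x else + 0
  inner : ∀ m a → ∑₁ (m ℕ.* k) (λ x → δ (a ℕ.* x) (m ℕ.* k) * f′ a x)
        ≡ (if a % suc j ℕ.≡ᵇ 0 then ∑₁ (m ℕ.* k) (λ x → δ (a / suc j ℕ.* x) m * f (a / suc j) x) else + 0)
  inner m a with a % suc j in e
  ... | zero  = ∑₁-cong (m ℕ.* k) λ x _ → cong (_* f (a / suc j) x) (trans (cong (λ z → δ z (m ℕ.* k)) (trans (cong (ℕ._* x) (a≡ e)) (swap (a / suc j) k x)))
          (δ-injective (ℕ._* k) (ℕP.*-cancelʳ-≡ _ _ k) (a / suc j ℕ.* x) m))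
    where
    a≡ : a % suc j ≡ 0 → a ≡ a / suc j ℕ.* k
    a≡ e = trans (DM.m≡m%n+[m/n]*n a (suc j)) (cong (ℕ._+ a / suc j ℕ.* k) e)
    swap : ∀ a k x → a ℕ.* k ℕ.* x ≡ a ℕ.* x ℕ.* k
    swap a k x = trans (ℕP.*-assoc a k x) (trans (cong (a ℕ.*_) (ℕP.*-comm k x)) (sym (ℕP.*-assoc a x k)))
  ... | suc r = ∑₁-0 (m ℕ.* k) λ x _ → ℤP.*-zeroʳ (δ (a ℕ.* x) (m ℕ.* k))
  none : ∀ n → ¬ (k ∣ n) → ∀ a x → δ (a ℕ.* x) n * f′ a x ≡ + 0
  none n k∤n a x with a % suc j in e
  ... | zero  = cong (_* f (a / suc j) x) (δ-≢ λ h → k∤n (subst (k ∣_) h (∣P.∣m⇒∣m*n x (∣P.m%n≡0⇒n∣m a (suc j) e))))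
  ... | suc r = ℤP.*-zeroʳ (δ (a ℕ.* x) n)
  go : ∀ n → Λ f′ n ≡ dil k (Λ f) n
  go n with k ∣? n
  ... | no k∤n = trans (∑₁-0 n λ a _ → ∑₁-0 n λ x _ → none n k∤n a x) (sym (dil-∤ j (Λ f) n k∤n))
  ... | yes (divides m refl) = trans (∑₁-cong (m ℕ.* k) λ a _ → inner m a) (trans (∑₁-multiples j (λ a → ∑₁ (m ℕ.* k) (λ x → δ (a ℕ.* x) m * f a x)) m)
        (trans (∑₁-cong m λ { (suc a) _ → ∑₁-extend _ (ℕP.m≤m*n m k) λ x m<x → cong (_* f (suc a) x) (δ-≢ (ℕP.>⇒≢ (ℕP.<-≤-trans m<x (ℕP.m≤n*m x (suc a))))) }) (sym (dil-* j (Λ f) m))))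

if-* : ∀ (b : Bool) (c z y : ℤ) → c * ((if b then z else + 0) * y) ≡ (if b then c * (z * y) else + 0)
if-* true  c z y = refl
if-* false c z y = ℤP.*-zeroʳ c

factor-Dˡ : ∀ j u c α β → ⟪ factor u c (D (suc j) α) β ⟫ ≈ dil (suc j) ⟪ factor u c α β ⟫
factor-Dˡ j u c α β = S.sym (S.trans (dil-⊕ (suc j) _ _) (⊕-cong (dil-con (suc j) u)
  (S.trans (S.sym (Λ-multiples j (λ a x → c * (α a * β x)))) (Λ-cong λ a x _ _ → sym (if-* (a % suc j ℕ.≡ᵇ 0) c (α (a / suc j)) (β x))))))

factor-flip : ∀ u c α β → ⟪ factor u c α β ⟫ ≈ ⟪ factor u c β α ⟫
factor-flip u c α β = ⊕-cong S.refl (S.trans (S.sym (Λ-flip _)) (Λ-cong λ a x _ _ → cong (c *_) (ℤP.*-comm (α x) (β a))))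

factor-Dʳ : ∀ j u c α β → ⟪ factor u c α (D (suc j) β) ⟫ ≈ dil (suc j) ⟪ factor u c α β ⟫
factor-Dʳ j u c α β = S.trans (factor-flip u c α (D (suc j) β)) (S.trans (factor-Dˡ j u c β α) (dil-cong (suc j) (factor-flip u c β α)))

-- All characters and dilations are put on the first variable, so that the second has period 1 and
-- the tables are indexed by residues modulo 40.
module Mod40 where
  private
    a₁ a₂ a₅ a₁₀ l₁ l₅ X X₂₀ X₄₀ : Factor
    a₁ = factor (+ 1) (+ 4) χ₋₄ 𝟙
    a₂ = factor (+ 1) (+ 4) (D 2 χ₋₄) 𝟙
    a₅ = factor (+ 1) (+ 4) (D 5 χ₋₄) 𝟙
    a₁₀ = factor (+ 1) (+ 4) (D 10 χ₋₄) 𝟙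
    l₁ = factor (+ 1) (+ 2) χ₋₈ 𝟙
    l₅ = factor (+ 1) (+ 2) (D 5 χ₋₈) 𝟙
    X = factor (+ 1) (+ 1) χ₋₄₀ 𝟙
    X₂₀ = factor (+ 1) (+ 1) χ₋₂₀ 𝟙
    X₄₀ = factor (+ 1) (+ 1) (D 2 χ₋₂₀) 𝟙

    a₁ₚ : ∀ a x → proj₂ a₁ (a % 40) (x % 1) ≡ proj₂ a₁ a x
    a₁ₚ = factor-periodic 40 1 (+ 1) (+ 4) (χ₋₄-periodic 40 (divides 10 refl)) (𝟙-periodic 1)
    a₂ₚ : ∀ a x → proj₂ a₂ (a % 40) (x % 1) ≡ proj₂ a₂ a x
    a₂ₚ = factor-periodic 40 1 (+ 1) (+ 4) (D-periodic 1 20 (χ₋₄-periodic 20 (divides 5 refl))) (𝟙-periodic 1)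
    a₅ₚ : ∀ a x → proj₂ a₅ (a % 40) (x % 1) ≡ proj₂ a₅ a x
    a₅ₚ = factor-periodic 40 1 (+ 1) (+ 4) (D-periodic 4 8 (χ₋₄-periodic 8 (divides 2 refl))) (𝟙-periodic 1)
    a₁₀ₚ : ∀ a x → proj₂ a₁₀ (a % 40) (x % 1) ≡ proj₂ a₁₀ a x
    a₁₀ₚ = factor-periodic 40 1 (+ 1) (+ 4) (D-periodic 9 4 (χ₋₄-periodic 4 (divides 1 refl))) (𝟙-periodic 1)
    l₁ₚ : ∀ a x → proj₂ l₁ (a % 40) (x % 1) ≡ proj₂ l₁ a x
    l₁ₚ = factor-periodic 40 1 (+ 1) (+ 2) (χ₋₈-periodic 40 (divides 5 refl)) (𝟙-periodic 1)
    l₅ₚ : ∀ a x → proj₂ l₅ (a % 40) (x % 1) ≡ proj₂ l₅ a x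
    l₅ₚ = factor-periodic 40 1 (+ 1) (+ 2) (D-periodic 4 8 (χ₋₈-periodic 8 (divides 1 refl))) (𝟙-periodic 1)
    Xₚ : ∀ a x → proj₂ X (a % 40) (x % 1) ≡ proj₂ X a x
    Xₚ = factor-periodic 40 1 (+ 1) (+ 1) χ₋₄₀-periodic (𝟙-periodic 1)
    X₂₀ₚ : ∀ a x → proj₂ X₂₀ (a % 40) (x % 1) ≡ proj₂ X₂₀ a x
    X₂₀ₚ = factor-periodic 40 1 (+ 1) (+ 1) (χ₋₂₀-periodic 40 (divides 2 refl)) (𝟙-periodic 1)
    X₄₀ₚ : ∀ a x → proj₂ X₄₀ (a % 40) (x % 1) ≡ proj₂ X₄₀ a x
    X₄₀ₚ = factor-periodic 40 1 (+ 1) (+ 1) (D-periodic 1 20 (χ₋₂₀-periodic 20 (divides 1 refl))) (𝟙-periodic 1)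
    χ₃ₚ : ∀ a → χ₃ (a % 40) ≡ χ₃ a
    χ₃ₚ a = cong₂ _*_ (χ₂-periodic 40 (divides 5 refl) a) (χ₁-periodic 40 (divides 8 refl) a)

  E₀₃-table : List ℕ
  E₀₃-table = 3333333333333333333333333333333333333333
    ∷ 3312335444233321222333322212333244453321
    ∷ 3132313132333435353435343535343332313132
    ∷ 3223311322323223435434434534322323223113
    ∷ 3333333333333333333333333333333333333333
    ∷ 3311335123353253431534114351343523533215
    ∷ 3531353432353331343231353132343133353234
    ∷ 3413314342333354244334522543344245333324
    ∷ 3432323434323234343232343432323434323234
    ∷ 3422332243233351241333242242333142153332
    ∷ 3233333332333233343334333333343334333233
    ∷ 3332355323333423444234534114354324443243
    ∷ 3333333333333333333333333333333333333333
    ∷ 3342323323243325431232234311343223213452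
    ∷ 3232353535323231333534343131313434353331
    ∷ 3153331441333513255331542313313245133552
    ∷ 3234343232343432323434323234343232343432
    ∷ 3253334444443335232433152443333442513342
    ∷ 3235313431343135323334313532353235313433
    ∷ 3344352323323253443335434142344324143453
    ∷ 3333333333333333333333333333333333333333
    ∷ 3354341423443241434533344352323323253443
    ∷ 3334313532353235313433323531343134313532
    ∷ 3243315244333344251334232533344444433352
    ∷ 3234343232343432323434323234343232343432
    ∷ 3255331542313313245133552315333144133351
    ∷ 3133353434313131343435333132323535353232
    ∷ 3254312322343113432232134523342323323243
    ∷ 3333333333333333333333333333333333333333
    ∷ 3342344423453411435432444324333323553233
    ∷ 3332333433343333333433343332333233333332
    ∷ 3233351241333242242333142153332342233224
    ∷ 3432323434323234343232343432323434323234
    ∷ 3423333542443345225433442453333243413314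
    ∷ 3432353331343231353132343133353234353135
    ∷ 3512335325343153411435134352353321533113
    ∷ 3333333333333333333333333333333333333333
    ∷ 3311322323223435434434534322323223113322
    ∷ 3231313233343535343534353534333231313231
    ∷ 3123354442333212223333222123332444533213 ∷ []

  -- The constant terms sum to `3 - 4 - 5 + 2 - 10 = -14`, the value of the L-function of `χ₃` at
  -- -1, next to the coefficients `2 d χ₃(d)`.
  E₀₃-terms : List Term
  E₀₃-terms = (+ 3 , a₁ , X) ∷ (- (+ 4) , a₂ , X) ∷ (- (+ 5) , a₅ , X) ∷ (+ 2 , l₁ , X₂₀) ∷ (- (+ 10) , l₅ , X₂₀) ∷ []

  private module C-E₀₃ = Certificate 40 1 E₀₃-terms (fromTable 40 1 (+ 16) E₀₃-table) (+ 2) (+ 0) (λ d _ → χ₃ d)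

  E₀₃-identity : total E₀₃-terms ≈ con (constant E₀₃-terms) ⊕ Λ C-E₀₃.ε
  E₀₃-identity = C-E₀₃.Sound.certified (a₁ₚ , Xₚ , a₂ₚ , Xₚ , a₅ₚ , Xₚ , l₁ₚ , X₂₀ₚ , l₅ₚ , X₂₀ₚ , refl) (fromTable-periodic 40 1 (+ 16) E₀₃-table) (λ d _ → χ₃ₚ d) refl refl

  E₃₀-table : List ℕ
  E₃₀-table = 3434333234323433323232323334323432333434
    ∷ 4433333333233333333333333333333233333333
    ∷ 3333333333333333333333333333333333333333
    ∷ 4334333333333233333333333333332333333333
    ∷ 3333333333333333333333333333333333333333
    ∷ 3333333333333333333333333333333333333333
    ∷ 3333333333333333333333333333333333333333
    ∷ 2333333233333333343333333333334333333333
    ∷ 3333333333333333333333333333333333333333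
    ∷ 4333333334233333333333333333333333333332
    ∷ 3233333332333233343334333333343334333233
    ∷ 2333333333323333333334333333334333333333
    ∷ 3333333333333333333333333333333333333333
    ∷ 4332333333233433333333333333333333333333
    ∷ 3333333333333333333333333333333333333333
    ∷ 3333333333333333333333333333333333333333
    ∷ 3333333333333333333333333333333333333333
    ∷ 2333333433433333323333333333333333333333
    ∷ 3333333333333333333333333333333333333333
    ∷ 2333333333333333333233333333344333333333
    ∷ 3333333333333333333333333333333333333333
    ∷ 2333333333443333333332333333333333333333
    ∷ 3333333333333333333333333333333333333333
    ∷ 2333333333333333333333323333334334333333
    ∷ 3333333333333333333333333333333333333333
    ∷ 3333333333333333333333333333333333333333
    ∷ 3333333333333333333333333333333333333333
    ∷ 4333333333333333333333333334332333333233
    ∷ 3333333333333333333333333333333333333333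
    ∷ 2333333333433333333433333333323333333333
    ∷ 3332333433343333333433343332333233333332
    ∷ 4233333333333333333333333333332433333333
    ∷ 3333333333333333333333333333333333333333
    ∷ 2333333333433333333333343333333332333333
    ∷ 3333333333333333333333333333333333333333
    ∷ 3333333333333333333333333333333333333333
    ∷ 3333333333333333333333333333333333333333
    ∷ 4333333333233333333333333332333333333433
    ∷ 3333333333333333333333333333333333333333
    ∷ 4333333332333333333333333333332333333334 ∷ []

  -- Here the weight is attached to the variable `e` without character (`α = 0`, `β = 8`), and the
  -- constant terms cancel.
  E₃₀-terms : List Term
  E₃₀-terms = (+ 1 , a₁ , X) ∷ (- (+ 1) , a₅ , X) ∷ (- (+ 4) , a₁₀ , X) ∷ (+ 2 , l₁ , X₂₀) ∷ (+ 2 , l₅ , X₂₀) ∷ []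

  private module C-E₃₀ = Certificate 40 1 E₃₀-terms (fromTable 40 1 (+ 16) E₃₀-table) (+ 0) (+ 8) (λ d _ → χ₃ d)

  E₃₀-identity : total E₃₀-terms ≈ con (constant E₃₀-terms) ⊕ Λ C-E₃₀.ε
  E₃₀-identity = C-E₃₀.Sound.certified (a₁ₚ , Xₚ , a₅ₚ , Xₚ , a₁₀ₚ , Xₚ , l₁ₚ , X₂₀ₚ , l₅ₚ , X₂₀ₚ , refl) (fromTable-periodic 40 1 (+ 16) E₃₀-table) (λ d _ → χ₃ₚ d) refl refl

  X-table : List ℕ
  X-table = 3333333333333333333333333333333333333333
    ∷ 3322334433243322334433443322334233443322
    ∷ 3232323434343434323232323234343434343232
    ∷ 3223322332433243344334433443342334233223
    ∷ 3333333333333333333333333333333333333333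
    ∷ 3322334433123345332233443322335433213344
    ∷ 3432343432323432323434323434323234323234
    ∷ 3443344334433423322332233223322332433443
    ∷ 3333333333333333333333333333333333333333
    ∷ 3342332433243342332433243342334233243342
    ∷ 3234313432343235323432343134323432353234
    ∷ 3443322334433443322332233443322332233443
    ∷ 3333333333333333333333333333333333333333
    ∷ 3342334433243324332433243322334233423342
    ∷ 3234343234343232343232343432343432323432
    ∷ 3243352332533423324334233143341332433423
    ∷ 3333333333333333333333333333333333333333
    ∷ 3324332233223342334233423344334433243324
    ∷ 3434323232323234343434343232323232343434
    ∷ 3423324334433423324332433423322332433423
    ∷ 3333333333333333333333333333333333333333
    ∷ 3324334233223324334233423324334433423324
    ∷ 3434343232323232343434343432323232323434
    ∷ 3423342334433443324332433243322332233423
    ∷ 3333333333333333333333333333333333333333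
    ∷ 3324334233143341332433423324335233253342
    ∷ 3234323234343234343232343232343432343432
    ∷ 3243324332433223342334233423342334433243
    ∷ 3333333333333333333333333333333333333333
    ∷ 3344332233223344332233223344334433223344
    ∷ 3432353234323431343234323532343234313432
    ∷ 3243342332433243342334233243342334233243
    ∷ 3333333333333333333333333333333333333333
    ∷ 3344334233223322332233223324334433443344
    ∷ 3432323432323434323434323234323234343234
    ∷ 3443312334533223344332233543321334433223
    ∷ 3333333333333333333333333333333333333333
    ∷ 3322332433243344334433443342334233223322
    ∷ 3232343434343432323232323434343434323232
    ∷ 3223344332433223344334433223342334433223 ∷ []

  -- The shape is that of `(φ(q)φ(q¹⁰) + φ(q²)φ(q⁵))²`: the `a` factors are squares of thetas, and
  -- `l₁ l₅` is the mixed product of all four.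
  X-terms : List Term
  X-terms = (+ 4 , X , X) ∷ (- (+ 1) , a₁ , a₁₀) ∷ (- (+ 1) , a₂ , a₅) ∷ (- (+ 2) , l₁ , l₅) ∷ []

  private module C-X = Certificate 40 1 X-terms (fromTable 40 1 (+ 8) X-table) (+ 0) (+ 0) (λ _ _ → + 0)

  X-identity : total X-terms ≈ con (constant X-terms) ⊕ Λ C-X.ε
  X-identity = C-X.Sound.certified (Xₚ , Xₚ , a₁ₚ , a₁₀ₚ , a₂ₚ , a₅ₚ , l₁ₚ , l₅ₚ , refl) (fromTable-periodic 40 1 (+ 8) X-table) (λ _ _ → refl) refl refl

  H₁-table : List ℕ
  H₁-table = 3333333333333333333333333333333333333333
    ∷ 3334444444422222222333322222222444444443
    ∷ 3334141212135252545433345452525312121414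
    ∷ 3443443442442242232232232232242244244344
    ∷ 3414341434143414341434143414341434143414
    ∷ 3444434244322443224232222324223442234424
    ∷ 3413143412125312525434535434525213521214
    ∷ 3424424342442334224232422423242243324424
    ∷ 3414341434143414341434143414341434143414
    ∷ 3422442243432442243232442244232342244234
    ∷ 3414131414325213521234545354543212531252
    ∷ 3234422443232244224434322442234344224422
    ∷ 3252325232523252325232523252325232523252
    ∷ 3222443344222322244434442233224443444222
    ∷ 3254141314145232531232145453545412321352
    ∷ 3222432442342223242434442342243244434242
    ∷ 3252325232523252325232523252325232523252
    ∷ 3243422244222434232434232444224442324342
    ∷ 3252145413145412523332125414535414521233
    ∷ 3342424242242424243333242424244242424233
    ∷ 3333333333333333333333333333333333333333
    ∷ 3332424242442424242333342424242242424243
    ∷ 3332125414535414521233325214541314541252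
    ∷ 3243423244422444232434232434222442224342
    ∷ 3252325232523252325232523252325232523252
    ∷ 3242434442342243244434242322243244234222
    ∷ 3253123214545354541232135232541413141452
    ∷ 3222444344422332244434442223222443344222
    ∷ 3252325232523252325232523252325232523252
    ∷ 3224422443432244223434422442232344224432
    ∷ 3252135212345453545432125312523414131414
    ∷ 3432442243232442244232342244234342244224
    ∷ 3414341434143414341434143414341434143414
    ∷ 3424423342242324224232422433244243424424
    ∷ 3412125312525434535434525213521214341314
    ∷ 3424432244322423222232422344223442434444
    ∷ 3414341434143414341434143414341434143414
    ∷ 3443442442242232232232232242244244344344
    ∷ 3414121213525254543334545252531212141433
    ∷ 3344444444222222223333222222224444444433 ∷ []

  -- Together with `H₂-terms` this gives two linear relations between `X₂₀` and its dilation by 2.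
  -- Comparing them is the source of the quintic modular equation, and this one also determines
  -- `X₂₀` in the end.
  H₁-terms : List Term
  H₁-terms = (+ 5 , X₂₀ , a₁₀) ∷ (- (+ 1) , X₂₀ , a₂) ∷ (- (+ 1) , X₄₀ , a₁) ∷ (+ 2 , X₄₀ , a₂) ∷ (+ 5 , X₄₀ , a₅) ∷ (- (+ 10) , X₄₀ , a₁₀) ∷ []

  private module C-H₁ = Certificate 40 1 H₁-terms (fromTable 40 1 (+ 8) H₁-table) (+ 0) (+ 0) (λ _ _ → + 0)

  H₁-identity : total H₁-terms ≈ con (constant H₁-terms) ⊕ Λ C-H₁.ε
  H₁-identity = C-H₁.Sound.certified (X₂₀ₚ , a₁₀ₚ , X₂₀ₚ , a₂ₚ , X₄₀ₚ , a₁ₚ , X₄₀ₚ , a₂ₚ , X₄₀ₚ , a₅ₚ , X₄₀ₚ , a₁₀ₚ , refl) (fromTable-periodic 40 1 (+ 8) H₁-table) (λ _ _ → refl) refl refl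

  H₂-table : List ℕ
  H₂-table = 3333333333333333333333333333333333333333
    ∷ 3323333333223333333455433333332233333332
    ∷ 3233333333343333333332333333333433333333
    ∷ 3333334333433433323313313323334334333433
    ∷ 3333333333333333333333333333333333333333
    ∷ 3333333333333333333333333333333333333333
    ∷ 3334333333333233333333343333333332333333
    ∷ 3333333333433243343313333331334334233433
    ∷ 3333333333333333333333333333333333333333
    ∷ 3333333333243333332253333333352233333342
    ∷ 3234333432323433343232343334323234333432
    ∷ 3243333334233333333352233333322533333333
    ∷ 3333333333333333333333333333333333333333
    ∷ 3334332233433333333313343344334331333333
    ∷ 3333333433333333323333333334333333333233
    ∷ 3333333333333333333333333333333333333333
    ∷ 3333333333333333333333333333333333333333
    ∷ 3332333433433323333313343334334333433133
    ∷ 3333333332333333333433333333323333333334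
    ∷ 3433333332233333334352333333322333333325
    ∷ 3531333135353133313535313331353531333135
    ∷ 3523333333223333333253433333332233333334
    ∷ 3433333333323333333334333333333233333333
    ∷ 3331334333433433343313333323334334333233
    ∷ 3333333333333333333333333333333333333333
    ∷ 3333333333333333333333333333333333333333
    ∷ 3332333333333433333333323333333334333333
    ∷ 3333333133433443343313333333334332233433
    ∷ 3333333333333333333333333333333333333333
    ∷ 3333333335223333332253333333332433333342
    ∷ 3234333432323433343232343334323234333432
    ∷ 3243333332253333333352233333342333333333
    ∷ 3333333333333333333333333333333333333333
    ∷ 3334332433433133333313343342334333333333
    ∷ 3333333233333333343333333332333333333433
    ∷ 3333333333333333333333333333333333333333
    ∷ 3333333333333333333333333333333333333333
    ∷ 3334333433433323313313323334334333433333
    ∷ 3333333334333333333233333333343333333332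
    ∷ 3233333332233333334554333333322333333323 ∷ []

  H₂-terms : List Term
  H₂-terms = (+ 1 , X₂₀ , a₁) ∷ (- (+ 1) , X₂₀ , a₂) ∷ (- (+ 1) , X₂₀ , a₅) ∷ (+ 1 , X₂₀ , a₁₀) ∷ (- (+ 1) , X₄₀ , a₁) ∷ (+ 1 , X₄₀ , a₅) ∷ []

  private module C-H₂ = Certificate 40 1 H₂-terms (fromTable 40 1 (+ 8) H₂-table) (+ 0) (+ 0) (λ _ _ → + 0)

  H₂-identity : total H₂-terms ≈ con (constant H₂-terms) ⊕ Λ C-H₂.ε
  H₂-identity = C-H₂.Sound.certified (X₂₀ₚ , a₁ₚ , X₂₀ₚ , a₂ₚ , X₂₀ₚ , a₅ₚ , X₂₀ₚ , a₁₀ₚ , X₄₀ₚ , a₁ₚ , X₄₀ₚ , a₅ₚ , refl) (fromTable-periodic 40 1 (+ 8) H₂-table) (λ _ _ → refl) refl refl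

-- The `Y` factors have a character modulo 4 or 8 in the first variable and one modulo 5 in the
-- second. Dilations by 2 are therefore put on the first and those by 5 on the second variable,
-- which keeps the tables at 40 residue pairs.
module Mod8×5 where
  private
    a₁ a₂ a₅ a₁₀ l₁ l₅ Y Y₂₀ Y₄₀ : Factor
    a₁ = factor (+ 1) (+ 4) χ₋₄ 𝟙
    a₂ = factor (+ 1) (+ 4) (D 2 χ₋₄) 𝟙
    a₅ = factor (+ 1) (+ 4) χ₋₄ (D 5 𝟙)
    a₁₀ = factor (+ 1) (+ 4) (D 2 χ₋₄) (D 5 𝟙)
    l₁ = factor (+ 1) (+ 2) χ₋₈ 𝟙
    l₅ = factor (+ 1) (+ 2) χ₋₈ (D 5 𝟙)
    Y = factor (+ 0) (+ 1) χ₋₈ χ₁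
    Y₂₀ = factor (+ 0) (+ 1) χ₋₄ χ₁
    Y₄₀ = factor (+ 0) (+ 1) (D 2 χ₋₄) χ₁

    a₁ₚ : ∀ a x → proj₂ a₁ (a % 8) (x % 5) ≡ proj₂ a₁ a x
    a₁ₚ = factor-periodic 8 5 (+ 1) (+ 4) (χ₋₄-periodic 8 (divides 2 refl)) (𝟙-periodic 5)
    a₂ₚ : ∀ a x → proj₂ a₂ (a % 8) (x % 5) ≡ proj₂ a₂ a x
    a₂ₚ = factor-periodic 8 5 (+ 1) (+ 4) (D-periodic 1 4 (χ₋₄-periodic 4 (divides 1 refl))) (𝟙-periodic 5)
    a₅ₚ : ∀ a x → proj₂ a₅ (a % 8) (x % 5) ≡ proj₂ a₅ a x
    a₅ₚ = factor-periodic 8 5 (+ 1) (+ 4) (χ₋₄-periodic 8 (divides 2 refl)) (D-periodic 4 1 (𝟙-periodic 1))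
    a₁₀ₚ : ∀ a x → proj₂ a₁₀ (a % 8) (x % 5) ≡ proj₂ a₁₀ a x
    a₁₀ₚ = factor-periodic 8 5 (+ 1) (+ 4) (D-periodic 1 4 (χ₋₄-periodic 4 (divides 1 refl))) (D-periodic 4 1 (𝟙-periodic 1))
    l₁ₚ : ∀ a x → proj₂ l₁ (a % 8) (x % 5) ≡ proj₂ l₁ a x
    l₁ₚ = factor-periodic 8 5 (+ 1) (+ 2) (χ₋₈-periodic 8 (divides 1 refl)) (𝟙-periodic 5)
    l₅ₚ : ∀ a x → proj₂ l₅ (a % 8) (x % 5) ≡ proj₂ l₅ a x
    l₅ₚ = factor-periodic 8 5 (+ 1) (+ 2) (χ₋₈-periodic 8 (divides 1 refl)) (D-periodic 4 1 (𝟙-periodic 1))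
    Yₚ : ∀ a x → proj₂ Y (a % 8) (x % 5) ≡ proj₂ Y a x
    Yₚ = factor-periodic 8 5 (+ 0) (+ 1) (χ₋₈-periodic 8 (divides 1 refl)) (χ₁-periodic 5 (divides 1 refl))
    Y₂₀ₚ : ∀ a x → proj₂ Y₂₀ (a % 8) (x % 5) ≡ proj₂ Y₂₀ a x
    Y₂₀ₚ = factor-periodic 8 5 (+ 0) (+ 1) (χ₋₄-periodic 8 (divides 2 refl)) (χ₁-periodic 5 (divides 1 refl))
    Y₄₀ₚ : ∀ a x → proj₂ Y₄₀ (a % 8) (x % 5) ≡ proj₂ Y₄₀ a x
    Y₄₀ₚ = factor-periodic 8 5 (+ 0) (+ 1) (D-periodic 1 4 (χ₋₄-periodic 4 (divides 1 refl))) (χ₁-periodic 5 (divides 1 refl))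
    χ₂ₚ : ∀ a → χ₂ (a % 8) ≡ χ₂ a
    χ₂ₚ = χ₂-periodic 8 (divides 1 refl)
    χ₁ₚ : ∀ a → χ₁ (a % 5) ≡ χ₁ a
    χ₁ₚ = χ₁-periodic 5 (divides 1 refl)

  E₁₂-table : List ℕ
  E₁₂-table = 3333333333333333333333333333333333333333
    ∷ 3333323333333334333333333433333333323333
    ∷ 3333343333333332333333333233333333343333
    ∷ 3333343333333332333333333233333333343333
    ∷ 3333323333333334333333333433333333323333
    ∷ 3244233333333333333333333333333333332442
    ∷ 3333333332234323344333333333333234322333
    ∷ 3333333343433423233233333333333243343433
    ∷ 3333333433424333233233333333333334243343
    ∷ 3333332333223433344333333333333343223332
    ∷ 3333332442333333333333333342243333333333
    ∷ 3333333322333333443333333333443333332233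
    ∷ 3333334343333333323233333323233333333434
    ∷ 3333333434333333232333333332323333334343
    ∷ 3333332233333333334433333344333333333322
    ∷ 3422433333333333333333333342243333333333
    ∷ 3333333223343233333433333443334323433333
    ∷ 3333334334342333332333333232332332433333
    ∷ 3333334334333243323333333233232423333333
    ∷ 3333333223332343433333333433344432333333
    ∷ 3333333333333333333333333333333333333333
    ∷ 3333333333333333333333333333333333333333
    ∷ 3333333333333333333333333333333333333333
    ∷ 3333333333333333333333333333333333333333
    ∷ 3333333333333333333333333333333333333333
    ∷ 3422433333333333422433333333333333333333
    ∷ 3333333333432344433333333333343432333223
    ∷ 3333333333233242323333333333233423334334
    ∷ 3333333333242332332333333332333332434334
    ∷ 3333333333443234333433333343333323433223
    ∷ 3333333333333333422433333333333333332442
    ∷ 3333332233333333334433333344333333333322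
    ∷ 3333333434333333232333333332323333334343
    ∷ 3333334343333333323233333323233333333434
    ∷ 3333333322333333443333333333443333332233
    ∷ 3244232442333333333333333333333333333333
    ∷ 3333322333323433333333333334432343233332
    ∷ 3333343433324333333333333323324334233343
    ∷ 3333343343333423333333333323324243333433
    ∷ 3333323332334323333333333334432234332333 ∷ []

  E₁₂-terms : List Term
  E₁₂-terms = (- (+ 1) , a₁ , Y) ∷ (+ 3 , a₅ , Y) ∷ (- (+ 4) , a₁₀ , Y) ∷ (+ 2 , l₁ , Y₂₀) ∷ (+ 2 , l₅ , Y₂₀) ∷ []

  private module C-E₁₂ = Certificate 8 5 E₁₂-terms (fromTable 8 5 (+ 16) E₁₂-table) (+ 2) (+ 0) (λ d e → χ₂ d * χ₁ e)

  E₁₂-identity : total E₁₂-terms ≈ con (constant E₁₂-terms) ⊕ Λ C-E₁₂.ε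
  E₁₂-identity = C-E₁₂.Sound.certified (a₁ₚ , Yₚ , a₅ₚ , Yₚ , a₁₀ₚ , Yₚ , l₁ₚ , Y₂₀ₚ , l₅ₚ , Y₂₀ₚ , refl) (fromTable-periodic 8 5 (+ 16) E₁₂-table) (λ d e → cong₂ _*_ (χ₂ₚ d) (χ₁ₚ e)) refl refl

  E₂₁-table : List ℕ
  E₂₁-table = 3333334224333333244233333324423333334224
    ∷ 3333334224333333244233333324423333334224
    ∷ 3333334224333333244233333324423333334224
    ∷ 3333334224333333244233333324423333334224
    ∷ 3333334224333333244233333324423333334224
    ∷ 3333334224333333333333333333333333332442
    ∷ 4444442243222223333333333333333333324423
    ∷ 2222222434444443333333333333333333344232
    ∷ 2222224342444443333333333333333333342324
    ∷ 4444443422222223333333333333333333323244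
    ∷ 3333332442333333333333333342243333333333
    ∷ 3333332442333333333333333342243333333333
    ∷ 3333332442333333333333333342243333333333
    ∷ 3333332442333333333333333342243333333333
    ∷ 3333332442333333333333333342243333333333
    ∷ 3333333333333333244233333342243333333333
    ∷ 2222233333333332442333333422434444433333
    ∷ 4444433333333334423233333224342222233333
    ∷ 4444433333333334232433333243422222233333
    ∷ 2222233333333332324433333434224444433333
    ∷ 3333333333333333333333333333333333333333
    ∷ 3333333333333333333333333333333333333333
    ∷ 3333333333333333333333333333333333333333
    ∷ 3333333333333333333333333333333333333333
    ∷ 3333333333333333333333333333333333333333
    ∷ 3333333333333333422433333324423333333333
    ∷ 2222233333444444224333333244233333333333
    ∷ 4444433333222222243433333442323333333333
    ∷ 4444433333222222434233333423243333333333
    ∷ 2222233333444444342233333232443333333333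
    ∷ 3333333333333333422433333333333333332442
    ∷ 3333333333333333422433333333333333332442
    ∷ 3333333333333333422433333333333333332442
    ∷ 3333333333333333422433333333333333332442
    ∷ 3333333333333333422433333333333333332442
    ∷ 3333332442333333333333333333333333334224
    ∷ 4444424423333333333333333333332222242243
    ∷ 2222244232333333333333333333334444422434
    ∷ 2222242324333333333333333333334444424342
    ∷ 4444423244333333333333333333332222243422 ∷ []

  E₂₁-terms : List Term
  E₂₁-terms = (- (+ 1) , a₁ , Y) ∷ (- (+ 4) , a₂ , Y) ∷ (+ 5 , a₅ , Y) ∷ (- (+ 2) , l₁ , Y₂₀) ∷ (+ 10 , l₅ , Y₂₀) ∷ []

  private module C-E₂₁ = Certificate 8 5 E₂₁-terms (fromTable 8 5 (+ 16) E₂₁-table) (+ 0) (+ 8) (λ d e → χ₂ d * χ₁ e)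

  E₂₁-identity : total E₂₁-terms ≈ con (constant E₂₁-terms) ⊕ Λ C-E₂₁.ε
  E₂₁-identity = C-E₂₁.Sound.certified (a₁ₚ , Yₚ , a₂ₚ , Yₚ , a₅ₚ , Yₚ , l₁ₚ , Y₂₀ₚ , l₅ₚ , Y₂₀ₚ , refl) (fromTable-periodic 8 5 (+ 16) E₂₁-table) (λ d e → cong₂ _*_ (χ₂ₚ d) (χ₁ₚ e)) refl refl

  Y-table : List ℕ
  Y-table = 3333333333333333333333333333333333333333
    ∷ 3333333333333333333333333333333333333333
    ∷ 3333333333333333333333333333333333333333
    ∷ 3333333333333333333333333333333333333333
    ∷ 3333333333333333333333333333333333333333
    ∷ 3333333333122225444433333333335444412222
    ∷ 3333333333242424422433333333334242422442
    ∷ 3333333333244224244233333333334224424224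
    ∷ 3333333333222444244233333333334442224224
    ∷ 3333333333224244422433333333334424222442
    ∷ 3333312222333335444433333122223333354444
    ∷ 3333324422333334224433333244223333342244
    ∷ 3333322424333334424233333224243333344242
    ∷ 3333324242333334242433333242423333342424
    ∷ 3333322244333334442233333222443333344422
    ∷ 3333354444544443333333333122221222233333
    ∷ 3333344224424243333333333224422424233333
    ∷ 3333342442422443333333333242242442233333
    ∷ 3333342442444223333333333242242224433333
    ∷ 3333344224442423333333333224422242433333
    ∷ 3333333333333333333333333333333333333333
    ∷ 3333333333333333333333333333333333333333
    ∷ 3333333333333333333333333333333333333333
    ∷ 3333333333333333333333333333333333333333
    ∷ 3333333333333333333333333333333333333333
    ∷ 3333333333122221222233333333335444454444
    ∷ 3333333333242422244233333333334242444224
    ∷ 3333333333244222422433333333334224442442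
    ∷ 3333333333222442422433333333334442242442
    ∷ 3333333333224242244233333333334424244224
    ∷ 3333354444333331222233333544443333312222
    ∷ 3333342244333332442233333422443333324422
    ∷ 3333344242333332242433333442423333322424
    ∷ 3333342424333332424233333424243333324242
    ∷ 3333344422333332224433333444223333322244
    ∷ 3333312222544443333333333544441222233333
    ∷ 3333322442424243333333333442242424233333
    ∷ 3333324224422443333333333424422442233333
    ∷ 3333324224444223333333333424422224433333
    ∷ 3333322442442423333333333442242242433333 ∷ []

  Y-terms : List Term
  Y-terms = (+ 4 , Y , Y) ∷ (- (+ 1) , a₁ , a₁₀) ∷ (- (+ 1) , a₂ , a₅) ∷ (+ 2 , l₁ , l₅) ∷ []

  private module C-Y = Certificate 8 5 Y-terms (fromTable 8 5 (+ 8) Y-table) (+ 0) (+ 0) (λ _ _ → + 0)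

  Y-identity : total Y-terms ≈ con (constant Y-terms) ⊕ Λ C-Y.ε
  Y-identity = C-Y.Sound.certified (Yₚ , Yₚ , a₁ₚ , a₁₀ₚ , a₂ₚ , a₅ₚ , l₁ₚ , l₅ₚ , refl) (fromTable-periodic 8 5 (+ 8) Y-table) (λ _ _ → refl) refl refl

  Y₂₀-table : List ℕ
  Y₂₀-table = 3333333333333333333333333333333333333333
    ∷ 3333333333333333333333333333333333333333
    ∷ 3333333333333333333333333333333333333333
    ∷ 3333333333333333333333333333333333333333
    ∷ 3333333333333333333333333333333333333333
    ∷ 3333333333342243066033333333333244236006
    ∷ 3333333333632360233233333333330343064334
    ∷ 3333333333033046344333333333336336203223
    ∷ 3333333333040336344333333333336263303223
    ∷ 3333333333663230233233333333330034364334
    ∷ 3333336006333333066033333360063333330660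
    ∷ 3333343346333332332033333433463333323320
    ∷ 3333322303333334436333333223033333344363
    ∷ 3333323032333334363433333230323333343634
    ∷ 3333346433333332023333333464333333320233
    ∷ 3333330660324423333333333360063422433333
    ∷ 3333302332034303333333333643346323633333
    ∷ 3333363443633623333333333032230330433333
    ∷ 3333363443626333333333333032230403333333
    ∷ 3333302332003433333333333643346632333333
    ∷ 3333333333333333333333333333333333333333
    ∷ 3333333333333333333333333333333333333333
    ∷ 3333333333333333333333333333333333333333
    ∷ 3333333333333333333333333333333333333333
    ∷ 3333333333333333333333333333333333333333
    ∷ 3333333333342243600633333333333244230660
    ∷ 3333333333632366433433333333330343002332
    ∷ 3333333333033040322333333333336336263443
    ∷ 3333333333040330322333333333336263363443
    ∷ 3333333333663236433433333333330034302332
    ∷ 3333330660333333600633333306603333336006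
    ∷ 3333323320333334334633333233203333343346
    ∷ 3333344363333332230333333443633333322303
    ∷ 3333343634333332303233333436343333323032
    ∷ 3333320233333334643333333202333333346433
    ∷ 3333336006324423333333333306603422433333
    ∷ 3333364334034303333333333023326323633333
    ∷ 3333303223633623333333333634430330433333
    ∷ 3333303223626333333333333634430403333333
    ∷ 3333364334003433333333333023326632333333 ∷ []

  -- A relation between `Y₂₀` and its dilation by 2 in which `Y₄₀` is the inhomogeneous part, known
  -- from `Y-terms`.
  Y₂₀-terms : List Term
  Y₂₀-terms = (+ 1 , Y₂₀ , a₂) ∷ (+ 5 , Y₂₀ , a₁₀) ∷ (+ 2 , Y₄₀ , a₁) ∷ (- (+ 1) , Y , l₁) ∷ (- (+ 5) , Y , l₅) ∷ []

  private module C-Y₂₀ = Certificate 8 5 Y₂₀-terms (fromTable 8 5 (+ 4) Y₂₀-table) (+ 0) (+ 0) (λ _ _ → + 0)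

  Y₂₀-identity : total Y₂₀-terms ≈ con (constant Y₂₀-terms) ⊕ Λ C-Y₂₀.ε
  Y₂₀-identity = C-Y₂₀.Sound.certified (Y₂₀ₚ , a₂ₚ , Y₂₀ₚ , a₁₀ₚ , Y₄₀ₚ , a₁ₚ , Yₚ , l₁ₚ , Yₚ , l₅ₚ , refl) (fromTable-periodic 8 5 (+ 4) Y₂₀-table) (λ _ _ → refl) refl refl

module Mod8×2 where
  private
    o₁ o₂ a₄ : Factor
    o₁ = factor (+ 0) (+ 4) χ₋₄ odd
    o₂ = factor (+ 0) (+ 4) (D 2 χ₋₄) odd
    a₄ = factor (+ 1) (+ 4) (D 2 χ₋₄) (D 2 𝟙)

    o₁ₚ : ∀ a x → proj₂ o₁ (a % 8) (x % 2) ≡ proj₂ o₁ a x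
    o₁ₚ = factor-periodic 8 2 (+ 0) (+ 4) (χ₋₄-periodic 8 (divides 2 refl)) odd-periodic
    o₂ₚ : ∀ a x → proj₂ o₂ (a % 8) (x % 2) ≡ proj₂ o₂ a x
    o₂ₚ = factor-periodic 8 2 (+ 0) (+ 4) (D-periodic 1 4 (χ₋₄-periodic 4 (divides 1 refl))) odd-periodic
    a₄ₚ : ∀ a x → proj₂ a₄ (a % 8) (x % 2) ≡ proj₂ a₄ a x
    a₄ₚ = factor-periodic 8 2 (+ 1) (+ 4) (D-periodic 1 4 (χ₋₄-periodic 4 (divides 1 refl))) (D-periodic 1 1 (𝟙-periodic 1))

  L₄-table : List ℕ
  L₄-table = 3333333333333333
    ∷ 3333333333333333
    ∷ 3333323333333233
    ∷ 3333333233333332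
    ∷ 3333333333333533
    ∷ 3323332355235323
    ∷ 3333323333333233
    ∷ 3332333333323333
    ∷ 3333353333333533
    ∷ 3333353333333533
    ∷ 3333323333333233
    ∷ 3333333233333332
    ∷ 3333353333333333
    ∷ 3323532355233323
    ∷ 3333323333333233
    ∷ 3332333333323333 ∷ []

  -- Restriction to odd `x` subtracts the dilation by 2, so this says `(L₄(q) - L₄(q²))² = 4 (L₄(q²)
  -- - L₄(q⁴)) L₄(q⁴)`. The series `φ²` satisfies the same equation.
  L₄-terms : List Term
  L₄-terms = (+ 1 , o₁ , o₁) ∷ (- (+ 4) , o₂ , a₄) ∷ []

  private module C-L₄ = Certificate 8 2 L₄-terms (fromTable 8 2 (+ 32) L₄-table) (+ 0) (+ 0) (λ _ _ → + 0)

  L₄-identity : total L₄-terms ≈ con (constant L₄-terms) ⊕ Λ C-L₄.ε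
  L₄-identity = C-L₄.Sound.certified (o₁ₚ , o₁ₚ , o₂ₚ , a₄ₚ , refl) (fromTable-periodic 8 2 (+ 32) L₄-table) (λ _ _ → refl) refl refl

module Mod8 where
  private
    a₁ a₂ l₁ : Factor
    a₁ = factor (+ 1) (+ 4) χ₋₄ 𝟙
    a₂ = factor (+ 1) (+ 4) (D 2 χ₋₄) 𝟙
    l₁ = factor (+ 1) (+ 2) χ₋₈ 𝟙

    a₁ₚ : ∀ a x → proj₂ a₁ (a % 8) (x % 1) ≡ proj₂ a₁ a x
    a₁ₚ = factor-periodic 8 1 (+ 1) (+ 4) (χ₋₄-periodic 8 (divides 2 refl)) (𝟙-periodic 1)
    a₂ₚ : ∀ a x → proj₂ a₂ (a % 8) (x % 1) ≡ proj₂ a₂ a x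
    a₂ₚ = factor-periodic 8 1 (+ 1) (+ 4) (D-periodic 1 4 (χ₋₄-periodic 4 (divides 1 refl))) (𝟙-periodic 1)
    l₁ₚ : ∀ a x → proj₂ l₁ (a % 8) (x % 1) ≡ proj₂ l₁ a x
    l₁ₚ = factor-periodic 8 1 (+ 1) (+ 2) (χ₋₈-periodic 8 (divides 1 refl)) (𝟙-periodic 1)

  L₈-table : List ℕ
  L₈-table = 33333333
    ∷ 33243342
    ∷ 32343234
    ∷ 34433223
    ∷ 33333333
    ∷ 33223344
    ∷ 34323432
    ∷ 32433423 ∷ []

  L₈-terms : List Term
  L₈-terms = (+ 1 , l₁ , l₁) ∷ (- (+ 1) , a₁ , a₂) ∷ []

  private module C-L₈ = Certificate 8 1 L₈-terms (fromTable 8 1 (+ 8) L₈-table) (+ 0) (+ 0) (λ _ _ → + 0)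

  L₈-identity : total L₈-terms ≈ con (constant L₈-terms) ⊕ Λ C-L₈.ε
  L₈-identity = C-L₈.Sound.certified (l₁ₚ , l₁ₚ , a₁ₚ , a₂ₚ , refl) (fromTable-periodic 8 1 (+ 8) L₈-table) (λ _ _ → refl) refl refl

-- From certificates to series, and the two-square theorem

lam-0 : ∀ u f → lam u f 0 ≡ u
lam-0 u f = trans (⊕-at (con u) (Λ f) 0) (trans (cong (_+_ u) (∑₁-def 0 _)) (ℤP.+-identityʳ u))

lam-1 : ∀ u f → lam u f 1 ≡ f 1 1
lam-1 u f = trans (⊕-at (con u) (Λ f) 1) (trans (ℤP.+-identityˡ _) (trans (∑₁-def 1 _) (trans (ℤP.+-identityˡ _)
  (trans (∑₁-def 1 _) (trans (ℤP.+-identityˡ _) (ℤP.*-identityˡ (f 1 1)))))))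

infix 4 _⇝_
record _⇝_ (f : Factor) (A : Series) : Set where
  constructor as
  field value : ⟪ f ⟫ ≈ A

infixr 5 _⊗_∷_
-- Evaluates a list of terms whose factors have known values. The list is an index, so it is
-- inferred from the evidence and need not be written again.
data Total : List Term → Series → Set where
  []    : Total [] (con (+ 0))
  _⊗_∷_ : ∀ {c f g t A B R} → f ⇝ A → g ⇝ B → Total t R → Total ((c , f , g) ∷ t) (con c ⊛ (A ⊛ B) ⊕ R)

total-value : ∀ {t R} → Total t R → total t ≈ R
total-value []                  = S.refl
total-value (as p ⊗ as q ∷ r) = ⊕-cong (⊛-cong S.refl (⊛-cong p q)) (total-value r)

Λ-zero : ∀ {f : ℕ → ℕ → ℤ} → (∀ a x → f a x ≡ + 0) → Λ f ≈ con (+ 0)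
Λ-zero p = S.trans (Λ-cong λ a x _ _ → p a x) Λ-0

vanishing : ∀ {t R} {f : ℕ → ℕ → ℤ} → Total t R → total t ≈ con (+ 0) ⊕ Λ f → (∀ a x → f a x ≡ + 0) → R ≈ con (+ 0)
vanishing r p f0 = S.trans (S.sym (total-value r)) (S.trans p (S.trans (⊕-cong S.refl (Λ-zero f0)) (identity 0 (κ (+ 0) :+ κ (+ 0) := κ (+ 0)) [])))

null : ∀ a x → (+ 0 * + a + + 0 * + x) * + 0 ≡ + 0
null a x = ℤP.*-zeroʳ (+ 0 * + a + + 0 * + x)

L₄ L₈ X₄₀ Y₄₀ X₂₀ Y₂₀ : Series
L₄  = ⟪ factor (+ 1) (+ 4) χ₋₄ 𝟙 ⟫
L₈  = ⟪ factor (+ 1) (+ 2) χ₋₈ 𝟙 ⟫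
X₄₀ = ⟪ factor (+ 1) (+ 1) χ₋₄₀ 𝟙 ⟫
Y₄₀ = ⟪ factor (+ 0) (+ 1) χ₋₈ χ₁ ⟫
X₂₀ = ⟪ factor (+ 1) (+ 1) χ₋₂₀ 𝟙 ⟫
Y₂₀ = ⟪ factor (+ 0) (+ 1) χ₋₄ χ₁ ⟫

oddPart : Series → Series
oddPart A = A ⊕ ⊝ dil 2 A

L₄-odd : ⟪ factor (+ 0) (+ 4) χ₋₄ odd ⟫ ≈ oddPart L₄
L₄-odd = begin
  con (+ 0) ⊕ Λ (λ a x → + 4 * (χ₋₄ a * odd x))
    ≈⟨ ⊕-cong S.refl (S.trans (Λ-cong λ a x _ _ → split a x) (Λ-linear (- + 1) _ _)) ⟩
  con (+ 0) ⊕ (con (- + 1) ⊛ Λ (λ a x → + 4 * (χ₋₄ a * D 2 𝟙 x)) ⊕ Λ (λ a x → + 4 * (χ₋₄ a * 𝟙 x)))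
    ≈⟨ identity 2 (λ f g → κ (+ 0) :+ (κ (- + 1) :* f :+ g) := (κ (+ 1) :+ g) :+ :- (κ (+ 1) :+ f)) (Λ (λ a x → + 4 * (χ₋₄ a * D 2 𝟙 x)) ∷ Λ (λ a x → + 4 * (χ₋₄ a * 𝟙 x)) ∷ []) ⟩
  L₄ ⊕ ⊝ ⟪ factor (+ 1) (+ 4) χ₋₄ (D 2 𝟙) ⟫
    ≈⟨ ⊕-cong S.refl (⊝-cong (factor-Dʳ 1 (+ 1) (+ 4) χ₋₄ 𝟙)) ⟩
  oddPart L₄ ∎
  where
  open ≈R
  parity : ∀ r → r < 2 → + r ≡ + 1 - (if r ℕ.≡ᵇ 0 then + 1 else + 0)
  parity zero          _ = refl
  parity (suc zero)    _ = refl
  parity (suc (suc r)) (s≤s (s≤s ()))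
  split : ∀ a x → + 4 * (χ₋₄ a * odd x) ≡ - + 1 * (+ 4 * (χ₋₄ a * D 2 𝟙 x)) + + 4 * (χ₋₄ a * 𝟙 x)
  split a x = trans (cong (λ z → + 4 * (χ₋₄ a * z)) (parity (x % 2) (DM.m%n<n x 2))) (lemma (χ₋₄ a) (D 2 𝟙 x))
    where
    lemma : ∀ c d → + 4 * (c * (+ 1 - d)) ≡ - + 1 * (+ 4 * (c * d)) + + 4 * (c * + 1)
    lemma = solve-∀

-- One power of `q` is lost because `u` begins with a multiple of `q`.
unit-0-tail : ∀ u d n → u 0 ≡ + 0 → u 1 ≢ + 0 → u ⊛ d ≈[ suc n ] con (+ 0) → d ≈[ n ] con (+ 0)
unit-0-tail u d n u0 u1 p = unit-0 (tail u) d n u1 (tr λ i i<n →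
  trans (trans (sym (ℤP.+-identityˡ _)) (cong (λ z → z * d (suc i) + (tail u ⊛ d) i) (sym u0))) (trans (coeff< p (suc i) (s≤s i<n)) (sym (con-0 i))))

-- The relation determines A modulo q^(2m-1) from A modulo q^m, since oddPart A starts with 4q.
module _ (A B : Series) (A₀ : A 0 ≡ + 1) (B₀ : B 0 ≡ + 1) (A₁ : A 1 ≡ + 4) (B₁ : B 1 ≡ + 4)
  (hA : oddPart A ⊛ oddPart A ≈ 𝟒 ⊛ (dil 2 (oddPart A) ⊛ dil 4 A))
  (hB : oddPart B ⊛ oddPart B ≈ 𝟒 ⊛ (dil 2 (oddPart B) ⊛ dil 4 B)) where
  private
    oddPart-0 : ∀ C → oddPart C 0 ≡ + 0
    oddPart-0 C = trans (⊕-at C (⊝ dil 2 C) 0) (trans (cong (_+_ (C 0)) (⊝-at (dil 2 C) 0)) (ℤP.+-inverseʳ (C 0)))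
    oddPart-1 : ∀ C → oddPart C 1 ≡ C 1
    oddPart-1 C = trans (⊕-at C (⊝ dil 2 C) 1) (trans (cong (_+_ (C 1)) (⊝-at (dil 2 C) 1)) (ℤP.+-identityʳ (C 1)))

    refine : ∀ n → A ≈[ suc n ] B → A ≈[ suc (n ℕ.+ n) ] B
    refine n p = ⊖-0 ([]-trans (≈⇒≈[] (identity 4 (λ a b a′ b′ → a :+ :- b := ((a :+ :- a′) :+ :- (b :+ :- b′)) :+ (a′ :+ :- b′)) (A ∷ B ∷ dil 2 A ∷ dil 2 B ∷ [])))
        ([]-trans ([]-⊕ odd-eq ([]-trans ([]-⊕ dil2p []-refl) (≈⇒≈[] (identity 1 (λ x → x :+ :- x := κ (+ 0)) (dil 2 B ∷ [])))))
        (≈⇒≈[] (identity 0 (κ (+ 0) :+ κ (+ 0) := κ (+ 0)) []))))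
      where
      p₂ : dil 2 A ≈[ suc (suc (n ℕ.+ n)) ] dil 2 B
      p₂ = subst (λ m → dil 2 A ≈[ suc m ] dil 2 B) (ℕP.+-suc n n) ([]-dil2 p)
      dil2p : dil 2 A ≈[ suc (n ℕ.+ n) ] dil 2 B
      dil2p = ≈[]-weaken (ℕP.n≤1+n _) p₂
      p₄ : dil 4 A ≈[ suc (suc (n ℕ.+ n)) ] dil 4 B
      p₄ = []-trans (≈⇒≈[] (S.sym (dil-∘ 1 1 A))) ([]-trans (≈[]-weaken (ℕP.m≤m+n _ _) ([]-dil2 p₂)) (≈⇒≈[] (dil-∘ 1 1 B)))
      odd₂ : dil 2 (oddPart A) ≈[ suc (suc (n ℕ.+ n)) ] dil 2 (oddPart B)
      odd₂ = subst (λ m → dil 2 (oddPart A) ≈[ suc m ] dil 2 (oddPart B)) (ℕP.+-suc n n)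
        ([]-dil2 ([]-⊕ p ([]-⊝ (≈[]-weaken (s≤s (ℕP.m≤m+n n n)) dil2p))))
      sq : oddPart A ⊛ oddPart A ≈[ suc (suc (n ℕ.+ n)) ] oddPart B ⊛ oddPart B
      sq = []-trans (≈⇒≈[] hA) ([]-trans ([]-⊛ []-refl ([]-⊛ odd₂ p₄)) (≈⇒≈[] (S.sym hB)))
      odd-eq : oddPart A ⊕ ⊝ oddPart B ≈[ suc (n ℕ.+ n) ] con (+ 0)
      odd-eq = unit-0-tail (oddPart A ⊕ oddPart B) (oddPart A ⊕ ⊝ oddPart B) (suc (n ℕ.+ n))
        (trans (⊕-at _ _ 0) (cong₂ _+_ (oddPart-0 A) (oddPart-0 B)))
        (λ e → case trans (sym (trans (⊕-at _ _ 1) (cong₂ _+_ (trans (oddPart-1 A) A₁) (trans (oddPart-1 B) B₁)))) e of λ ())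
        ([]-trans (≈⇒≈[] (identity 2 (λ a b → (a :+ b) :* (a :+ :- b) := a :* a :+ :- (b :* b)) (oddPart A ∷ oddPart B ∷ [])))
        ([]-trans ([]-⊕ sq []-refl) (≈⇒≈[] (identity 1 (λ x → x :+ :- x := κ (+ 0)) (oddPart B ⊛ oddPart B ∷ [])))))

  oddPart-unique : A ≈ B
  oddPart-unique = ≈[]⇒≈ go
    where
    go : ∀ n → A ≈[ n ] B
    go zero          = tr λ _ ()
    go (suc zero)    = tr λ { zero _ → trans A₀ (sym B₀) ; (suc _) (s≤s ()) }
    go (suc (suc zero)) = tr λ { zero _ → trans A₀ (sym B₀) ; (suc zero) _ → trans A₁ (sym B₁) ; (suc (suc _)) (s≤s (s≤s ())) }
    go (suc (suc (suc n))) = ≈[]-weaken (s≤s (s≤s (subst (suc n ≤_) (sym (ℕP.+-suc n n)) (s≤s (ℕP.m≤m+n n n))))) (refine (suc n) (go (suc (suc n))))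

-- Twice the left side is `φ(q)² - φ(-q)²`, by the formula for the sum of these squares, and both
-- factors of this difference are known.
φ²-odd : oddPart (φ ⊛ φ) ≈ 𝟒 ⊛ (dil 4 φ ⊛ (q ⊛ dil 8 ψ))
φ²-odd = cancel 0 𝟐 (λ ()) (begin
  𝟐 ⊛ (φ ⊛ φ ⊕ ⊝ dil 2 (φ ⊛ φ))
    ≈⟨ ⊛-cong S.refl (⊕-cong S.refl (⊝-cong (dil-⊛ 2 φ φ))) ⟩
  𝟐 ⊛ (φ ⊛ φ ⊕ ⊝ (dil 2 φ ⊛ dil 2 φ))
    ≈⟨ identity 2 (λ f g → κ (+ 2) :* (f :* f :+ :- (g :* g)) := κ (+ 2) :* (f :* f) :+ :- (κ (+ 2) :* (g :* g))) (φ ∷ dil 2 φ ∷ []) ⟩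
  𝟐 ⊛ (φ ⊛ φ) ⊕ ⊝ (𝟐 ⊛ (dil 2 φ ⊛ dil 2 φ))
    ≈⟨ ⊕-cong S.refl (⊝-cong (S.sym φ²+φ′²)) ⟩
  𝟐 ⊛ (φ ⊛ φ) ⊕ ⊝ (φ ⊛ φ ⊕ φ′ ⊛ φ′)
    ≈⟨ identity 2 (λ f g → κ (+ 2) :* (f :* f) :+ :- (f :* f :+ g :* g) := (f :+ g) :* (f :+ :- g)) (φ ∷ φ′ ∷ []) ⟩
  (φ ⊕ φ′) ⊛ (φ ⊕ ⊝ φ′)
    ≈⟨ ⊛-cong φ+φ′ φ-φ′ ⟩
  (𝟐 ⊛ dil 4 φ) ⊛ (𝟒 ⊛ (q ⊛ dil 8 ψ))
    ≈⟨ identity 2 (λ f g → (κ (+ 2) :* f) :* (κ (+ 4) :* g) := κ (+ 2) :* (κ (+ 4) :* (f :* g))) (dil 4 φ ∷ q ⊛ dil 8 ψ ∷ []) ⟩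
  𝟐 ⊛ (𝟒 ⊛ (dil 4 φ ⊛ (q ⊛ dil 8 ψ))) ∎)
  where open ≈R

φ²-relation : oddPart (φ ⊛ φ) ⊛ oddPart (φ ⊛ φ) ≈ 𝟒 ⊛ (dil 2 (oddPart (φ ⊛ φ)) ⊛ dil 4 (φ ⊛ φ))
φ²-relation = begin
  oddPart (φ ⊛ φ) ⊛ oddPart (φ ⊛ φ)
    ≈⟨ ⊛-cong φ²-odd φ²-odd ⟩
  (𝟒 ⊛ (dil 4 φ ⊛ (q ⊛ dil 8 ψ))) ⊛ (𝟒 ⊛ (dil 4 φ ⊛ (q ⊛ dil 8 ψ)))
    ≈⟨ identity 3 (λ f q p → (κ (+ 4) :* (f :* (q :* p))) :* (κ (+ 4) :* (f :* (q :* p))) := κ (+ 16) :* ((q :* q) :* ((p :* p) :* (f :* f)))) (dil 4 φ ∷ q ∷ dil 8 ψ ∷ []) ⟩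
  con (+ 16) ⊛ ((q ⊛ q) ⊛ ((dil 8 ψ ⊛ dil 8 ψ) ⊛ (dil 4 φ ⊛ dil 4 φ)))
    ≈⟨ ⊛-cong S.refl (⊛-cong S.refl (⊛-cong ψ²₈ S.refl)) ⟩
  con (+ 16) ⊛ ((q ⊛ q) ⊛ ((dil 8 φ ⊛ dil 8 (dil 2 ψ)) ⊛ (dil 4 φ ⊛ dil 4 φ)))
    ≈⟨ identity 4 (λ q a b f → κ (+ 16) :* ((q :* q) :* ((a :* b) :* (f :* f))) := κ (+ 4) :* ((κ (+ 4) :* (a :* ((q :* q) :* b))) :* (f :* f))) (q ∷ dil 8 φ ∷ dil 8 (dil 2 ψ) ∷ dil 4 φ ∷ []) ⟩
  𝟒 ⊛ ((𝟒 ⊛ (dil 8 φ ⊛ ((q ⊛ q) ⊛ dil 8 (dil 2 ψ)))) ⊛ (dil 4 φ ⊛ dil 4 φ))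
    ≈⟨ ⊛-cong S.refl (⊛-cong (S.sym odd₂) (S.sym (dil-⊛ 4 φ φ))) ⟩
  𝟒 ⊛ (dil 2 (oddPart (φ ⊛ φ)) ⊛ dil 4 (φ ⊛ φ)) ∎
  where
  open ≈R
  odd₂ : dil 2 (oddPart (φ ⊛ φ)) ≈ 𝟒 ⊛ (dil 8 φ ⊛ ((q ⊛ q) ⊛ dil 8 (dil 2 ψ)))
  odd₂ = S.trans (dil-cong 2 φ²-odd) (S.trans (dil-⊛ 2 𝟒 _) (⊛-cong (dil-con 2 _) (S.trans (dil-⊛ 2 (dil 4 φ) _) (⊛-cong (dil-∘ 1 3 φ)
    (S.trans (dil-⊛ 2 q _) (⊛-cong (S.trans (dil-M 1 1) (S.sym (M-+ 1 1))) (S.trans (dil-∘ 1 7 ψ) (S.sym (dil-∘ 7 1 ψ)))))))))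

-- Jacobi's two-square theorem: both series begin with `1 + 4q` and satisfy the equation of
-- `oddPart-unique`, one by a certificate, the other by `φ²-relation`.
L₄≈φ² : L₄ ≈ φ ⊛ φ
L₄≈φ² = oddPart-unique L₄ (φ ⊛ φ) (lam-0 (+ 1) _) refl (lam-1 (+ 1) _) refl relation φ²-relation
  where
  o₁ : factor (+ 0) (+ 4) χ₋₄ odd ⇝ oddPart L₄
  o₁ = as L₄-odd
  o₂ : factor (+ 0) (+ 4) (D 2 χ₋₄) odd ⇝ dil 2 (oddPart L₄)
  o₂ = as (S.trans (factor-Dˡ 1 (+ 0) (+ 4) χ₋₄ odd) (dil-cong 2 L₄-odd))
  a₄ : factor (+ 1) (+ 4) (D 2 χ₋₄) (D 2 𝟙) ⇝ dil 4 L₄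
  a₄ = as (S.trans (factor-Dˡ 1 (+ 1) (+ 4) χ₋₄ (D 2 𝟙)) (S.trans (dil-cong 2 (factor-Dʳ 1 (+ 1) (+ 4) χ₋₄ 𝟙)) (dil-∘ 1 1 L₄)))
  relation : oddPart L₄ ⊛ oddPart L₄ ≈ 𝟒 ⊛ (dil 2 (oddPart L₄) ⊛ dil 4 L₄)
  relation = ≈[]⇒≈ λ n → ⊖-0 (≈⇒≈[] (S.trans
    (identity 3 (λ o p a → o :* o :+ :- (κ (+ 4) :* (p :* a)) := κ (+ 1) :* (o :* o) :+ (κ (- + 4) :* (p :* a) :+ κ (+ 0))) (oddPart L₄ ∷ dil 2 (oddPart L₄) ∷ dil 4 L₄ ∷ []))
    (vanishing (o₁ ⊗ o₁ ∷ o₂ ⊗ a₄ ∷ []) Mod8×2.L₄-identity null)))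

-- Eta quotients

shift-at : ∀ j f i → (M j ⊛ f) i ≡ (if j ℕ.≤ᵇ i then f (i ∸ j) else + 0)
shift-at j f i with j ℕ.≤ᵇ i in e
... | true  = M-⊛ j f i (ℕP.≤ᵇ⇒≤ j i (subst T (sym e) _))
... | false = M-⊛-< j f i (ℕP.≰⇒> λ j≤i → subst T e (ℕP.≤⇒≤ᵇ j≤i))

mulOneMinus-⊛ : ∀ j f → mulOneMinus j f ≈ (𝟏 ⊕ ⊝ M j) ⊛ f
mulOneMinus-⊛ j f = S.trans (pw λ i → trans (cong (λ c → f i - c) (sym (shift-at j f i))) (sym (trans (⊕-at f (⊝ (M j ⊛ f)) i) (cong (_+_ (f i)) (⊝-at (M j ⊛ f) i)))))
  (identity 2 (λ m f → f :+ :- (m :* f) := (κ (+ 1) :+ :- m) :* f) (M j ∷ f ∷ []))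

sumℤ-applyUpTo : ∀ (g : ℕ → ℤ) n → sumℤ (List.applyUpTo g n) ≡ ∑ n g
sumℤ-applyUpTo g zero    = refl
sumℤ-applyUpTo g (suc n) = trans (cong (_+_ (g 0)) (sumℤ-applyUpTo (g ∘ suc) n)) (sym (∑-suc n g))

sumℤ-upTo : ∀ (g : ℕ → ℤ) n → sumℤ (List.map g (List.upTo n)) ≡ ∑ n g
sumℤ-upTo g n = trans (cong sumℤ (ListP.map-upTo g n)) (sumℤ-applyUpTo g n)

geometric : ∀ j f n → (𝟏 ⊕ ⊝ M j) ⊛ ⨁ n (λ t → M (t ℕ.* j) ⊛ f) ≈ f ⊕ ⊝ (M (n ℕ.* j) ⊛ f)
geometric j f zero    = S.trans (⊛-cong S.refl (pw λ { zero → refl ; (suc _) → refl })) (identity 2 (λ m f → (κ (+ 1) :+ :- m) :* κ (+ 0) := f :+ :- (κ (+ 1) :* f)) (M j ∷ f ∷ []))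
geometric j f (suc n) = begin
  (𝟏 ⊕ ⊝ M j) ⊛ ⨁ (suc n) (λ t → M (t ℕ.* j) ⊛ f)
    ≈⟨ ⊛-cong S.refl (⨁-suc n _) ⟩
  (𝟏 ⊕ ⊝ M j) ⊛ (⨁ n (λ t → M (t ℕ.* j) ⊛ f) ⊕ M (n ℕ.* j) ⊛ f)
    ≈⟨ identity 3 (λ a s m → a :* (s :+ m) := a :* s :+ a :* m) (𝟏 ⊕ ⊝ M j ∷ ⨁ n (λ t → M (t ℕ.* j) ⊛ f) ∷ M (n ℕ.* j) ⊛ f ∷ []) ⟩
  (𝟏 ⊕ ⊝ M j) ⊛ ⨁ n (λ t → M (t ℕ.* j) ⊛ f) ⊕ (𝟏 ⊕ ⊝ M j) ⊛ (M (n ℕ.* j) ⊛ f)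
    ≈⟨ ⊕-cong (geometric j f n) S.refl ⟩
  f ⊕ ⊝ (M (n ℕ.* j) ⊛ f) ⊕ (𝟏 ⊕ ⊝ M j) ⊛ (M (n ℕ.* j) ⊛ f)
    ≈⟨ identity 3 (λ f l m → f :+ :- (l :* f) :+ (κ (+ 1) :+ :- m) :* (l :* f) := f :+ :- ((m :* l) :* f)) (f ∷ M (n ℕ.* j) ∷ M j ∷ []) ⟩
  f ⊕ ⊝ ((M j ⊛ M (n ℕ.* j)) ⊛ f)
    ≈⟨ ⊕-cong S.refl (⊝-cong (⊛-cong (M-+ j (n ℕ.* j)) S.refl)) ⟩
  f ⊕ ⊝ (M (suc n ℕ.* j) ⊛ f) ∎
  where open ≈R

-- Modulo `qⁿ` the division is the geometric sum with `n` summands; its remainder is divisible by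
-- `qⁿ`.
divOneMinus-⊛ : ∀ j f → (𝟏 ⊕ ⊝ M (suc j)) ⊛ divOneMinus (suc j) f ≈ f
divOneMinus-⊛ j f = ≈[]⇒≈ λ n → []-trans ([]-⊛ []-refl (truncate n)) ([]-trans (≈⇒≈[] (geometric (suc j) f n))
  ([]-trans ([]-⊕ []-refl ([]-⊝ ([]-⊛ (M-small (n ℕ.* suc j) n (ℕP.m≤m*n n (suc j))) []-refl)))
  (≈⇒≈[] (identity 1 (λ f → f :+ :- (κ (+ 0) :* f) := f) (f ∷ [])))))
  where
  truncate : ∀ n → divOneMinus (suc j) f ≈[ n ] ⨁ n (λ t → M (t ℕ.* suc j) ⊛ f)
  truncate n = tr λ i i<n → trans (sumℤ-upTo _ (suc i)) (trans (∑-cong (suc i) λ t _ → sym (shift-at (t ℕ.* suc j) f i))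
    (sym (∑-extend (λ t → (M (t ℕ.* suc j) ⊛ f) i) i<n λ t i<t → M-⊛-< (t ℕ.* suc j) f i (ℕP.<-≤-trans i<t (ℕP.m≤m*n t (suc j))))))

times : Series → ℕ → Series → Series
times a e = iter e (a ⊛_)

times-cong : ∀ {a b f g} e → a ≈ b → f ≈ g → times a e f ≈ times b e g
times-cong zero    p q = q
times-cong (suc e) p q = ⊛-cong p (times-cong e p q)

[]-times : ∀ {a b f g n} e → a ≈[ n ] b → f ≈[ n ] g → times a e f ≈[ n ] times b e g
[]-times zero    p q = q
[]-times (suc e) p q = []-⊛ p ([]-times e p q)

times-⊛ˡ : ∀ a e f g → g ⊛ times a e f ≈ times a e (g ⊛ f)
times-⊛ˡ a zero    f g = S.refl
times-⊛ˡ a (suc e) f g = S.trans (identity 3 (λ a g h → g :* (a :* h) := a :* (g :* h)) (a ∷ g ∷ times a e f ∷ [])) (⊛-cong S.refl (times-⊛ˡ a e f g))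

times-⊛ʳ : ∀ a e f g → times a e f ⊛ g ≈ f ⊛ times a e g
times-⊛ʳ a e f g = S.trans (pw (⊛-comm _ g)) (S.trans (times-⊛ˡ a e f g) (S.trans (times-cong e S.refl (pw (⊛-comm g f))) (S.sym (times-⊛ˡ a e g f))))

times-product : ∀ a b e f → times (a ⊛ b) e f ≈ times a e (times b e f)
times-product a b zero    f = S.refl
times-product a b (suc e) f = S.trans (⊛-cong S.refl (times-product a b e f)) (S.trans (pw (⊛-assoc a b _)) (⊛-cong S.refl (times-⊛ˡ a e (times b e f) b)))

powOneMinus-+ : ∀ e j f → powOneMinus (+ e) j f ≈ times (𝟏 ⊕ ⊝ M j) e f
powOneMinus-+ zero    j f = S.refl
powOneMinus-+ (suc e) j f = S.trans (mulOneMinus-⊛ j _) (⊛-cong S.refl (powOneMinus-+ e j f))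

powOneMinus-- : ∀ e j f → times (𝟏 ⊕ ⊝ M (suc j)) e (iter e (divOneMinus (suc j)) f) ≈ f
powOneMinus-- zero    j f = S.refl
powOneMinus-- (suc e) j f = S.trans (times-⊛ˡ a e _ a) (S.trans (times-cong e S.refl (divOneMinus-⊛ j _)) (powOneMinus-- e j f))
  where
  a : Series
  a = 𝟏 ⊕ ⊝ M (suc j)

-- The fold applies the last entry of the list first, so induction on the number of factors has to
-- peel off the innermost one.
fold-suc : ∀ (h : ℕ → Series → Series) f n → List.foldr h f (List.map suc (List.upTo (suc n))) ≡ List.foldr h (h (suc n) f) (List.map suc (List.upTo n))
fold-suc h f n = trans (cong (List.foldr h f) (trans (ListP.map-upTo suc (suc n)) (trans (sym (ListP.applyUpTo-∷ʳ suc n)) (cong (List._∷ʳ suc n) (sym (ListP.map-upTo suc n))))))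
  (ListP.foldr-∷ʳ h f (suc n) (List.map suc (List.upTo n)))

times-1 : ∀ e f → times 𝟏 e f ≈ f
times-1 zero    f = S.refl
times-1 (suc e) f = S.trans (⊛-idˡ _) (times-1 e f)

etaFactor-+ : ∀ n k e f → etaFactorUpTo n (k , + e) f ≈ times (Poch k n) e f
etaFactor-+ zero    k e f = S.sym (times-1 e f)
etaFactor-+ (suc n) k e f = S.trans (pw λ i → cong (λ g → g i) (fold-suc (λ m g → powOneMinus (+ e) (k ℕ.* m) g) f n)) (S.trans (etaFactor-+ n k e _)
  (S.trans (times-cong e S.refl (powOneMinus-+ e (k ℕ.* suc n) f)) (S.sym (times-product _ _ e f))))

etaFactor-- : ∀ n k e f → times (Poch (suc k) n) (suc e) (etaFactorUpTo n (suc k , -[1+ e ]) f) ≈ f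
etaFactor-- zero    k e f = times-1 (suc e) f
etaFactor-- (suc n) k e f = S.trans (times-cong (suc e) (pw (⊛-comm (Poch (suc k) n) _)) (pw λ i → cong (λ g → g i) (fold-suc (λ m g → powOneMinus -[1+ e ] (suc k ℕ.* m) g) f n)))
  (S.trans (times-product _ (Poch (suc k) n) (suc e) _) (S.trans (times-cong (suc e) S.refl (etaFactor-- n k e _)) (powOneMinus-- (suc e) _ f)))

-- The quotient is characterised by `denominator · f = numerator`, so no inverse series has to be
-- formed. `P k` is either the full product `dil k E` or its truncation `Poch k n`.
numerator denominator : (ℕ → Series) → List (ℕ × ℤ) → Series
numerator P []                     = 𝟏
numerator P ((k , + e) ∷ fs)       = times (P k) e (numerator P fs)
numerator P ((k , -[1+ e ]) ∷ fs)  = numerator P fs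
denominator P []                    = 𝟏
denominator P ((k , + e) ∷ fs)      = denominator P fs
denominator P ((k , -[1+ e ]) ∷ fs) = times (P k) (suc e) (denominator P fs)

AllPositive : List (ℕ × ℤ) → Set
AllPositive []                 = ⊤
AllPositive ((zero , _) ∷ fs)  = ⊥
AllPositive ((suc _ , _) ∷ fs) = AllPositive fs

truncated-eta : ∀ n fs → AllPositive fs → denominator (λ k → Poch k n) fs ⊛ List.foldr (etaFactorUpTo n) one fs ≈ numerator (λ k → Poch k n) fs
truncated-eta n [] _ = S.trans (⊛-idˡ one) (pw λ { zero → refl ; (suc i) → refl })
truncated-eta n ((suc k , + e) ∷ fs) ⁺ = S.trans (⊛-cong S.refl (etaFactor-+ n (suc k) e _)) (S.trans (times-⊛ˡ _ e _ _) (times-cong e S.refl (truncated-eta n fs ⁺)))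
truncated-eta n ((suc k , -[1+ e ]) ∷ fs) ⁺ = S.trans (times-⊛ʳ _ (suc e) _ _) (S.trans (⊛-cong S.refl (etaFactor-- n k e _)) (truncated-eta n fs ⁺))

[]-numerator : ∀ n fs → AllPositive fs → numerator (λ k → dil k E) fs ≈[ suc n ] numerator (λ k → Poch k n) fs
[]-numerator n [] _ = []-refl
[]-numerator n ((suc k , + e) ∷ fs) ⁺ = []-times e (dilE-Poch k n) ([]-numerator n fs ⁺)
[]-numerator n ((suc k , -[1+ e ]) ∷ fs) ⁺ = []-numerator n fs ⁺

[]-denominator : ∀ n fs → AllPositive fs → denominator (λ k → dil k E) fs ≈[ suc n ] denominator (λ k → Poch k n) fs
[]-denominator n [] _ = []-refl
[]-denominator n ((suc k , + e) ∷ fs) ⁺ = []-denominator n fs ⁺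
[]-denominator n ((suc k , -[1+ e ]) ∷ fs) ⁺ = []-times (suc e) (dilE-Poch k n) ([]-denominator n fs ⁺)

-- At the index `N` the truncated products may be replaced by the full ones, since they agree up to
-- `N`; the denominator, having a non-zero constant term, is then cancelled modulo `q^(N+1)`.
etaQuotient : ∀ s fs {f} → AllPositive fs → denominator (λ k → dil k E) fs 0 ≢ + 0 →
  denominator (λ k → dil k E) fs ⊛ f ≈ numerator (λ k → dil k E) fs → ∀ n → etaQuotCoeff s fs n ≡ (M s ⊛ f) n
etaQuotient s fs {f} ⁺ d₀ h n = trans (cong (λ c → if s ℕ.≤ᵇ n then c else + 0) (prod (n ∸ s))) (sym (shift-at s f n))
  where
  prod : ∀ N → prodCoeff fs N ≡ f N
  prod N = coeff< (unit-cancel (denominator (λ k → dil k E) fs) d₀ ([]-trans ([]-⊛ ([]-denominator N fs ⁺) []-refl)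
    ([]-trans (≈⇒≈[] (truncated-eta N fs ⁺)) ([]-trans ([]-sym ([]-numerator N fs ⁺)) (≈⇒≈[] (S.sym h)))))) N ℕP.≤-refl

-- Representation numbers

∑-reverse : ∀ n (f : ℕ → ℤ) → ∑ n (λ i → f (n ∸ i)) ≡ ∑ n (λ i → f (suc i))
∑-reverse zero    f = refl
∑-reverse (suc n) f = trans (∑-suc n _) (trans (cong (_+_ (f (suc n))) (∑-reverse n f)) (ℤP.+-comm (f (suc n)) _))

-- The list runs from `-n` to `n`. Its first `n` entries are the negative ones in descending
-- absolute value, which `∑-reverse` matches with the positive ones.
sumℤ-range : ∀ n (h : ℤ → ℤ) (h′ : ℕ → ℤ) → (∀ v → h v ≡ h′ ℤ.∣ v ∣) →
  sumℤ (List.map h (range n)) ≡ ∑ (suc n) (λ m → two m * h′ m)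
sumℤ-range n h h′ p = begin
  sumℤ (List.map h (range n))
    ≡⟨ cong sumℤ (sym (ListP.map-∘ {g = h} {f = λ i → + i - + n} (List.upTo (suc (n ℕ.+ n))))) ⟩
  sumℤ (List.map (λ i → h (+ i - + n)) (List.upTo (suc (n ℕ.+ n))))
    ≡⟨ sumℤ-upTo _ (suc (n ℕ.+ n)) ⟩
  ∑ (suc (n ℕ.+ n)) (λ i → h (+ i - + n))
    ≡⟨ cong (λ l → ∑ l (λ i → h (+ i - + n))) (sym (ℕP.+-suc n n)) ⟩
  ∑ (n ℕ.+ suc n) (λ i → h (+ i - + n))
    ≡⟨ ∑-++ n (suc n) _ ⟩
  ∑ n (λ i → h (+ i - + n)) + ∑ (suc n) (λ i → h (+ (n ℕ.+ i) - + n))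
    ≡⟨ cong₂ _+_ (trans (∑-cong n λ i i<n → trans (cong h (below i (ℕP.<⇒≤ i<n))) (trans (p (- + (n ∸ i))) (cong h′ (ℤP.∣-i∣≡∣i∣ (+ (n ∸ i)))))) (∑-reverse n h′))
                 (trans (∑-cong (suc n) λ i _ → trans (cong h (above i)) (p (+ i))) (∑-suc n h′)) ⟩
  ∑ n (λ i → h′ (suc i)) + (h′ 0 + ∑ n (λ i → h′ (suc i)))
    ≡⟨ lemma (∑ n (λ i → h′ (suc i))) (h′ 0) ⟩
  + 1 * h′ 0 + + 2 * ∑ n (λ i → h′ (suc i))
    ≡⟨ cong (_+_ (+ 1 * h′ 0)) (sym (∑-*ˡ n (+ 2) _)) ⟩
  + 1 * h′ 0 + ∑ n (λ i → + 2 * h′ (suc i))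
    ≡⟨ sym (∑-suc n _) ⟩
  ∑ (suc n) (λ m → two m * h′ m) ∎
  where
  open ≡-Reasoning
  lemma : ∀ a b → a + (b + a) ≡ + 1 * b + + 2 * a
  lemma = solve-∀
  below : ∀ i → i ≤ n → + i - + n ≡ - + (n ∸ i)
  below i i≤n = trans (ℤP.m-n≡m⊖n i n) (ℤP.⊖-≤ i≤n)
  above : ∀ i → + (n ℕ.+ i) - + n ≡ + i
  above i = trans (cong (_- + n) (ℤP.pos-+ n i)) (cancel-lemma (+ n) (+ i))
    where
    cancel-lemma : ∀ a b → a + b - a ≡ b
    cancel-lemma = solve-∀

sumℤ-++ : ∀ xs ys → sumℤ (xs List.++ ys) ≡ sumℤ xs + sumℤ ys
sumℤ-++ []       ys = sym (ℤP.+-identityˡ _)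
sumℤ-++ (a ∷ xs) ys = trans (cong (_+_ a) (sumℤ-++ xs ys)) (sym (ℤP.+-assoc a _ _))

sumℤ-concatMap : ∀ {A B : Set} (h : B → ℤ) (f : A → List B) xs → sumℤ (List.map h (List.concatMap f xs)) ≡ sumℤ (List.map (λ a → sumℤ (List.map h (f a))) xs)
sumℤ-concatMap h f []       = refl
sumℤ-concatMap h f (a ∷ xs) = trans (cong sumℤ (ListP.map-++ h (f a) _)) (trans (sumℤ-++ (List.map h (f a)) _) (cong (_+_ (sumℤ (List.map h (f a)))) (sumℤ-concatMap h f xs)))

sumℤ-cong : ∀ {A : Set} {g h : A → ℤ} xs → (∀ a → g a ≡ h a) → sumℤ (List.map g xs) ≡ sumℤ (List.map h xs)
sumℤ-cong xs p = cong sumℤ (ListP.map-cong p xs)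

sumℤ-grid : ∀ r (h : ℤ × ℤ × ℤ × ℤ → ℤ) →
  sumℤ (List.map h (List.concatMap (λ a → List.concatMap (λ b → List.concatMap (λ c → List.map (λ d → (a , b , c , d)) r) r) r) r)) ≡
  sumℤ (List.map (λ a → sumℤ (List.map (λ b → sumℤ (List.map (λ c → sumℤ (List.map (λ d → h (a , b , c , d)) r)) r)) r)) r)
sumℤ-grid r h = trans (sumℤ-concatMap h _ r) (sumℤ-cong r λ a → trans (sumℤ-concatMap h _ r) (sumℤ-cong r λ b →
  trans (sumℤ-concatMap h _ r) (sumℤ-cong r λ c → cong sumℤ (sym (ListP.map-∘ r)))))

length-filter : ∀ {A : Set} {P : A → Set} (P? : ∀ a → Dec (P a)) xs → + List.length (List.filter P? xs) ≡ sumℤ (List.map (λ a → if ⌊ P? a ⌋ then + 1 else + 0) xs)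
length-filter P? []       = refl
length-filter P? (a ∷ xs) with P? a
... | yes _ = trans (ℤP.pos-+ 1 (List.length (List.filter P? xs))) (cong (_+_ (+ 1)) (length-filter P? xs))
... | no  _ = trans (length-filter P? xs) (sym (ℤP.+-identityˡ _))

indicator-δ : ∀ n e v → v ≡ + e → (if ⌊ + n ℤ.≟ v ⌋ then + 1 else + 0) ≡ δ e n
indicator-δ n e v refl with + n ℤ.≟ + e
... | yes refl = sym (δ-refl e)
... | no  n≢e  = sym (δ-≢ {e} {n} λ { refl → n≢e refl })

theta-step : ∀ a e G n → (M e ⊛ (dil (suc a) φ ⊛ G)) n ≡ ∑ (suc n) (λ m → two m * (M (e ℕ.+ m ℕ.* m ℕ.* suc a) ⊛ G) n)
theta-step a e G n = trans (coeff< ([]-⊛ []-refl ([]-⊛ partial []-refl)) n ℕP.≤-refl) (trans (coeff expand n) (∑-cong (suc n) λ m _ → con-⊛ (two m) _ n))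
  where
  summand : ℕ → Series
  summand m = con (two m) ⊛ M (m ℕ.* m ℕ.* suc a)
  partial : dil (suc a) φ ≈[ suc n ] ⨁ (suc n) summand
  partial = tr λ i i≤n → trans (dil-sparse a two _ (suc n) i x≤x² i≤n) (∑-cong (suc n) λ m _ →
    sym (trans (con-⊛ (two m) (M (m ℕ.* m ℕ.* suc a)) i) (cong (two m *_) (M-δ (m ℕ.* m ℕ.* suc a) i))))
  expand : M e ⊛ (⨁ (suc n) summand ⊛ G) ≈ ⨁ (suc n) (λ m → con (two m) ⊛ (M (e ℕ.+ m ℕ.* m ℕ.* suc a) ⊛ G))
  expand = S.trans (identity 3 (λ e s g → e :* (s :* g) := (e :* g) :* s) (M e ∷ ⨁ (suc n) summand ∷ G ∷ [])) (S.trans (S.sym (⨁-⊛ (suc n) (M e ⊛ G) summand))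
    (⨁-cong (suc n) λ m _ → S.trans (identity 4 (λ e g c k → (e :* g) :* (c :* k) := c :* ((e :* k) :* g)) (M e ∷ G ∷ con (two m) ∷ M (m ℕ.* m ℕ.* suc a) ∷ []))
      (⊛-cong S.refl (⊛-cong (M-+ e _) S.refl))))

square-abs : ∀ a v → + a * v * v ≡ + (ℤ.∣ v ∣ ℕ.* ℤ.∣ v ∣ ℕ.* a)
square-abs a v = trans (ℤP.*-assoc (+ a) v v) (trans (cong (_*_ (+ a)) (square v)) (trans (sym (ℤP.pos-* a (ℤ.∣ v ∣ ℕ.* ℤ.∣ v ∣))) (cong +_ (ℕP.*-comm a _))))
  where
  square : ∀ v → v * v ≡ + (ℤ.∣ v ∣ ℕ.* ℤ.∣ v ∣)
  square (+ m)    = sym (ℤP.pos-* m m)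
  square -[1+ m ] = refl

-- Sums out one variable. `K e` counts the ways to complete the partial sum `e` to `n` with the
-- remaining variables, as a coefficient of `qᵉ · G`; one more variable multiplies `G` by a theta
-- series. The iteration starts with the last variable, where `G` is `𝟏`.
count-step : ∀ n a G (K : ℤ → ℤ) → (∀ v e → v ≡ + e → K v ≡ (M e ⊛ G) n) →
  ∀ v e → v ≡ + e → sumℤ (List.map (λ x → K (v + + suc a * x * x)) (range n)) ≡ (M e ⊛ (dil (suc a) φ ⊛ G)) n
count-step n a G K h v e v≡e = trans (sumℤ-range n _ (λ m → (M (e ℕ.+ m ℕ.* m ℕ.* suc a) ⊛ G) n)
    (λ x → h _ _ (trans (cong₂ _+_ v≡e (square-abs (suc a) x)) (sym (ℤP.pos-+ e _))))) (sym (theta-step a e G n))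

N-theta : ∀ a b c d n → + N (suc a) (suc b) (suc c) (suc d) n ≡ (dil (suc a) φ ⊛ (dil (suc b) φ ⊛ (dil (suc c) φ ⊛ dil (suc d) φ))) n
N-theta a b c d n = trans (length-filter test (box4 n)) (trans (sumℤ-grid (range n) (λ v → if ⌊ test v ⌋ then + 1 else + 0)) (trans
  (sumℤ-cong {h = λ x → K₃ (+ 0 + + suc a * x * x)} (range n) λ x → cong K₃ (sym (ℤP.+-identityˡ (+ suc a * x * x))))
  (trans (count-step n a _ K₃ (count-step n b _ K₂ (count-step n c _ K₁ (count-step n d 𝟏 K₀ base))) (+ 0) 0 refl)
    (coeff (S.trans (⊛-idˡ _) (⊛-cong S.refl (⊛-cong S.refl (⊛-cong S.refl (identity 1 (λ f → f :* κ (+ 1) := f) (dil (suc d) φ ∷ [])))))) n))))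
  where
  K₀ K₁ K₂ K₃ : ℤ → ℤ
  K₀ v = if ⌊ + n ℤ.≟ v ⌋ then + 1 else + 0
  K₁ v = sumℤ (List.map (λ x → K₀ (v + + suc d * x * x)) (range n))
  K₂ v = sumℤ (List.map (λ x → K₁ (v + + suc c * x * x)) (range n))
  K₃ v = sumℤ (List.map (λ x → K₂ (v + + suc b * x * x)) (range n))
  test : ((x₁ , x₂ , x₃ , x₄) : ℤ × ℤ × ℤ × ℤ) → Dec (+ n ≡ + suc a * x₁ * x₁ + + suc b * x₂ * x₂ + + suc c * x₃ * x₃ + + suc d * x₄ * x₄)
  test (x₁ , x₂ , x₃ , x₄) = + n ℤ.≟ (+ suc a * x₁ * x₁ + + suc b * x₂ * x₂ + + suc c * x₃ * x₃ + + suc d * x₄ * x₄)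
  base : ∀ v e → v ≡ + e → K₀ v ≡ (M e ⊛ 𝟏) n
  base v e v≡e = trans (indicator-δ n e v v≡e) (trans (sym (M-δ e n)) (sym (coeff (identity 1 (λ f → f :* κ (+ 1) := f) (M e ∷ [])) n)))

-- Relations between theta functions

from-difference : ∀ {f g} → f ⊕ ⊝ g ≈ con (+ 0) → f ≈ g
from-difference p = ≈[]⇒≈ λ n → ⊖-0 (≈⇒≈[] p)

to-difference : ∀ {f g} → f ≈ g → f ⊕ ⊝ g ≈ con (+ 0)
to-difference {f} {g} p = S.trans (⊕-cong p S.refl) (identity 1 (λ g → g :+ :- g := κ (+ 0)) (g ∷ []))

a₁⇝ : factor (+ 1) (+ 4) χ₋₄ 𝟙 ⇝ φ ⊛ φ
a₁⇝ = as L₄≈φ²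

aˡ⇝ : ∀ i → factor (+ 1) (+ 4) (D (suc i) χ₋₄) 𝟙 ⇝ dil (suc i) φ ⊛ dil (suc i) φ
aˡ⇝ i = as (S.trans (factor-Dˡ i (+ 1) (+ 4) χ₋₄ 𝟙) (S.trans (dil-cong (suc i) L₄≈φ²) (dil-⊛ (suc i) φ φ)))

a₅⇝ : factor (+ 1) (+ 4) χ₋₄ (D 5 𝟙) ⇝ dil 5 φ ⊛ dil 5 φ
a₅⇝ = as (S.trans (factor-Dʳ 4 (+ 1) (+ 4) χ₋₄ 𝟙) (S.trans (dil-cong 5 L₄≈φ²) (dil-⊛ 5 φ φ)))

a₁₀⇝ : factor (+ 1) (+ 4) (D 2 χ₋₄) (D 5 𝟙) ⇝ dil 10 φ ⊛ dil 10 φ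
a₁₀⇝ = as (S.trans (factor-Dˡ 1 (+ 1) (+ 4) χ₋₄ (D 5 𝟙)) (S.trans (dil-cong 2 (S.trans (_⇝_.value a₅⇝) (S.sym (dil-⊛ 5 φ φ))))
  (S.trans (dil-∘ 1 4 (φ ⊛ φ)) (dil-⊛ 10 φ φ))))

L₈≈φφ₂ : L₈ ≈ φ ⊛ dil 2 φ
L₈≈φφ₂ = square-injective 0 L₈ (φ ⊛ dil 2 φ) (λ e → case trans (sym (cong (_+ + 1) (lam-0 (+ 1) _))) e of λ ()) (from-difference (S.trans
  (identity 3 (λ l x z → l :* l :+ :- ((x :* z) :* (x :* z)) := κ (+ 1) :* (l :* l) :+ (κ (- + 1) :* ((x :* x) :* (z :* z)) :+ κ (+ 0))) (L₈ ∷ φ ∷ dil 2 φ ∷ []))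
  (vanishing (l₁ ⊗ l₁ ∷ a₁⇝ ⊗ aˡ⇝ 1 ∷ []) Mod8.L₈-identity null)))
  where
  l₁ : factor (+ 1) (+ 2) χ₋₈ 𝟙 ⇝ L₈
  l₁ = as S.refl

l₁⇝ : factor (+ 1) (+ 2) χ₋₈ 𝟙 ⇝ φ ⊛ dil 2 φ
l₁⇝ = as L₈≈φφ₂

l₅ˡ⇝ : factor (+ 1) (+ 2) (D 5 χ₋₈) 𝟙 ⇝ dil 5 φ ⊛ dil 10 φ
l₅ˡ⇝ = as (S.trans (factor-Dˡ 4 (+ 1) (+ 2) χ₋₈ 𝟙) (S.trans (dil-cong 5 L₈≈φφ₂) (S.trans (dil-⊛ 5 φ (dil 2 φ)) (⊛-cong S.refl (dil-∘ 4 1 φ)))))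

l₅ʳ⇝ : factor (+ 1) (+ 2) χ₋₈ (D 5 𝟙) ⇝ dil 5 φ ⊛ dil 10 φ
l₅ʳ⇝ = as (S.trans (factor-Dʳ 4 (+ 1) (+ 2) χ₋₈ 𝟙) (S.trans (dil-cong 5 L₈≈φφ₂) (S.trans (dil-⊛ 5 φ (dil 2 φ)) (⊛-cong S.refl (dil-∘ 4 1 φ)))))

X⇝ : factor (+ 1) (+ 1) χ₋₄₀ 𝟙 ⇝ X₄₀
X⇝ = as S.refl

Y⇝ : factor (+ 0) (+ 1) χ₋₈ χ₁ ⇝ Y₄₀
Y⇝ = as S.refl

X₂₀⇝ : factor (+ 1) (+ 1) χ₋₂₀ 𝟙 ⇝ X₂₀
X₂₀⇝ = as S.refl

Y₂₀⇝ : factor (+ 0) (+ 1) χ₋₄ χ₁ ⇝ Y₂₀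
Y₂₀⇝ = as S.refl

X₂₀₂⇝ : factor (+ 1) (+ 1) (D 2 χ₋₂₀) 𝟙 ⇝ dil 2 X₂₀
X₂₀₂⇝ = as (factor-Dˡ 1 (+ 1) (+ 1) χ₋₂₀ 𝟙)

Y₂₀₂⇝ : factor (+ 0) (+ 1) (D 2 χ₋₄) χ₁ ⇝ dil 2 Y₂₀
Y₂₀₂⇝ = as (factor-Dˡ 1 (+ 0) (+ 1) χ₋₄ χ₁)

-- The right side is the sum of the theta series of the two reduced forms of discriminant -40,
-- `x² + 10y²` and `2x² + 5y²`.
X₄₀-theta : 𝟐 ⊛ X₄₀ ≈ φ ⊛ dil 10 φ ⊕ dil 2 φ ⊛ dil 5 φ
X₄₀-theta = square-injective 0 (𝟐 ⊛ X₄₀) (φ ⊛ dil 10 φ ⊕ dil 2 φ ⊛ dil 5 φ)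
  (λ e → case trans (sym (cong₂ _+_ (cong (_*_ (+ 2)) (lam-0 (+ 1) _)) (⊕-at (φ ⊛ dil 10 φ) (dil 2 φ ⊛ dil 5 φ) 0))) e of λ ()) (from-difference (S.trans
  (identity 5 (λ R x z X Z → (κ (+ 2) :* R) :* (κ (+ 2) :* R) :+ :- ((x :* Z :+ z :* X) :* (x :* Z :+ z :* X))
    := κ (+ 4) :* (R :* R) :+ (κ (- + 1) :* ((x :* x) :* (Z :* Z)) :+ (κ (- + 1) :* ((z :* z) :* (X :* X)) :+ (κ (- + 2) :* ((x :* z) :* (X :* Z)) :+ κ (+ 0)))))
    (X₄₀ ∷ φ ∷ dil 2 φ ∷ dil 5 φ ∷ dil 10 φ ∷ []))
  (vanishing (X⇝ ⊗ X⇝ ∷ a₁⇝ ⊗ aˡ⇝ 9 ∷ aˡ⇝ 1 ⊗ aˡ⇝ 4 ∷ l₁⇝ ⊗ l₅ˡ⇝ ∷ []) Mod40.X-identity null)))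

-- The difference of the same theta series. Both sides begin with `2q`, so the witness for the sign
-- is the index 1.
Y₄₀-theta : 𝟐 ⊛ Y₄₀ ≈ φ ⊛ dil 10 φ ⊕ ⊝ (dil 2 φ ⊛ dil 5 φ)
Y₄₀-theta = square-injective 1 (𝟐 ⊛ Y₄₀) (φ ⊛ dil 10 φ ⊕ ⊝ (dil 2 φ ⊛ dil 5 φ))
  (λ e → case trans (sym (cong₂ _+_ (trans (con-⊛ (+ 2) Y₄₀ 1) (cong (_*_ (+ 2)) (lam-1 (+ 0) _)))
    (trans (⊕-at (φ ⊛ dil 10 φ) (⊝ (dil 2 φ ⊛ dil 5 φ)) 1) (cong (_+_ (+ 2)) (⊝-at (dil 2 φ ⊛ dil 5 φ) 1))))) e of λ ()) (from-difference (S.trans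
  (identity 5 (λ R x z X Z → (κ (+ 2) :* R) :* (κ (+ 2) :* R) :+ :- ((x :* Z :+ :- (z :* X)) :* (x :* Z :+ :- (z :* X)))
    := κ (+ 4) :* (R :* R) :+ (κ (- + 1) :* ((x :* x) :* (Z :* Z)) :+ (κ (- + 1) :* ((z :* z) :* (X :* X)) :+ (κ (+ 2) :* ((x :* z) :* (X :* Z)) :+ κ (+ 0)))))
    (Y₄₀ ∷ φ ∷ dil 2 φ ∷ dil 5 φ ∷ dil 10 φ ∷ []))
  (vanishing (Y⇝ ⊗ Y⇝ ∷ a₁⇝ ⊗ a₁₀⇝ ∷ aˡ⇝ 1 ⊗ a₅⇝ ∷ l₁⇝ ⊗ l₅ʳ⇝ ∷ []) Mod8×5.Y-identity null)))

-- Polynomial relations between the theta functions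

Poly : Set
Poly = Polynomial 12

infixl 8 _·_
_·_ : ∀ {m} → ℕ → Polynomial m → Polynomial m
c · p = κ (+ c) :* p

infix 10 _² _³ _⁴ _⁵ _⁶
_² _³ _⁴ _⁵ _⁶ : ∀ {m} → Polynomial m → Polynomial m
p ² = p :* p
p ³ = p :* p :* p
p ⁴ = p :* p :* p :* p
p ⁵ = p :* p :* p :* p :* p
p ⁶ = p :* p :* p :* p :* p :* p

ρ : Vec Series 12
ρ = φ ∷ φ′ ∷ dil 5 φ ∷ dil 5 φ′ ∷ dil 2 φ ∷ dil 10 φ ∷ dil 2 φ′ ∷ dil 10 φ′
  ∷ dil 4 ψ ∷ M 2 ⊛ dil 20 ψ ∷ q ⊛ (dil 2 ψ ⊛ dil 10 ψ) ∷ 𝟐 ⊛ q ∷ []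

dil-⟦⟧ : ∀ l {m} (p : Polynomial m) (ρ ρ′ : Vec Series m) → (∀ i → dil l (Vec.lookup ρ i) ≈ Vec.lookup ρ′ i) → dil l (⟦ p ⟧ ρ) ≈ ⟦ p ⟧ ρ′
dil-⟦⟧ l (Ring.op Ring.[+] p p′) ρ ρ′ h = S.trans (dil-⊕ l _ _) (⊕-cong (dil-⟦⟧ l p ρ ρ′ h) (dil-⟦⟧ l p′ ρ ρ′ h))
dil-⟦⟧ l (Ring.op Ring.[*] p p′) ρ ρ′ h = S.trans (dil-⊛ l _ _) (⊛-cong (dil-⟦⟧ l p ρ ρ′ h) (dil-⟦⟧ l p′ ρ ρ′ h))
dil-⟦⟧ l (κ c)            ρ ρ′ h = dil-con l c
dil-⟦⟧ l (Ring.var i)     ρ ρ′ h = h i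
dil-⟦⟧ l (p Ring.:^ zero)  ρ ρ′ h = dil-con l (+ 1)
dil-⟦⟧ l (p Ring.:^ suc e) ρ ρ′ h = S.trans (dil-⊛ l _ _) (⊛-cong (dil-⟦⟧ l p ρ ρ′ h) (dil-⟦⟧ l (p Ring.:^ e) ρ ρ′ h))
dil-⟦⟧ l (:- p)           ρ ρ′ h = S.trans (dil-⊝ l _) (⊝-cong (dil-⟦⟧ l p ρ ρ′ h))

-- A relation is kept as syntax, so that membership in the ideal of known relations becomes a
-- comparison of normal forms: `by` accepts a combination built with `⊞` and `⊠`, and `divide` also
-- removes a factor that is not the zero series.
record Zero (p : Poly) : Set where
  constructor zeroes
  field holds : ⟦ p ⟧ ρ ≈ con (+ 0)
open Zero

same : ∀ {p p′} → {T (is-just (Ring.normalise p Ring.≟N Ring.normalise p′))} → ⟦ p ⟧ ρ ≈ ⟦ p′ ⟧ ρ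
same {p} {p′} {t} with Ring.normalise p Ring.≟N Ring.normalise p′
... | just e = S.trans (S.sym (Ring.correct p ρ)) (S.trans (Ring.⟦ e ⟧N-cong ρ) (Ring.correct p′ ρ))

infixl 5 _⊞_
_⊞_ : ∀ {p p′} → Zero p → Zero p′ → Zero (p :+ p′)
zeroes h ⊞ zeroes h′ = zeroes (S.trans (⊕-cong h h′) (identity 0 (κ (+ 0) :+ κ (+ 0) := κ (+ 0)) []))

infix 6 _⊠_
_⊠_ : ∀ c {p} → Zero p → Zero (c :* p)
c ⊠ zeroes h = zeroes (S.trans (⊛-cong S.refl h) (identity 1 (λ c → c :* κ (+ 0) := κ (+ 0)) (⟦ c ⟧ ρ ∷ [])))

by : ∀ {p p′} → {T (is-just (Ring.normalise p Ring.≟N Ring.normalise p′))} → Zero p′ → Zero p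
by {p} {p′} {t} (zeroes h) = zeroes (S.trans (same {p} {p′} {t}) h)

divide : ∀ m k {p p′} → ⟦ m ⟧ ρ k ≢ + 0 → {T (is-just (Ring.normalise (m :* p) Ring.≟N Ring.normalise p′))} → Zero p′ → Zero p
divide m k {p} {p′} m≢0 {t} (zeroes h) = zeroes (nz-0 k (⟦ m ⟧ ρ) (⟦ p ⟧ ρ) m≢0 (S.trans (same {m :* p} {p′} {t}) h))

square-root : ∀ p p′ k → ⟦ p ⟧ ρ k + ⟦ p′ ⟧ ρ k ≢ + 0 → Zero (p :* p :- p′ :* p′) → Zero (p :- p′)
square-root p p′ k nz (zeroes h) = zeroes (to-difference (square-injective k (⟦ p ⟧ ρ) (⟦ p′ ⟧ ρ) nz (from-difference h)))

-- x = φ(q), y = φ(-q), z = φ(q²), j = φ(-q²), and the capitals are the same at q⁵; further s = ψ(q⁴), t = q²ψ(q²⁰),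
-- r = qψ(q²)ψ(q¹⁰) and k = 2q.
x y X Y z Z j J s t r k : Poly
x = Ring.var (# 0)
y = Ring.var (# 1)
X = Ring.var (# 2)
Y = Ring.var (# 3)
z = Ring.var (# 4)
Z = Ring.var (# 5)
j = Ring.var (# 6)
J = Ring.var (# 7)
s = Ring.var (# 8)
t = Ring.var (# 9)
r = Ring.var (# 10)
k = Ring.var (# 11)

Quartic : ∀ {m} (x y X Y : Polynomial m) → Polynomial m
Quartic x y X Y = x ⁴ :+ y ⁴ :- 6 · x ² :* X ² :- 6 · y ² :* Y ² :+ 5 · X ⁴ :+ 5 · Y ⁴

-- In terms of `q`: `n = φ(-q²)φ(-q¹⁰)` and `η = 4q³ψ(q⁴)ψ(q²⁰)`; `u = 8qψ(q⁴)²` and `a = 2φ(q²)²`,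
-- with `v` and `A` their dilations by 5; `w = 4qW(q⁴)`. Finally `ν`, `π` and `ω` turn out to be
-- `4XYη`, `4XYzZ` and `4X²n`, which makes these products rational in `x`, `y`, `X`, `Y`.
n η u v o a A w ν π ω Q Q₂ : Poly
n = j :* J
η = 2 · k :* s :* t
u = x :* x :- y :* y
v = X :* X :- Y :* Y
o = x :* X :- y :* Y
a = x :* x :+ y :* y
A = X :* X :+ Y :* Y
w = x :* Y :- y :* X
ν = X :* (y :* (X :* X :- x :* x) :+ 2 · x :* X :* Y) :- Y :* (x :* (Y :* Y :- y :* y) :+ 2 · y :* X :* Y)
π = X :* (y :* (X :* X :- x :* x) :+ 2 · x :* X :* Y) :+ Y :* (x :* (Y :* Y :- y :* y) :+ 2 · y :* X :* Y)
ω = x :* Y ³ :+ 5 · y :* X :* Y ² :- x :* y ² :* Y :- y ³ :* X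
Q = x ² :* Y ² :- x ² :* y ² :+ X ² :* y ² :- 5 · X ² :* Y ² :+ 4 · x :* y :* X :* Y
Q₂ = Quartic x y X Y

opaque
  unfolding _⊕_ ⊝_
  -- Coefficients are evaluated here, hence the unfolding. The indices are those of the leading
  -- terms: `w` begins with `4q` and `η` with `4q³`.
  w≢0 : ⟦ w ⟧ ρ 1 ≢ + 0
  w≢0 ()
  ν≢0 : ⟦ 4 · X :* Y :* η ⟧ ρ 3 + ⟦ ν ⟧ ρ 3 ≢ + 0
  ν≢0 ()
  π≢0 : ⟦ 4 · X :* Y :* z :* Z ⟧ ρ 0 + ⟦ π ⟧ ρ 0 ≢ + 0
  π≢0 ()
  ω≢0 : ⟦ 4 · X :* X :* n ⟧ ρ 0 + ⟦ ω ⟧ ρ 0 ≢ + 0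
  ω≢0 ()

dil-φ² : ∀ i → dil (suc i) φ ⊛ dil (suc i) φ ⊕ dil (suc i) φ′ ⊛ dil (suc i) φ′ ≈ 𝟐 ⊛ (dil (suc i ℕ.* 2) φ ⊛ dil (suc i ℕ.* 2) φ)
dil-φ² i = S.trans (S.sym (S.trans (dil-⊕ (suc i) _ _) (⊕-cong (dil-⊛ (suc i) φ φ) (dil-⊛ (suc i) φ′ φ′))))
  (S.trans (dil-cong (suc i) φ²+φ′²) (S.trans (dil-⊛ (suc i) 𝟐 _) (⊛-cong (dil-con (suc i) _)
    (S.trans (dil-⊛ (suc i) _ _) (⊛-cong (dil-∘ i 1 φ) (dil-∘ i 1 φ))))))

z≈0 : Zero (2 · z :* z :- x :* x :- y :* y)
z≈0 = zeroes (S.trans (identity 3 (λ z x y → κ (+ 2) :* z :* z :+ :- (x :* x) :+ :- (y :* y) := :- (x :* x :+ y :* y :+ :- (κ (+ 2) :* (z :* z)))) (dil 2 φ ∷ φ ∷ φ′ ∷ []))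
  (S.trans (⊝-cong (to-difference φ²+φ′²)) (identity 0 (:- κ (+ 0) := κ (+ 0)) [])))

Z≈0 : Zero (2 · Z :* Z :- X :* X :- Y :* Y)
Z≈0 = zeroes (S.trans (identity 3 (λ z x y → κ (+ 2) :* z :* z :+ :- (x :* x) :+ :- (y :* y) := :- (x :* x :+ y :* y :+ :- (κ (+ 2) :* (z :* z)))) (dil 10 φ ∷ dil 5 φ ∷ dil 5 φ′ ∷ []))
  (S.trans (⊝-cong (to-difference (dil-φ² 4))) (identity 0 (:- κ (+ 0) := κ (+ 0)) [])))

j≈0 : Zero (j :* j :- x :* y)
j≈0 = zeroes (to-difference (S.sym φφ′))

J≈0 : Zero (J :* J :- X :* Y)
J≈0 = zeroes (to-difference (S.sym (S.trans (S.sym (dil-⊛ 5 φ φ′)) (S.trans (dil-cong 5 φφ′) (S.trans (dil-⊛ 5 _ _) (⊛-cong (dil-∘ 4 1 φ′) (dil-∘ 4 1 φ′)))))))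

φ²-φ′² : φ ⊛ φ ⊕ ⊝ (φ′ ⊛ φ′) ≈ con (+ 8) ⊛ (q ⊛ (dil 4 ψ ⊛ dil 4 ψ))
φ²-φ′² = begin
  φ ⊛ φ ⊕ ⊝ (φ′ ⊛ φ′)
    ≈⟨ identity 2 (λ f g → f :* f :+ :- (g :* g) := (f :+ g) :* (f :+ :- g)) (φ ∷ φ′ ∷ []) ⟩
  (φ ⊕ φ′) ⊛ (φ ⊕ ⊝ φ′)
    ≈⟨ ⊛-cong φ+φ′ φ-φ′ ⟩
  (𝟐 ⊛ dil 4 φ) ⊛ (𝟒 ⊛ (q ⊛ dil 8 ψ))
    ≈⟨ identity 3 (λ f q p → (κ (+ 2) :* f) :* (κ (+ 4) :* (q :* p)) := κ (+ 8) :* (q :* (f :* p))) (dil 4 φ ∷ q ∷ dil 8 ψ ∷ []) ⟩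
  con (+ 8) ⊛ (q ⊛ (dil 4 φ ⊛ dil 8 ψ))
    ≈⟨ ⊛-cong S.refl (⊛-cong S.refl (S.sym (S.trans (S.sym (dil-⊛ 4 ψ ψ)) (S.trans (dil-cong 4 ψ²) (S.trans (dil-⊛ 4 _ _) (⊛-cong S.refl (dil-∘ 3 1 ψ))))))) ⟩
  con (+ 8) ⊛ (q ⊛ (dil 4 ψ ⊛ dil 4 ψ)) ∎
  where open ≈R

s≈0 : Zero (4 · k :* s :* s :- u)
s≈0 = zeroes (to-difference (S.sym (S.trans φ²-φ′² (identity 2 (λ q s → κ (+ 8) :* (q :* (s :* s)) := κ (+ 4) :* (κ (+ 2) :* q) :* s :* s) (q ∷ dil 4 ψ ∷ [])))))

t≈0 : Zero (4 · k :* t :* t :- v)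
t≈0 = zeroes (to-difference (S.sym (begin
  dil 5 φ ⊛ dil 5 φ ⊕ ⊝ (dil 5 φ′ ⊛ dil 5 φ′)
    ≈⟨ ⊕-cong (S.sym (dil-⊛ 5 φ φ)) (S.trans (⊝-cong (S.sym (dil-⊛ 5 φ′ φ′))) (S.sym (dil-⊝ 5 _))) ⟩
  dil 5 (φ ⊛ φ) ⊕ dil 5 (⊝ (φ′ ⊛ φ′))
    ≈⟨ S.trans (S.sym (dil-⊕ 5 _ _)) (dil-cong 5 φ²-φ′²) ⟩
  dil 5 (con (+ 8) ⊛ (q ⊛ (dil 4 ψ ⊛ dil 4 ψ)))
    ≈⟨ S.trans (dil-⊛ 5 _ _) (⊛-cong (dil-con 5 _) (S.trans (dil-⊛ 5 q _) (⊛-cong (S.trans (dil-M 4 1) (S.sym (S.trans (⊛-cong (S.refl {q}) (M-+ 2 2)) (M-+ 1 4)))) (S.trans (dil-⊛ 5 _ _) (⊛-cong (dil-∘ 4 3 ψ) (dil-∘ 4 3 ψ)))))) ⟩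
  con (+ 8) ⊛ ((q ⊛ (M 2 ⊛ M 2)) ⊛ (dil 20 ψ ⊛ dil 20 ψ))
    ≈⟨ identity 3 (λ q m s → κ (+ 8) :* ((q :* (m :* m)) :* (s :* s)) := κ (+ 4) :* (κ (+ 2) :* q) :* (m :* s) :* (m :* s)) (q ∷ M 2 ∷ dil 20 ψ ∷ []) ⟩
  ⟦ 4 · k :* t :* t ⟧ ρ ∎)))
  where open ≈R

H₁≈0 : X₂₀ ⊛ ⟦ 5 · Z :* Z :- z :* z ⟧ ρ ⊕ ⊝ (dil 2 X₂₀ ⊛ ⟦ x :* x :- 2 · z :* z :- 5 · X :* X :+ 10 · Z :* Z ⟧ ρ) ≈ con (+ 0)
H₁≈0 = S.trans
  (identity 6 (λ e f x z X Z → e :* (κ (+ 5) :* Z :* Z :- z :* z) :+ :- (f :* (x :* x :- κ (+ 2) :* z :* z :- κ (+ 5) :* X :* X :+ κ (+ 10) :* Z :* Z))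
    := κ (+ 5) :* (e :* (Z :* Z)) :+ (κ (- + 1) :* (e :* (z :* z)) :+ (κ (- + 1) :* (f :* (x :* x)) :+ (κ (+ 2) :* (f :* (z :* z)) :+ (κ (+ 5) :* (f :* (X :* X)) :+ (κ (- + 10) :* (f :* (Z :* Z)) :+ κ (+ 0)))))))
    (X₂₀ ∷ dil 2 X₂₀ ∷ φ ∷ dil 2 φ ∷ dil 5 φ ∷ dil 10 φ ∷ []))
  (vanishing (X₂₀⇝ ⊗ aˡ⇝ 9 ∷ X₂₀⇝ ⊗ aˡ⇝ 1 ∷ X₂₀₂⇝ ⊗ a₁⇝ ∷ X₂₀₂⇝ ⊗ aˡ⇝ 1 ∷ X₂₀₂⇝ ⊗ aˡ⇝ 4 ∷ X₂₀₂⇝ ⊗ aˡ⇝ 9 ∷ []) Mod40.H₁-identity null)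

H₂≈0 : X₂₀ ⊛ ⟦ x :* x :- z :* z :- X :* X :+ Z :* Z ⟧ ρ ⊕ ⊝ (dil 2 X₂₀ ⊛ ⟦ x :* x :- X :* X ⟧ ρ) ≈ con (+ 0)
H₂≈0 = S.trans
  (identity 6 (λ e f x z X Z → e :* (x :* x :- z :* z :- X :* X :+ Z :* Z) :+ :- (f :* (x :* x :- X :* X))
    := κ (+ 1) :* (e :* (x :* x)) :+ (κ (- + 1) :* (e :* (z :* z)) :+ (κ (- + 1) :* (e :* (X :* X)) :+ (κ (+ 1) :* (e :* (Z :* Z)) :+ (κ (- + 1) :* (f :* (x :* x)) :+ (κ (+ 1) :* (f :* (X :* X)) :+ κ (+ 0)))))))
    (X₂₀ ∷ dil 2 X₂₀ ∷ φ ∷ dil 2 φ ∷ dil 5 φ ∷ dil 10 φ ∷ []))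
  (vanishing (X₂₀⇝ ⊗ a₁⇝ ∷ X₂₀⇝ ⊗ aˡ⇝ 1 ∷ X₂₀⇝ ⊗ aˡ⇝ 4 ∷ X₂₀⇝ ⊗ aˡ⇝ 9 ∷ X₂₀₂⇝ ⊗ a₁⇝ ∷ X₂₀₂⇝ ⊗ aˡ⇝ 4 ∷ []) Mod40.H₂-identity null)

-- Eliminating X₂₀ between the two relations leaves a relation between thetas alone.
H₁₂≈0 : Zero ((5 · Z :* Z :- z :* z) :* (x :* x :- X :* X) :- (x :* x :- 2 · z :* z :- 5 · X :* X :+ 10 · Z :* Z) :* (x :* x :- z :* z :- X :* X :+ Z :* Z))
H₁₂≈0 = zeroes (nz-0 0 (X₂₀ ⊛ dil 2 X₂₀) _ (λ h → case trans (sym (cong₂ _*_ (lam-0 (+ 1) _) (lam-0 (+ 1) _))) h of λ ())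
  (S.trans (identity 6 (λ e f p p′ p″ p‴ → (e :* f) :* (p :* p‴ :+ :- (p′ :* p″)) := (f :* p‴) :* (e :* p :+ :- (f :* p′)) :+ :- ((f :* p′) :* (e :* p″ :+ :- (f :* p‴))))
      (X₂₀ ∷ dil 2 X₂₀ ∷ ⟦ 5 · Z :* Z :- z :* z ⟧ ρ ∷ ⟦ x :* x :- 2 · z :* z :- 5 · X :* X :+ 10 · Z :* Z ⟧ ρ ∷ ⟦ x :* x :- z :* z :- X :* X :+ Z :* Z ⟧ ρ ∷ ⟦ x :* x :- X :* X ⟧ ρ ∷ []))
    (S.trans (⊕-cong (⊛-cong S.refl H₁≈0) (⊝-cong (⊛-cong S.refl H₂≈0)))
      (identity 2 (λ f g → f :* κ (+ 0) :+ :- (g :* κ (+ 0)) := κ (+ 0)) (dil 2 X₂₀ ⊛ ⟦ x :* x :- X :* X ⟧ ρ ∷ dil 2 X₂₀ ⊛ ⟦ x :* x :- 2 · z :* z :- 5 · X :* X :+ 10 · Z :* Z ⟧ ρ ∷ [])))))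

-- This is `H₁₂≈0`, rescaled, with `2z²` and `2Z²` replaced by `x² + y²` and `X² + Y²`.
Q₂≈0 : Zero Q₂
Q₂≈0 = by (:- κ (+ 2) ⊠ H₁₂≈0 ⊞ (u :- v :- (x ² :- X ²) :+ (x ² :- 2 · z ² :- 5 · X ² :+ 10 · Z ²)) ⊠ z≈0
  ⊞ (5 · (x ² :- X ²) :- 5 · (u :- v) :- (x ² :- 2 · z ² :- 5 · X ² :+ 10 · Z ²)) ⊠ Z≈0)

Q₂-dilated : Zero (Quartic z j Z J)
Q₂-dilated = zeroes (S.trans (S.sym (dil-⟦⟧ 2 Q₂′ (φ ∷ φ′ ∷ dil 5 φ ∷ dil 5 φ′ ∷ []) (dil 2 φ ∷ dil 2 φ′ ∷ dil 10 φ ∷ dil 10 φ′ ∷ [])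
    (λ { 0F → S.refl ; 1F → S.refl ; 2F → dil-∘ 1 4 φ ; 3F → dil-∘ 1 4 φ′ })))
  (S.trans (dil-cong 2 (holds Q₂≈0)) (dil-con 2 _)))
  where
  Q₂′ : Polynomial 4
  Q₂′ = Quartic (Ring.var 0F) (Ring.var 1F) (Ring.var 2F) (Ring.var 3F)

-- Four times the dilated equation is rewritten through `2z² = x² + y²` and `j² = xy`. Subtracted
-- from `Q₂` it cancels all terms of `Q₂`, and `6Q` is left.
Q≈0 : Zero Q
Q≈0 = divide (κ (+ 6)) 0 (λ ()) (Q₂≈0 ⊞ :- κ (+ 4) ⊠ Q₂-dilated ⊞ c₁ ⊠ z≈0 ⊞ c₂ ⊠ Z≈0 ⊞ c₃ ⊠ j≈0 ⊞ c₄ ⊠ J≈0)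
  where
  c₁ c₂ c₃ c₄ : Poly
  c₁ = 2 · z ² :+ a :- 12 · Z ²
  c₂ = 10 · Z ² :+ 5 · A :- 6 · a
  c₃ = 4 · j ² :+ 4 · x :* y :- 24 · J ²
  c₄ = 20 · J ² :+ 20 · X :* Y :- 24 · x :* y

-- Q and Q₂ generate the relations between x, y, X, Y only after inverting w = 4q + ⋯, whence the divisions by w;
-- the cofactors come from linear algebra.
Tₙ≈0 : Zero (ω ² :- 16 · X ⁴ :* x :* y :* X :* Y)
Tₙ≈0 = divide w 1 w≢0 ((:- (x ³ :* X ² :* Y) :- x ² :* y :* X ³ :- x :* y ² :* Y ³ :+ x :* X ⁴ :* Y :+ x :* Y ⁵ :- y ³ :* X :* Y ² :+ 5 · y :* X ⁵ :+ 5 · y :* X :* Y ⁴) ⊠ Q≈0 ⊞ (:- (x :* y ² :* X ² :* Y) :+ x :* X ² :* Y ³ :- y ³ :* X ³ :+ 5 · y :* X ³ :* Y ²) ⊠ Q₂≈0)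

-- By `s≈0` and `t≈0`, `4η² = uv`, and modulo `Q` and `Q₂` the square of `ν` is `4X²Y²uv`. `A₂≈0`
-- and `A₃≈0` take square roots likewise, from `4z²Z² = aA` and `n² = xyXY`.
A₁≈0 : Zero (4 · X :* Y :* η :- ν)
A₁≈0 = square-root (4 · X :* Y :* η) ν 3 ν≢0
  (by ((x ² :* X ² :- 2 · x :* y :* X :* Y :+ y ² :* Y ² :- X ⁴ :- Y ⁴) ⊠ Q≈0 ⊞ :- (X ² :* Y ²) ⊠ Q₂≈0
    ⊞ (16 · k :* X ² :* Y ² :* t ²) ⊠ s≈0 ⊞ (4 · X ² :* Y ² :* u) ⊠ t≈0))

A₂≈0 : Zero (4 · X :* Y :* z :* Z :- π)
A₂≈0 = square-root (4 · X :* Y :* z :* Z) π 0 π≢0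
  (by ((x ² :* X ² :+ 2 · x :* y :* X :* Y :+ y ² :* Y ² :- X ⁴ :- Y ⁴) ⊠ Q≈0 ⊞ :- (X ² :* Y ²) ⊠ Q₂≈0
    ⊞ (8 · X ² :* Y ² :* Z ²) ⊠ z≈0 ⊞ (4 · X ² :* Y ² :* a) ⊠ Z≈0))

A₃≈0 : Zero (4 · X :* X :* n :- ω)
A₃≈0 = square-root (4 · X :* X :* n) ω 0 ω≢0
  (by (:- κ (+ 1) ⊠ Tₙ≈0 ⊞ (16 · X ⁴ :* J ²) ⊠ j≈0 ⊞ (16 · X ⁴ :* x :* y) ⊠ J≈0))

-- Multiplication by `4XYz` leaves only `z²` and `zZ`, which are `a/2` and `π/(4XY)`. Relations
-- linear in `z` and `Z` are thereby reduced to relations between `x`, `y`, `X`, `Y`.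
eliminate-z : ∀ p p′ → Zero (2 · X :* Y :* a :* p :+ π :* p′) → Zero (z :* p :+ Z :* p′)
eliminate-z p p′ h = zeroes (nz-0 0 (⟦ 4 · X :* Y :* z ⟧ ρ) _ (λ ()) (S.trans
  (identity 8 (λ X Y z Z a b p p′ → κ (+ 4) :* X :* Y :* z :* (z :* p :+ Z :* p′)
      := (κ (+ 2) :* X :* Y :* a :* p :+ b :* p′) :+ κ (+ 2) :* X :* Y :* p :* (κ (+ 2) :* z :* z :+ :- a) :+ p′ :* (κ (+ 4) :* X :* Y :* z :* Z :+ :- b))
    (⟦ X ⟧ ρ ∷ ⟦ Y ⟧ ρ ∷ ⟦ z ⟧ ρ ∷ ⟦ Z ⟧ ρ ∷ ⟦ a ⟧ ρ ∷ ⟦ π ⟧ ρ ∷ ⟦ p ⟧ ρ ∷ ⟦ p′ ⟧ ρ ∷ []))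
  (holds (h ⊞ (2 · X :* Y :* p) ⊠ z≈a ⊞ p′ ⊠ A₂≈0))))
  where
  z≈a : Zero (2 · z :* z :- a)
  z≈a = by z≈0

T₁≈0 : Zero (2 · ν :* A :- π :* (u :- v) :+ 4 · X :* Y :* A :* o)
T₁≈0 = divide w 1 w≢0 ((x ² :* X ² :- x ² :* Y ² :+ 2 · x :* y :* X :* Y :- y ² :* X ² :+ y ² :* Y ² :- 3 · X ⁴ :- 3 · Y ⁴) ⊠ Q≈0 ⊞ (x :* y :* X :* Y :- 3 · X ² :* Y ²) ⊠ Q₂≈0)

T₂≈0 : Zero (2 · ν :* a :- π :* (5 · v :- u) :- 4 · X :* Y :* a :* o)
T₂≈0 = divide w 1 w≢0 ((:- (3 · x ² :* X ²) :- x ² :* Y ² :+ 2 · x :* y :* X :* Y :- y ² :* X ² :- 3 · y ² :* Y ² :+ 5 · X ⁴ :+ 5 · Y ⁴) ⊠ Q≈0 ⊞ (:- (3 · x :* y :* X :* Y) :+ 5 · X ² :* Y ²) ⊠ Q₂≈0)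

T₄≈0 : Zero (A :* Y :* ω :- X :* π :* (x :* y :- X :* Y) :- 2 · X ² :* Y :* A :* (x :* Y :+ y :* X))
T₄≈0 = divide w 1 w≢0 ((:- (x ² :* X ² :* Y) :+ x :* y :* X ³ :- x :* y :* X :* Y ² :+ y ² :* X ² :* Y :+ X ⁴ :* Y :+ Y ⁵) ⊠ Q≈0 ⊞ (X ² :* Y ³) ⊠ Q₂≈0)

-- Removes `Zη` in favour of `z` and `Z` with coefficients in `x`, `y`, `X`, `Y`; `N₂≈0` and `n₁≈0`
-- do the same for `zη` and `Zn`.
N₁≈0 : Zero (4 · Z :* η :- z :* (u :- v) :+ 2 · Z :* o)
N₁≈0 = divide (4 · X :* Y :* Z) 0 (λ ()) (T₁≈0 ⊞ (2 · A) ⊠ A₁≈0 ⊞ (8 · X :* Y :* η :+ 4 · X :* Y :* o) ⊠ Z≈0 ⊞ (:- (u :- v)) ⊠ A₂≈0)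

N₂≈0 : Zero (4 · z :* η :+ Z :* u :- 2 · z :* o :- 5 · Z :* v)
N₂≈0 = divide (4 · X :* Y :* z) 0 (λ ()) (T₂≈0 ⊞ (2 · a) ⊠ A₁≈0 ⊞ (8 · X :* Y :* η :- 4 · X :* Y :* o) ⊠ z≈0 ⊞ (u :- 5 · v) ⊠ A₂≈0)

n₁≈0 : Zero (2 · Z :* n :- z :* (x :* y :- X :* Y) :- Z :* (x :* Y :+ y :* X))
n₁≈0 = divide (4 · X ² :* Y :* Z) 0 (λ ()) (T₄≈0 ⊞ (A :* Y) ⊠ A₃≈0 ⊞ (4 · X ² :* n :* Y :- 2 · X ² :* Y :* (x :* Y :+ y :* X)) ⊠ Z≈0 ⊞ (:- (X :* (x :* y :- X :* Y))) ⊠ A₂≈0)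

T₃≈0 : Zero (2 · X ² :* Y ² :* (u :* A :+ v :* a) :- π :* ν :- 2 · Y ² :* w :* ω)
T₃≈0 = by ((x ² :* X ² :- y ² :* Y ² :- X ⁴ :- Y ⁴) ⊠ Q≈0 ⊞ (:- (X ² :* Y ²)) ⊠ Q₂≈0)

-- Up to the relations for squares this is `8k(Zs - zt)² = 4wn`, the functional equation of `W`
-- after the dilation by 2.
K₃≈0 : Zero (u :* A :+ v :* a :- 8 · z :* Z :* η :- 4 · w :* n)
K₃≈0 = divide (2 · X ² :* Y ²) 0 (λ ()) (T₃≈0 ⊞ (:- π) ⊠ A₁≈0 ⊞ (:- (4 · X :* Y :* η)) ⊠ A₂≈0 ⊞ (:- (2 · Y ² :* w)) ⊠ A₃≈0)

-- The product formula for W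

W : Series
W = dil 2 ψ ⊛ dil 5 φ ⊕ ⊝ (q ⊛ (φ ⊛ dil 10 ψ))

W-form : Polynomial 5
W-form = Ring.var 0F :* Ring.var 1F :- Ring.var 2F :* (Ring.var 3F :* Ring.var 4F)

dil2-W : dil 2 W ≈ ⟦ Z :* s :- z :* t ⟧ ρ
dil2-W = S.trans (dil-⟦⟧ 2 W-form (dil 2 ψ ∷ dil 5 φ ∷ q ∷ φ ∷ dil 10 ψ ∷ []) (dil 4 ψ ∷ dil 10 φ ∷ M 2 ∷ dil 2 φ ∷ dil 20 ψ ∷ [])
    λ { 0F → dil-∘ 1 1 ψ ; 1F → dil-∘ 1 4 φ ; 2F → dil-M 1 1 ; 3F → S.refl ; 4F → dil-∘ 1 9 ψ })
  (identity 5 (λ a b c d e → a :* b :- c :* (d :* e) := b :* a :- d :* (c :* e)) (dil 4 ψ ∷ dil 10 φ ∷ M 2 ∷ dil 2 φ ∷ dil 20 ψ ∷ []))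

φ-dilated : ∀ i → dil 5 (Vec.lookup (dil 4 φ ∷ q ∷ dil 8 ψ ∷ []) i) ≈ Vec.lookup (dil 20 φ ∷ q ⊛ M 4 ∷ dil 40 ψ ∷ []) i
φ-dilated 0F = dil-∘ 4 3 φ
φ-dilated 1F = S.trans (dil-M 4 1) (S.sym (M-+ 1 4))
φ-dilated 2F = dil-∘ 4 7 ψ

φ₅-split : dil 5 φ ≈ dil 20 φ ⊕ 𝟐 ⊛ ((q ⊛ M 4) ⊛ dil 40 ψ)
φ₅-split = S.trans (dil-cong 5 φ-split) (dil-⟦⟧ 5 (Ring.var 0F :+ κ (+ 2) :* (Ring.var 1F :* Ring.var 2F)) (dil 4 φ ∷ q ∷ dil 8 ψ ∷ []) (dil 20 φ ∷ q ⊛ M 4 ∷ dil 40 ψ ∷ []) φ-dilated)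

φ′₅-split : dil 5 φ′ ≈ dil 20 φ ⊕ ⊝ (𝟐 ⊛ ((q ⊛ M 4) ⊛ dil 40 ψ))
φ′₅-split = S.trans (dil-cong 5 φ′-split) (dil-⟦⟧ 5 (Ring.var 0F :+ :- (κ (+ 2) :* (Ring.var 1F :* Ring.var 2F))) (dil 4 φ ∷ q ∷ dil 8 ψ ∷ []) (dil 20 φ ∷ q ⊛ M 4 ∷ dil 40 ψ ∷ []) φ-dilated)

dil4-W : 𝟒 ⊛ (q ⊛ dil 4 W) ≈ ⟦ w ⟧ ρ
dil4-W = begin
  𝟒 ⊛ (q ⊛ dil 4 W)
    ≈⟨ ⊛-cong S.refl (⊛-cong S.refl (dil-⟦⟧ 4 W-form (dil 2 ψ ∷ dil 5 φ ∷ q ∷ φ ∷ dil 10 ψ ∷ []) (dil 8 ψ ∷ dil 20 φ ∷ M 4 ∷ dil 4 φ ∷ dil 40 ψ ∷ [])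
        λ { 0F → dil-∘ 3 1 ψ ; 1F → dil-∘ 3 4 φ ; 2F → dil-M 3 1 ; 3F → S.refl ; 4F → dil-∘ 3 9 ψ })) ⟩
  𝟒 ⊛ (q ⊛ (dil 8 ψ ⊛ dil 20 φ ⊕ ⊝ (M 4 ⊛ (dil 4 φ ⊛ dil 40 ψ))))
    ≈⟨ identity 6 (λ q a b c d e → κ (+ 4) :* (q :* (a :* b :- c :* (d :* e)))
        := (d :+ κ (+ 2) :* (q :* a)) :* (b :+ :- (κ (+ 2) :* ((q :* c) :* e))) :- (d :+ :- (κ (+ 2) :* (q :* a))) :* (b :+ κ (+ 2) :* ((q :* c) :* e)))
        (q ∷ dil 8 ψ ∷ dil 20 φ ∷ M 4 ∷ dil 4 φ ∷ dil 40 ψ ∷ []) ⟩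
  (dil 4 φ ⊕ 𝟐 ⊛ (q ⊛ dil 8 ψ)) ⊛ (dil 20 φ ⊕ ⊝ (𝟐 ⊛ ((q ⊛ M 4) ⊛ dil 40 ψ))) ⊕ ⊝ ((dil 4 φ ⊕ ⊝ (𝟐 ⊛ (q ⊛ dil 8 ψ))) ⊛ (dil 20 φ ⊕ 𝟐 ⊛ ((q ⊛ M 4) ⊛ dil 40 ψ)))
    ≈⟨ S.sym (⊕-cong (⊛-cong φ-split φ′₅-split) (⊝-cong (⊛-cong φ′-split φ₅-split))) ⟩
  ⟦ w ⟧ ρ ∎
  where open ≈R

-- After the dilation by 2 everything is visible among the twelve series: `W(q²) = Zs - zt` and
-- `4qW(q⁴) = w`. The common factor `16q` makes both sides polynomials in them and is cancelled.
W² : W ⊛ W ≈ dil 2 W ⊛ (φ′ ⊛ dil 5 φ′)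
W² = dil-injective 1 (S.trans (dil-⊛ 2 W W) (S.trans (cancel 1 (con (+ 16) ⊛ q) (λ ()) (begin
  (con (+ 16) ⊛ q) ⊛ (dil 2 W ⊛ dil 2 W)
    ≈⟨ ⊛-cong S.refl (⊛-cong dil2-W dil2-W) ⟩
  (con (+ 16) ⊛ q) ⊛ (⟦ Z :* s :- z :* t ⟧ ρ ⊛ ⟦ Z :* s :- z :* t ⟧ ρ)
    ≈⟨ identity 2 (λ q f → (κ (+ 16) :* q) :* (f :* f) := κ (+ 8) :* (κ (+ 2) :* q) :* (f :* f)) (q ∷ ⟦ Z :* s :- z :* t ⟧ ρ ∷ []) ⟩
  ⟦ 8 · k :* (Z :* s :- z :* t) ² ⟧ ρ
    ≈⟨ from-difference (holds square) ⟩
  ⟦ 4 · w :* n ⟧ ρ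
    ≈⟨ ⊛-cong (⊛-cong S.refl (S.sym dil4-W)) S.refl ⟩
  𝟒 ⊛ (𝟒 ⊛ (q ⊛ dil 4 W)) ⊛ (dil 2 φ′ ⊛ dil 10 φ′)
    ≈⟨ identity 3 (λ q f g → κ (+ 4) :* (κ (+ 4) :* (q :* f)) :* g := (κ (+ 16) :* q) :* (f :* g)) (q ∷ dil 4 W ∷ dil 2 φ′ ⊛ dil 10 φ′ ∷ []) ⟩
  (con (+ 16) ⊛ q) ⊛ (dil 4 W ⊛ (dil 2 φ′ ⊛ dil 10 φ′)) ∎))
  (S.sym (S.trans (dil-⊛ 2 _ _) (⊛-cong (dil-∘ 1 1 W) (S.trans (dil-⊛ 2 _ _) (⊛-cong S.refl (dil-∘ 1 4 φ′))))))))
  where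
  open ≈R
  square : Zero (8 · k :* (Z :* s :- z :* t) ² :- 4 · w :* n)
  square = by (K₃≈0 ⊞ (4 · k :* s ²) ⊠ Z≈0 ⊞ A ⊠ s≈0 ⊞ (4 · k :* t ²) ⊠ z≈0 ⊞ a ⊠ t≈0)

-- By `gauss` the product satisfies the same functional equation `A² = A(q²)φ(-q)φ(-q⁵)` as `W`, and
-- that equation has one solution with constant term 1.
W≈EE₅ : W ≈ E ⊛ dil 5 E
W≈EE₅ = square-dil-unique W (E ⊛ dil 5 E) W₀ refl (begin
  W ⊛ W ⊛ dil 2 (E ⊛ dil 5 E)
    ≈⟨ ⊛-cong W² (S.trans (dil-⊛ 2 E (dil 5 E)) (⊛-cong S.refl (dil-∘ 1 4 E))) ⟩
  dil 2 W ⊛ (φ′ ⊛ dil 5 φ′) ⊛ (dil 2 E ⊛ dil 10 E)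
    ≈⟨ identity 5 (λ w p p′ e e′ → w :* (p :* p′) :* (e :* e′) := w :* ((p :* e) :* (p′ :* e′))) (dil 2 W ∷ φ′ ∷ dil 5 φ′ ∷ dil 2 E ∷ dil 10 E ∷ []) ⟩
  dil 2 W ⊛ ((φ′ ⊛ dil 2 E) ⊛ (dil 5 φ′ ⊛ dil 10 E))
    ≈⟨ ⊛-cong S.refl (⊛-cong gauss (S.trans (⊛-cong S.refl (S.sym (dil-∘ 4 1 E))) (S.trans (S.sym (dil-⊛ 5 φ′ (dil 2 E))) (S.trans (dil-cong 5 gauss) (dil-⊛ 5 E E))))) ⟩
  dil 2 W ⊛ ((E ⊛ E) ⊛ (dil 5 E ⊛ dil 5 E))
    ≈⟨ identity 3 (λ w e f → w :* ((e :* e) :* (f :* f)) := w :* ((e :* f) :* (e :* f))) (dil 2 W ∷ E ∷ dil 5 E ∷ []) ⟩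
  dil 2 W ⊛ ((E ⊛ dil 5 E) ⊛ (E ⊛ dil 5 E)) ∎)
  where
  open ≈R
  W₀ : W 0 ≡ + 1
  W₀ = trans (⊕-at _ _ 0) (cong (_+_ (+ 1)) (⊝-at (q ⊛ (φ ⊛ dil 10 ψ)) 0))

ψ²-dilated : ∀ i → dil (suc i) ψ ⊛ dil (suc i) ψ ≈ dil (suc i) φ ⊛ dil (suc i ℕ.* 2) ψ
ψ²-dilated i = S.trans (S.sym (dil-⊛ (suc i) ψ ψ)) (S.trans (dil-cong (suc i) ψ²) (S.trans (dil-⊛ (suc i) φ (dil 2 ψ)) (⊛-cong S.refl (dil-∘ i 1 ψ))))

-- The square of `W` expanded from its definition, with `ψ(q²)² = φ(q²)ψ(q⁴)`, and compared with
-- `W²`. Its mixed term brings in `r`.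
K≈0 : Zero (s :* z :* X ² :+ t :* Z :* x ² :- 2 · r :* x :* X :- (Z :* s :- z :* t) :* y :* Y)
K≈0 = zeroes (begin
  ⟦ s :* z :* X ² :+ t :* Z :* x ² :- 2 · r :* x :* X :- (Z :* s :- z :* t) :* y :* Y ⟧ ρ
    ≈⟨ identity 9 (λ s z X m g Z x r f → s :* z :* (X :* X) :+ (m :* g) :* Z :* (x :* x) :- κ (+ 2) :* r :* x :* X :- f
        := (z :* s) :* (X :* X) :+ m :* (Z :* g) :* (x :* x) :- κ (+ 2) :* r :* x :* X :- f)
        (dil 4 ψ ∷ dil 2 φ ∷ dil 5 φ ∷ M 2 ∷ dil 20 ψ ∷ dil 10 φ ∷ φ ∷ ⟦ r ⟧ ρ ∷ ⟦ (Z :* s :- z :* t) :* y :* Y ⟧ ρ ∷ []) ⟩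
  (dil 2 φ ⊛ dil 4 ψ) ⊛ (dil 5 φ ⊛ dil 5 φ) ⊕ M 2 ⊛ (dil 10 φ ⊛ dil 20 ψ) ⊛ (φ ⊛ φ) ⊕ ⊝ ⟦ 2 · r :* x :* X ⟧ ρ ⊕ ⊝ ⟦ (Z :* s :- z :* t) :* y :* Y ⟧ ρ
    ≈⟨ ⊕-cong (⊕-cong (⊕-cong (⊛-cong (S.sym (ψ²-dilated 1)) S.refl) (⊛-cong (⊛-cong (S.sym (M-+ 1 1)) (S.sym (ψ²-dilated 9))) S.refl)) S.refl) S.refl ⟩
  (dil 2 ψ ⊛ dil 2 ψ) ⊛ (dil 5 φ ⊛ dil 5 φ) ⊕ (q ⊛ q) ⊛ (dil 10 ψ ⊛ dil 10 ψ) ⊛ (φ ⊛ φ) ⊕ ⊝ ⟦ 2 · r :* x :* X ⟧ ρ ⊕ ⊝ ⟦ (Z :* s :- z :* t) :* y :* Y ⟧ ρ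
    ≈⟨ identity 8 (λ p X q p′ x f y Y → (p :* p) :* (X :* X) :+ (q :* q) :* (p′ :* p′) :* (x :* x) :+ :- (κ (+ 2) :* (q :* (p :* p′)) :* x :* X) :+ :- (f :* y :* Y)
        := (p :* X :+ :- (q :* (x :* p′))) :* (p :* X :+ :- (q :* (x :* p′))) :+ :- (f :* (y :* Y)))
        (dil 2 ψ ∷ dil 5 φ ∷ q ∷ dil 10 ψ ∷ φ ∷ ⟦ Z :* s :- z :* t ⟧ ρ ∷ φ′ ∷ dil 5 φ′ ∷ []) ⟩
  W ⊛ W ⊕ ⊝ (⟦ Z :* s :- z :* t ⟧ ρ ⊛ (φ′ ⊛ dil 5 φ′))
    ≈⟨ to-difference (S.trans W² (⊛-cong dil2-W S.refl)) ⟩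
  con (+ 0) ∎)
  where open ≈R

-- Relations that contain the eta quotients

p₅ q₅ : Poly
p₅ = 18 · X :* Y ² :- 4 · x :* y :* Y :- 2 · y ² :* X :+ 2 · x :* o :- 2 · X :* (u :- 3 · v)
q₅ = :- (4 · x :* Y ²) :- 8 · y :* X :* Y :- 3 · x :* u :+ 5 · x :* v :+ 4 · X :* o

L₅≈0 : Zero (z :* p₅ :+ Z :* q₅)
L₅≈0 = eliminate-z p₅ q₅ (divide w 1 w≢0 ((3 · x ³ :* X ² :- 3 · x ³ :* Y ² :+ 6 · x ² :* y :* X :* Y :- 3 · x :* y ² :* X ² :+ 3 · x :* y ² :* Y ² :- 9 · x :* X ⁴ :- 9 · x :* Y ⁴) ⊠ Q≈0 ⊞ (3 · x ² :* y :* X :* Y :- 9 · x :* X ² :* Y ²) ⊠ Q₂≈0))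

-- The first summand is 12 times `D₂` below. After `η` and `n` have been removed by `N₁≈0`, `N₂≈0`
-- and `n₁≈0`, what remains is linear in `z` and `Z`, namely `L₅≈0`.
E₅≈0 : Zero (12 · Y :* (z :* X :* Y :- n :* Z) :+ 2 · z :* y :* w :+ 2 · Z :* Y :* w :- x :* (2 · Z :* u :- 4 · z :* η) :- 2 · X :* (4 · Z :* η :- 2 · z :* v))
E₅≈0 = by (L₅≈0 ⊞ (:- (6 · Y)) ⊠ n₁≈0 ⊞ x ⊠ N₂≈0 ⊞ (:- (2 · X)) ⊠ N₁≈0)

p₇ q₇ : Poly
p₇ = 6 · u :* X ² :- 3 · x ² :* (u :- v) :- 6 · y :* Y :* o :- X :* (8 · y :* w :+ 2 · x :* o :- 5 · X :* (u :- v) :+ 10 · X :* v)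
q₇ = 6 · u :* y :* Y :- 3 · x ² :* (:- (2 · o)) :- 3 · y :* Y :* (5 · v :- u) :- X :* (20 · Y :* w :- 2 · x :* u :+ x :* (5 · v :- u) :- 5 · X :* (:- (2 · o)))

L₇≈0 : Zero (z :* p₇ :+ Z :* q₇)
L₇≈0 = eliminate-z p₇ q₇ (divide w 1 w≢0 ((:- (9 · x ³ :* X ³) :+ 3 · x ³ :* X :* Y ² :- 15 · x ² :* y :* X ² :* Y :+ 3 · x ² :* y :* Y ³ :+ 3 · x :* y ² :* X ³ :- 27 · x :* y ² :* X :* Y ² :+ 15 · x :* X ⁵ :+ 15 · x :* X :* Y ⁴ :+ 15 · y ³ :* X ² :* Y :- 9 · y ³ :* Y ³ :+ 15 · y :* X ⁴ :* Y :+ 15 · y :* Y ⁵) ⊠ Q≈0 ⊞ (:- (6 · x ³ :* X :* Y ²) :- 3 · x ² :* y :* X ² :* Y :- 9 · x :* y ² :* X :* Y ² :+ 15 · x :* X ³ :* Y ² :+ 15 · y :* X ² :* Y ³) ⊠ Q₂≈0))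

-- The series `r` is reached only through `K≈0`, as the product `rxX`. This costs a surplus factor
-- `X`, divided out in `E₇′≈0`; in `E₆≈0` it is `x`.
E₇≈0 : Zero (48 · k :* s ² :* z :* X ² :- 48 · k :* r :* s :* x :* X :- X :* (8 · z :* y :* w :+ 20 · Z :* Y :* w :- 2 · x :* Z :* u :+ 4 · x :* z :* η :- 20 · X :* Z :* η :+ 10 · z :* X :* v))
E₇≈0 = by (L₇≈0 ⊞ (24 · k :* s) ⊠ K≈0 ⊞ (6 · z :* X ² :+ 6 · Z :* y :* Y) ⊠ s≈0 ⊞ (5 · X ² :- 3 · x ²) ⊠ N₁≈0 ⊞ (:- (3 · y :* Y :+ x :* X)) ⊠ N₂≈0)

p₆ q₆ : Poly
p₆ = 6 · X ² :* o :- 3 · y :* Y :* (u :- v) :+ 6 · v :* y :* Y :- x :* (2 · x :* o :- 4 · y :* w :+ X :* (u :- v) :- 2 · X :* v)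
q₆ = 3 · X ² :* (5 · v :- u) :- 6 · v :* x ² :- 3 · y :* Y :* (:- (2 · o)) :- x :* (8 · Y :* w :- 2 · x :* u :+ x :* (5 · v :- u) :+ X :* (:- (2 · o)))

L₆≈0 : Zero (z :* p₆ :+ Z :* q₆)
L₆≈0 = eliminate-z p₆ q₆ (divide w 1 w≢0 ((:- (3 · x ⁴ :* X ²) :+ 3 · x ⁴ :* Y ² :- 6 · x ³ :* y :* X :* Y :+ 3 · x ² :* y ² :* X ² :- 3 · x ² :* y ² :* Y ² :+ 12 · x ² :* X ⁴ :+ 3 · x ² :* X ² :* Y ² :+ 3 · x ² :* Y ⁴ :- 6 · x :* y :* X ³ :* Y :- 3 · y ² :* X ⁴ :+ 9 · y ² :* X ² :* Y ² :- 6 · y ² :* Y ⁴ :- 15 · X ⁶ :- 15 · X ² :* Y ⁴) ⊠ Q≈0 ⊞ (:- (3 · x ³ :* y :* X :* Y) :+ 3 · x ² :* X ² :* Y ² :+ 9 · x :* y :* X ³ :* Y :- 6 · y ² :* X ² :* Y ² :- 15 · X ⁴ :* Y ²) ⊠ Q₂≈0))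

E₆≈0 : Zero (48 · k :* r :* t :* x :* X :- 48 · k :* t ² :* x ² :* Z :- x :* (8 · Z :* Y :* w :- 4 · z :* y :* w :- 2 · x :* Z :* u :+ 4 · x :* z :* η :+ 4 · X :* Z :* η :- 2 · z :* X :* v))
E₆≈0 = by (L₆≈0 ⊞ (:- (24 · k :* t)) ⊠ K≈0 ⊞ (6 · z :* y :* Y :- 6 · x ² :* Z) ⊠ t≈0 ⊞ (3 · X ² :- x ²) ⊠ N₂≈0 ⊞ (:- (3 · y :* Y :+ x :* X)) ⊠ N₁≈0)

T₈≈0 : Zero ((4 · x :* X ² :* Y :+ π :+ ν) :* (5 · A :- a) :- (2 · π :+ 4 · X :* Y :* (x :* X :+ y :* Y)) :* (5 · Y ² :- y ²))
T₈≈0 = divide w 1 w≢0 ((2 · x ² :* X ² :+ 2 · y ² :* Y ² :- 10 · X ⁴ :- 10 · Y ⁴) ⊠ Q≈0 ⊞ (2 · x :* y :* X :* Y :- 10 · X ² :* Y ²) ⊠ Q₂≈0)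

-- Says that `T⁺` satisfies the relation `H₁≈0` of `X₂₀`: the last bracketed sum of thetas is
-- `2T⁺(q²)`, and `5A - a` and `5Y² - y²` are `2(5Z² - z²)` and `x² - 2z² - 5X² + 10Z²`.
Θ≈0 : Zero ((x :* X :+ z :* Z :+ η) :* (5 · A :- a) :- (2 · z :* Z :+ x :* X :+ y :* Y) :* (5 · Y ² :- y ²))
Θ≈0 = divide (4 · X :* Y) 0 (λ ()) (T₈≈0 ⊞ (5 · A :- a) ⊠ A₁≈0 ⊞ (5 · A :- a :- 2 · (5 · Y ² :- y ²)) ⊠ A₂≈0)

T₉≈0 : Zero ((4 · x :* X ² :* Y :- π :- ν) :* (a :+ 5 · A) :+ 2 · (2 · π :- 4 · X :* Y :* (x :* X :+ y :* Y)) :* x ² :- 2 · π :* (x ² :- 5 · X ²) :- 4 · X :* Y :* x :* X :* (5 · A :- a))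
T₉≈0 = by ((2 · x :* Y :- 2 · y :* X) ⊠ Q≈0)

-- The analogue for `T⁻` and the certificate of `Y₂₀`, with `2Y₄₀ = xZ - zX` inserted and multiplied
-- out.
Ψ≈0 : Zero ((x :* X :- z :* Z :- η) :* (a :+ 5 · A) :+ 2 · (2 · z :* Z :- x :* X :- y :* Y) :* x ² :- 2 · z :* Z :* (x ² :- 5 · X ²) :- x :* X :* (5 · A :- a))
Ψ≈0 = divide (4 · X :* Y) 0 (λ ()) (T₉≈0 ⊞ (:- (a :+ 5 · A)) ⊠ A₁≈0 ⊞ (:- (a :+ 5 · A) :+ 4 · x ² :- 2 · (x ² :- 5 · X ²)) ⊠ A₂≈0)

-- The theta series of discriminant -20

dil2-linear-unique : ∀ {D p p′} → D 0 ≡ + 0 → p 0 ≢ + 0 → p ⊛ D ≈ p′ ⊛ dil 2 D → D ≈ con (+ 0)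
dil2-linear-unique {D} {p} {p′} D₀ p₀ h = ≈[]⇒≈ go
  where
  refine : ∀ n → D ≈[ n ] con (+ 0) → D ≈[ n ℕ.+ n ] con (+ 0)
  refine n e = unit-0 p D (n ℕ.+ n) p₀ ([]-trans (≈⇒≈[] h) ([]-trans ([]-⊛ []-refl ([]-trans ([]-dil2 e) (≈⇒≈[] (dil-con 2 (+ 0)))))
    (≈⇒≈[] (identity 1 (λ p → p :* κ (+ 0) := κ (+ 0)) (p′ ∷ [])))))
  go : ∀ n → D ≈[ n ] con (+ 0)
  go zero          = tr λ _ ()
  go (suc zero)    = tr λ { zero _ → D₀ ; (suc _) (s≤s ()) }
  go (suc (suc n)) = ≈[]-weaken (s≤s (subst (suc n ≤_) (sym (ℕP.+-suc n n)) (s≤s (ℕP.m≤m+n n n)))) (refine (suc n) (go (suc n)))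

-- Twice the even part of `φ(q)φ(q⁵)`: after splitting both factors, the mixed products have odd
-- exponents and cancel.
φ₄-φφ₅ : 𝟐 ⊛ (dil 4 φ ⊛ dil 20 φ ⊕ dil 2 (⟦ η ⟧ ρ)) ≈ ⟦ x :* X :+ y :* Y ⟧ ρ
φ₄-φφ₅ = begin
  𝟐 ⊛ (dil 4 φ ⊛ dil 20 φ ⊕ dil 2 (⟦ η ⟧ ρ))
    ≈⟨ ⊛-cong S.refl (⊕-cong S.refl (dil-⟦⟧ 2 η-form (q ∷ dil 4 ψ ∷ M 2 ∷ dil 20 ψ ∷ []) (q ⊛ q ∷ dil 8 ψ ∷ M 4 ∷ dil 40 ψ ∷ [])
        λ { 0F → S.trans (dil-M 1 1) (S.sym (M-+ 1 1)) ; 1F → dil-∘ 1 3 ψ ; 2F → dil-M 1 2 ; 3F → dil-∘ 1 19 ψ })) ⟩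
  𝟐 ⊛ (dil 4 φ ⊛ dil 20 φ ⊕ 𝟐 ⊛ (𝟐 ⊛ (q ⊛ q)) ⊛ dil 8 ψ ⊛ (M 4 ⊛ dil 40 ψ))
    ≈⟨ identity 6 (λ f F q p m P → κ (+ 2) :* (f :* F :+ κ (+ 2) :* (κ (+ 2) :* (q :* q)) :* p :* (m :* P))
        := (f :+ κ (+ 2) :* (q :* p)) :* (F :+ κ (+ 2) :* ((q :* m) :* P)) :+ (f :+ :- (κ (+ 2) :* (q :* p))) :* (F :+ :- (κ (+ 2) :* ((q :* m) :* P))))
        (dil 4 φ ∷ dil 20 φ ∷ q ∷ dil 8 ψ ∷ M 4 ∷ dil 40 ψ ∷ []) ⟩
  (dil 4 φ ⊕ 𝟐 ⊛ (q ⊛ dil 8 ψ)) ⊛ (dil 20 φ ⊕ 𝟐 ⊛ ((q ⊛ M 4) ⊛ dil 40 ψ)) ⊕ (dil 4 φ ⊕ ⊝ (𝟐 ⊛ (q ⊛ dil 8 ψ))) ⊛ (dil 20 φ ⊕ ⊝ (𝟐 ⊛ ((q ⊛ M 4) ⊛ dil 40 ψ)))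
    ≈⟨ S.sym (⊕-cong (⊛-cong φ-split φ₅-split) (⊛-cong φ′-split φ′₅-split)) ⟩
  ⟦ x :* X :+ y :* Y ⟧ ρ ∎
  where
  open ≈R
  η-form : Polynomial 4
  η-form = 2 · (2 · Ring.var 0F) :* Ring.var 1F :* (Ring.var 2F :* Ring.var 3F)

dil2-zZ : dil 2 (⟦ z :* Z ⟧ ρ) ≈ dil 4 φ ⊛ dil 20 φ
dil2-zZ = S.trans (dil-⊛ 2 _ _) (⊛-cong (dil-∘ 1 1 φ) (dil-∘ 1 9 φ))

dil2-xX : dil 2 (⟦ x :* X ⟧ ρ) ≈ ⟦ z :* Z ⟧ ρ
dil2-xX = S.trans (dil-⊛ 2 _ _) (⊛-cong S.refl (dil-∘ 1 4 φ))

-- Sum and difference of the theta series of the two reduced forms of discriminant -20. `xX` belongs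
-- to `x² + 5y²`; `zZ + η` belongs to `2x² + 2xy + 3y² = ((2x + y)² + 5y²)/2`, even `y` giving `zZ`
-- and odd `y` giving `η`.
T⁺ T⁻ : Poly
T⁺ = x :* X :+ z :* Z :+ η
T⁻ = x :* X :- z :* Z :- η

dil2-T⁺ : 𝟐 ⊛ dil 2 (⟦ T⁺ ⟧ ρ) ≈ ⟦ 2 · z :* Z :+ x :* X :+ y :* Y ⟧ ρ
dil2-T⁺ = begin
  𝟐 ⊛ dil 2 (⟦ T⁺ ⟧ ρ)
    ≈⟨ ⊛-cong S.refl (S.trans (dil-⊕ 2 _ _) (⊕-cong (S.trans (dil-⊕ 2 _ _) (⊕-cong dil2-xX dil2-zZ)) S.refl)) ⟩
  𝟐 ⊛ (⟦ z :* Z ⟧ ρ ⊕ dil 4 φ ⊛ dil 20 φ ⊕ dil 2 (⟦ η ⟧ ρ))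
    ≈⟨ identity 3 (λ a b c → κ (+ 2) :* (a :+ b :+ c) := κ (+ 2) :* a :+ κ (+ 2) :* (b :+ c)) (⟦ z :* Z ⟧ ρ ∷ dil 4 φ ⊛ dil 20 φ ∷ dil 2 (⟦ η ⟧ ρ) ∷ []) ⟩
  𝟐 ⊛ ⟦ z :* Z ⟧ ρ ⊕ 𝟐 ⊛ (dil 4 φ ⊛ dil 20 φ ⊕ dil 2 (⟦ η ⟧ ρ))
    ≈⟨ ⊕-cong S.refl φ₄-φφ₅ ⟩
  ⟦ 2 · (z :* Z) :+ (x :* X :+ y :* Y) ⟧ ρ
    ≈⟨ same {2 · (z :* Z) :+ (x :* X :+ y :* Y)} {2 · z :* Z :+ x :* X :+ y :* Y} ⟩
  ⟦ 2 · z :* Z :+ x :* X :+ y :* Y ⟧ ρ ∎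
  where open ≈R

dil2-T⁻ : 𝟐 ⊛ dil 2 (⟦ T⁻ ⟧ ρ) ≈ ⟦ 2 · z :* Z :- x :* X :- y :* Y ⟧ ρ
dil2-T⁻ = begin
  𝟐 ⊛ dil 2 (⟦ T⁻ ⟧ ρ)
    ≈⟨ ⊛-cong S.refl (S.trans (dil-⊕ 2 _ _) (⊕-cong (S.trans (dil-⊕ 2 _ _) (⊕-cong dil2-xX (S.trans (dil-⊝ 2 _) (⊝-cong dil2-zZ)))) (dil-⊝ 2 _))) ⟩
  𝟐 ⊛ (⟦ z :* Z ⟧ ρ ⊕ ⊝ (dil 4 φ ⊛ dil 20 φ) ⊕ ⊝ dil 2 (⟦ η ⟧ ρ))
    ≈⟨ identity 3 (λ a b c → κ (+ 2) :* (a :- b :- c) := κ (+ 2) :* a :- κ (+ 2) :* (b :+ c)) (⟦ z :* Z ⟧ ρ ∷ dil 4 φ ⊛ dil 20 φ ∷ dil 2 (⟦ η ⟧ ρ) ∷ []) ⟩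
  𝟐 ⊛ ⟦ z :* Z ⟧ ρ ⊕ ⊝ (𝟐 ⊛ (dil 4 φ ⊛ dil 20 φ ⊕ dil 2 (⟦ η ⟧ ρ)))
    ≈⟨ ⊕-cong S.refl (⊝-cong φ₄-φφ₅) ⟩
  ⟦ 2 · (z :* Z) :- (x :* X :+ y :* Y) ⟧ ρ
    ≈⟨ same {2 · (z :* Z) :- (x :* X :+ y :* Y)} {2 · z :* Z :- x :* X :- y :* Y} ⟩
  ⟦ 2 · z :* Z :- x :* X :- y :* Y ⟧ ρ ∎
  where open ≈R

-- Both sides satisfy the linear relation of `H₁≈0` with their own dilation, so their difference
-- does too; it has constant term 0 and must vanish.
X₂₀-theta : 𝟐 ⊛ X₂₀ ≈ ⟦ T⁺ ⟧ ρ
X₂₀-theta = from-difference (dil2-linear-unique {p = ⟦ p ⟧ ρ} {p′ = ⟦ p′ ⟧ ρ} at₀ p₀ (begin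
  ⟦ p ⟧ ρ ⊛ (𝟐 ⊛ X₂₀ ⊕ ⊝ θ)
    ≈⟨ identity 5 (λ e f p p′ t → p :* (κ (+ 2) :* e :- t) := κ (+ 2) :* (e :* p :- f :* p′) :+ κ (+ 2) :* f :* p′ :- p :* t) (X₂₀ ∷ dil 2 X₂₀ ∷ ⟦ p ⟧ ρ ∷ ⟦ p′ ⟧ ρ ∷ θ ∷ []) ⟩
  𝟐 ⊛ (X₂₀ ⊛ ⟦ p ⟧ ρ ⊕ ⊝ (dil 2 X₂₀ ⊛ ⟦ p′ ⟧ ρ)) ⊕ 𝟐 ⊛ dil 2 X₂₀ ⊛ ⟦ p′ ⟧ ρ ⊕ ⊝ (⟦ p ⟧ ρ ⊛ θ)
    ≈⟨ ⊕-cong (⊕-cong (⊛-cong S.refl H₁≈0) S.refl) (⊝-cong T-relation) ⟩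
  𝟐 ⊛ con (+ 0) ⊕ 𝟐 ⊛ dil 2 X₂₀ ⊛ ⟦ p′ ⟧ ρ ⊕ ⊝ (⟦ p′ ⟧ ρ ⊛ dil 2 θ)
    ≈⟨ identity 3 (λ f p t → κ (+ 2) :* κ (+ 0) :+ κ (+ 2) :* f :* p :+ :- (p :* t) := p :* (κ (+ 2) :* f :- t)) (dil 2 X₂₀ ∷ ⟦ p′ ⟧ ρ ∷ dil 2 θ ∷ []) ⟩
  ⟦ p′ ⟧ ρ ⊛ (𝟐 ⊛ dil 2 X₂₀ ⊕ ⊝ dil 2 θ)
    ≈⟨ ⊛-cong S.refl (S.sym (S.trans (dil-⊕ 2 _ _) (⊕-cong (S.trans (dil-⊛ 2 𝟐 X₂₀) (⊛-cong (dil-con 2 _) S.refl)) (dil-⊝ 2 θ)))) ⟩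
  ⟦ p′ ⟧ ρ ⊛ dil 2 (𝟐 ⊛ X₂₀ ⊕ ⊝ θ) ∎))
  where
  open ≈R
  p p′ : Poly
  p = 5 · Z :* Z :- z :* z
  p′ = x :* x :- 2 · z :* z :- 5 · X :* X :+ 10 · Z :* Z
  θ : Series
  θ = ⟦ T⁺ ⟧ ρ
  relation : Zero (2 · (p :* T⁺) :- p′ :* (2 · z :* Z :+ x :* X :+ y :* Y))
  relation = by (Θ≈0 ⊞ (5 · T⁺ :- 5 · (2 · z :* Z :+ x :* X :+ y :* Y)) ⊠ Z≈0 ⊞ ((2 · z :* Z :+ x :* X :+ y :* Y) :- T⁺) ⊠ z≈0)
  T-relation : ⟦ p ⟧ ρ ⊛ θ ≈ ⟦ p′ ⟧ ρ ⊛ dil 2 θ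
  T-relation = cancel 0 𝟐 (λ ()) (S.trans (from-difference (holds relation)) (S.trans (⊛-cong S.refl (S.sym dil2-T⁺))
    (identity 2 (λ p t → p :* (κ (+ 2) :* t) := κ (+ 2) :* (p :* t)) (⟦ p′ ⟧ ρ ∷ dil 2 θ ∷ []))))
  opaque
    unfolding _⊕_ ⊝_
    p₀ : ⟦ p ⟧ ρ 0 ≢ + 0
    p₀ ()
    at₀ : (𝟐 ⊛ X₂₀ ⊕ ⊝ θ) 0 ≡ + 0
    at₀ = cong (λ c → + 2 * c + - (+ 2)) (lam-0 (+ 1) (λ a x → + 1 * (χ₋₂₀ a * 𝟙 x)))

-- The inhomogeneous parts cancel in the difference, which leaves `p · D = p′ · D(q²)`. The extra
-- factor 2 lets `Y₄₀-theta` and `dil2-T⁻` be substituted in doubled form.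
Y₂₀-theta : 𝟐 ⊛ Y₂₀ ≈ ⟦ T⁻ ⟧ ρ
Y₂₀-theta = from-difference (dil2-linear-unique {p = ⟦ p ⟧ ρ} {p′ = ⟦ p′ ⟧ ρ} at₀ p₀ (cancel 0 𝟐 (λ ()) (from-difference (begin
  𝟐 ⊛ (⟦ p ⟧ ρ ⊛ (𝟐 ⊛ Y₂₀ ⊕ ⊝ θ)) ⊕ ⊝ (𝟐 ⊛ (⟦ p′ ⟧ ρ ⊛ dil 2 (𝟐 ⊛ Y₂₀ ⊕ ⊝ θ)))
    ≈⟨ ⊕-cong S.refl (⊝-cong (⊛-cong S.refl (⊛-cong S.refl (S.trans (dil-⊕ 2 _ _) (⊕-cong (S.trans (dil-⊛ 2 𝟐 Y₂₀) (⊛-cong (dil-con 2 _) S.refl)) (dil-⊝ 2 θ)))))) ⟩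
  𝟐 ⊛ (⟦ p ⟧ ρ ⊛ (𝟐 ⊛ Y₂₀ ⊕ ⊝ θ)) ⊕ ⊝ (𝟐 ⊛ (⟦ p′ ⟧ ρ ⊛ (𝟐 ⊛ dil 2 Y₂₀ ⊕ ⊝ dil 2 θ)))
    ≈⟨ identity 9 (λ e f R t t₂ x z X Z → κ (+ 2) :* ((z :* z :+ κ (+ 5) :* Z :* Z) :* (κ (+ 2) :* e :- t)) :- κ (+ 2) :* ((:- (κ (+ 2) :* x :* x)) :* (κ (+ 2) :* f :- t₂))
        := κ (+ 4) :* (κ (+ 1) :* (e :* (z :* z)) :+ (κ (+ 5) :* (e :* (Z :* Z)) :+ (κ (+ 2) :* (f :* (x :* x)) :+ (κ (- + 1) :* (R :* (x :* z)) :+ (κ (- + 5) :* (R :* (X :* Z)) :+ κ (+ 0))))))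
          :- ((κ (+ 2) :* (z :* z :+ κ (+ 5) :* Z :* Z)) :* t :+ κ (+ 2) :* (κ (+ 2) :* t₂) :* x :* x :- κ (+ 2) :* (κ (+ 2) :* R) :* (x :* z :+ κ (+ 5) :* X :* Z)))
        (Y₂₀ ∷ dil 2 Y₂₀ ∷ Y₄₀ ∷ θ ∷ dil 2 θ ∷ φ ∷ dil 2 φ ∷ dil 5 φ ∷ dil 10 φ ∷ []) ⟩
  𝟒 ⊛ (con (+ 1) ⊛ (Y₂₀ ⊛ (dil 2 φ ⊛ dil 2 φ)) ⊕ (con (+ 5) ⊛ (Y₂₀ ⊛ (dil 10 φ ⊛ dil 10 φ)) ⊕ (𝟐 ⊛ (dil 2 Y₂₀ ⊛ (φ ⊛ φ)) ⊕ (con (- + 1) ⊛ (Y₄₀ ⊛ (φ ⊛ dil 2 φ)) ⊕ (con (- + 5) ⊛ (Y₄₀ ⊛ (dil 5 φ ⊛ dil 10 φ)) ⊕ con (+ 0))))))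
    ⊕ ⊝ (⟦ 2 · p ⟧ ρ ⊛ θ ⊕ 𝟐 ⊛ (𝟐 ⊛ dil 2 θ) ⊛ φ ⊛ φ ⊕ ⊝ (𝟐 ⊛ (𝟐 ⊛ Y₄₀) ⊛ ⟦ x :* z :+ 5 · X :* Z ⟧ ρ))
    ≈⟨ ⊕-cong (⊛-cong S.refl (vanishing (Y₂₀⇝ ⊗ aˡ⇝ 1 ∷ Y₂₀⇝ ⊗ a₁₀⇝ ∷ Y₂₀₂⇝ ⊗ a₁⇝ ∷ Y⇝ ⊗ l₁⇝ ∷ Y⇝ ⊗ l₅ʳ⇝ ∷ []) Mod8×5.Y₂₀-identity null))
        (⊝-cong (⊕-cong (⊕-cong S.refl (⊛-cong (⊛-cong (⊛-cong S.refl dil2-T⁻) S.refl) S.refl)) (⊝-cong (⊛-cong (⊛-cong S.refl Y₄₀-theta) S.refl)))) ⟩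
  𝟒 ⊛ con (+ 0) ⊕ ⊝ ⟦ T-combination ⟧ ρ
    ≈⟨ ⊕-cong S.refl (⊝-cong (holds relation)) ⟩
  𝟒 ⊛ con (+ 0) ⊕ ⊝ con (+ 0)
    ≈⟨ identity 0 (κ (+ 4) :* κ (+ 0) :+ :- κ (+ 0) := κ (+ 0)) [] ⟩
  con (+ 0) ∎))))
  where
  open ≈R
  p p′ T-combination : Poly
  p = z :* z :+ 5 · Z :* Z
  p′ = :- (2 · x :* x)
  T-combination = 2 · p :* T⁻ :+ 2 · (2 · z :* Z :- x :* X :- y :* Y) :* x :* x :- 2 · (x :* Z :- z :* X) :* (x :* z :+ 5 · X :* Z)
  θ : Series
  θ = ⟦ T⁻ ⟧ ρ
  relation : Zero T-combination
  relation = by (Ψ≈0 ⊞ (T⁻ :+ x :* X) ⊠ z≈0 ⊞ (5 · T⁻ :- 5 · x :* X) ⊠ Z≈0)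
  opaque
    unfolding _⊕_ ⊝_
    p₀ : ⟦ p ⟧ ρ 0 ≢ + 0
    p₀ ()
    at₀ : (𝟐 ⊛ Y₂₀ ⊕ ⊝ θ) 0 ≡ + 0
    at₀ = cong (λ c → + 2 * c + + 0) (lam-0 (+ 0) (λ a x → + 1 * (χ₋₄ a * χ₁ x)))

E₆′≈0 : Zero (48 · k :* r :* t :* X :- 48 · k :* t ² :* x :* Z :- (8 · Z :* Y :* w :- 4 · z :* y :* w :- 2 · x :* Z :* u :+ 4 · x :* z :* η :+ 4 · X :* Z :* η :- 2 · z :* X :* v))
E₆′≈0 = divide x 0 (λ ()) E₆≈0

E₇′≈0 : Zero (48 · k :* s ² :* z :* X :- 48 · k :* r :* s :* x :- (8 · z :* y :* w :+ 20 · Z :* Y :* w :- 2 · x :* Z :* u :+ 4 · x :* z :* η :- 20 · X :* Z :* η :+ 10 · z :* X :* v))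
E₇′≈0 = divide X 0 (λ ()) E₇≈0

-- The eight formulas as polynomial identities

P₀₃ P₁₂ P₂₁ P₃₀ D₁ D₂ D₃ D₄ : Poly
P₀₃ = (x :* Z :+ z :* X) :* (3 · x :* x :- 4 · z :* z :- 5 · X :* X) :+ T⁺ :* (2 · x :* z :- 10 · X :* Z)
P₃₀ = (x :* Z :+ z :* X) :* (x :* x :- X :* X :- 4 · Z :* Z) :+ T⁺ :* (2 · x :* z :+ 2 · X :* Z)
P₁₂ = (x :* Z :- z :* X) :* (3 · X :* X :- x :* x :- 4 · Z :* Z) :+ T⁻ :* (2 · x :* z :+ 2 · X :* Z)
P₂₁ = (x :* Z :- z :* X) :* (5 · X :* X :- x :* x :- 4 · z :* z) :+ T⁻ :* (10 · X :* Z :- 2 · x :* z)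
D₁ = z :* y :* w
D₂ = Y :* (z :* X :* Y :- n :* Z)
D₃ = k :* r :* t :* X :- k :* t :* t :* x :* Z
D₄ = k :* s :* s :* z :* X :- k :* r :* s :* x

-- 96 times the difference of the two sides of a claimed formula: P₀₃ and P₁₂ are 4 times, P₂₁ and P₃₀ 16 times a divisor
-- sum, D₁ and D₂ are 4 times, D₃ and D₄ twice an eta quotient.
combination : Poly → (c₁₂ c₂₁ c₃₀ e₁ e₂ e₃ e₄ : ℤ) → Poly
combination p c₁₂ c₂₁ c₃₀ e₁ e₂ e₃ e₄ = 672 · p :+ 24 · P₀₃ :- κ (+ 24 * c₁₂) :* P₁₂ :- κ (+ 6 * c₂₁) :* P₂₁ :- κ (+ 6 * c₃₀) :* P₃₀
  :- κ (+ 24 * e₁) :* D₁ :- κ (+ 24 * e₂) :* D₂ :- κ (+ 48 * e₃) :* D₃ :- κ (+ 48 * e₄) :* D₄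

p₈ q₈ : Poly
p₈ = x ² :* X :- 2 · x :* y :* Y :- y ² :* X :- X ³ :+ 3 · X :* Y ²
q₈ = x :* X ² :- x ³ :- x :* y ² :- x :* Y ² :+ 2 · y :* X :* Y

-- Once `η`, `n`, `z²`, `Z²` and the eta quotients have been removed, each of the eight formulas is
-- a combination of this relation and `L₅≈0`.
L₈≈0 : Zero (z :* p₈ :+ Z :* q₈)
L₈≈0 = eliminate-z p₈ q₈ (divide w 1 w≢0 ((x ³ :* X ² :- x ³ :* Y ² :+ x :* y ² :* X ² :- x :* y ² :* Y ² :- x :* X ⁴ :- x :* Y ⁴ :+ 2 · y ³ :* X :* Y) ⊠ Q≈0 ⊞ (x ² :* y :* X :* Y :- x :* X ² :* Y ²) ⊠ Q₂≈0))

-- The integers are seven times the coefficients of the formula, for instance `-12 = 4 · (-3)`.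
-- Since `D₂`, `D₃`, `D₄` occur in `E₅≈0`, `E₆′≈0`, `E₇′≈0` with the coefficients 12, 48, 48, those
-- three multipliers are forced to be `-2e₂`, `-e₃`, `-e₄` in all eight cases.
G₁≈0 : Zero (combination (x ³ :* Z) (- + 5) (+ 4) (+ 20) (- + 12) (+ 60) (- + 60) (+ 36))
G₁≈0 = by ((κ (+ 16)) ⊠ L₅≈0 ⊞ (:- (κ (+ 24))) ⊠ L₈≈0 ⊞ (:- (120 · X)) ⊠ N₁≈0 ⊞ (24 · x) ⊠ N₂≈0 ⊞ (:- (96 · X :* z) :- 240 · x :* Z) ⊠ z≈0 ⊞ (240 · X :* z) ⊠ Z≈0 ⊞ (:- (κ (+ 120))) ⊠ E₅≈0 ⊞ (κ (+ 60)) ⊠ E₆′≈0 ⊞ (:- (κ (+ 36))) ⊠ E₇′≈0)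

G₂≈0 : Zero (combination (x ² :* z :* X) (+ 5) (- + 4) (+ 20) (- + 8) (+ 0) (+ 0) (+ 16))
G₂≈0 = by ((:- (κ (+ 16))) ⊠ L₅≈0 ⊞ (κ (+ 24)) ⊠ L₈≈0 ⊞ (:- (40 · X)) ⊠ N₁≈0 ⊞ (8 · x) ⊠ N₂≈0 ⊞ (:- (48 · x :* Z)) ⊠ z≈0 ⊞ (:- (240 · X :* z) :+ 480 · x :* Z) ⊠ Z≈0 ⊞ (:- (κ (+ 16))) ⊠ E₇′≈0)

G₃≈0 : Zero (combination (x :* z ² :* Z) (- + 5) (+ 2) (+ 10) (+ 4) (+ 20) (+ 20) (+ 4))
G₃≈0 = by ((κ (+ 4)) ⊠ L₅≈0 ⊞ (:- (κ (+ 96))) ⊠ L₈≈0 ⊞ (:- (200 · X)) ⊠ N₁≈0 ⊞ (:- (68 · x)) ⊠ N₂≈0 ⊞ (:- (72 · X :* z) :+ 144 · x :* Z) ⊠ z≈0 ⊞ (120 · X :* z :- 120 · x :* Z) ⊠ Z≈0 ⊞ (:- (κ (+ 40))) ⊠ E₅≈0 ⊞ (:- (κ (+ 20))) ⊠ E₆′≈0 ⊞ (:- (κ (+ 4))) ⊠ E₇′≈0)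

G₄≈0 : Zero (combination (x :* X ² :* Z) (- + 1) (+ 4) (+ 4) (+ 0) (+ 8) (- + 8) (+ 8))
G₄≈0 = by ((κ (+ 24)) ⊠ L₈≈0 ⊞ (:- (8 · X)) ⊠ N₁≈0 ⊞ (:- (8 · x)) ⊠ N₂≈0 ⊞ (:- (96 · X :* z) :- 48 · x :* Z) ⊠ z≈0 ⊞ (48 · X :* z) ⊠ Z≈0 ⊞ (:- (κ (+ 16))) ⊠ E₅≈0 ⊞ (κ (+ 8)) ⊠ E₆′≈0 ⊞ (:- (κ (+ 8))) ⊠ E₇′≈0)

G₅≈0 : Zero (combination (x :* Z ³) (- + 1) (+ 2) (+ 2) (+ 0) (+ 12) (+ 12) (+ 12))
G₅≈0 = by ((:- (κ (+ 12))) ⊠ L₅≈0 ⊞ (κ (+ 24)) ⊠ L₈≈0 ⊞ (:- (48 · X)) ⊠ N₁≈0 ⊞ (:- (12 · x)) ⊠ N₂≈0 ⊞ (:- (72 · X :* z) :- 48 · x :* Z) ⊠ z≈0 ⊞ (:- (24 · X :* z) :+ 312 · x :* Z) ⊠ Z≈0 ⊞ (:- (κ (+ 24))) ⊠ E₅≈0 ⊞ (:- (κ (+ 12))) ⊠ E₆′≈0 ⊞ (:- (κ (+ 12))) ⊠ E₇′≈0)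

G₆≈0 : Zero (combination (z ³ :* X) (+ 5) (- + 2) (+ 10) (- + 12) (+ 0) (+ 0) (+ 0))
G₆≈0 = by ((:- (κ (+ 4))) ⊠ L₅≈0 ⊞ (:- (κ (+ 84))) ⊠ L₈≈0 ⊞ (:- (60 · X)) ⊠ N₁≈0 ⊞ (48 · x) ⊠ N₂≈0 ⊞ (312 · X :* z :+ 24 · x :* Z) ⊠ z≈0 ⊞ (:- (240 · X :* z) :+ 360 · x :* Z) ⊠ Z≈0)

G₇≈0 : Zero (combination (z :* X ³) (+ 1) (- + 4) (+ 4) (- + 12) (- + 12) (- + 36) (+ 12))
G₇≈0 = by ((κ (+ 24)) ⊠ L₈≈0 ⊞ (24 · X) ⊠ N₁≈0 ⊞ (24 · x) ⊠ N₂≈0 ⊞ (:- (48 · x :* Z)) ⊠ z≈0 ⊞ (:- (240 · X :* z) :+ 96 · x :* Z) ⊠ Z≈0 ⊞ (κ (+ 24)) ⊠ E₅≈0 ⊞ (κ (+ 36)) ⊠ E₆′≈0 ⊞ (:- (κ (+ 12))) ⊠ E₇′≈0)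

G₈≈0 : Zero (combination (z :* X :* Z ²) (+ 1) (- + 2) (+ 2) (- + 4) (+ 4) (- + 12) (+ 4))
G₈≈0 = by ((κ (+ 12)) ⊠ L₅≈0 ⊞ (:- (κ (+ 12))) ⊠ L₈≈0 ⊞ (:- (68 · X)) ⊠ N₁≈0 ⊞ (40 · x) ⊠ N₂≈0 ⊞ (:- (24 · X :* z) :- 24 · x :* Z) ⊠ z≈0 ⊞ (144 · X :* z :+ 72 · x :* Z) ⊠ Z≈0 ⊞ (:- (κ (+ 8))) ⊠ E₅≈0 ⊞ (κ (+ 12)) ⊠ E₆′≈0 ⊞ (:- (κ (+ 4))) ⊠ E₇′≈0)

-- Divisor sums and eta quotients as polynomials in theta functions

divisorSum : (ℕ → ℤ) → (ℕ → ℤ) → Series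
divisorSum χ ψ = Λ (λ d e → ψ d * χ e * + d)

Λ-scale : ∀ c {f g : ℕ → ℕ → ℤ} → (∀ d e → f d e ≡ c * g d e) → Λ f ≈ con c ⊛ Λ g
Λ-scale c {f} {g} h = S.trans (Λ-cong λ d e _ _ → trans (h d e) (sym (ℤP.+-identityʳ _))) (S.trans (Λ-linear c g (λ _ _ → + 0))
  (S.trans (⊕-cong S.refl Λ-0) (identity 1 (λ f → f :+ κ (+ 0) := f) (con c ⊛ Λ g ∷ []))))

P₀₃-series : ⟦ P₀₃ ⟧ ρ ≈ 𝟒 ⊛ (con (- + 7) ⊕ divisorSum χ₀ χ₃)
P₀₃-series = S.trans (⊕-cong (⊛-cong (S.sym X₄₀-theta) S.refl) (⊛-cong (S.sym X₂₀-theta) S.refl)) (S.trans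
  (identity 6 (λ e f x z X Z → (κ (+ 2) :* e) :* (3 · x :* x :- 4 · z :* z :- 5 · X :* X) :+ (κ (+ 2) :* f) :* (2 · x :* z :- 10 · X :* Z)
    := κ (+ 2) :* (κ (+ 3) :* ((x :* x) :* e) :+ (κ (- + 4) :* ((z :* z) :* e) :+ (κ (- + 5) :* ((X :* X) :* e) :+ (κ (+ 2) :* ((x :* z) :* f) :+ (κ (- + 10) :* ((X :* Z) :* f) :+ κ (+ 0)))))))
    (X₄₀ ∷ X₂₀ ∷ φ ∷ dil 2 φ ∷ dil 5 φ ∷ dil 10 φ ∷ [])) (S.trans
  (⊛-cong S.refl (S.trans (S.sym (total-value (a₁⇝ ⊗ X⇝ ∷ aˡ⇝ 1 ⊗ X⇝ ∷ aˡ⇝ 4 ⊗ X⇝ ∷ l₁⇝ ⊗ X₂₀⇝ ∷ l₅ˡ⇝ ⊗ X₂₀⇝ ∷ [])))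
    (S.trans Mod40.E₀₃-identity (⊕-cong S.refl (Λ-scale (+ 2) λ d e → lemma (χ₃ d) (+ d) (+ e))))))
  (identity 1 (λ f → κ (+ 2) :* (κ (- + 14) :+ κ (+ 2) :* f) := κ (+ 4) :* (κ (- + 7) :+ f)) (divisorSum χ₀ χ₃ ∷ []))))
  where
  lemma : ∀ c d e → (+ 2 * d + + 0 * e) * c ≡ + 2 * (c * + 1 * d)
  lemma = solve-∀

-- The certificate has the character on `d` and the weight on `e`, opposite to `divisorSum`;
-- `Λ-flip` exchanges the two. The same happens for `P₂₁-series`.
P₃₀-series : ⟦ P₃₀ ⟧ ρ ≈ con (+ 16) ⊛ divisorSum χ₃ χ₀
P₃₀-series = S.trans (⊕-cong (⊛-cong (S.sym X₄₀-theta) S.refl) (⊛-cong (S.sym X₂₀-theta) S.refl)) (S.trans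
  (identity 6 (λ e f x z X Z → (κ (+ 2) :* e) :* (x :* x :- X :* X :- 4 · Z :* Z) :+ (κ (+ 2) :* f) :* (2 · x :* z :+ 2 · X :* Z)
    := κ (+ 2) :* (κ (+ 1) :* ((x :* x) :* e) :+ (κ (- + 1) :* ((X :* X) :* e) :+ (κ (- + 4) :* ((Z :* Z) :* e) :+ (κ (+ 2) :* ((x :* z) :* f) :+ (κ (+ 2) :* ((X :* Z) :* f) :+ κ (+ 0)))))))
    (X₄₀ ∷ X₂₀ ∷ φ ∷ dil 2 φ ∷ dil 5 φ ∷ dil 10 φ ∷ [])) (S.trans
  (⊛-cong S.refl (S.trans (S.sym (total-value (a₁⇝ ⊗ X⇝ ∷ aˡ⇝ 4 ⊗ X⇝ ∷ aˡ⇝ 9 ⊗ X⇝ ∷ l₁⇝ ⊗ X₂₀⇝ ∷ l₅ˡ⇝ ⊗ X₂₀⇝ ∷ [])))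
    (S.trans Mod40.E₃₀-identity (⊕-cong S.refl (S.trans (Λ-scale (+ 8) λ d e → lemma (χ₃ d) (+ d) (+ e)) (⊛-cong S.refl (Λ-flip _)))))))
  (identity 1 (λ f → κ (+ 2) :* (κ (+ 0) :+ κ (+ 8) :* f) := κ (+ 16) :* f) (divisorSum χ₃ χ₀ ∷ []))))
  where
  lemma : ∀ c d e → (+ 0 * d + + 8 * e) * c ≡ + 8 * (+ 1 * c * e)
  lemma = solve-∀

P₁₂-series : ⟦ P₁₂ ⟧ ρ ≈ 𝟒 ⊛ divisorSum χ₁ χ₂
P₁₂-series = S.trans (⊕-cong (⊛-cong (S.sym Y₄₀-theta) S.refl) (⊛-cong (S.sym Y₂₀-theta) S.refl)) (S.trans
  (identity 6 (λ e f x z X Z → (κ (+ 2) :* e) :* (3 · X :* X :- x :* x :- 4 · Z :* Z) :+ (κ (+ 2) :* f) :* (2 · x :* z :+ 2 · X :* Z)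
    := κ (+ 2) :* (κ (- + 1) :* ((x :* x) :* e) :+ (κ (+ 3) :* ((X :* X) :* e) :+ (κ (- + 4) :* ((Z :* Z) :* e) :+ (κ (+ 2) :* ((x :* z) :* f) :+ (κ (+ 2) :* ((X :* Z) :* f) :+ κ (+ 0)))))))
    (Y₄₀ ∷ Y₂₀ ∷ φ ∷ dil 2 φ ∷ dil 5 φ ∷ dil 10 φ ∷ [])) (S.trans
  (⊛-cong S.refl (S.trans (S.sym (total-value (a₁⇝ ⊗ Y⇝ ∷ a₅⇝ ⊗ Y⇝ ∷ a₁₀⇝ ⊗ Y⇝ ∷ l₁⇝ ⊗ Y₂₀⇝ ∷ l₅ʳ⇝ ⊗ Y₂₀⇝ ∷ [])))
    (S.trans Mod8×5.E₁₂-identity (⊕-cong S.refl (Λ-scale (+ 2) λ d e → lemma (χ₂ d) (χ₁ e) (+ d) (+ e))))))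
  (identity 1 (λ f → κ (+ 2) :* (κ (+ 0) :+ κ (+ 2) :* f) := κ (+ 4) :* f) (divisorSum χ₁ χ₂ ∷ []))))
  where
  lemma : ∀ b c d e → (+ 2 * d + + 0 * e) * (b * c) ≡ + 2 * (b * c * d)
  lemma = solve-∀

P₂₁-series : ⟦ P₂₁ ⟧ ρ ≈ con (+ 16) ⊛ divisorSum χ₂ χ₁
P₂₁-series = S.trans (⊕-cong (⊛-cong (S.sym Y₄₀-theta) S.refl) (⊛-cong (S.sym Y₂₀-theta) S.refl)) (S.trans
  (identity 6 (λ e f x z X Z → (κ (+ 2) :* e) :* (5 · X :* X :- x :* x :- 4 · z :* z) :+ (κ (+ 2) :* f) :* (10 · X :* Z :- 2 · x :* z)
    := κ (+ 2) :* (κ (- + 1) :* ((x :* x) :* e) :+ (κ (- + 4) :* ((z :* z) :* e) :+ (κ (+ 5) :* ((X :* X) :* e) :+ (κ (- + 2) :* ((x :* z) :* f) :+ (κ (+ 10) :* ((X :* Z) :* f) :+ κ (+ 0)))))))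
    (Y₄₀ ∷ Y₂₀ ∷ φ ∷ dil 2 φ ∷ dil 5 φ ∷ dil 10 φ ∷ [])) (S.trans
  (⊛-cong S.refl (S.trans (S.sym (total-value (a₁⇝ ⊗ Y⇝ ∷ aˡ⇝ 1 ⊗ Y⇝ ∷ a₅⇝ ⊗ Y⇝ ∷ l₁⇝ ⊗ Y₂₀⇝ ∷ l₅ʳ⇝ ⊗ Y₂₀⇝ ∷ [])))
    (S.trans Mod8×5.E₂₁-identity (⊕-cong S.refl (S.trans (Λ-scale (+ 8) λ d e → lemma (χ₂ d) (χ₁ e) (+ d) (+ e)) (⊛-cong S.refl (Λ-flip _)))))))
  (identity 1 (λ f → κ (+ 2) :* (κ (+ 0) :+ κ (+ 8) :* f) := κ (+ 16) :* f) (divisorSum χ₂ χ₁ ∷ []))))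
  where
  lemma : ∀ b c d e → (+ 0 * d + + 8 * e) * (b * c) ≡ + 8 * (c * b * e)
  lemma = solve-∀

-- The four eta quotients without their leading powers of `q`.
Δ₁ Δ₂ Δ₃ Δ₄ : Series
Δ₁ = dil 2 φ ⊛ φ′ ⊛ dil 4 W
Δ₂ = dil 5 φ′ ⊛ dil 10 φ′ ⊛ dil 8 W
Δ₃ = dil 10 ψ ⊛ dil 20 ψ ⊛ W
Δ₄ = dil 2 ψ ⊛ dil 4 ψ ⊛ W

D₁-series : ⟦ D₁ ⟧ ρ ≈ 𝟒 ⊛ (M 1 ⊛ Δ₁)
D₁-series = S.trans (⊛-cong S.refl (S.sym dil4-W)) (identity 4 (λ z y q w → z :* y :* (κ (+ 4) :* (q :* w)) := κ (+ 4) :* (q :* (z :* y :* w))) (dil 2 φ ∷ φ′ ∷ q ∷ dil 4 W ∷ []))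

-- Since `J² = XY`, the polynomial factors as `YJ(zJ - jZ)`, and the last factor is the dilation by
-- 2 of `w = 4qW(q⁴)`.
D₂-series : ⟦ D₂ ⟧ ρ ≈ 𝟒 ⊛ (M 2 ⊛ Δ₂)
D₂-series = begin
  ⟦ D₂ ⟧ ρ
    ≈⟨ from-difference (holds D₂-factors) ⟩
  ⟦ Y :* J :* (z :* J :- j :* Z) ⟧ ρ
    ≈⟨ ⊛-cong S.refl (S.sym dil8-W) ⟩
  dil 5 φ′ ⊛ dil 10 φ′ ⊛ (𝟒 ⊛ (M 2 ⊛ dil 8 W))
    ≈⟨ identity 4 (λ z y q w → z :* y :* (κ (+ 4) :* (q :* w)) := κ (+ 4) :* (q :* (z :* y :* w))) (dil 5 φ′ ∷ dil 10 φ′ ∷ M 2 ∷ dil 8 W ∷ []) ⟩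
  𝟒 ⊛ (M 2 ⊛ Δ₂) ∎
  where
  open ≈R
  D₂-factors : Zero (D₂ :- Y :* J :* (z :* J :- j :* Z))
  D₂-factors = by ((:- (Y :* z)) ⊠ J≈0)
  w-form : Polynomial 4
  w-form = Ring.var 0F :* Ring.var 3F :- Ring.var 1F :* Ring.var 2F
  dil8-W : 𝟒 ⊛ (M 2 ⊛ dil 8 W) ≈ ⟦ z :* J :- j :* Z ⟧ ρ
  dil8-W = S.trans (S.sym (S.trans (dil-⊛ 2 𝟒 _) (⊛-cong (dil-con 2 _) (S.trans (dil-⊛ 2 q _) (⊛-cong (dil-M 1 1) (dil-∘ 1 3 W))))))
    (S.trans (dil-cong 2 dil4-W) (dil-⟦⟧ 2 w-form (φ ∷ φ′ ∷ dil 5 φ ∷ dil 5 φ′ ∷ []) (dil 2 φ ∷ dil 2 φ′ ∷ dil 10 φ ∷ dil 10 φ′ ∷ [])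
      λ { 0F → S.refl ; 1F → S.refl ; 2F → dil-∘ 1 4 φ ; 3F → dil-∘ 1 4 φ′ }))

-- Replacing `φ(q¹⁰)ψ(q²⁰)` by `ψ(q¹⁰)²` makes `W` a common factor; for `D₄` it is
-- `φ(q²)ψ(q⁴) = ψ(q²)²`.
D₃-series : ⟦ D₃ ⟧ ρ ≈ 𝟐 ⊛ (M 4 ⊛ Δ₃)
D₃-series = begin
  ⟦ D₃ ⟧ ρ
    ≈⟨ identity 8 (λ q p p′ m g X x Z → (κ (+ 2) :* q) :* (q :* (p :* p′)) :* (m :* g) :* X :- (κ (+ 2) :* q) :* (m :* g) :* (m :* g) :* x :* Z
        := κ (+ 2) :* ((q :* q) :* m :* p :* p′ :* g :* X :- q :* (m :* m) :* (Z :* g) :* g :* x))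
        (q ∷ dil 2 ψ ∷ dil 10 ψ ∷ M 2 ∷ dil 20 ψ ∷ dil 5 φ ∷ φ ∷ dil 10 φ ∷ []) ⟩
  𝟐 ⊛ ((q ⊛ q) ⊛ M 2 ⊛ dil 2 ψ ⊛ dil 10 ψ ⊛ dil 20 ψ ⊛ dil 5 φ ⊕ ⊝ (q ⊛ (M 2 ⊛ M 2) ⊛ (dil 10 φ ⊛ dil 20 ψ) ⊛ dil 20 ψ ⊛ φ))
    ≈⟨ ⊛-cong S.refl (⊕-cong (⊛-cong (⊛-cong (⊛-cong (⊛-cong (S.trans (⊛-cong (M-+ 1 1) S.refl) (M-+ 2 2)) S.refl) S.refl) S.refl) S.refl)
        (⊝-cong (⊛-cong (⊛-cong (⊛-cong (⊛-cong S.refl (M-+ 2 2)) (S.sym (ψ²-dilated 9))) S.refl) S.refl))) ⟩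
  𝟐 ⊛ (M 4 ⊛ dil 2 ψ ⊛ dil 10 ψ ⊛ dil 20 ψ ⊛ dil 5 φ ⊕ ⊝ (q ⊛ M 4 ⊛ (dil 10 ψ ⊛ dil 10 ψ) ⊛ dil 20 ψ ⊛ φ))
    ≈⟨ identity 7 (λ m p p′ g X q x → κ (+ 2) :* (m :* p :* p′ :* g :* X :+ :- (q :* m :* (p′ :* p′) :* g :* x)) := κ (+ 2) :* (m :* (p′ :* g :* (p :* X :+ :- (q :* (x :* p′))))))
        (M 4 ∷ dil 2 ψ ∷ dil 10 ψ ∷ dil 20 ψ ∷ dil 5 φ ∷ q ∷ φ ∷ []) ⟩
  𝟐 ⊛ (M 4 ⊛ Δ₃) ∎
  where open ≈R

D₄-series : ⟦ D₄ ⟧ ρ ≈ 𝟐 ⊛ (M 1 ⊛ Δ₄)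
D₄-series = begin
  ⟦ D₄ ⟧ ρ
    ≈⟨ identity 7 (λ q s z X p p′ x → (κ (+ 2) :* q) :* s :* s :* z :* X :- (κ (+ 2) :* q) :* (q :* (p :* p′)) :* s :* x
        := κ (+ 2) :* (q :* ((z :* s) :* s :* X :- q :* p :* p′ :* s :* x)))
        (q ∷ dil 4 ψ ∷ dil 2 φ ∷ dil 5 φ ∷ dil 2 ψ ∷ dil 10 ψ ∷ φ ∷ []) ⟩
  𝟐 ⊛ (q ⊛ ((dil 2 φ ⊛ dil 4 ψ) ⊛ dil 4 ψ ⊛ dil 5 φ ⊕ ⊝ (q ⊛ dil 2 ψ ⊛ dil 10 ψ ⊛ dil 4 ψ ⊛ φ)))
    ≈⟨ ⊛-cong S.refl (⊛-cong S.refl (⊕-cong (⊛-cong (⊛-cong (S.sym (ψ²-dilated 1)) S.refl) S.refl) S.refl)) ⟩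
  𝟐 ⊛ (q ⊛ ((dil 2 ψ ⊛ dil 2 ψ) ⊛ dil 4 ψ ⊛ dil 5 φ ⊕ ⊝ (q ⊛ dil 2 ψ ⊛ dil 10 ψ ⊛ dil 4 ψ ⊛ φ)))
    ≈⟨ identity 6 (λ q s X p p′ x → κ (+ 2) :* (q :* ((p :* p) :* s :* X :+ :- (q :* p :* p′ :* s :* x))) := κ (+ 2) :* (q :* (p :* s :* (p :* X :+ :- (q :* (x :* p′))))))
        (q ∷ dil 4 ψ ∷ dil 5 φ ∷ dil 2 ψ ∷ dil 10 ψ ∷ φ ∷ []) ⟩
  𝟐 ⊛ (M 1 ⊛ Δ₄) ∎
  where open ≈R

dil-1 : ∀ f → dil 1 f ≈ f
dil-1 f = pw λ n → trans (cong (dil 1 f) (sym (ℕP.*-identityʳ n))) (dil-* 0 f n)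

W-dilated : ∀ i → dil (suc i) W ≈ dil (suc i) E ⊛ dil (suc i ℕ.* 5) E
W-dilated i = S.trans (dil-cong (suc i) W≈EE₅) (S.trans (dil-⊛ (suc i) E (dil 5 E)) (⊛-cong S.refl (dil-∘ i 4 E)))

gauss-dilated : ∀ i → dil (suc i) φ′ ⊛ dil (suc i ℕ.* 2) E ≈ dil (suc i) E ⊛ dil (suc i) E
gauss-dilated i = S.trans (⊛-cong S.refl (S.sym (dil-∘ i 1 E))) (S.trans (S.sym (dil-⊛ (suc i) φ′ (dil 2 E))) (S.trans (dil-cong (suc i) gauss) (dil-⊛ (suc i) E E)))

ψE-dilated : ∀ i → dil (suc i) ψ ⊛ dil (suc i) E ≈ dil (suc i ℕ.* 2) E ⊛ dil (suc i ℕ.* 2) E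
ψE-dilated i = S.trans (S.sym (dil-⊛ (suc i) ψ E)) (S.trans (dil-cong (suc i) ψE) (S.trans (dil-⊛ (suc i) _ _) (⊛-cong (dil-∘ i 1 E) (dil-∘ i 1 E))))

-- From `φ(q) = E(-q)²/E(q²)`, where `E-neg` trades the unwanted `E(-q)` for products in even powers
-- of `q` and `E(q)`.
φ-eta : φ ⊛ (E ⊛ E) ⊛ (dil 4 E ⊛ dil 4 E) ≈ ⟦ Ring.var 0F ⁵ ⟧ (dil 2 E ∷ [])
φ-eta = cancel 0 (dil 2 E) (λ ()) (begin
  dil 2 E ⊛ (φ ⊛ (E ⊛ E) ⊛ (dil 4 E ⊛ dil 4 E))
    ≈⟨ identity 4 (λ f p e g → f :* (p :* (e :* e) :* (g :* g)) := (p :* f) :* (e :* e :* (g :* g))) (dil 2 E ∷ φ ∷ E ∷ dil 4 E ∷ []) ⟩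
  (φ ⊛ dil 2 E) ⊛ (E ⊛ E ⊛ (dil 4 E ⊛ dil 4 E))
    ≈⟨ ⊛-cong φE₂ S.refl ⟩
  (neg E ⊛ neg E) ⊛ (E ⊛ E ⊛ (dil 4 E ⊛ dil 4 E))
    ≈⟨ identity 3 (λ n e g → (n :* n) :* (e :* e :* (g :* g)) := (e :* n :* g) :* (e :* n :* g)) (neg E ∷ E ∷ dil 4 E ∷ []) ⟩
  (E ⊛ neg E ⊛ dil 4 E) ⊛ (E ⊛ neg E ⊛ dil 4 E)
    ≈⟨ ⊛-cong E-neg E-neg ⟩
  (dil 2 E ⊛ (dil 2 E ⊛ dil 2 E)) ⊛ (dil 2 E ⊛ (dil 2 E ⊛ dil 2 E))
    ≈⟨ identity 1 (λ f → (f :* (f :* f)) :* (f :* (f :* f)) := f :* f ⁵) (dil 2 E ∷ []) ⟩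
  dil 2 E ⊛ ⟦ Ring.var 0F ⁵ ⟧ (dil 2 E ∷ []) ∎)
  where open ≈R

φ₂-eta : dil 2 φ ⊛ (dil 2 E ⊛ dil 2 E) ⊛ (dil 8 E ⊛ dil 8 E) ≈ ⟦ Ring.var 0F ⁵ ⟧ (dil 4 E ∷ [])
φ₂-eta = S.trans (S.sym (dil-⟦⟧ 2 form (φ ∷ E ∷ dil 4 E ∷ []) (dil 2 φ ∷ dil 2 E ∷ dil 8 E ∷ []) λ { 0F → S.refl ; 1F → S.refl ; 2F → dil-∘ 1 3 E }))
  (S.trans (dil-cong 2 φ-eta) (dil-⟦⟧ 2 (Ring.var 0F ⁵) (dil 2 E ∷ []) (dil 4 E ∷ []) λ { 0F → dil-∘ 1 1 E }))
  where
  form : Polynomial 3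
  form = Ring.var 0F :* (Ring.var 1F :* Ring.var 1F) :* (Ring.var 2F :* Ring.var 2F)

d₁-series : ∀ n → d₁ n ≡ (M 1 ⊛ Δ₁) n
d₁-series = etaQuotient 1 ((1 , + 2) ∷ (4 , + 6) ∷ (20 , + 1) ∷ (2 , - (+ 3)) ∷ (8 , - (+ 2)) ∷ []) {Δ₁} _ (λ ()) (begin
  times e₂ 3 (times e₈ 2 𝟏) ⊛ Δ₁
    ≈⟨ ⊛-cong S.refl (⊛-cong S.refl (W-dilated 3)) ⟩
  times e₂ 3 (times e₈ 2 𝟏) ⊛ (dil 2 φ ⊛ φ′ ⊛ (e₄ ⊛ e₂₀))
    ≈⟨ identity 6 (λ a b z y c d → (a :* (a :* (a :* (b :* (b :* κ (+ 1)))))) :* (z :* y :* (c :* d)) := (z :* (a :* a) :* (b :* b)) :* (y :* a) :* (c :* d)) (e₂ ∷ e₈ ∷ dil 2 φ ∷ φ′ ∷ e₄ ∷ e₂₀ ∷ []) ⟩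
  (dil 2 φ ⊛ (e₂ ⊛ e₂) ⊛ (e₈ ⊛ e₈)) ⊛ (φ′ ⊛ e₂) ⊛ (e₄ ⊛ e₂₀)
    ≈⟨ ⊛-cong (⊛-cong φ₂-eta (S.trans gauss (S.sym (⊛-cong (dil-1 E) (dil-1 E))))) S.refl ⟩
  ⟦ Ring.var 0F ⁵ ⟧ (e₄ ∷ []) ⊛ (dil 1 E ⊛ dil 1 E) ⊛ (e₄ ⊛ e₂₀)
    ≈⟨ identity 3 (λ c e d → (c ⁵) :* (e :* e) :* (c :* d) := e :* (e :* (c :* (c :* (c :* (c :* (c :* (c :* (d :* κ (+ 1)))))))))) (e₄ ∷ dil 1 E ∷ e₂₀ ∷ []) ⟩
  times (dil 1 E) 2 (times e₄ 6 (times e₂₀ 1 𝟏)) ∎)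
  where
  open ≈R
  e₂ e₄ e₈ e₂₀ : Series
  e₂ = dil 2 E
  e₄ = dil 4 E
  e₈ = dil 8 E
  e₂₀ = dil 20 E

d₂-series : ∀ n → d₂ n ≡ (M 2 ⊛ Δ₂) n
d₂-series = etaQuotient 2 ((5 , + 2) ∷ (8 , + 1) ∷ (10 , + 1) ∷ (40 , + 1) ∷ (20 , - (+ 1)) ∷ []) {Δ₂} _ (λ ()) (begin
  times (dil 20 E) 1 𝟏 ⊛ Δ₂
    ≈⟨ ⊛-cong S.refl (⊛-cong S.refl (W-dilated 7)) ⟩
  times (dil 20 E) 1 𝟏 ⊛ (dil 5 φ′ ⊛ dil 10 φ′ ⊛ (dil 8 E ⊛ dil 40 E))
    ≈⟨ identity 5 (λ a y j c d → (a :* κ (+ 1)) :* (y :* j :* (c :* d)) := y :* (j :* a) :* (c :* d)) (dil 20 E ∷ dil 5 φ′ ∷ dil 10 φ′ ∷ dil 8 E ∷ dil 40 E ∷ []) ⟩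
  dil 5 φ′ ⊛ (dil 10 φ′ ⊛ dil 20 E) ⊛ (dil 8 E ⊛ dil 40 E)
    ≈⟨ ⊛-cong (⊛-cong S.refl (gauss-dilated 9)) S.refl ⟩
  dil 5 φ′ ⊛ (dil 10 E ⊛ dil 10 E) ⊛ (dil 8 E ⊛ dil 40 E)
    ≈⟨ identity 4 (λ y e c d → y :* (e :* e) :* (c :* d) := (y :* e) :* (c :* (e :* (d :* κ (+ 1))))) (dil 5 φ′ ∷ dil 10 E ∷ dil 8 E ∷ dil 40 E ∷ []) ⟩
  (dil 5 φ′ ⊛ dil 10 E) ⊛ times (dil 8 E) 1 (times (dil 10 E) 1 (times (dil 40 E) 1 𝟏))
    ≈⟨ S.trans (⊛-cong (gauss-dilated 4) S.refl) (pw (⊛-assoc _ _ _)) ⟩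
  times (dil 5 E) 2 (times (dil 8 E) 1 (times (dil 10 E) 1 (times (dil 40 E) 1 𝟏))) ∎)
  where open ≈R

W-eta : W ≈ dil 1 E ⊛ dil 5 E
W-eta = S.trans W≈EE₅ (⊛-cong (S.sym (dil-1 E)) S.refl)

d₃-series : ∀ n → d₃ n ≡ (M 4 ⊛ Δ₃) n
d₃-series = etaQuotient 4 ((1 , + 1) ∷ (5 , + 1) ∷ (20 , + 1) ∷ (40 , + 2) ∷ (10 , - (+ 1)) ∷ []) {Δ₃} _ (λ ()) (begin
  times (dil 10 E) 1 𝟏 ⊛ Δ₃
    ≈⟨ ⊛-cong S.refl (⊛-cong S.refl W-eta) ⟩
  times (dil 10 E) 1 𝟏 ⊛ (dil 10 ψ ⊛ dil 20 ψ ⊛ (dil 1 E ⊛ dil 5 E))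
    ≈⟨ identity 5 (λ a p p′ c d → (a :* κ (+ 1)) :* (p :* p′ :* (c :* d)) := (p :* a) :* p′ :* (c :* d)) (dil 10 E ∷ dil 10 ψ ∷ dil 20 ψ ∷ dil 1 E ∷ dil 5 E ∷ []) ⟩
  (dil 10 ψ ⊛ dil 10 E) ⊛ dil 20 ψ ⊛ (dil 1 E ⊛ dil 5 E)
    ≈⟨ ⊛-cong (⊛-cong (ψE-dilated 9) S.refl) S.refl ⟩
  (dil 20 E ⊛ dil 20 E) ⊛ dil 20 ψ ⊛ (dil 1 E ⊛ dil 5 E)
    ≈⟨ identity 4 (λ e p c d → (e :* e) :* p :* (c :* d) := (p :* e) :* (e :* (c :* d))) (dil 20 E ∷ dil 20 ψ ∷ dil 1 E ∷ dil 5 E ∷ []) ⟩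
  (dil 20 ψ ⊛ dil 20 E) ⊛ (dil 20 E ⊛ (dil 1 E ⊛ dil 5 E))
    ≈⟨ ⊛-cong (ψE-dilated 19) S.refl ⟩
  (dil 40 E ⊛ dil 40 E) ⊛ (dil 20 E ⊛ (dil 1 E ⊛ dil 5 E))
    ≈⟨ identity 4 (λ f e c d → (f :* f) :* (e :* (c :* d)) := c :* (d :* (e :* (f :* (f :* κ (+ 1)))))) (dil 40 E ∷ dil 20 E ∷ dil 1 E ∷ dil 5 E ∷ []) ⟩
  times (dil 1 E) 1 (times (dil 5 E) 1 (times (dil 20 E) 1 (times (dil 40 E) 2 𝟏))) ∎)
  where open ≈R

d₄-series : ∀ n → d₄ n ≡ (M 1 ⊛ Δ₄) n
d₄-series = etaQuotient 1 ((1 , + 1) ∷ (4 , + 1) ∷ (5 , + 1) ∷ (8 , + 2) ∷ (2 , - (+ 1)) ∷ []) {Δ₄} _ (λ ()) (begin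
  times (dil 2 E) 1 𝟏 ⊛ Δ₄
    ≈⟨ ⊛-cong S.refl (⊛-cong S.refl W-eta) ⟩
  times (dil 2 E) 1 𝟏 ⊛ (dil 2 ψ ⊛ dil 4 ψ ⊛ (dil 1 E ⊛ dil 5 E))
    ≈⟨ identity 5 (λ a p p′ c d → (a :* κ (+ 1)) :* (p :* p′ :* (c :* d)) := (p :* a) :* p′ :* (c :* d)) (dil 2 E ∷ dil 2 ψ ∷ dil 4 ψ ∷ dil 1 E ∷ dil 5 E ∷ []) ⟩
  (dil 2 ψ ⊛ dil 2 E) ⊛ dil 4 ψ ⊛ (dil 1 E ⊛ dil 5 E)
    ≈⟨ ⊛-cong (⊛-cong (ψE-dilated 1) S.refl) S.refl ⟩
  (dil 4 E ⊛ dil 4 E) ⊛ dil 4 ψ ⊛ (dil 1 E ⊛ dil 5 E)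
    ≈⟨ identity 4 (λ e p c d → (e :* e) :* p :* (c :* d) := (p :* e) :* (e :* (c :* d))) (dil 4 E ∷ dil 4 ψ ∷ dil 1 E ∷ dil 5 E ∷ []) ⟩
  (dil 4 ψ ⊛ dil 4 E) ⊛ (dil 4 E ⊛ (dil 1 E ⊛ dil 5 E))
    ≈⟨ ⊛-cong (ψE-dilated 3) S.refl ⟩
  (dil 8 E ⊛ dil 8 E) ⊛ (dil 4 E ⊛ (dil 1 E ⊛ dil 5 E))
    ≈⟨ identity 4 (λ f e c d → (f :* f) :* (e :* (c :* d)) := c :* (e :* (d :* (f :* (f :* κ (+ 1)))))) (dil 8 E ∷ dil 4 E ∷ dil 1 E ∷ dil 5 E ∷ []) ⟩
  times (dil 1 E) 1 (times (dil 4 E) 1 (times (dil 5 E) 1 (times (dil 8 E) 2 𝟏))) ∎)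
  where open ≈R

sumℤ-filter : ∀ {A : Set} {P : A → Set} (P? : ∀ a → Dec (P a)) (g : A → ℤ) xs →
  sumℤ (List.map g (List.filter P? xs)) ≡ sumℤ (List.map (λ a → if ⌊ P? a ⌋ then g a else + 0) xs)
sumℤ-filter P? g []       = refl
sumℤ-filter P? g (a ∷ xs) with P? a
... | yes _ = cong (_+_ (g a)) (sumℤ-filter P? g xs)
... | no  _ = trans (sumℤ-filter P? g xs) (sym (ℤP.+-identityˡ _))

σ-divisorSum : ∀ χ ψ n → 1 ≤ n → divisorSum χ ψ n ≡ σ χ ψ n
σ-divisorSum χ ψ n 1≤n = sym (trans (sumℤ-filter (λ i → suc i ∣? n) _ (List.upTo n)) (trans (sumℤ-upTo _ n)
  (trans (∑-cong n λ i _ → inner i) (sym (∑₁-def n _)))))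
  where
  f : ℕ → ℕ → ℤ
  f d e = ψ d * χ e * + d
  inner : ∀ i → (if ⌊ suc i ∣? n ⌋ then ψ (suc i) * χ (n / suc i) * (+ suc i) else + 0) ≡ ∑₁ n (λ e → δ (suc i ℕ.* e) n * f (suc i) e)
  inner i with suc i ∣? n
  ... | no  i∤n = sym (∑₁-0 n λ e _ → cong (_* f (suc i) e) (δ-≢ λ h → i∤n (divides e (trans (sym h) (ℕP.*-comm (suc i) e)))))
  ... | yes (divides m refl) = trans (cong (f (suc i)) (DM.m*n/n≡m m (suc i))) (sym (trans
        (∑₁-cong (m ℕ.* suc i) λ e _ → cong (_* f (suc i) e) (trans (cong (λ z → δ z (m ℕ.* suc i)) (ℕP.*-comm (suc i) e)) (δ-injective (ℕ._* suc i) (ℕP.*-cancelʳ-≡ _ _ (suc i)) e m)))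
        (∑₁-δ (f (suc i)) (ℕP.n≢0⇒n>0 λ { refl → ℕP.<-irrefl refl 1≤n }) (ℕP.m≤m*n m (suc i)))))

-- Comparison of coefficients

opaque
  unfolding _⊕_ ⊝_

  combination-at : ∀ p c₁₂ c₂₁ c₃₀ e₁ e₂ e₃ e₄ n → ⟦ combination p c₁₂ c₂₁ c₃₀ e₁ e₂ e₃ e₄ ⟧ ρ n ≡
    + 672 * ⟦ p ⟧ ρ n + + 24 * ⟦ P₀₃ ⟧ ρ n + - (+ 24 * c₁₂ * ⟦ P₁₂ ⟧ ρ n) + - (+ 6 * c₂₁ * ⟦ P₂₁ ⟧ ρ n) + - (+ 6 * c₃₀ * ⟦ P₃₀ ⟧ ρ n)
    + - (+ 24 * e₁ * ⟦ D₁ ⟧ ρ n) + - (+ 24 * e₂ * ⟦ D₂ ⟧ ρ n) + - (+ 48 * e₃ * ⟦ D₃ ⟧ ρ n) + - (+ 48 * e₄ * ⟦ D₄ ⟧ ρ n)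
  combination-at p c₁₂ c₂₁ c₃₀ e₁ e₂ e₃ e₄ n =
    cong₂ _+_ (cong₂ _+_ (cong₂ _+_ (cong₂ _+_ (cong₂ _+_ (cong₂ _+_ (cong₂ _+_ (cong₂ _+_ (con-⊛ (+ 672) (⟦ p ⟧ ρ) n) (con-⊛ (+ 24) (⟦ P₀₃ ⟧ ρ) n))
      (minus (+ 24 * c₁₂) P₁₂)) (minus (+ 6 * c₂₁) P₂₁)) (minus (+ 6 * c₃₀) P₃₀))
      (minus (+ 24 * e₁) D₁)) (minus (+ 24 * e₂) D₂)) (minus (+ 48 * e₃) D₃)) (minus (+ 48 * e₄) D₄)
    where
    minus : ∀ c p′ → - (con c ⊛ ⟦ p′ ⟧ ρ) n ≡ - (c * ⟦ p′ ⟧ ρ n)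
    minus c p′ = cong -_ (con-⊛ c (⟦ p′ ⟧ ρ) n)

conclude : ∀ p {c₁₂ c₂₁ c₃₀ e₁ e₂ e₃ e₄} → Zero (combination p c₁₂ c₂₁ c₃₀ e₁ e₂ e₃ e₄) → ∀ m → 1 ≤ m →
  + 7 * ⟦ p ⟧ ρ m ≡ - σ χ₀ χ₃ m + c₁₂ * σ χ₁ χ₂ m + c₂₁ * σ χ₂ χ₁ m + c₃₀ * σ χ₃ χ₀ m + (e₁ * d₁ m + e₂ * d₂ m + e₃ * d₃ m + e₄ * d₄ m)
-- Matching `m` as a successor makes constant series vanish at `m`, in particular the -7 in
-- `P₀₃-series`. The factor 96 makes the integer coefficients of `combination` comparable with the
-- formula and is cancelled.
conclude p {c₁₂} {c₂₁} {c₃₀} {e₁} {e₂} {e₃} {e₄} (zeroes h) m@(suc _) 1≤m =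
  ℤP.*-cancelˡ-≡ (+ 96) _ _ (trans (regroup (⟦ p ⟧ ρ m) (σ χ₀ χ₃ m) (σ χ₁ χ₂ m) (σ χ₂ χ₁ m) (σ χ₃ χ₀ m) (d₁ m) (d₂ m) (d₃ m) (d₄ m) c₁₂ c₂₁ c₃₀ e₁ e₂ e₃ e₄)
    (trans (cong (_+ + 96 * rhs) (trans (sym substituted) (coeff h m))) (ℤP.+-identityˡ _)))
  where
  rhs : ℤ
  rhs = - σ χ₀ χ₃ m + c₁₂ * σ χ₁ χ₂ m + c₂₁ * σ χ₂ χ₁ m + c₃₀ * σ χ₃ χ₀ m + (e₁ * d₁ m + e₂ * d₂ m + e₃ * d₃ m + e₄ * d₄ m)
  regroup : ∀ p s₀₃ s₁₂ s₂₁ s₃₀ d₁ d₂ d₃ d₄ c₁₂ c₂₁ c₃₀ e₁ e₂ e₃ e₄ → + 96 * (+ 7 * p) ≡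
    + 672 * p + + 24 * (+ 4 * s₀₃) + - (+ 24 * c₁₂ * (+ 4 * s₁₂)) + - (+ 6 * c₂₁ * (+ 16 * s₂₁)) + - (+ 6 * c₃₀ * (+ 16 * s₃₀))
    + - (+ 24 * e₁ * (+ 4 * d₁)) + - (+ 24 * e₂ * (+ 4 * d₂)) + - (+ 48 * e₃ * (+ 2 * d₃)) + - (+ 48 * e₄ * (+ 2 * d₄))
    + + 96 * (- s₀₃ + c₁₂ * s₁₂ + c₂₁ * s₂₁ + c₃₀ * s₃₀ + (e₁ * d₁ + e₂ * d₂ + e₃ * d₃ + e₄ * d₄))
  regroup = solve-∀
  scaled : ∀ c {f g v} → f ≈ con c ⊛ g → g m ≡ v → f m ≡ c * v
  scaled c {g = g} e e′ = trans (coeff e m) (trans (con-⊛ c g m) (cong (_*_ c) e′))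
  substituted : ⟦ combination p c₁₂ c₂₁ c₃₀ e₁ e₂ e₃ e₄ ⟧ ρ m ≡
    + 672 * ⟦ p ⟧ ρ m + + 24 * (+ 4 * σ χ₀ χ₃ m) + - (+ 24 * c₁₂ * (+ 4 * σ χ₁ χ₂ m)) + - (+ 6 * c₂₁ * (+ 16 * σ χ₂ χ₁ m)) + - (+ 6 * c₃₀ * (+ 16 * σ χ₃ χ₀ m))
    + - (+ 24 * e₁ * (+ 4 * d₁ m)) + - (+ 24 * e₂ * (+ 4 * d₂ m)) + - (+ 48 * e₃ * (+ 2 * d₃ m)) + - (+ 48 * e₄ * (+ 2 * d₄ m))
  substituted = trans (combination-at p c₁₂ c₂₁ c₃₀ e₁ e₂ e₃ e₄ m)
    (cong₂ _+_ (cong₂ _+_ (cong₂ _+_ (cong₂ _+_ (cong₂ _+_ (cong₂ _+_ (cong₂ _+_ (cong (λ v → + 672 * ⟦ p ⟧ ρ m + + 24 * v)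
        (scaled (+ 4) P₀₃-series (trans (⊕-at (con (- + 7)) (divisorSum χ₀ χ₃) m) (trans (ℤP.+-identityˡ _) (σ-divisorSum χ₀ χ₃ m 1≤m)))))
      (minus (+ 24 * c₁₂) (scaled (+ 4) P₁₂-series (σ-divisorSum χ₁ χ₂ m 1≤m)))) (minus (+ 6 * c₂₁) (scaled (+ 16) P₂₁-series (σ-divisorSum χ₂ χ₁ m 1≤m))))
      (minus (+ 6 * c₃₀) (scaled (+ 16) P₃₀-series (σ-divisorSum χ₃ χ₀ m 1≤m)))) (minus (+ 24 * e₁) (scaled (+ 4) D₁-series (sym (d₁-series m)))))
      (minus (+ 24 * e₂) (scaled (+ 4) D₂-series (sym (d₂-series m))))) (minus (+ 48 * e₃) (scaled (+ 2) D₃-series (sym (d₃-series m)))))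
      (minus (+ 48 * e₄) (scaled (+ 2) D₄-series (sym (d₄-series m)))))
    where
    minus : ∀ c {v v′} → v ≡ v′ → - (c * v) ≡ - (c * v′)
    minus c e = cong (λ v → - (c * v)) e

N₁ : ∀ m → + N 1 1 1 10 m ≡ ⟦ x ³ :* Z ⟧ ρ m
N₁ m = trans (N-theta 0 0 0 9 m) (coeff (S.trans (⊛-cong (dil-1 φ) (⊛-cong (dil-1 φ) (⊛-cong (dil-1 φ) S.refl))) (same {x :* (x :* (x :* Z))} {x ³ :* Z})) m)

N₂ : ∀ m → + N 1 1 2 5 m ≡ ⟦ x ² :* z :* X ⟧ ρ m
N₂ m = trans (N-theta 0 0 1 4 m) (coeff (S.trans (⊛-cong (dil-1 φ) (⊛-cong (dil-1 φ) S.refl)) (same {x :* (x :* (z :* X))} {x ² :* z :* X})) m)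

N₃ : ∀ m → + N 1 2 2 10 m ≡ ⟦ x :* z ² :* Z ⟧ ρ m
N₃ m = trans (N-theta 0 1 1 9 m) (coeff (S.trans (⊛-cong (dil-1 φ) S.refl) (same {x :* (z :* (z :* Z))} {x :* z ² :* Z})) m)

N₄ : ∀ m → + N 1 5 5 10 m ≡ ⟦ x :* X ² :* Z ⟧ ρ m
N₄ m = trans (N-theta 0 4 4 9 m) (coeff (S.trans (⊛-cong (dil-1 φ) S.refl) (same {x :* (X :* (X :* Z))} {x :* X ² :* Z})) m)

N₅ : ∀ m → + N 1 10 10 10 m ≡ ⟦ x :* Z ³ ⟧ ρ m
N₅ m = trans (N-theta 0 9 9 9 m) (coeff (S.trans (⊛-cong (dil-1 φ) S.refl) (same {x :* (Z :* (Z :* Z))} {x :* Z ³})) m)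

N₆ : ∀ m → + N 2 2 2 5 m ≡ ⟦ z ³ :* X ⟧ ρ m
N₆ m = trans (N-theta 1 1 1 4 m) (coeff (same {z :* (z :* (z :* X))} {z ³ :* X}) m)

N₇ : ∀ m → + N 2 5 5 5 m ≡ ⟦ z :* X ³ ⟧ ρ m
N₇ m = trans (N-theta 1 4 4 4 m) (coeff (same {z :* (X :* (X :* X))} {z :* X ³}) m)

N₈ : ∀ m → + N 2 5 10 10 m ≡ ⟦ z :* X :* Z ² ⟧ ρ m
N₈ m = trans (N-theta 1 4 9 9 m) (coeff (same {z :* (X :* (Z :* Z))} {z :* X :* Z ²}) m)

theorem3p4 : (n : ℕ) → 1 ≤ n →
    ((+ 7) * (+ N 1 1 1 10 n) ≡
       - σ χ₀ χ₃ n - (+ 5) * σ χ₁ χ₂ n + (+ 4) * σ χ₂ χ₁ n + (+ 20) * σ χ₃ χ₀ n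
       + (+ 4) * (- ((+ 3) * d₁ n) + (+ 15) * d₂ n - (+ 15) * d₃ n + (+ 9) * d₄ n))
  × ((+ 7) * (+ N 1 1 2 5 n) ≡
       - σ χ₀ χ₃ n + (+ 5) * σ χ₁ χ₂ n - (+ 4) * σ χ₂ χ₁ n + (+ 20) * σ χ₃ χ₀ n
       + (+ 8) * (- d₁ n + (+ 2) * d₄ n))
  × ((+ 7) * (+ N 1 2 2 10 n) ≡
       - σ χ₀ χ₃ n - (+ 5) * σ χ₁ χ₂ n + (+ 2) * σ χ₂ χ₁ n + (+ 10) * σ χ₃ χ₀ n
       + (+ 4) * (d₁ n + (+ 5) * d₂ n + (+ 5) * d₃ n + d₄ n))
  × ((+ 7) * (+ N 1 5 5 10 n) ≡
       - σ χ₀ χ₃ n - σ χ₁ χ₂ n + (+ 4) * σ χ₂ χ₁ n + (+ 4) * σ χ₃ χ₀ n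
       + (+ 8) * (d₂ n - d₃ n + d₄ n))
  × ((+ 7) * (+ N 1 10 10 10 n) ≡
       - σ χ₀ χ₃ n - σ χ₁ χ₂ n + (+ 2) * σ χ₂ χ₁ n + (+ 2) * σ χ₃ χ₀ n
       + (+ 12) * (d₂ n + d₃ n + d₄ n))
  × ((+ 7) * (+ N 2 2 2 5 n) ≡
       - σ χ₀ χ₃ n + (+ 5) * σ χ₁ χ₂ n - (+ 2) * σ χ₂ χ₁ n + (+ 10) * σ χ₃ χ₀ n
       - (+ 12) * d₁ n)
  × ((+ 7) * (+ N 2 5 5 5 n) ≡
       - σ χ₀ χ₃ n + σ χ₁ χ₂ n - (+ 4) * σ χ₂ χ₁ n + (+ 4) * σ χ₃ χ₀ n
       + (+ 12) * (- d₁ n - d₂ n - (+ 3) * d₃ n + d₄ n))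
  × ((+ 7) * (+ N 2 5 10 10 n) ≡
       - σ χ₀ χ₃ n + σ χ₁ χ₂ n - (+ 2) * σ χ₂ χ₁ n + (+ 2) * σ χ₃ χ₀ n
       + (+ 4) * (- d₁ n + d₂ n - (+ 3) * d₃ n + d₄ n))
theorem3p4 m 1≤m =
    result 1 1 1 10 (x ³ :* Z) (- + 5) (+ 4) (+ 20) (- + 12) (+ 60) (- + 60) (+ 36) N₁ G₁≈0 regroup₁
  , result 1 1 2 5 (x ² :* z :* X) (+ 5) (- + 4) (+ 20) (- + 8) (+ 0) (+ 0) (+ 16) N₂ G₂≈0 regroup₂
  , result 1 2 2 10 (x :* z ² :* Z) (- + 5) (+ 2) (+ 10) (+ 4) (+ 20) (+ 20) (+ 4) N₃ G₃≈0 regroup₃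
  , result 1 5 5 10 (x :* X ² :* Z) (- + 1) (+ 4) (+ 4) (+ 0) (+ 8) (- + 8) (+ 8) N₄ G₄≈0 regroup₄
  , result 1 10 10 10 (x :* Z ³) (- + 1) (+ 2) (+ 2) (+ 0) (+ 12) (+ 12) (+ 12) N₅ G₅≈0 regroup₅
  , result 2 2 2 5 (z ³ :* X) (+ 5) (- + 2) (+ 10) (- + 12) (+ 0) (+ 0) (+ 0) N₆ G₆≈0 regroup₆
  , result 2 5 5 5 (z :* X ³) (+ 1) (- + 4) (+ 4) (- + 12) (- + 12) (- + 36) (+ 12) N₇ G₇≈0 regroup₇
  , result 2 5 10 10 (z :* X :* Z ²) (+ 1) (- + 2) (+ 2) (- + 4) (+ 4) (- + 12) (+ 4) N₈ G₈≈0 regroup₈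
  where
  -- `F` is the right side in the shape of the theorem; the `regroup` equations only pull out common
  -- factors such as 4, 8 or 12 and drop zero coefficients.
  result : ∀ a b c d p c₁₂ c₂₁ c₃₀ e₁ e₂ e₃ e₄ {F : (s₀ s₁ s₂ s₃ e₁ e₂ e₃ e₄ : ℤ) → ℤ} → (∀ i → + N a b c d i ≡ ⟦ p ⟧ ρ i) → Zero (combination p c₁₂ c₂₁ c₃₀ e₁ e₂ e₃ e₄) →
    (∀ s₀ s₁ s₂ s₃ f₁ f₂ f₃ f₄ → - s₀ + c₁₂ * s₁ + c₂₁ * s₂ + c₃₀ * s₃ + (e₁ * f₁ + e₂ * f₂ + e₃ * f₃ + e₄ * f₄) ≡ F s₀ s₁ s₂ s₃ f₁ f₂ f₃ f₄) →
    + 7 * + N a b c d m ≡ F (σ χ₀ χ₃ m) (σ χ₁ χ₂ m) (σ χ₂ χ₁ m) (σ χ₃ χ₀ m) (d₁ m) (d₂ m) (d₃ m) (d₄ m)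
  result a b c d p c₁₂ c₂₁ c₃₀ e₁ e₂ e₃ e₄ h z f = trans (cong (_*_ (+ 7)) (h m)) (trans (conclude p {c₁₂} {c₂₁} {c₃₀} {e₁} {e₂} {e₃} {e₄} z m 1≤m) (f _ _ _ _ _ _ _ _))
  regroup₁ : ∀ s₀ s₁ s₂ s₃ e₁ e₂ e₃ e₄ → - s₀ + (- + 5) * s₁ + (+ 4) * s₂ + (+ 20) * s₃ + ((- + 12) * e₁ + (+ 60) * e₂ + (- + 60) * e₃ + (+ 36) * e₄)
    ≡ - s₀ - (+ 5) * s₁ + (+ 4) * s₂ + (+ 20) * s₃ + (+ 4) * (- ((+ 3) * e₁) + (+ 15) * e₂ - (+ 15) * e₃ + (+ 9) * e₄)
  regroup₁ = solve-∀
  regroup₂ : ∀ s₀ s₁ s₂ s₃ e₁ e₂ e₃ e₄ → - s₀ + (+ 5) * s₁ + (- + 4) * s₂ + (+ 20) * s₃ + ((- + 8) * e₁ + (+ 0) * e₂ + (+ 0) * e₃ + (+ 16) * e₄)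
    ≡ - s₀ + (+ 5) * s₁ - (+ 4) * s₂ + (+ 20) * s₃ + (+ 8) * (- e₁ + (+ 2) * e₄)
  regroup₂ = solve-∀
  regroup₃ : ∀ s₀ s₁ s₂ s₃ e₁ e₂ e₃ e₄ → - s₀ + (- + 5) * s₁ + (+ 2) * s₂ + (+ 10) * s₃ + ((+ 4) * e₁ + (+ 20) * e₂ + (+ 20) * e₃ + (+ 4) * e₄)
    ≡ - s₀ - (+ 5) * s₁ + (+ 2) * s₂ + (+ 10) * s₃ + (+ 4) * (e₁ + (+ 5) * e₂ + (+ 5) * e₃ + e₄)
  regroup₃ = solve-∀
  regroup₄ : ∀ s₀ s₁ s₂ s₃ e₁ e₂ e₃ e₄ → - s₀ + (- + 1) * s₁ + (+ 4) * s₂ + (+ 4) * s₃ + ((+ 0) * e₁ + (+ 8) * e₂ + (- + 8) * e₃ + (+ 8) * e₄)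
    ≡ - s₀ - s₁ + (+ 4) * s₂ + (+ 4) * s₃ + (+ 8) * (e₂ - e₃ + e₄)
  regroup₄ = solve-∀
  regroup₅ : ∀ s₀ s₁ s₂ s₃ e₁ e₂ e₃ e₄ → - s₀ + (- + 1) * s₁ + (+ 2) * s₂ + (+ 2) * s₃ + ((+ 0) * e₁ + (+ 12) * e₂ + (+ 12) * e₃ + (+ 12) * e₄)
    ≡ - s₀ - s₁ + (+ 2) * s₂ + (+ 2) * s₃ + (+ 12) * (e₂ + e₃ + e₄)
  regroup₅ = solve-∀
  regroup₆ : ∀ s₀ s₁ s₂ s₃ e₁ e₂ e₃ e₄ → - s₀ + (+ 5) * s₁ + (- + 2) * s₂ + (+ 10) * s₃ + ((- + 12) * e₁ + (+ 0) * e₂ + (+ 0) * e₃ + (+ 0) * e₄)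
    ≡ - s₀ + (+ 5) * s₁ - (+ 2) * s₂ + (+ 10) * s₃ - (+ 12) * e₁
  regroup₆ = solve-∀
  regroup₇ : ∀ s₀ s₁ s₂ s₃ e₁ e₂ e₃ e₄ → - s₀ + (+ 1) * s₁ + (- + 4) * s₂ + (+ 4) * s₃ + ((- + 12) * e₁ + (- + 12) * e₂ + (- + 36) * e₃ + (+ 12) * e₄)
    ≡ - s₀ + s₁ - (+ 4) * s₂ + (+ 4) * s₃ + (+ 12) * (- e₁ - e₂ - (+ 3) * e₃ + e₄)
  regroup₇ = solve-∀
  regroup₈ : ∀ s₀ s₁ s₂ s₃ e₁ e₂ e₃ e₄ → - s₀ + (+ 1) * s₁ + (- + 2) * s₂ + (+ 2) * s₃ + ((- + 4) * e₁ + (+ 4) * e₂ + (- + 12) * e₃ + (+ 4) * e₄)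
    ≡ - s₀ + s₁ - (+ 2) * s₂ + (+ 2) * s₃ + (+ 4) * (- e₁ + e₂ - (+ 3) * e₃ + e₄)
  regroup₈ = solve-∀
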